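{- Let $n\geq 3$ be an integer and $p$ an odd prime with $p\nmid n(n-1)$. For $t\in\mathbb{F}_p^\times$ let $f_t(y)=y^n-y^{n-1}+\frac{(n-1)^{n-1}t}{n^n}\in\mathbb{F}_p[y]$, and let $\beta_n(t)=1$ if $n$ is odd and $\beta_n(t)=1-(p-1)\varphi((1-n)t)$ if $n$ is even. Then $${_n\widetilde{G}_n}(t)=\frac{\beta_n(t)-1}{p}+\sum_{\substack{a\in\mathbb{F}_p\\ f_t(a)\equiv 0\pmod p}}\varphi(a(a-1)).$$
   Context: $\varphi$ denotes the quadratic character of $\mathbb{F}_p^\times$, extended by $\varphi(0)=0$. $\Gamma_p$ is Morita's $p$-adic gamma function; $\omega$ is the Teichmüller character of $\mathbb{F}_p^\times$ ($\omega(a)\equiv a\pmod p$), $\overline{\omega}$ its inverse, and every multiplicative character (including the trivial one) takes value $0$ at $0$. $\langle x\rangle$ denotes the fractional part and $\lfloor x\rfloor$ the floor of $x\in\mathbb{Q}$. For $a_k,b_k\in\mathbb{Q}\cap\mathbb{Z}_p$ and $t\in\mathbb{F}_p$, $${_n\mathbb{G}_n}\left[\begin{array}{ccc}a_1,&\ldots,&a_n\\ b_1,&\ldots,&b_n\end{array}\Big| t\right]:=\frac{ -1}{p-1}\sum_{a=0}^{p-2}(-1)^{an}\,\overline{\omega}^a(t)\prod_{k=1}^n(-p)^{ -\lfloor\langle a_k\rangle-\frac{a}{p-1}\rfloor-\lfloor\langle -b_k\rangle+\frac{a}{p-1}\rfloor}\frac{\Gamma_p(\langle a_k-\frac{a}{p-1}\rangle)}{\Gamma_p(\langle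 a_k\rangle)}\frac{\Gamma_p(\langle -b_k+\frac{a}{p-1}\rangle)}{\Gamma_p(\langle -b_k\rangle)}.$$ Define ${_n\widetilde{G}_n}(t):={_n\mathbb{G}_n}\left[\begin{array}{ccccc}\frac12,&\frac{1}{2(n-1)},&\frac{3}{2(n-1)},&\ldots,&\frac{2n-3}{2(n-1)}\\ 0,&\frac1n,&\frac2n,&\ldots,&\frac{n-1}{n}\end{array}\Big| t\right]$. The sum is over the distinct elements $a\in\mathbb{F}_p$ with $f_t(a)=0$. -}

module Defs where

open import Data.Nat as ℕ using (ℕ; zero; suc)
open import Data.Integer as ℤ using (ℤ; +_; -[1+_])
open import Data.Rational as ℚ using (ℚ; ↥_; ↧ₙ_)
open import Data.Integer.Divisibility using (_∣_)
open import Data.Bool using (Bool; true; false; if_then_else_; _∧_; not)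
open import Data.List using (List; []; _∷_; map; upTo; foldr; filterᵇ; applyUpTo; zip; length)
open import Data.Bool.ListAction using (any)
open import Data.Product using (_×_; _,_)

modℤ : ℤ → ℕ → ℕ
modℤ x zero    = 0
modℤ x (suc m) = x ℤ.%ℕ suc m

modℕ : ℕ → ℕ → ℕ
modℕ x m = modℤ (+ x) m

sumℤ : List ℤ → ℤ
sumℤ = foldr ℤ._+_ (+ 0)

prodℤ : List ℤ → ℤ
prodℤ = foldr ℤ._*_ (+ 1)

_≡_[mod_] : ℤ → ℤ → ℕ → Set
x ≡ y [mod m ] = (+ m) ∣ (x ℤ.- y)

sgnPow : ℕ → ℤ
sgnPow e = if modℕ e 2 ℕ.≡ᵇ 0 then + 1 else ℤ.- (+ 1)

-- an inverse of a unit u modulo p^k (Euler: u^(φ(p^k) - 1))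
invMod : (p k : ℕ) → ℤ → ℤ
invMod p k u = u ℤ.^ ((p ℕ.^ (k ℕ.∸ 1)) ℕ.* (p ℕ.∸ 1) ℕ.∸ 1)

-- image modulo p^k of a rational number with denominator prime to p
ratMod : (p k : ℕ) → ℚ → ℤ
ratMod p k q = (↥ q) ℤ.* invMod p k (+ (↧ₙ q))

floorℚ : ℚ → ℤ
floorℚ = ℚ.floor

frac : ℚ → ℚ
frac x = x ℚ.- (floorℚ x ℚ./ 1)

-- Morita's p-adic gamma function.
-- For a positive integer N,  Γ_p(N) = (-1)^N ∏_{0<j<N, p∤j} j , and Γ_p
-- is the continuous extension to Z_p.  For p odd,
-- Γ_p(x) ≡ Γ_p(y) (mod p^k) whenever x ≡ y (mod p^k), so the image of
-- Γ_p(x) in Z/p^k Z is Γ_p(N) with N ≡ x (mod p^k), 0 ≤ N < p^k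
-- (with Γ_p(0) = 1).

gammaNat : (p N : ℕ) → ℤ
gammaNat p N =
  sgnPow N ℤ.*
  prodℤ (map (λ j → + j)
    (filterᵇ (λ j → not (j ℕ.≡ᵇ 0) ∧ not (modℕ j p ℕ.≡ᵇ 0)) (upTo N)))

gammaMod : (p k : ℕ) → ℚ → ℤ
gammaMod p k x = gammaNat p (modℤ (ratMod p k x) (p ℕ.^ k))

-- Teichmüller character modulo p^k:  ω(t) ≡ t^(p^(k-1)) (mod p^k),
-- and  ω̄^a(t) = ω(t)^(-a).

omegaMod : (p k t : ℕ) → ℤ
omegaMod p k t = (+ t) ℤ.^ (p ℕ.^ (k ℕ.∸ 1))

omegaBarPowMod : (p k a t : ℕ) → ℤ
omegaBarPowMod p k a t = invMod p k (omegaMod p k t) ℤ.^ a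

-- p^s · (-p)^e  for an integer exponent e with s + e ≥ 0
-- (returns 0 if s + e < 0, which never happens below)

scaledPow : (p s : ℕ) → ℤ → ℤ
scaledPow p s e with (+ s) ℤ.+ e
... | + d     = sgnPow ℤ.∣ e ∣ ℤ.* (+ (p ℕ.^ d))
... | -[1+ _ ] = + 0

φ : (p : ℕ) → ℤ → ℤ
φ p x =
  if modℤ x p ℕ.≡ᵇ 0 then + 0
  else if any (λ y → modℕ (y ℕ.* y) p ℕ.≡ᵇ modℤ x p) (upTo p) then + 1
  else ℤ.- (+ 1)

f : (p n t : ℕ) → ℤ → ℤ
f p n t y = (y ℤ.^ n) ℤ.- (y ℤ.^ (n ℕ.∸ 1))
            ℤ.+ (+ ((n ℕ.∸ 1) ℕ.^ (n ℕ.∸ 1) ℕ.* t)) ℤ.* invMod p 1 (+ (n ℕ.^ n))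

isRoot : (p n t : ℕ) → ℕ → Bool
isRoot p n t a = modℤ (f p n t (+ a)) p ℕ.≡ᵇ 0

rootSum : (p n t : ℕ) → ℤ
rootSum p n t =
  sumℤ (map (λ a → φ p ((+ a) ℤ.* ((+ a) ℤ.- (+ 1))))
            (filterᵇ (isRoot p n t) (upTo p)))

β : (p n t : ℕ) → ℤ
β p n t =
  if modℕ n 2 ℕ.≡ᵇ 1 then + 1
  else (+ 1) ℤ.- (+ (p ℕ.∸ 1)) ℤ.* φ p ((+ 1 ℤ.- + n) ℤ.* (+ t))

topParams : ℕ → List ℚ
topParams zero = []
topParams (suc zero) = (+ 1 ℚ./ 2) ∷ []
topParams (suc (suc m)) =
  (+ 1 ℚ./ 2) ∷ applyUpTo (λ j → + (2 ℕ.* j ℕ.+ 1) ℚ./ (2 ℕ.* suc m)) (suc m)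

bottomParams : ℕ → List ℚ
bottomParams zero = []
bottomParams (suc m) =
  (+ 0 ℚ./ 1) ∷ applyUpTo (λ j → + (suc j) ℚ./ suc m) m

-- The hypergeometric function nGn, scaled by p^n and reduced mod p^k.
--
-- For parameter lists as = (a_1,…,a_n), bs = (b_1,…,b_n) and t ∈ F_p^×
-- (represented by 1 ≤ t < p),  GMod p k as bs t  is congruent modulo p^k
-- to  p^n · nGn[as; bs | t]  (an element of Z_p, since every exponent of
-- (-p) in the defining sum is ≥ -1 per factor).

-- x / d as a rational (0 if d = 0; only used with d = p - 1 ≥ 2)
divℚ : ℤ → ℕ → ℚ
divℚ x zero    = ℚ.0ℚ
divℚ x (suc d) = x ℚ./ suc d

module _ (p k a : ℕ) where

  private
    α : ℚ
    α = divℚ (+ a) (p ℕ.∸ 1)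

  expo : ℚ × ℚ → ℤ
  expo (ak , bk) =
    ℤ.- floorℚ (frac ak ℚ.- α) ℤ.- floorℚ (frac (ℚ.- bk) ℚ.+ α)

  gammaRatio : ℚ × ℚ → ℤ
  gammaRatio (ak , bk) =
    gammaMod p k (frac (ak ℚ.- α)) ℤ.* invMod p k (gammaMod p k (frac ak))
    ℤ.* gammaMod p k (frac (ℚ.- bk ℚ.+ α))
    ℤ.* invMod p k (gammaMod p k (frac (ℚ.- bk)))

GMod : (p k : ℕ) → List ℚ → List ℚ → ℕ → ℤ
GMod p k as bs t =
  ℤ.- invMod p k (+ (p ℕ.∸ 1)) ℤ.*
  sumℤ (map term (upTo (p ℕ.∸ 1)))
  where
  n : ℕ
  n = length as
  ps : List (ℚ × ℚ)
  ps = zip as bs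
  term : ℕ → ℤ
  term a = sgnPow (a ℕ.* n) ℤ.* omegaBarPowMod p k a t
           ℤ.* scaledPow p n (sumℤ (map (expo p k a) ps))
           ℤ.* prodℤ (map (gammaRatio p k a) ps)

GtildeMod : (p k n t : ℕ) → ℤ
GtildeMod p k n t = GMod p k (topParams n) (bottomParams n) t

-- p^n · ( (β_n(t) - 1)/p + Σ_{f_t(a)=0} φ(a(a-1)) )
RHSscaled : (p n t : ℕ) → ℤ
RHSscaled p n t =
  (+ (p ℕ.^ (n ℕ.∸ 1))) ℤ.* (β p n t ℤ.- + 1)
  ℤ.+ (+ (p ℕ.^ n)) ℤ.* rootSum p n t

{-# OPTIONS --safe #-}
module Submission where

-- Following Dwork, exp(Y + Y^p/p) has n-th coefficient c_n of valuation at least -⌊n/p⌋, and a trace identity for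
-- the operator it defines on power series (commuting up to a factor p with a twisted derivation) identifies
-- ∑ᵢ (-p)^i c_{b+(p-1)i} with Γ_p(b/(p-1)) up to the factor 1 - p: this is the Gross–Koblitz formula, here modulo p^k.
-- The values of exp(Y + Y^p/p) at Y^(p-1) = -p, scaled by Teichmüller representatives, form an additive character, so
-- Jacobi sums are products of three values of Γ_p.  Gauss's multiplication formula collapses the parameters of the
-- hypergeometric function to three such values, and orthogonality of characters then turns the sum into one over
-- pairs with x + y + 1 = 0 and x^a y^b fixed, which are the roots of f_t; the trivial characters contribute β_n.

-- A root π of π^q = -p, where q = p - 1, is not rational, so individual Gauss sums are out of
-- reach. Only the part of a series in Y supported on multiples of q is evaluated, by putting Y^q =
-- -p. This functional `ev` averages over the q choices of π and, up to a factor q, turns the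
-- additive character into `η`, with value q at 0 and -1 elsewhere. Hence three variables are
-- treated at once and Jacobi sums appear directly. Nothing is completed: rationals with denominator
-- prime to p (`Int`) carry the congruences modulo p^k (`Iv`), series are cut off where the
-- remaining terms are divisible by p^k, and results return to ℤ by cancelling units. The trace
-- formula has an error term proportional to b + qN. The choice N = b(1 + p + ⋯ + p^(k-1)), an
-- approximation of -b/q, makes this scalar b p^k. Exponents of characters are natural numbers
-- instead of residues modulo q; they are kept positive wherever a character has to vanish at 0.

-- Finite sums and products over a commutative monoid.

module BigOperators where

  open import Algebra.Structures using (IsCommutativeMonoid)
  open import Algebra.Bundles using (CommutativeMonoid)
  open import Data.Nat using (ℕ; zero; suc; _+_; _*_; _∸_; _<_)
  open import Data.Nat.Properties
  open import Data.Fin as Fin using (Fin; toℕ; fromℕ<)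
  open import Data.Fin.Properties using (toℕ<n; toℕ-fromℕ<; toℕ-injective)
  open import Data.Fin.Permutation using (Permutation; permutation; _⟨$⟩ʳ_)
  open import Level using (0ℓ)
  open import Function using (_∘_)
  open import Relation.Nullary using (yes; no)
  open import Relation.Binary.PropositionalEquality

  module Big {A : Set} {_∙_ : A → A → A} {ε : A} (isCM : IsCommutativeMonoid _≡_ _∙_ ε) where

    private
      module M = IsCommutativeMonoid isCM
      cm : CommutativeMonoid 0ℓ 0ℓ
      cm = record { isCommutativeMonoid = isCM }

    open import Algebra.Properties.CommutativeMonoid.Sum cm using (sum; sum-permute)

    big : ℕ → (ℕ → A) → A
    big zero    f = ε
    big (suc n) f = big n f ∙ f n

    interchange : ∀ a b c d → (a ∙ b) ∙ (c ∙ d) ≡ (a ∙ c) ∙ (b ∙ d)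
    interchange a b c d = begin
      (a ∙ b) ∙ (c ∙ d)  ≡⟨ M.assoc a b (c ∙ d) ⟩
      a ∙ (b ∙ (c ∙ d))  ≡⟨ cong (a ∙_) (trans (sym (M.assoc b c d)) (trans (cong (_∙ d) (M.comm b c)) (M.assoc c b d))) ⟩
      a ∙ (c ∙ (b ∙ d))  ≡⟨ sym (M.assoc a c (b ∙ d)) ⟩
      (a ∙ c) ∙ (b ∙ d)  ∎
      where open ≡-Reasoning

    big-rel : (R : A → A → Set) → R ε ε → (∀ {a b c d} → R a b → R c d → R (a ∙ c) (b ∙ d)) →
      ∀ n {f g} → (∀ i → i < n → R (f i) (g i)) → R (big n f) (big n g)
    big-rel R e c zero h = e
    big-rel R e c (suc n) h = c (big-rel R e c n (λ i i<n → h i (m<n⇒m<1+n i<n))) (h n ≤-refl)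

    big-pred : (P : A → Set) → P ε → (∀ {a b} → P a → P b → P (a ∙ b)) →
      ∀ n {f} → (∀ i → i < n → P (f i)) → P (big n f)
    big-pred P e c zero h = e
    big-pred P e c (suc n) h = c (big-pred P e c n (λ i i<n → h i (m<n⇒m<1+n i<n))) (h n ≤-refl)

    big-cong : ∀ n {f g} → (∀ i → i < n → f i ≡ g i) → big n f ≡ big n g
    big-cong = big-rel _≡_ refl (cong₂ _∙_)

    big-ext : ∀ n {f g} → (∀ i → f i ≡ g i) → big n f ≡ big n g
    big-ext n h = big-cong n (λ i _ → h i)

    big-ε : ∀ n {f} → (∀ i → i < n → f i ≡ ε) → big n f ≡ ε
    big-ε = big-pred (_≡ ε) refl (λ { refl refl → M.identityˡ ε })

    big-∙ : ∀ n f g → big n (λ i → f i ∙ g i) ≡ big n f ∙ big n g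
    big-∙ zero f g = sym (M.identityˡ ε)
    big-∙ (suc n) f g = trans (cong₂ _∙_ (big-∙ n f g) refl) (interchange _ _ _ _)

    big-split : ∀ m n f → big (m + n) f ≡ big m f ∙ big n (λ i → f (m + i))
    big-split m zero f rewrite +-identityʳ m = sym (M.identityʳ _)
    big-split m (suc n) f rewrite +-suc m n =
      trans (cong (_∙ f (m + n)) (big-split m n f)) (M.assoc _ _ _)

    big-head : ∀ n f → big (suc n) f ≡ f 0 ∙ big n (f ∘ suc)
    big-head n f = trans (big-split 1 n f) (cong₂ _∙_ (M.identityˡ _) refl)

    big-swap : ∀ m n (f : ℕ → ℕ → A) →
      big m (λ i → big n (λ j → f i j)) ≡ big n (λ j → big m (λ i → f i j))
    big-swap zero n f = sym (big-ε n (λ _ _ → refl))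
    big-swap (suc m) n f = trans (cong₂ _∙_ (big-swap m n f) refl) (sym (big-∙ n _ _))

    big-blocks : ∀ m n f → big (m * n) f ≡ big m (λ i → big n (λ j → f (i * n + j)))
    big-blocks zero n f = refl
    big-blocks (suc m) n f = begin
      big (n + m * n) f                                    ≡⟨ cong (λ s → big s f) (+-comm n (m * n)) ⟩
      big (m * n + n) f                                    ≡⟨ big-split (m * n) n f ⟩
      big (m * n) f ∙ big n (λ j → f (m * n + j))          ≡⟨ cong₂ _∙_ (big-blocks m n f) refl ⟩
      big (suc m) (λ i → big n (λ j → f (i * n + j)))      ∎
      where open ≡-Reasoning

    big-rev : ∀ n f → big n f ≡ big n (λ i → f (n ∸ suc i))
    big-rev zero f = refl
    big-rev (suc n) f = begin
      big n f ∙ f n                               ≡⟨ M.comm _ _ ⟩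
      f n ∙ big n f                               ≡⟨ cong (f n ∙_) (big-rev n f) ⟩
      f n ∙ big n (λ i → f (n ∸ suc i))           ≡⟨ sym (big-head n (λ i → f (n ∸ i))) ⟩
      big (suc n) (λ i → f (n ∸ i))               ∎
      where open ≡-Reasoning

    big-single : ∀ n f j → j < n → (∀ i → i < n → i ≢ j → f i ≡ ε) → big n f ≡ f j
    big-single (suc n) f j j<sn h with j ≟ n
    ... | yes refl = trans (cong (_∙ f n) (big-ε n (λ i i<n → h i (m<n⇒m<1+n i<n) (<⇒≢ i<n)))) (M.identityˡ _)
    ... | no j≢n = trans (cong₂ _∙_ (big-single n f j (≤∧≢⇒< (≤-pred j<sn) j≢n)
                                       (λ i i<n → h i (m<n⇒m<1+n i<n)))
                                    (h n ≤-refl (λ n≡j → j≢n (sym n≡j)))) (M.identityʳ _)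

    private
      big-sum : ∀ n f → big n f ≡ sum {n} (f ∘ toℕ)
      big-sum zero f = refl
      big-sum (suc n) f = trans (big-head n f) (cong (f 0 ∙_) (big-sum n (f ∘ suc)))

    -- Both maps live on all of ℕ and need only preserve the initial segment; they are carried to
    -- `Fin n`, where invariance under permutations is available.
    big-perm : ∀ n (σ τ : ℕ → ℕ) → (∀ i → i < n → σ i < n) → (∀ i → i < n → τ i < n) →
      (∀ i → i < n → σ (τ i) ≡ i) → (∀ i → i < n → τ (σ i) ≡ i) →
      ∀ f → big n (f ∘ σ) ≡ big n f
    big-perm n σ τ σ< τ< στ τσ f = sym (begin
      big n f                                  ≡⟨ big-sum n f ⟩
      sum {n} (f ∘ toℕ)                        ≡⟨ sum-permute (f ∘ toℕ) π ⟩
      sum {n} (λ i → f (toℕ (π ⟨$⟩ʳ i)))       ≡⟨ sum-cong {n} (λ i → cong f (toℕ-fromℕ< (σ< (toℕ i) (toℕ<n i)))) ⟩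
      sum {n} (f ∘ σ ∘ toℕ)                    ≡⟨ sym (big-sum n (f ∘ σ)) ⟩
      big n (f ∘ σ)                            ∎)
      where
      open ≡-Reasoning
      sum-cong : ∀ {m} {g h : Fin m → A} → (∀ i → g i ≡ h i) → sum g ≡ sum h
      sum-cong {zero} e = refl
      sum-cong {suc m} e = cong₂ _∙_ (e Fin.zero) (sum-cong (e ∘ Fin.suc))
      lift : (ρ : ℕ → ℕ) → (∀ i → i < n → ρ i < n) → Fin n → Fin n
      lift ρ ρ< i = fromℕ< (ρ< (toℕ i) (toℕ<n i))
      cancel : ∀ (ρ ρ′ : ℕ → ℕ) ρ< ρ′< → (∀ i → i < n → ρ (ρ′ i) ≡ i) → ∀ i → lift ρ ρ< (lift ρ′ ρ′< i) ≡ i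
      cancel ρ ρ′ ρ< ρ′< e i = toℕ-injective (trans (toℕ-fromℕ< _)
        (trans (cong ρ (toℕ-fromℕ< _)) (e (toℕ i) (toℕ<n i))))
      π : Permutation n n
      π = permutation (lift σ σ<) (lift τ τ<) (cancel σ τ σ< τ< στ) (cancel τ σ τ< σ< τσ)

  module RingBig {A : Set} {_+ᴬ_ _*ᴬ_ : A → A → A} {0ᴬ : A}
    (+-cm : IsCommutativeMonoid _≡_ _+ᴬ_ 0ᴬ)
    (distribˡ : ∀ x y z → x *ᴬ (y +ᴬ z) ≡ (x *ᴬ y) +ᴬ (x *ᴬ z)) (zeroʳ : ∀ x → x *ᴬ 0ᴬ ≡ 0ᴬ)
    (*-comm′ : ∀ x y → x *ᴬ y ≡ y *ᴬ x) where

    open Big +-cm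

    big-*ˡ : ∀ n c f → c *ᴬ big n f ≡ big n (λ i → c *ᴬ f i)
    big-*ˡ zero c f = zeroʳ c
    big-*ˡ (suc n) c f = trans (distribˡ c _ _) (cong₂ _+ᴬ_ (big-*ˡ n c f) refl)

    big-*ʳ : ∀ n c f → big n f *ᴬ c ≡ big n (λ i → f i *ᴬ c)
    big-*ʳ n c f = trans (*-comm′ _ c) (trans (big-*ˡ n c f) (big-ext n (λ i → *-comm′ c (f i))))

-- Congruences of integers with explicit quotients.

module Congruences where

  open BigOperators
  open import Defs using (modℤ)
  open import Data.Nat as ℕ using (ℕ; zero; suc; NonZero)
  import Data.Nat.Properties as ℕ
  import Data.Nat.Divisibility as ℕ
  open import Data.Integer using (ℤ; +_; _+_; _*_; -_; _-_; _^_; ∣_∣; _/ℕ_)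
  open import Data.Integer.Properties
  import Data.Integer.Divisibility as U
  open import Data.Integer.Divisibility.Signed using (_∣_; divides; ∣ᵤ⇒∣; ∣⇒∣ᵤ)
  import Data.Integer.DivMod as ℤ
  open import Data.Integer.Tactic.RingSolver using (solve-∀)
  open import Data.Product using (_,_)
  import Data.Sum as ⊎
  open import Data.Empty using (⊥-elim)
  open import Level using (0ℓ)
  open import Relation.Binary.Bundles using (Setoid)
  open import Relation.Nullary using (Dec; yes; no)
  open import Relation.Binary.PropositionalEquality

  open Big +-0-isCommutativeMonoid public using () renaming
    (big to ∑; big-rel to ∑-rel; big-cong to ∑-cong; big-ext to ∑-ext; big-ε to ∑-zero; big-∙ to ∑-+
    ; big-head to ∑-head; big-swap to ∑-swap; big-single to ∑-single; big-perm to ∑-perm)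
  open Big *-1-isCommutativeMonoid public using () renaming
    (big to ∏; big-rel to ∏-rel; big-cong to ∏-cong; big-ext to ∏-ext; big-ε to ∏-one; big-∙ to ∏-*; big-split to ∏-split
    ; big-head to ∏-head; big-swap to ∏-swap; big-blocks to ∏-blocks; big-perm to ∏-perm)
  open RingBig +-0-isCommutativeMonoid *-distribˡ-+ *-zeroʳ *-comm public using () renaming
    (big-*ˡ to ∑-*ˡ; big-*ʳ to ∑-*ʳ)

  infix 4 _≈[_]_

  -- The quotient is stored because it is used as a number later on: the defects of additivity of
  -- Teichmüller lifts, divided by p, are such quotients.
  record _≈[_]_ (x : ℤ) (m : ℕ) (y : ℤ) : Set where
    constructor by
    field
      quotient : ℤ
      equality : x ≡ y + + m * quotient

  module _ {m : ℕ} where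

    ≡⇒≈ : ∀ {x y} → x ≡ y → x ≈[ m ] y
    ≡⇒≈ {x} refl = by (+ 0) (lem x (+ m))
      where
      lem : ∀ x n → x ≡ x + n * + 0
      lem = solve-∀

    ≈-refl : ∀ {x} → x ≈[ m ] x
    ≈-refl = ≡⇒≈ refl

    ≈-sym : ∀ {x y} → x ≈[ m ] y → y ≈[ m ] x
    ≈-sym {x} {y} (by c refl) = by (- c) (lem y (+ m) c)
      where
      lem : ∀ y n c → y ≡ (y + n * c) + n * - c
      lem = solve-∀

    ≈-trans : ∀ {x y z} → x ≈[ m ] y → y ≈[ m ] z → x ≈[ m ] z
    ≈-trans {z = z} (by c refl) (by d refl) = by (c + d) (lem z (+ m) c d)
      where
      lem : ∀ z n c d → (z + n * d) + n * c ≡ z + n * (c + d)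
      lem = solve-∀

    +-mod : ∀ {x y u v} → x ≈[ m ] y → u ≈[ m ] v → x + u ≈[ m ] y + v
    +-mod {y = y} {v = v} (by c refl) (by d refl) = by (c + d) (lem y v (+ m) c d)
      where
      lem : ∀ y v n c d → (y + n * c) + (v + n * d) ≡ (y + v) + n * (c + d)
      lem = solve-∀

    *-mod : ∀ {x y u v} → x ≈[ m ] y → u ≈[ m ] v → x * u ≈[ m ] y * v
    *-mod {y = y} {v = v} (by c refl) (by d refl) = by (y * d + c * v + c * (+ m * d)) (lem y v (+ m) c d)
      where
      lem : ∀ y v n c d → (y + n * c) * (v + n * d) ≡ y * v + n * (y * d + c * v + c * (n * d))
      lem = solve-∀

    neg-mod : ∀ {x y} → x ≈[ m ] y → - x ≈[ m ] - y
    neg-mod {y = y} (by c refl) = by (- c) (lem y (+ m) c)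
      where
      lem : ∀ y n c → - (y + n * c) ≡ - y + n * - c
      lem = solve-∀

    -‿mod : ∀ {x y u v} → x ≈[ m ] y → u ≈[ m ] v → x - u ≈[ m ] y - v
    -‿mod a b = +-mod a (neg-mod b)

    *-modˡ : ∀ x {u v} → u ≈[ m ] v → x * u ≈[ m ] x * v
    *-modˡ x = *-mod (≈-refl {x})

    *-modʳ : ∀ x {u v} → u ≈[ m ] v → u * x ≈[ m ] v * x
    *-modʳ x e = *-mod e (≈-refl {x})

    ^-mod : ∀ {x y} n → x ≈[ m ] y → x ^ n ≈[ m ] y ^ n
    ^-mod zero e = ≈-refl
    ^-mod (suc n) e = *-mod e (^-mod n e)

    ∑-mod : ∀ n {f g} → (∀ i → i ℕ.< n → f i ≈[ m ] g i) → ∑ n f ≈[ m ] ∑ n g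
    ∑-mod = ∑-rel _≈[ m ]_ ≈-refl +-mod

    ∏-mod : ∀ n {f g} → (∀ i → i ℕ.< n → f i ≈[ m ] g i) → ∏ n f ≈[ m ] ∏ n g
    ∏-mod = ∏-rel _≈[ m ]_ ≈-refl *-mod

    ∑-mod-zero : ∀ n {f} → (∀ i → i ℕ.< n → f i ≈[ m ] + 0) → ∑ n f ≈[ m ] + 0
    ∑-mod-zero n h = ≈-trans (∑-mod n h) (≡⇒≈ (∑-zero n (λ _ _ → refl)))

    ≈⇒∣ : ∀ {x y} → x ≈[ m ] y → + m U.∣ x - y
    ≈⇒∣ {x} {y} (by c refl) = ∣⇒∣ᵤ (divides c (lem y (+ m) c))
      where
      lem : ∀ y n c → (y + n * c) - y ≡ c * n
      lem = solve-∀

    ∣⇒≈ : ∀ {x y} → + m U.∣ x - y → x ≈[ m ] y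
    ∣⇒≈ {x} {y} d with ∣ᵤ⇒∣ d
    ... | divides c e = by c (trans (lem x y) (cong (_+_ y) (trans e (*-comm c (+ m)))))
      where
      lem : ∀ x y → x ≡ y + (x - y)
      lem = solve-∀

    0≈⇒∣ : ∀ {n} → + n ≈[ m ] + 0 → m ℕ.∣ n
    0≈⇒∣ {n} e = subst (λ z → m ℕ.∣ ∣ z ∣) (+-identityʳ (+ n)) (≈⇒∣ e)

    ∣⇒0≈ : ∀ {n} → m ℕ.∣ n → + n ≈[ m ] + 0
    ∣⇒0≈ {n} d = ∣⇒≈ (subst (λ z → m ℕ.∣ ∣ z ∣) (sym (+-identityʳ (+ n))) d)

    m≈0 : ∀ x → + m * x ≈[ m ] + 0
    m≈0 x = by x (sym (+-identityˡ _))

    *-zero-mod : ∀ x {y} → y ≈[ m ] + 0 → x * y ≈[ m ] + 0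
    *-zero-mod x e = ≈-trans (*-modˡ x e) (≡⇒≈ (*-zeroʳ x))

    *-zero-modʳ : ∀ {x} y → x ≈[ m ] + 0 → x * y ≈[ m ] + 0
    *-zero-modʳ y e = ≈-trans (*-modʳ y e) (≡⇒≈ (*-zeroˡ y))

    cancel-mod : ∀ {u v x y} → u * v ≈[ m ] + 1 → u * x ≈[ m ] u * y → x ≈[ m ] y
    cancel-mod {u} {v} {x} {y} uv e = ≈-trans (≈-sym (half x)) (≈-trans (*-modˡ v e) (half y))
      where
      half : ∀ z → v * (u * z) ≈[ m ] z
      half z = ≈-trans (≡⇒≈ (lem u v z)) (≈-trans (*-modʳ z uv) (≡⇒≈ (*-identityˡ z)))
        where
        lem : ∀ u v z → v * (u * z) ≡ (u * v) * z
        lem = solve-∀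

    minus-zero : ∀ {x y} → x - y ≈[ m ] + 0 → x ≈[ m ] y
    minus-zero {x} {y} e = ≈-trans (≡⇒≈ (lem x y)) (≈-trans (+-mod e (≈-refl {y})) (≡⇒≈ (+-identityˡ y)))
      where
      lem : ∀ x y → x ≡ (x - y) + y
      lem = solve-∀

    zero-minus : ∀ {x y} → x ≈[ m ] y → x - y ≈[ m ] + 0
    zero-minus {x} {y} e = ≈-trans (-‿mod e ≈-refl) (≡⇒≈ (+-inverseʳ y))

  ≈-down : ∀ {m n x y} → m ℕ.∣ n → x ≈[ n ] y → x ≈[ m ] y
  ≈-down {m} {y = y} (ℕ.divides d refl) (by c refl) = by (+ d * c) (cong (_+_ y) (trans (cong (_* c) (pos-* d m)) (lem (+ d) (+ m) c)))
    where
    lem : ∀ d m c → d * m * c ≡ m * (d * c)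
    lem = solve-∀

  *-up : ∀ {m x y} d → x ≈[ m ] y → + d * x ≈[ d ℕ.* m ] + d * y
  *-up {m} {y = y} d (by c refl) = by c (trans (lem (+ d) y (+ m) c) (cong (λ z → + d * y + z * c) (sym (pos-* d m))))
    where
    lem : ∀ d y m c → d * (y + m * c) ≡ d * y + d * m * c
    lem = solve-∀

  ≈-setoid : ℕ → Setoid 0ℓ 0ℓ
  ≈-setoid m = record { Carrier = ℤ ; _≈_ = _≈[ m ]_ ; isEquivalence = record { refl = ≈-refl ; sym = ≈-sym ; trans = ≈-trans } }

  module ≈-Reasoning (m : ℕ) where
    open import Relation.Binary.Reasoning.Setoid (≈-setoid m) public

  modℤ-< : ∀ {m} .{{_ : NonZero m}} x → modℤ x m ℕ.< m
  modℤ-< {suc m} x = ℤ.n%ℕd<d x (suc m)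

  modℤ-≈ : ∀ {m} .{{_ : NonZero m}} x → + (modℤ x m) ≈[ m ] x
  modℤ-≈ {suc m} x = ≈-sym (by (x /ℕ suc m)
    (trans (ℤ.a≡a%ℕn+[a/ℕn]*n x (suc m)) (cong (λ z → + (modℤ x (suc m)) + z) (*-comm (x /ℕ suc m) (+ suc m)))))

  module _ {m : ℕ} .{{m≢0 : NonZero m}} where

    residue-unique : ∀ {i j} → i ℕ.< m → j ℕ.< m → + i ≈[ m ] + j → i ≡ j
    residue-unique {i} {j} i<m j<m e = ⊎.[_,_]′ (λ i≤j → sym (go i≤j j<m (≈-sym e))) (λ j≤i → go j≤i i<m e) (ℕ.≤-total i j)
      where
      go : ∀ {a b} → a ℕ.≤ b → b ℕ.< m → + b ≈[ m ] + a → b ≡ a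
      go {a} {b} a≤b b<m e = trans (sym (ℕ.m∸n+n≡m a≤b)) (cong (ℕ._+ a) (small (b ℕ.∸ a) refl))
        where
        m∣b∸a : m ℕ.∣ b ℕ.∸ a
        m∣b∸a = subst (λ z → m ℕ.∣ ∣ z ∣) (trans ([+m]-[+n]≡m⊖n b a) (⊖-≥ a≤b)) (≈⇒∣ e)
        small : ∀ d → d ≡ b ℕ.∸ a → b ℕ.∸ a ≡ 0
        small zero eq = sym eq
        small (suc d) eq = ⊥-elim (ℕ.>⇒∤ (ℕ.≤-<-trans (ℕ.≤-trans (ℕ.≤-reflexive eq) (ℕ.m∸n≤m b a)) b<m) (subst (m ℕ.∣_) (sym eq) m∣b∸a))

    modℤ-cong : ∀ {x y} → x ≈[ m ] y → modℤ x m ≡ modℤ y m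
    modℤ-cong {x} {y} e = residue-unique (modℤ-< x) (modℤ-< y) (≈-trans (modℤ-≈ x) (≈-trans e (≈-sym (modℤ-≈ y))))

    modℤ-small : ∀ {i} → i ℕ.< m → modℤ (+ i) m ≡ i
    modℤ-small {i} i<m = residue-unique (modℤ-< (+ i)) i<m (modℤ-≈ (+ i))

    modℤ-eq : ∀ {x i} → i ℕ.< m → x ≈[ m ] + i → modℤ x m ≡ i
    modℤ-eq i<m e = trans (modℤ-cong e) (modℤ-small i<m)

    modℤ-inv : ∀ {x y} → modℤ x m ≡ modℤ y m → x ≈[ m ] y
    modℤ-inv {x} {y} e = ≈-trans (≈-sym (modℤ-≈ x)) (≈-trans (≡⇒≈ (cong +_ e)) (modℤ-≈ y))

    ≈? : ∀ x y → Dec (x ≈[ m ] y)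
    ≈? x y with modℤ x m ℕ.≟ modℤ y m
    ... | yes e = yes (modℤ-inv e)
    ... | no ne = no (λ e → ne (modℤ-cong e))

  *-^ : ∀ x y n → (x * y) ^ n ≡ x ^ n * y ^ n
  *-^ x y zero = refl
  *-^ x y (suc n) = trans (cong (x * y *_) (*-^ x y n)) (lem x y (x ^ n) (y ^ n))
    where
    lem : ∀ x y a b → x * y * (a * b) ≡ x * a * (y * b)
    lem = solve-∀

  pos-^ : ∀ a n → + (a ℕ.^ n) ≡ (+ a) ^ n
  pos-^ a zero = refl
  pos-^ a (suc n) = trans (pos-* a (a ℕ.^ n)) (cong (+ a *_) (pos-^ a n))

  ∑-const : ∀ n c → ∑ n (λ _ → c) ≡ + n * c
  ∑-const zero c = sym (*-zeroˡ c)
  ∑-const (suc n) c = trans (cong (_+ c) (∑-const n c)) (trans (lem (+ n) c) (cong (_* c) (+-comm (+ n) (+ 1))))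
    where
    lem : ∀ n c → n * c + c ≡ (n + + 1) * c
    lem = solve-∀

  ∏-const : ∀ n c → ∏ n (λ _ → c) ≡ c ^ n
  ∏-const zero c = refl
  ∏-const (suc n) c = trans (cong (_* c) (∏-const n c)) (*-comm (c ^ n) c)

  ∏-^ : ∀ n f e → ∏ n f ^ e ≡ ∏ n (λ i → f i ^ e)
  ∏-^ zero f e = ^-zeroˡ e
  ∏-^ (suc n) f e = trans (*-^ (∏ n f) (f n) e) (cong (_* f n ^ e) (∏-^ n f e))

-- Residues modulo an odd prime: Fermat, Wilson, characters and orthogonality.

module Residues where

  open BigOperators
  open Congruences
  open import Defs using (modℤ)
  open import Data.Nat as ℕ using (ℕ; zero; suc; NonZero; z≤n; s≤s)
  import Data.Nat.Properties as ℕ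
  import Data.Nat.Divisibility as ℕ
  import Data.Nat.DivMod as ℕ
  import Data.Nat.Tactic.RingSolver as ℕ
  open import Data.Nat.Primality using (Prime; prime⇒nonZero; prime⇒nonTrivial; euclidsLemma)
  open import Data.Nat.GCD using (module Bézout)
  open import Data.Nat.Coprimality using (prime⇒coprime; coprime-Bézout)
  open import Data.Integer using (ℤ; +_; _+_; _*_; -_; _-_; _^_; ∣_∣)
  open import Data.Integer.Properties
  open import Data.Integer.Tactic.RingSolver using (solve-∀)
  open import Data.Product using (Σ-syntax; _,_; _×_; proj₁; proj₂)
  open import Data.Sum using (_⊎_; inj₁; inj₂)
  open import Data.Empty using (⊥-elim)
  open import Relation.Binary.Definitions using (tri<; tri≈; tri>)
  open import Relation.Nullary using (Dec; yes; no; ¬_)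
  open import Relation.Binary.PropositionalEquality

  -1ℤ : ℤ
  -1ℤ = - + 1

  -1^-even : ∀ h → -1ℤ ^ (h ℕ.+ h) ≡ + 1
  -1^-even h = trans (^-distribˡ-+-* -1ℤ h h) (trans (sym (*-^ -1ℤ -1ℤ h)) (^-zeroˡ h))

  -- Finite differences replace the count of roots of a polynomial: they give Wilson's theorem and,
  -- without primitive roots, elements on which a given character is nontrivial.
  Δ : ℕ → (ℕ → ℤ) → ℕ → ℤ
  Δ zero    f x = f x
  Δ (suc n) f x = Δ n f (suc x) - Δ n f x

  Δ-leibniz : ∀ n g x → Δ (suc n) (λ y → + y * g y) x ≡ (+ x + + suc n) * Δ (suc n) g x + + suc n * Δ n g x
  Δ-leibniz zero g x = lem (+ x) (g (suc x)) (g x)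
    where
    lem : ∀ X a b → (+ 1 + X) * a - X * b ≡ (X + + 1) * (a - b) + + 1 * b
    lem = solve-∀
  Δ-leibniz (suc n) g x = begin
    Δ (suc n) (λ y → + y * g y) (suc x) - Δ (suc n) (λ y → + y * g y) x
      ≡⟨ cong₂ _-_ (Δ-leibniz n g (suc x)) (Δ-leibniz n g x) ⟩
    ((+ suc x + + suc n) * Δ (suc n) g (suc x) + + suc n * Δ n g (suc x)) - ((+ x + + suc n) * Δ (suc n) g x + + suc n * Δ n g x)
      ≡⟨ lem (+ x) (+ n) (Δ (suc n) g (suc x)) (Δ n g (suc x)) (Δ n g x) ⟩
    (+ x + + suc (suc n)) * Δ (suc (suc n)) g x + + suc (suc n) * Δ (suc n) g x ∎
    where
    open ≡-Reasoning
    lem : ∀ X N a b c → ((+ 1 + X + (+ 1 + N)) * a + (+ 1 + N) * b) - ((X + (+ 1 + N)) * (b - c) + (+ 1 + N) * c)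
      ≡ (X + (+ 1 + (+ 1 + N))) * (a - (b - c)) + (+ 1 + (+ 1 + N)) * (b - c)
    lem = solve-∀

  fact : ℕ → ℤ
  fact n = ∏ n (λ i → + suc i)

  -- The two claims are proved together: the Leibniz rule for y · y^n expresses the next top
  -- difference through both of them, and a constant top difference has difference 0.
  Δ-power : ∀ n → (∀ x → Δ n (λ y → (+ y) ^ n) x ≡ fact n) × (∀ x → Δ (suc n) (λ y → (+ y) ^ n) x ≡ + 0)
  Δ-power zero = (λ x → refl) , (λ x → refl)
  Δ-power (suc n) with Δ-power n
  ... | top , over = top′ , (λ x → trans (cong₂ _-_ (top′ (suc x)) (top′ x)) (+-inverseʳ (fact (suc n))))
    where
    open ≡-Reasoning
    top′ : ∀ x → Δ (suc n) (λ y → + y * (+ y) ^ n) x ≡ fact n * + suc n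
    top′ x = begin
      Δ (suc n) (λ y → + y * (+ y) ^ n) x   ≡⟨ Δ-leibniz n (λ y → (+ y) ^ n) x ⟩
      (+ x + + suc n) * Δ (suc n) (λ y → (+ y) ^ n) x + + suc n * Δ n (λ y → (+ y) ^ n) x
                                            ≡⟨ cong₂ (λ a b → (+ x + + suc n) * a + + suc n * b) (over x) (top x) ⟩
      (+ x + + suc n) * + 0 + + suc n * fact n ≡⟨ lem (+ x + + suc n) (+ suc n) (fact n) ⟩
      fact n * + suc n                      ∎
      where
      lem : ∀ a b c → a * + 0 + b * c ≡ c * b
      lem = solve-∀

  module _ {m : ℕ} (N : ℕ) (f : ℕ → ℤ) (ones : ∀ i → 1 ℕ.≤ i → i ℕ.≤ N → f i ≈[ m ] + 1) where

    Δ-ones : ∀ n x → 1 ℕ.≤ x → x ℕ.+ suc n ℕ.≤ N → Δ (suc n) f x ≈[ m ] + 0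
    Δ-ones zero x 1≤x b = -‿mod (ones (suc x) (s≤s z≤n) (subst (ℕ._≤ N) (ℕ.+-comm x 1) b)) (ones x 1≤x (ℕ.m+n≤o⇒m≤o x b))
    Δ-ones (suc n) x 1≤x b =
      -‿mod (Δ-ones n (suc x) (s≤s z≤n) (subst (ℕ._≤ N) (ℕ.+-suc x (suc n)) b))
            (Δ-ones n x 1≤x (ℕ.≤-trans (ℕ.+-monoʳ-≤ x (ℕ.n≤1+n _)) b))

    -- The function differs from the constant 1 only at 0, and the value there enters the (n+1)-st
    -- difference with sign (-1)^(n+1).
    Δ-ones-0 : f 0 ≈[ m ] + 0 → ∀ n → suc n ℕ.≤ N → Δ (suc n) f 0 ≈[ m ] -1ℤ ^ n
    Δ-ones-0 f0 zero b = -‿mod (ones 1 (s≤s z≤n) b) f0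
    Δ-ones-0 f0 (suc n) b = ≈-trans
      (-‿mod (Δ-ones n 1 (s≤s z≤n) b) (Δ-ones-0 f0 n (ℕ.≤-trans (ℕ.n≤1+n _) b)))
      (≡⇒≈ (lem (-1ℤ ^ n)))
      where
      lem : ∀ a → + 0 - a ≡ (- + 1) * a
      lem = solve-∀

  search : ∀ {P : ℕ → Set} → (∀ i → Dec (P i)) → ∀ n → (∀ i → i ℕ.< n → P i) ⊎ (Σ[ i ∈ ℕ ] (i ℕ.< n × ¬ P i))
  search P? zero = inj₁ (λ i ())
  search {P} P? (suc n) with search P? n | P? n
  ... | inj₂ (i , i<n , ¬p) | _ = inj₂ (i , ℕ.m<n⇒m<1+n i<n , ¬p)
  ... | inj₁ all | no ¬p = inj₂ (n , ℕ.≤-refl , ¬p)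
  ... | inj₁ all | yes pn = inj₁ go
    where
    go : ∀ i → i ℕ.< suc n → P i
    go i i<sn with i ℕ.≟ n
    ... | yes refl = pn
    ... | no i≢n = all i (ℕ.≤∧≢⇒< (ℕ.≤-pred i<sn) i≢n)

  module OddPrime (p q h : ℕ) (pr : Prime p) (p≡1+q : p ≡ suc q) (q≡h+h : q ≡ h ℕ.+ h) where

    instance
      p≢0 : NonZero p
      p≢0 = prime⇒nonZero pr

    1<p : 1 ℕ.< p
    1<p = ℕ.nonTrivial⇒n>1 p {{prime⇒nonTrivial pr}}

    q<p : q ℕ.< p
    q<p = ℕ.≤-reflexive (sym p≡1+q)

    1≤q : 1 ℕ.≤ q
    1≤q = ℕ.≤-pred (subst (1 ℕ.<_) p≡1+q 1<p)

    1≤h : 1 ℕ.≤ h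
    1≤h = go h q≡h+h
      where
      go : ∀ h → q ≡ h ℕ.+ h → 1 ℕ.≤ h
      go zero e = ⊥-elim (ℕ.<-irrefl (sym e) 1≤q)
      go (suc _) _ = s≤s z≤n

    instance
      q≢0 : NonZero q
      q≢0 = ℕ.>-nonZero 1≤q

    p∣p^ : ∀ k → p ℕ.∣ p ℕ.^ suc k
    p∣p^ k = ℕ.divides (p ℕ.^ k) (ℕ.*-comm p (p ℕ.^ k))

    p^∣p^1+ : ∀ k → p ℕ.^ k ℕ.∣ p ℕ.^ suc k
    p^∣p^1+ k = ℕ.divides p refl

    +p≡1+q : + p ≡ + 1 + + q
    +p≡1+q = cong +_ p≡1+q

    -1^q : -1ℤ ^ q ≡ + 1
    -1^q = trans (cong (-1ℤ ^_) q≡h+h) (-1^-even h)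

    -1^p : -1ℤ ^ p ≡ -1ℤ
    -1^p = trans (cong (-1ℤ ^_) p≡1+q) (cong (-1ℤ *_) -1^q)

    -1^p^ : ∀ k → -1ℤ ^ (p ℕ.^ k) ≡ -1ℤ
    -1^p^ zero = refl
    -1^p^ (suc k) = trans (sym (^-*-assoc -1ℤ p (p ℕ.^ k))) (trans (cong (_^ (p ℕ.^ k)) -1^p) (-1^p^ k))

    Unit : ℤ → Set
    Unit x = ¬ (x ≈[ p ] + 0)

    unit? : ∀ x → (x ≈[ p ] + 0) ⊎ Unit x
    unit? x with ≈? {p} x (+ 0)
    ... | yes e = inj₁ e
    ... | no ¬e = inj₂ ¬e

    euclid : ∀ x y → x * y ≈[ p ] + 0 → x ≈[ p ] + 0 ⊎ y ≈[ p ] + 0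
    euclid x y e with euclidsLemma ∣ x ∣ ∣ y ∣ pr (subst (p ℕ.∣_) (abs-* x y) (to (x * y) e))
      where
      to : ∀ z → z ≈[ p ] + 0 → p ℕ.∣ ∣ z ∣
      to z e = subst (λ w → p ℕ.∣ ∣ w ∣) (+-identityʳ z) (≈⇒∣ e)
    ... | inj₁ d = inj₁ (∣⇒≈ (subst (λ w → p ℕ.∣ ∣ w ∣) (sym (+-identityʳ x)) d))
    ... | inj₂ d = inj₂ (∣⇒≈ (subst (λ w → p ℕ.∣ ∣ w ∣) (sym (+-identityʳ y)) d))

    unit-≈ : ∀ {x y} → x ≈[ p ] y → Unit x → Unit y
    unit-≈ e u z = u (≈-trans e z)

    unit-* : ∀ {x y} → Unit x → Unit y → Unit (x * y)
    unit-* {x} {y} ux uy e with euclid x y e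
    ... | inj₁ z = ux z
    ... | inj₂ z = uy z

    unit-*ˡ : ∀ {x} y → Unit (x * y) → Unit x
    unit-*ˡ y u e = u (*-zero-modʳ y e)

    unit-small : ∀ i → 1 ℕ.≤ i → i ℕ.< p → Unit (+ i)
    unit-small (suc i) _ i<p e = ℕ.>⇒∤ i<p (0≈⇒∣ e)

    unit-1 : Unit (+ 1)
    unit-1 = unit-small 1 (s≤s z≤n) 1<p

    unit-^ : ∀ {x} n → Unit x → Unit (x ^ n)
    unit-^ zero u = unit-1
    unit-^ (suc n) u = unit-* u (unit-^ n u)

    unit-neg : ∀ {x} → Unit x → Unit (- x)
    unit-neg {x} u e = u (≈-trans (≡⇒≈ (sym (neg-involutive x))) (neg-mod e))

    unit--1 : Unit -1ℤ
    unit--1 = unit-neg unit-1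

    unit-∏ : ∀ n f → (∀ i → i ℕ.< n → Unit (f i)) → Unit (∏ n f)
    unit-∏ zero f u = unit-1
    unit-∏ (suc n) f u = unit-* (unit-∏ n f (λ i i<n → u i (ℕ.m<n⇒m<1+n i<n))) (u n ℕ.≤-refl)

    unit-2 : Unit (+ 2)
    unit-2 = unit-small 2 (s≤s z≤n) (subst (2 ℕ.<_) (sym p≡1+q) (s≤s (subst (2 ℕ.≤_) (sym q≡h+h) (ℕ.+-mono-≤ 1≤h 1≤h))))

    inverse-p : ∀ u → Unit u → Σ[ v ∈ ℤ ] u * v ≈[ p ] + 1
    inverse-p u unit = go (modℤ u p) refl
      where
      go : ∀ i → i ≡ modℤ u p → Σ[ v ∈ ℤ ] u * v ≈[ p ] + 1
      go zero e = ⊥-elim (unit (≈-trans (≈-sym (modℤ-≈ u)) (≡⇒≈ (cong +_ (sym e)))))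
      go (suc i) e with coprime-Bézout (prime⇒coprime {n = suc i} pr (subst (ℕ._< p) (sym e) (modℤ-< u)))
      ... | Bézout.+- x y eq = - + y , ≈-trans (*-modʳ (- + y) u≈) (≈-sym (by (+ x) (lem (+ suc i) (+ y) (+ x) (+ p) eq′)))
        where
        u≈ : u ≈[ p ] + suc i
        u≈ = ≈-trans (≈-sym (modℤ-≈ u)) (≡⇒≈ (cong +_ (sym e)))
        eq′ : + 1 + + y * + suc i ≡ + x * + p
        eq′ = trans (cong (_+_ (+ 1)) (sym (pos-* y (suc i)))) (trans (cong +_ eq) (pos-* x p))
        lem : ∀ i y x p → + 1 + y * i ≡ x * p → + 1 ≡ i * - y + p * x
        lem i y x p e = trans (l1 i y) (trans (cong (_+_ (i * - y)) e) (cong (_+_ (i * - y)) (*-comm x p)))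
          where
          l1 : ∀ i y → + 1 ≡ i * - y + (+ 1 + y * i)
          l1 = solve-∀
      ... | Bézout.-+ x y eq = + y , ≈-trans (*-modʳ (+ y) u≈) (by (+ x) (lem (+ suc i) (+ y) (+ x) (+ p) eq′))
        where
        u≈ : u ≈[ p ] + suc i
        u≈ = ≈-trans (≈-sym (modℤ-≈ u)) (≡⇒≈ (cong +_ (sym e)))
        eq′ : + 1 + + x * + p ≡ + y * + suc i
        eq′ = trans (cong (_+_ (+ 1)) (sym (pos-* x p))) (trans (cong +_ eq) (pos-* y (suc i)))
        lem : ∀ i y x p → + 1 + x * p ≡ y * i → i * y ≡ + 1 + p * x
        lem i y x p e = trans (*-comm i y) (trans (sym e) (cong (_+_ (+ 1)) (*-comm x p)))

    module _ (u : ℤ) (unit : Unit u) where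

      private
        v = proj₁ (inverse-p u unit)
        uv = proj₂ (inverse-p u unit)

        σ τ : ℕ → ℕ
        σ i = modℤ (u * + i) p
        τ i = modℤ (v * + i) p

        inv : ∀ a b → a * b ≈[ p ] + 1 → ∀ i → i ℕ.< p → modℤ (a * + modℤ (b * + i) p) p ≡ i
        inv a b ab i i<p = modℤ-eq i<p (begin
          a * + modℤ (b * + i) p   ≈⟨ *-modˡ a (modℤ-≈ (b * + i)) ⟩
          a * (b * + i)            ≡⟨ sym (*-assoc a b (+ i)) ⟩
          a * b * + i              ≈⟨ *-modʳ (+ i) ab ⟩
          + 1 * + i                ≡⟨ *-identityˡ (+ i) ⟩
          + i                      ∎)
          where open ≈-Reasoning p

        vu : v * u ≈[ p ] + 1
        vu = ≈-trans (≡⇒≈ (*-comm v u)) uv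

      -- Multiplication by a unit permutes the residues modulo p. The values of g are compared
      -- modulo an independent m, since characters of residues modulo p take values modulo p^k.
      scale-∑ : ∀ {m} (g : ℤ → ℤ) → (∀ {x y} → x ≈[ p ] y → g x ≈[ m ] g y) →
        ∑ p (λ i → g (u * + i)) ≈[ m ] ∑ p (λ i → g (+ i))
      scale-∑ g resp = ≈-trans (∑-mod p (λ i _ → resp (≈-sym (modℤ-≈ (u * + i)))))
        (≡⇒≈ (∑-perm p σ τ (λ i _ → modℤ-< (u * + i)) (λ i _ → modℤ-< (v * + i)) (inv u v uv) (inv v u vu) (λ i → g (+ i))))

      scale-∏ : ∀ {m} (g : ℤ → ℤ) → (∀ {x y} → x ≈[ p ] y → g x ≈[ m ] g y) →
        ∏ p (λ i → g (u * + i)) ≈[ m ] ∏ p (λ i → g (+ i))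
      scale-∏ g resp = ≈-trans (∏-mod p (λ i _ → resp (≈-sym (modℤ-≈ (u * + i)))))
        (≡⇒≈ (∏-perm p σ τ (λ i _ → modℤ-< (u * + i)) (λ i _ → modℤ-< (v * + i)) (inv u v uv) (inv v u vu) (λ i → g (+ i))))

    -- With multiples of p replaced by 1, a product over an interval becomes the restricted product
    -- in Morita's definition.
    strip : ℤ → ℤ
    strip x with unit? x
    ... | inj₁ _ = + 1
    ... | inj₂ _ = x

    strip-unit : ∀ {x} → Unit x → strip x ≡ x
    strip-unit {x} u with unit? x
    ... | inj₁ e = ⊥-elim (u e)
    ... | inj₂ _ = refl

    strip-zero : ∀ {x} → x ≈[ p ] + 0 → strip x ≡ + 1
    strip-zero {x} e with unit? x
    ... | inj₁ _ = refl
    ... | inj₂ u = ⊥-elim (u e)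

    strip-is-unit : ∀ x → Unit (strip x)
    strip-is-unit x with unit? x
    ... | inj₁ _ = unit-1
    ... | inj₂ u = u

    strip-mod : ∀ {m} → p ℕ.∣ m → ∀ {x y} → x ≈[ m ] y → strip x ≈[ m ] strip y
    strip-mod p∣m {x} {y} e with unit? x | unit? y
    ... | inj₁ _ | inj₁ _ = ≈-refl
    ... | inj₂ _ | inj₂ _ = e
    ... | inj₁ z | inj₂ u = ⊥-elim (u (≈-trans (≈-sym (≈-down p∣m e)) z))
    ... | inj₂ u | inj₁ z = ⊥-elim (u (≈-trans (≈-down p∣m e) z))

    ∏-p-head : ∀ f → ∏ p f ≡ f 0 * ∏ q (λ i → f (suc i))
    ∏-p-head f = trans (cong (λ s → ∏ s f) p≡1+q) (∏-head q f)

    ∑-p-head : ∀ f → ∑ p f ≡ f 0 + ∑ q (λ i → f (suc i))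
    ∑-p-head f = trans (cong (λ s → ∑ s f) p≡1+q) (∑-head q f)

    suc<p : ∀ {i} → i ℕ.< q → suc i ℕ.< p
    suc<p i<q = subst (_ ℕ.<_) (sym p≡1+q) (s≤s i<q)

    unit-fact : Unit (fact q)
    unit-fact = unit-∏ q _ (λ i i<q → unit-small (suc i) (s≤s z≤n) (suc<p i<q))

    ∏-strip : ∏ p (λ i → strip (+ i)) ≡ fact q
    ∏-strip = trans (∏-p-head _) (trans (cong₂ _*_ (strip-zero ≈-refl)
      (∏-cong q (λ i i<q → strip-unit (unit-small (suc i) (s≤s z≤n) (suc<p i<q))))) (*-identityˡ _))

    -- The product of the nonzero residues is invariant under multiplication by u and acquires the
    -- factor u^q.
    fermat : ∀ u → Unit u → u ^ q ≈[ p ] + 1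
    fermat u unit = cancel-mod {u = fact q} (proj₂ (inverse-p (fact q) unit-fact)) (begin
      fact q * u ^ q                                    ≡⟨ *-comm (fact q) (u ^ q) ⟩
      u ^ q * fact q                                    ≡⟨ cong (_* fact q) (sym (∏-const q u)) ⟩
      ∏ q (λ _ → u) * fact q                            ≡⟨ sym (∏-* q (λ _ → u) (λ i → + suc i)) ⟩
      ∏ q (λ i → u * + suc i)                           ≡⟨ ∏-cong q (λ i i<q → sym (strip-unit (unit-* unit (unit-small (suc i) (s≤s z≤n) (suc<p i<q))))) ⟩
      ∏ q (λ i → strip (u * + suc i))                   ≡⟨ sym (*-identityˡ _) ⟩
      + 1 * ∏ q (λ i → strip (u * + suc i))             ≡⟨ cong (_* ∏ q (λ i → strip (u * + suc i))) (sym (strip-zero (≡⇒≈ (*-zeroʳ u)))) ⟩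
      strip (u * + 0) * ∏ q (λ i → strip (u * + suc i)) ≡⟨ sym (∏-p-head (λ i → strip (u * + i))) ⟩
      ∏ p (λ i → strip (u * + i))                       ≈⟨ scale-∏ u unit strip (strip-mod (ℕ.∣-refl {p})) ⟩
      ∏ p (λ i → strip (+ i))                           ≡⟨ ∏-strip ⟩
      fact q                                            ≡⟨ sym (*-identityʳ (fact q)) ⟩
      fact q * + 1                                      ∎)
      where open ≈-Reasoning p

    fermat-p : ∀ x → x ^ p ≈[ p ] x
    fermat-p x with unit? x
    ... | inj₁ z = ≈-trans (≡⇒≈ (cong (x ^_) p≡1+q)) (≈-trans (*-zero-modʳ (x ^ q) z) (≈-sym z))
    ... | inj₂ u = ≈-trans (≡⇒≈ (cong (x ^_) p≡1+q)) (≈-trans (*-modˡ x (fermat x u)) (≡⇒≈ (*-identityʳ x)))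

    geometric : ∀ x y n → x ^ n - y ^ n ≡ (x - y) * ∑ n (λ i → x ^ i * y ^ (n ℕ.∸ suc i))
    geometric x y zero = sym (*-zeroʳ (x - y))
    geometric x y (suc n) = begin
      x * x ^ n - y * y ^ n
        ≡⟨ l1 x y (x ^ n) (y ^ n) ⟩
      (x - y) * x ^ n + y * (x ^ n - y ^ n)
        ≡⟨ cong (λ z → (x - y) * x ^ n + y * z) (geometric x y n) ⟩
      (x - y) * x ^ n + y * ((x - y) * S)
        ≡⟨ l2 x y (x ^ n) S ⟩
      (x - y) * (y * S + x ^ n * + 1)
        ≡⟨ cong (λ z → (x - y) * (z + x ^ n * + 1)) (trans (∑-*ˡ n y _) (∑-cong n step)) ⟩
      (x - y) * (∑ n (λ i → x ^ i * y ^ (n ℕ.∸ i)) + x ^ n * + 1)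
        ≡⟨ cong (λ z → (x - y) * (∑ n (λ i → x ^ i * y ^ (n ℕ.∸ i)) + x ^ n * y ^ z)) (sym (ℕ.n∸n≡0 n)) ⟩
      (x - y) * ∑ (suc n) (λ i → x ^ i * y ^ (suc n ℕ.∸ suc i)) ∎
      where
      open ≡-Reasoning
      S = ∑ n (λ i → x ^ i * y ^ (n ℕ.∸ suc i))
      l1 : ∀ x y a b → x * a - y * b ≡ (x - y) * a + y * (a - b)
      l1 = solve-∀
      l2 : ∀ x y a s → (x - y) * a + y * ((x - y) * s) ≡ (x - y) * (y * s + a * + 1)
      l2 = solve-∀
      step : ∀ i → i ℕ.< n → y * (x ^ i * y ^ (n ℕ.∸ suc i)) ≡ x ^ i * y ^ (n ℕ.∸ i)
      step i i<n = trans (l3 y (x ^ i) (y ^ (n ℕ.∸ suc i))) (cong (λ e → x ^ i * y ^ e) (sym (ℕ.+-∸-assoc 1 i<n)))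
        where
        l3 : ∀ y a b → y * (a * b) ≡ a * (y * b)
        l3 = solve-∀

    -- The cofactor of x - y in x^p - y^p is a sum of p terms, each congruent to y^(p-1) modulo p;
    -- this supplies the additional factor p.
    lift-power : ∀ j {x y} → x ≈[ p ℕ.^ suc j ] y → x ^ p ≈[ p ℕ.^ suc (suc j) ] y ^ p
    lift-power j {x} {y} e = minus-zero (≈-trans (≡⇒≈ (geometric x y p)) (from (zero-minus e) sum≈0))
      where
      e′ : x ≈[ p ] y
      e′ = ≈-down (p∣p^ j) e
      sum≈0 : ∑ p (λ i → x ^ i * y ^ (p ℕ.∸ suc i)) ≈[ p ] + 0
      sum≈0 = ≈-trans (∑-mod p term) (≈-trans (≡⇒≈ (∑-const p (y ^ q))) (m≈0 (y ^ q)))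
        where
        term : ∀ i → i ℕ.< p → x ^ i * y ^ (p ℕ.∸ suc i) ≈[ p ] y ^ q
        term i i<p = ≈-trans (*-modʳ (y ^ (p ℕ.∸ suc i)) (^-mod i e′)) (≡⇒≈ (trans (sym (^-distribˡ-+-* y i (p ℕ.∸ suc i)))
          (cong (y ^_) (trans (cong (λ s → i ℕ.+ (s ℕ.∸ suc i)) p≡1+q) (ℕ.m+[n∸m]≡n (ℕ.≤-pred (subst (i ℕ.<_) p≡1+q i<p)))))))
      from : ∀ {a b} → a ≈[ p ℕ.^ suc j ] + 0 → b ≈[ p ] + 0 → a * b ≈[ p ℕ.^ suc (suc j) ] + 0
      from (by c refl) (by d refl) = by (c * d) (trans (lem (+ (p ℕ.^ suc j)) (+ p) c d) (cong (λ z → + 0 + z * (c * d)) (sym (pos-* p (p ℕ.^ suc j)))))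
        where
        lem : ∀ m n c d → (+ 0 + m * c) * (+ 0 + n * d) ≡ + 0 + (n * m) * (c * d)
        lem = solve-∀

    lift-powers : ∀ k {x y} → x ≈[ p ] y → x ^ (p ℕ.^ k) ≈[ p ℕ.^ suc k ] y ^ (p ℕ.^ k)
    lift-powers zero {x} {y} e = subst (λ m → x * + 1 ≈[ m ] y * + 1) (sym (ℕ.*-identityʳ p)) (*-modʳ (+ 1) e)
    lift-powers (suc k) {x} {y} e = subst₂ (λ a b → a ≈[ p ℕ.^ suc (suc k) ] b) (assoc x) (assoc y) (lift-power k (lift-powers k e))
      where
      assoc : ∀ z → (z ^ (p ℕ.^ k)) ^ p ≡ z ^ (p ℕ.^ suc k)
      assoc z = trans (^-*-assoc z (p ℕ.^ k) p) (cong (z ^_) (ℕ.*-comm (p ℕ.^ k) p))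

    euler : ∀ k u → Unit u → u ^ (p ℕ.^ k ℕ.* q) ≈[ p ℕ.^ suc k ] + 1
    euler k u unit = ≈-trans (≡⇒≈ (trans (cong (u ^_) (ℕ.*-comm (p ℕ.^ k) q)) (sym (^-*-assoc u q (p ℕ.^ k)))))
      (≈-trans (lift-powers k (fermat u unit)) (≡⇒≈ (^-zeroˡ (p ℕ.^ k))))

    inverse-pk : ∀ k u → Unit u → Σ[ v ∈ ℤ ] u * v ≈[ p ℕ.^ k ] + 1
    inverse-pk zero u unit = + 0 , by (u * + 0 - + 1) (lem (u * + 0))
      where
      lem : ∀ x → x ≡ + 1 + + 1 * (x - + 1)
      lem = solve-∀
    inverse-pk (suc k) u unit = u ^ (p ℕ.^ k ℕ.* q ℕ.∸ 1) , ≈-trans (≡⇒≈ (cong (u ^_) 1+e)) (euler k u unit)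
      where
      1+e : 1 ℕ.+ (p ℕ.^ k ℕ.* q ℕ.∸ 1) ≡ p ℕ.^ k ℕ.* q
      1+e = ℕ.m+[n∸m]≡n (ℕ.*-mono-≤ (ℕ.m^n>0 p k) 1≤q)

    cancel-unit : ∀ k {u x y} → Unit u → u * x ≈[ p ℕ.^ k ] u * y → x ≈[ p ℕ.^ k ] y
    cancel-unit k {u} unit = cancel-mod {u = u} (proj₂ (inverse-pk k u unit))

    -- The q-th difference of y^q at 0 is q!. By Fermat the function is 1 on 1, ..., q and 0 at 0,
    -- so the same difference is (-1)^(q-1) = -1.
    wilson-p : fact q ≈[ p ] -1ℤ
    wilson-p = go q refl
      where
      go : ∀ r → r ≡ q → fact q ≈[ p ] -1ℤ
      go zero e = ⊥-elim (ℕ.<-irrefl e 1≤q)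
      go (suc r) refl = ≈-trans (≡⇒≈ (sym (proj₁ (Δ-power q) 0)))
        (≈-trans (Δ-ones-0 q (λ y → (+ y) ^ q) (λ i 1≤i i≤q → fermat (+ i) (unit-small i 1≤i (ℕ.≤-<-trans i≤q q<p)))
                   ≈-refl r ℕ.≤-refl)
                 (≡⇒≈ (lem (-1ℤ ^ r) -1^q)))
        where
        lem : ∀ z → -1ℤ * z ≡ + 1 → z ≡ -1ℤ
        lem z e = trans (l z) (cong (-1ℤ *_) e)
          where
          l : ∀ z → z ≡ (- + 1) * ((- + 1) * z)
          l = solve-∀

    triangular : ∑ p (λ i → + i) ≈[ p ] + 0
    triangular = go (euclid (+ 2) _ (≈-trans (≡⇒≈ (lem p)) (m≈0 (+ p - + 1))))
      where
      lem : ∀ n → + 2 * ∑ n (λ i → + i) ≡ + n * (+ n - + 1)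
      lem zero = refl
      lem (suc n) = trans (*-distribˡ-+ (+ 2) (∑ n (λ i → + i)) (+ n)) (trans (cong (_+ (+ 2 * + n)) (lem n)) (l (+ n)))
        where
        l : ∀ n → n * (n - + 1) + + 2 * n ≡ (+ 1 + n) * (+ 1 + n - + 1)
        l = solve-∀
      go : (+ 2 ≈[ p ] + 0) ⊎ (∑ p (λ i → + i) ≈[ p ] + 0) → ∑ p (λ i → + i) ≈[ p ] + 0
      go (inj₁ z) = ⊥-elim (unit-2 z)
      go (inj₂ z) = z

    ∑-mod-single : ∀ {m} n (f : ℕ → ℤ) j → j ℕ.< n → (∀ i → i ℕ.< n → i ≢ j → f i ≈[ m ] + 0) → ∑ n f ≈[ m ] f j
    ∑-mod-single {m} (suc n) f j j<sn z with j ℕ.≟ n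
    ... | yes refl = ≈-trans (+-mod (∑-mod-zero n (λ i i<n → z i (ℕ.m<n⇒m<1+n i<n) (ℕ.<⇒≢ i<n))) ≈-refl) (≡⇒≈ (+-identityˡ (f n)))
    ... | no j≢n = ≈-trans (+-mod (∑-mod-single n f j (ℕ.≤∧≢⇒< (ℕ.≤-pred j<sn) j≢n) (λ i i<n → z i (ℕ.m<n⇒m<1+n i<n)))
                                  (z n ℕ.≤-refl (λ e → j≢n (sym e)))) (≡⇒≈ (+-identityʳ (f j)))

    -- Wilson's theorem modulo a prime power: passing from p^k to p^(k+1) raises the product to the p-th power.

    ∏-progression : ∀ {n} a M → M * M ≈[ n ] + 0 → ∀ m →
      ∏ (suc m) (λ i → a + + i * M) ≈[ n ] a ^ suc m + M * ∑ (suc m) (λ i → + i) * a ^ m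
    ∏-progression {n} a M MM zero = ≡⇒≈ (lem a M)
      where
      lem : ∀ a M → + 1 * (a + + 0 * M) ≡ a * + 1 + M * (+ 0 + + 0) * + 1
      lem = solve-∀
    ∏-progression {n} a M MM (suc m) = begin
      ∏ (suc m) (λ i → a + + i * M) * (a + s * M)
        ≈⟨ *-modʳ (a + s * M) (∏-progression a M MM m) ⟩
      (a * a ^ m + M * T * a ^ m) * (a + s * M)
        ≡⟨ l1 a M (a ^ m) T s ⟩
      a * (a * a ^ m) + M * (T + s) * (a * a ^ m) + M * M * (T * a ^ m * s)
        ≈⟨ +-mod (≈-refl {x = a * (a * a ^ m) + M * (T + s) * (a * a ^ m)}) (*-zero-modʳ (T * a ^ m * s) MM) ⟩
      a * (a * a ^ m) + M * (T + s) * (a * a ^ m) + + 0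
        ≡⟨ +-identityʳ _ ⟩
      a ^ suc (suc m) + M * ∑ (suc (suc m)) (λ i → + i) * a ^ suc m ∎
      where
      open ≈-Reasoning n
      s = + suc m
      T = ∑ (suc m) (λ i → + i)
      l1 : ∀ a M b T s → (a * b + M * T * b) * (a + s * M) ≡ a * (a * b) + M * (T + s) * (a * b) + M * M * (T * b * s)
      l1 = solve-∀

    wilson : ∀ k → ∏ (p ℕ.^ suc k) (λ j → strip (+ j)) ≈[ p ℕ.^ suc k ] -1ℤ
    wilson zero = subst (λ m → ∏ m (λ j → strip (+ j)) ≈[ m ] -1ℤ) (sym (ℕ.*-identityʳ p)) (≈-trans (≡⇒≈ ∏-strip) wilson-p)
    wilson (suc k) = begin
      ∏ (p ℕ.* M) (λ j → strip (+ j))                            ≡⟨ ∏-blocks p M (λ j → strip (+ j)) ⟩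
      ∏ p (λ i → ∏ M (λ j → strip (+ (i ℕ.* M ℕ.+ j))))          ≡⟨ ∏-swap p M (λ i j → strip (+ (i ℕ.* M ℕ.+ j))) ⟩
      ∏ M (λ j → ∏ p (λ i → strip (+ (i ℕ.* M ℕ.+ j))))          ≈⟨ ∏-mod M (λ j _ → column j) ⟩
      ∏ M (λ j → strip (+ j) ^ p)                                ≡⟨ sym (∏-^ M (λ j → strip (+ j)) p) ⟩
      ∏ M (λ j → strip (+ j)) ^ p                                ≈⟨ lift-power k (wilson k) ⟩
      -1ℤ ^ p                                                    ≡⟨ -1^p ⟩
      -1ℤ                                                        ∎
      where
      M = p ℕ.^ suc k
      open ≈-Reasoning (p ℕ.^ suc (suc k))
      entry : ∀ i j → + (i ℕ.* M ℕ.+ j) ≡ + j + + i * + M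
      entry i j = trans (pos-+ (i ℕ.* M) j) (trans (+-comm (+ (i ℕ.* M)) (+ j)) (cong (_+_ (+ j)) (pos-* i M)))
      entry≈ : ∀ i j → + (i ℕ.* M ℕ.+ j) ≈[ p ] + j
      entry≈ i j = ≈-trans (≡⇒≈ (entry i j)) (≈-trans (+-mod (≈-refl {x = + j}) (*-zero-mod (+ i) (∣⇒0≈ (p∣p^ k)))) (≡⇒≈ (+-identityʳ (+ j))))
      MM : + M * + M ≈[ p ℕ.^ suc (suc k) ] + 0
      MM = ≈-trans (≡⇒≈ (sym (pos-* M M))) (∣⇒0≈ (ℕ.*-monoˡ-∣ M (p∣p^ k)))
      -- The p lifts j + iM of a residue j modulo M multiply to j^p: the linear term carries M times
      -- the sum of the i, which is divisible by pM.
      column : ∀ j → ∏ p (λ i → strip (+ (i ℕ.* M ℕ.+ j))) ≈[ p ℕ.^ suc (suc k) ] strip (+ j) ^ p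
      column j with unit? (+ j)
      ... | inj₁ z = ≡⇒≈ (trans (∏-one p (λ i _ → strip-zero (≈-trans (entry≈ i j) z))) (sym (^-zeroˡ p)))
      ... | inj₂ u = ≈-trans (≡⇒≈ (∏-cong p (λ i _ → trans (strip-unit (unit-≈ (≈-sym (entry≈ i j)) u)) (entry i j))))
        (subst (λ s → ∏ s (λ i → + j + + i * + M) ≈[ p ℕ.^ suc (suc k) ] (+ j) ^ s) (sym p≡1+q)
          (≈-trans (∏-progression (+ j) (+ M) MM q)
            (≈-trans (+-mod (≈-refl {x = (+ j) ^ suc q}) (*-zero-modʳ ((+ j) ^ q) MT)) (≡⇒≈ (+-identityʳ ((+ j) ^ suc q))))))
        where
        MT : + M * ∑ (suc q) (λ i → + i) ≈[ p ℕ.^ suc (suc k) ] + 0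
        MT = subst (λ s → + M * ∑ s (λ i → + i) ≈[ p ℕ.* M ] + 0) p≡1+q
          (subst (λ m → + M * ∑ p (λ i → + i) ≈[ m ] + 0) (ℕ.*-comm M p)
            (≈-trans (*-up M triangular) (≡⇒≈ (*-zeroʳ (+ M)))))

    -- Characters of (Z/p)ˣ with values modulo p^(κ+1) are the powers of the Teichmüller lift τ;
    -- for a positive exponent they vanish at the multiples of p.

    module Characters (κ : ℕ) where

      P : ℕ
      P = p ℕ.^ suc κ

      τ : ℤ → ℤ
      τ x = x ^ (p ℕ.^ κ)

      τ-resp : ∀ {x y} → x ≈[ p ] y → τ x ≈[ P ] τ y
      τ-resp = lift-powers κ

      τ-* : ∀ x y → τ (x * y) ≡ τ x * τ y
      τ-* x y = *-^ x y (p ℕ.^ κ)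

      τ-^ : ∀ x n → τ (x ^ n) ≡ τ x ^ n
      τ-^ x n = trans (^-*-assoc x n (p ℕ.^ κ)) (trans (cong (x ^_) (ℕ.*-comm n (p ℕ.^ κ))) (sym (^-*-assoc x (p ℕ.^ κ) n)))

      τ-1 : τ (+ 1) ≡ + 1
      τ-1 = ^-zeroˡ (p ℕ.^ κ)

      τ--1 : τ -1ℤ ≡ -1ℤ
      τ--1 = -1^p^ κ

      τ-zero : ∀ {x} → x ≈[ p ] + 0 → τ x ≈[ P ] + 0
      τ-zero e = ≈-trans (τ-resp e) (≡⇒≈ (0^ (p ℕ.^ κ) (ℕ.m^n>0 p κ)))
        where
        0^ : ∀ n → 1 ℕ.≤ n → (+ 0) ^ n ≡ + 0
        0^ (suc n) _ = *-zeroˡ ((+ 0) ^ n)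

      τ^-zero : ∀ {x} m → 1 ℕ.≤ m → x ≈[ p ] + 0 → τ x ^ m ≈[ P ] + 0
      τ^-zero {x} (suc m) _ e = *-zero-modʳ (τ x ^ m) (τ-zero e)

      τ-q : ∀ {x} → Unit x → τ x ^ q ≈[ P ] + 1
      τ-q {x} u = ≈-trans (≡⇒≈ (^-*-assoc x (p ℕ.^ κ) q)) (euler κ x u)

      τ-q* : ∀ {x} s → Unit x → τ x ^ (s ℕ.* q) ≈[ P ] + 1
      τ-q* {x} s u = ≈-trans (≡⇒≈ (trans (cong (τ x ^_) (ℕ.*-comm s q)) (sym (^-*-assoc (τ x) q s))))
        (≈-trans (^-mod s (τ-q u)) (≡⇒≈ (^-zeroˡ s)))

      τ^-period : ∀ {x} m s → Unit x → τ x ^ (m ℕ.+ s ℕ.* q) ≈[ P ] τ x ^ m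
      τ^-period {x} m s u = ≈-trans (≡⇒≈ (^-distribˡ-+-* (τ x) m (s ℕ.* q)))
        (≈-trans (*-modˡ (τ x ^ m) (τ-q* s u)) (≡⇒≈ (*-identityʳ (τ x ^ m))))

      τ^-cong-unit : ∀ {x} m m′ s s′ → Unit x → m ℕ.+ s ℕ.* q ≡ m′ ℕ.+ s′ ℕ.* q → τ x ^ m ≈[ P ] τ x ^ m′
      τ^-cong-unit {x} m m′ s s′ u e = ≈-trans (≈-sym (τ^-period m s u)) (≈-trans (≡⇒≈ (cong (τ x ^_) e)) (τ^-period m′ s′ u))

      -- The offsets s and s′ express a congruence of exponents modulo q without leaving ℕ.
      -- Positivity of both exponents matters at multiples of p, where the power with exponent 0
      -- would be 1.
      τ^-cong : ∀ x m m′ s s′ → 1 ℕ.≤ m → 1 ℕ.≤ m′ → m ℕ.+ s ℕ.* q ≡ m′ ℕ.+ s′ ℕ.* q → τ x ^ m ≈[ P ] τ x ^ m′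
      τ^-cong x m m′ s s′ 1≤m 1≤m′ e with unit? x
      ... | inj₁ z = ≈-trans (τ^-zero m 1≤m z) (≈-sym (τ^-zero m′ 1≤m′ z))
      ... | inj₂ u = τ^-cong-unit m m′ s s′ u e

      τ≈id : ∀ x → τ x ≈[ p ] x
      τ≈id x = go κ
        where
        go : ∀ k → x ^ (p ℕ.^ k) ≈[ p ] x
        go zero = ≡⇒≈ (*-identityʳ x)
        go (suc k) = ≈-trans (≡⇒≈ (sym (^-*-assoc x p (p ℕ.^ k)))) (≈-trans (^-mod (p ℕ.^ k) (fermat-p x)) (go k))

      τ-unit : ∀ {x} → Unit x → Unit (τ x)
      τ-unit = unit-^ (p ℕ.^ κ)

      p∣P : p ℕ.∣ P
      p∣P = p∣p^ κ

      ∑τ-trivial : ∀ s → 1 ℕ.≤ s → ∑ p (λ x → τ (+ x) ^ (s ℕ.* q)) ≈[ P ] + q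
      ∑τ-trivial s 1≤s = begin
        ∑ p (λ x → τ (+ x) ^ (s ℕ.* q))  ≡⟨ ∑-p-head _ ⟩
        τ (+ 0) ^ (s ℕ.* q) + ∑ q (λ i → τ (+ suc i) ^ (s ℕ.* q))
          ≈⟨ +-mod (τ^-zero (s ℕ.* q) (ℕ.*-mono-≤ 1≤s 1≤q) ≈-refl)
                   (∑-mod q (λ i i<q → τ-q* s (unit-small (suc i) (s≤s z≤n) (suc<p i<q)))) ⟩
        + 0 + ∑ q (λ _ → + 1)            ≡⟨ +-identityˡ _ ⟩
        ∑ q (λ _ → + 1)                  ≡⟨ ∑-const q (+ 1) ⟩
        + q * + 1                        ≡⟨ *-identityʳ (+ q) ⟩
        + q                              ∎
        where open ≈-Reasoning P

      -- If y^r were 1 at all of 1, ..., r + 1, its r-th difference at 1 would vanish modulo p; but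
      -- that difference is r!, a unit because r < p.
      non-root : ∀ r → 1 ℕ.≤ r → r ℕ.< q → Σ[ g ∈ ℤ ] (Unit g × ¬ (g ^ r ≈[ p ] + 1))
      non-root (suc r) _ r<q with search (λ i → ≈? {p} ((+ suc i) ^ suc r) (+ 1)) (suc (suc r))
      ... | inj₂ (i , i<r , ne) = + suc i , unit-small (suc i) (s≤s z≤n) (suc<p (ℕ.<-≤-trans i<r r<q)) , ne
      ... | inj₁ all = ⊥-elim (unit-∏ (suc r) (λ i → + suc i)
          (λ i i<r → unit-small (suc i) (s≤s z≤n) (suc<p (ℕ.<-trans i<r r<q)))
          (≈-trans (≡⇒≈ (sym (proj₁ (Δ-power (suc r)) 1)))
            (Δ-ones (suc (suc r)) (λ y → (+ y) ^ suc r) ones r 1 (s≤s z≤n) ℕ.≤-refl)))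
        where
        ones : ∀ i → 1 ℕ.≤ i → i ℕ.≤ suc (suc r) → (+ i) ^ suc r ≈[ p ] + 1
        ones (suc i) _ i≤ = all i i≤

      -- Scaling the variable by g multiplies the sum by τ(g)^m. With g^m different from 1 modulo p,
      -- the number τ(g)^m - 1 is a unit, so the sum vanishes modulo the full power of p and not
      -- just modulo p.
      ∑τ-nontrivial : ∀ m → ¬ (q ℕ.∣ m) → ∑ p (λ x → τ (+ x) ^ m) ≈[ P ] + 0
      ∑τ-nontrivial m q∤m with non-root (m ℕ.% q) (ℕ.n≢0⇒n>0 (λ e → q∤m (ℕ.m%n≡0⇒n∣m m q e))) (ℕ.m%n<n m q)
      ... | g , ug , ne = cancel-unit (suc κ) unit (≈-trans key (≡⇒≈ (sym (*-zeroʳ (τ g ^ m - + 1)))))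
        where
        S = ∑ p (λ x → τ (+ x) ^ m)
        g^m : g ^ m ≈[ p ] g ^ (m ℕ.% q)
        g^m = ≈-trans (≡⇒≈ (trans (cong (g ^_) (ℕ.m≡m%n+[m/n]*n m q)) (^-distribˡ-+-* g (m ℕ.% q) (m ℕ./ q ℕ.* q))))
          (≈-trans (*-modˡ (g ^ (m ℕ.% q)) (≈-trans (≡⇒≈ (trans (cong (g ^_) (ℕ.*-comm (m ℕ./ q) q)) (sym (^-*-assoc g q (m ℕ./ q)))))
            (≈-trans (^-mod (m ℕ./ q) (fermat g ug)) (≡⇒≈ (^-zeroˡ (m ℕ./ q)))))) (≡⇒≈ (*-identityʳ _)))
        unit : Unit (τ g ^ m - + 1)
        unit z = ne (≈-trans (≈-sym g^m) (≈-trans (≈-sym (^-mod m (τ≈id g))) (minus-zero z)))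
        scaled : τ g ^ m * S ≈[ P ] S
        scaled = ≈-trans (≡⇒≈ (trans (∑-*ˡ p (τ g ^ m) _) (∑-ext p (λ x → trans (sym (*-^ (τ g) (τ (+ x)) m)) (cong (_^ m) (sym (τ-* g (+ x))))))))
          (scale-∑ g ug (λ z → τ z ^ m) (λ e → ^-mod m (τ-resp e)))
        key : (τ g ^ m - + 1) * S ≈[ P ] + 0
        key = ≈-trans (≡⇒≈ (lem (τ g ^ m) S)) (zero-minus scaled)
          where
          lem : ∀ a s → (a - + 1) * s ≡ a * s - s
          lem = solve-∀

      ∑τ-powers-1 : ∀ {u} → u ≈[ p ] + 1 → ∑ q (λ a → τ u ^ a) ≈[ P ] + q
      ∑τ-powers-1 {u} e = ≈-trans (∑-mod q (λ a _ → ≈-trans (^-mod a (≈-trans (τ-resp e) (≡⇒≈ τ-1))) (≡⇒≈ (^-zeroˡ a))))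
        (≡⇒≈ (trans (∑-const q (+ 1)) (*-identityʳ (+ q))))

      -- Geometric series: τ(u)^q ≡ 1, and τ(u) - 1 is a unit because τ(u) ≡ u modulo p.
      ∑τ-powers : ∀ {u} → Unit u → ¬ (u ≈[ p ] + 1) → ∑ q (λ a → τ u ^ a) ≈[ P ] + 0
      ∑τ-powers {u} uu ne = cancel-unit (suc κ) unit (≈-trans key (≡⇒≈ (sym (*-zeroʳ (τ u - + 1)))))
        where
        unit : Unit (τ u - + 1)
        unit z = ne (≈-trans (≈-sym (τ≈id u)) (minus-zero z))
        key : (τ u - + 1) * ∑ q (λ a → τ u ^ a) ≈[ P ] + 0
        key = ≈-trans (≡⇒≈ (trans (cong ((τ u - + 1) *_) (∑-ext q (λ a → sym (trans (cong (τ u ^ a *_) (^-zeroˡ (q ℕ.∸ suc a))) (*-identityʳ _)))))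
            (trans (sym (geometric (τ u) (+ 1) q)) (cong (λ z → τ u ^ q - z) (^-zeroˡ q)))))
          (zero-minus (τ-q uu))

    half-unique : ∀ a → a ℕ.< q → q ℕ.∣ a ℕ.+ a → a ≢ 0 → a ≡ h
    half-unique a a<q (ℕ.divides c e) a≢0 = double (trans (trans e (cong (ℕ._* q) (c≡1 c e))) (trans (ℕ.+-identityʳ q) q≡h+h))
      where
      c≡1 : ∀ c → a ℕ.+ a ≡ c ℕ.* q → c ≡ 1
      c≡1 zero e = ⊥-elim (a≢0 (ℕ.m+n≡0⇒m≡0 a e))
      c≡1 (suc zero) e = refl
      c≡1 (suc (suc c)) e = ⊥-elim (ℕ.<-irrefl e (ℕ.<-≤-trans (ℕ.+-mono-< a<q a<q) (ℕ.+-monoʳ-≤ q (ℕ.m≤m+n q (c ℕ.* q)))))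
      double : a ℕ.+ a ≡ h ℕ.+ h → a ≡ h
      double e with ℕ.<-cmp a h
      ... | tri< l _ _ = ⊥-elim (ℕ.<-irrefl e (ℕ.+-mono-< l l))
      ... | tri≈ _ e′ _ = e′
      ... | tri> _ _ g = ⊥-elim (ℕ.<-irrefl (sym e) (ℕ.+-mono-< g g))

    h<q : h ℕ.< q
    h<q = subst (h ℕ.<_) (sym q≡h+h) (ℕ.m<m+n h 1≤h)

    -- Double count of the powers (y²/x)^a over y modulo p and 0 ≤ a < q. For fixed y ≠ 0 the sum
    -- over a is 0, as y²/x is never 1, and y = 0 contributes 1 through a = 0. For fixed a the sum
    -- over y vanishes unless q divides 2a, which leaves a = 0, contributing p ≡ 0, and a = h. Hence
    -- q x^(-h) ≡ 1 with q ≡ -1.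
    nonsquare : ∀ x → Unit x → (∀ y → y ℕ.< p → ¬ (+ y * + y ≈[ p ] x)) → x ^ h ≈[ p ] -1ℤ
    nonsquare x ux none = begin
      x ^ h                                     ≡⟨ lem (x ^ h) ⟩
      x ^ h * + 1                               ≈⟨ *-modˡ (x ^ h) (≈-sym (P⇒p total)) ⟩
      x ^ h * ∑ q (λ a → ∑ p (λ y → τ (+ y * + y * v) ^ a)) ≈⟨ *-modˡ (x ^ h) (P⇒p only-h) ⟩
      x ^ h * ∑ p (λ y → τ (+ y * + y * v) ^ h) ≈⟨ *-modˡ (x ^ h) (P⇒p at-h) ⟩
      x ^ h * (τ v ^ h * + q)                   ≡⟨ cong (λ z → x ^ h * (z ^ h * + q)) (*-identityʳ v) ⟩
      x ^ h * (v ^ h * + q)                     ≡⟨ trans (sym (*-assoc (x ^ h) (v ^ h) (+ q))) (cong (_* + q) (sym (*-^ x v h))) ⟩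
      (x * v) ^ h * + q                         ≈⟨ *-modʳ (+ q) (≈-trans (^-mod h xv) (≡⇒≈ (^-zeroˡ h))) ⟩
      + 1 * + q                                 ≡⟨ *-identityˡ (+ q) ⟩
      + q                                       ≈⟨ by (+ 1) (trans (l2 (+ q)) (cong (λ z → -1ℤ + z * + 1) (sym +p≡1+q))) ⟩
      -1ℤ                                       ∎
      where
      open ≈-Reasoning p
      open Characters 0
      P⇒p : ∀ {a b} → a ≈[ P ] b → a ≈[ p ] b
      P⇒p = ≈-down p∣P
      v = proj₁ (inverse-p x ux)
      xv = proj₂ (inverse-p x ux)
      uv : Unit v
      uv = unit-*ˡ x (λ e → unit-1 (≈-trans (≈-sym (≈-trans (≡⇒≈ (*-comm v x)) xv)) e))
      lem : ∀ a → a ≡ a * + 1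
      lem = solve-∀
      l2 : ∀ a → a ≡ (- + 1) + (+ 1 + a) * + 1
      l2 = solve-∀
      total : ∑ q (λ a → ∑ p (λ y → τ (+ y * + y * v) ^ a)) ≈[ P ] + 1
      total = ≈-trans (≡⇒≈ (trans (∑-swap q p (λ a y → τ (+ y * + y * v) ^ a)) (∑-p-head _)))
        (≈-trans (+-mod zero-term (∑-mod-zero q (λ i i<q → other i i<q))) (≡⇒≈ (+-identityʳ (+ 1))))
        where
        zero-term : ∑ q (λ a → τ (+ 0 * + 0 * v) ^ a) ≈[ P ] + 1
        zero-term = ∑-mod-single q (λ a → τ (+ 0 * + 0 * v) ^ a) 0 1≤q (λ a _ a≢0 → τ^-zero a (ℕ.n≢0⇒n>0 a≢0) (≡⇒≈ (*-zeroˡ v)))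
        other : ∀ i → i ℕ.< q → ∑ q (λ a → τ (+ suc i * + suc i * v) ^ a) ≈[ P ] + 0
        other i i<q = ∑τ-powers (unit-* (unit-* ui ui) uv) λ e → none (suc i) (suc<p i<q)
          (≈-trans (≡⇒≈ (sym (*-identityʳ _))) (≈-trans (*-modˡ (+ suc i * + suc i) (≈-sym xv))
            (≈-trans (≡⇒≈ (l3 (+ suc i * + suc i) x v)) (≈-trans (*-modʳ x e) (≡⇒≈ (*-identityˡ x))))))
          where
          ui = unit-small (suc i) (s≤s z≤n) (suc<p i<q)
          l3 : ∀ a x v → a * (x * v) ≡ a * v * x
          l3 = solve-∀
      term : ∀ a → ∑ p (λ y → τ (+ y * + y * v) ^ a) ≡ τ v ^ a * ∑ p (λ y → τ (+ y) ^ (a ℕ.+ a))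
      term a = trans (∑-ext p (λ y → trans (cong (_^ a) (trans (τ-* (+ y * + y) v) (cong (_* τ v) (τ-* (+ y) (+ y)))))
          (trans (*-^ (τ (+ y) * τ (+ y)) (τ v) a) (trans (*-comm _ (τ v ^ a)) (cong (τ v ^ a *_) (trans (*-^ (τ (+ y)) (τ (+ y)) a) (sym (^-distribˡ-+-* (τ (+ y)) a a))))))))
        (sym (∑-*ˡ p (τ v ^ a) _))
      only-h : ∑ q (λ a → ∑ p (λ y → τ (+ y * + y * v) ^ a)) ≈[ P ] ∑ p (λ y → τ (+ y * + y * v) ^ h)
      only-h = ∑-mod-single q _ h h<q others
        where
        others : ∀ a → a ℕ.< q → a ≢ h → ∑ p (λ y → τ (+ y * + y * v) ^ a) ≈[ P ] + 0
        others zero _ _ = ≈-trans (≡⇒≈ (trans (∑-const p (+ 1)) (*-identityʳ (+ p)))) (∣⇒0≈ (ℕ.divides 1 (sym (trans (ℕ.*-identityˡ (p ℕ.* 1)) (ℕ.*-identityʳ p)))))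
        others a@(suc _) a<q a≢h = ≈-trans (≡⇒≈ (term a)) (*-zero-mod (τ v ^ a) (∑τ-nontrivial (a ℕ.+ a) (λ d → a≢h (half-unique a a<q d λ ()))))
      at-h : ∑ p (λ y → τ (+ y * + y * v) ^ h) ≈[ P ] τ v ^ h * + q
      at-h = ≈-trans (≡⇒≈ (term h)) (*-modˡ (τ v ^ h)
        (subst (λ e → ∑ p (λ y → τ (+ y) ^ e) ≈[ P ] + q) (trans (ℕ.+-identityʳ q) q≡h+h) (∑τ-trivial 1 (s≤s z≤n))))

    -- Q k = 1 + p + ⋯ + p^(k-1)
    Q : ℕ → ℕ
    Q zero = 0
    Q (suc k) = suc (p ℕ.* Q k)

    -- In other words `Q k` represents -1/q modulo p^k, the source of all integer approximations to
    -- fractions b/q.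
    1+qQ : ∀ k → 1 ℕ.+ q ℕ.* Q k ≡ p ℕ.^ k
    1+qQ zero = cong suc (ℕ.*-zeroʳ q)
    1+qQ (suc k) = trans (cong (λ z → 1 ℕ.+ q ℕ.* suc (z ℕ.* Q k)) p≡1+q) (trans (lem q (Q k)) (cong₂ ℕ._*_ (sym p≡1+q) (1+qQ k)))
      where
      lem : ∀ q Q → 1 ℕ.+ q ℕ.* suc (suc q ℕ.* Q) ≡ suc q ℕ.* (1 ℕ.+ q ℕ.* Q)
      lem = ℕ.solve-∀

    Q-suc : ∀ k → Q (suc k) ≡ p ℕ.^ k ℕ.+ Q k
    Q-suc k = trans (cong (λ z → suc (z ℕ.* Q k)) p≡1+q) (trans (lem q (Q k)) (cong (ℕ._+ Q k) (1+qQ k)))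
      where
      lem : ∀ q Q → suc (suc q ℕ.* Q) ≡ 1 ℕ.+ q ℕ.* Q ℕ.+ Q
      lem = ℕ.solve-∀

    k≤Q : ∀ k → k ℕ.≤ Q k
    k≤Q zero = z≤n
    k≤Q (suc k) = s≤s (ℕ.≤-trans (k≤Q k) (ℕ.m≤n*m (Q k) p))

    -- Up to the sign (-1)^(n+1), this is Γ_p(n + 1).
    stripped : ℕ → ℤ
    stripped n = ∏ n (λ i → strip (+ suc i))

    stripped-unit : ∀ n → Unit (stripped n)
    stripped-unit n = unit-∏ n _ (λ i _ → strip-is-unit (+ suc i))

-- Formal power series in characteristic zero and their exponentials.

module PowerSeries where

  open BigOperators
  open import Algebra.Bundles using (CommutativeRing)
  open import Algebra.Structures using (IsCommutativeRing)
  import Algebra.Solver.Ring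
  import Algebra.Solver.Ring.AlmostCommutativeRing as ACR
  open import Data.Nat as ℕ using (ℕ; zero; suc; NonZero; z≤n; s≤s)
  import Data.Nat.Properties as ℕ
  import Data.Nat.DivMod as ℕ
  import Data.Nat.Divisibility as ℕ
  open import Data.Nat.Induction using (<-rec)
  open import Data.Integer as ℤ using (ℤ; +_)
  import Data.Integer.Properties as ℤ
  open import Data.Maybe using (Maybe; just; nothing)
  open import Data.Product using (_,_; _×_)
  open import Data.Empty using (⊥-elim)
  open import Level using (0ℓ)
  open import Relation.Nullary using (yes; no; ¬_)
  open import Relation.Binary.PropositionalEquality

  -- The only instance is ℚ. No valuation is built in: p-integrality is imposed afterwards by
  -- predicates on K.
  record CharZeroField : Set₁ where
    infixl 6 _+_
    infixl 7 _*_
    infix  8 -_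
    field
      K                 : Set
      _+_ _*_           : K → K → K
      -_                : K → K
      0# 1#             : K
      isCommutativeRing : IsCommutativeRing _≡_ _+_ _*_ -_ 0# 1#
      ι                 : ℤ → K
      ι-+               : ∀ x y → ι (x ℤ.+ y) ≡ ι x + ι y
      ι-*               : ∀ x y → ι (x ℤ.* y) ≡ ι x * ι y
      ι-neg             : ∀ x → ι (ℤ.- x) ≡ - ι x
      ι-0               : ι (+ 0) ≡ 0#
      ι-1               : ι (+ 1) ≡ 1#
      ι-injective       : ∀ {x y} → ι x ≡ ι y → x ≡ y
      inv               : ℕ → K
      inv-*             : ∀ n .{{_ : NonZero n}} → ι (+ n) * inv n ≡ 1#

  module Algebra₀ (F : CharZeroField) where

    open CharZeroField F public
    open IsCommutativeRing isCommutativeRing public using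
      (+-assoc; +-comm; +-identityˡ; +-identityʳ; *-assoc; *-comm; *-identityˡ; *-identityʳ; zeroˡ; zeroʳ; distribˡ; distribʳ; +-isCommutativeMonoid; *-isCommutativeMonoid)

    private
      KR : CommutativeRing 0ℓ 0ℓ
      KR = record { isCommutativeRing = isCommutativeRing }

      AR = ACR.fromCommutativeRing KR

      morphism : ℤ.+-*-rawRing ACR.-Raw-AlmostCommutative⟶ AR
      morphism = record
        { ⟦_⟧ = ι ; +-homo = ι-+ ; *-homo = ι-* ; -‿homo = ι-neg ; 0-homo = ι-0 ; 1-homo = ι-1 }

      coeff? : ∀ a b → Maybe (ι a ≡ ι b)
      coeff? a b with a ℤ.≟ b
      ... | yes e = just (cong ι e)
      ... | no _ = nothing

    open Algebra.Solver.Ring ℤ.+-*-rawRing AR morphism coeff? public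
      using (solve; _:=_; _:+_; _:*_; :-_; con; _:-_)

    open Big +-isCommutativeMonoid public using () renaming
      (big to ∑ᴷ; big-rel to ∑ᴷ-rel; big-pred to ∑ᴷ-pred; big-cong to ∑ᴷ-cong; big-ext to ∑ᴷ-ext; big-ε to ∑ᴷ-zero; big-∙ to ∑ᴷ-+
      ; big-split to ∑ᴷ-split; big-head to ∑ᴷ-head; big-swap to ∑ᴷ-swap; big-blocks to ∑ᴷ-blocks; big-rev to ∑ᴷ-rev; big-single to ∑ᴷ-single)
    open RingBig +-isCommutativeMonoid distribˡ zeroʳ *-comm public using () renaming (big-*ˡ to ∑ᴷ-*ˡ; big-*ʳ to ∑ᴷ-*ʳ)

    infixl 6 _-_
    _-_ : K → K → K
    x - y = x + - y

    infixr 8 _^_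
    _^_ : K → ℕ → K
    x ^ zero  = 1#
    x ^ suc n = x * x ^ n

    ^-+ : ∀ x m n → x ^ (m ℕ.+ n) ≡ x ^ m * x ^ n
    ^-+ x zero n = sym (*-identityˡ _)
    ^-+ x (suc m) n = trans (cong (x *_) (^-+ x m n)) (sym (*-assoc _ _ _))

    ^-* : ∀ x m n → x ^ (m ℕ.* n) ≡ (x ^ n) ^ m
    ^-* x zero n = refl
    ^-* x (suc m) n = trans (^-+ x n (m ℕ.* n)) (cong (x ^ n *_) (^-* x m n))

    *-^ᴷ : ∀ x y n → (x * y) ^ n ≡ x ^ n * y ^ n
    *-^ᴷ x y zero = sym (*-identityˡ 1#)
    *-^ᴷ x y (suc n) = trans (cong (x * y *_) (*-^ᴷ x y n))
      (solve 4 (λ x y a b → x :* y :* (a :* b) := x :* a :* (y :* b)) refl x y (x ^ n) (y ^ n))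

    1^ : ∀ n → 1# ^ n ≡ 1#
    1^ zero = refl
    1^ (suc n) = trans (*-identityˡ _) (1^ n)

    ι-^ : ∀ x n → ι (x ℤ.^ n) ≡ ι x ^ n
    ι-^ x zero = ι-1
    ι-^ x (suc n) = trans (ι-* x (x ℤ.^ n)) (cong (ι x *_) (ι-^ x n))

    ι-suc : ∀ n → ι (+ suc n) ≡ 1# + ι (+ n)
    ι-suc n = trans (ι-+ (+ 1) (+ n)) (cong (_+ ι (+ n)) ι-1)

    ι-+ℕ : ∀ m n → ι (+ (m ℕ.+ n)) ≡ ι (+ m) + ι (+ n)
    ι-+ℕ m n = trans (cong ι (ℤ.pos-+ m n)) (ι-+ (+ m) (+ n))

    ι-*ℕ : ∀ m n → ι (+ (m ℕ.* n)) ≡ ι (+ m) * ι (+ n)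
    ι-*ℕ m n = trans (cong ι (ℤ.pos-* m n)) (ι-* (+ m) (+ n))

    cancel-ι : ∀ n .{{_ : NonZero n}} {x y} → ι (+ n) * x ≡ ι (+ n) * y → x ≡ y
    cancel-ι n {x} {y} e = trans (sym (half x)) (trans (cong (inv n *_) e) (half y))
      where
      half : ∀ z → inv n * (ι (+ n) * z) ≡ z
      half z = trans (solve 3 (λ a b c → a :* (b :* c) := b :* a :* c) refl (inv n) (ι (+ n)) z)
        (trans (cong (_* z) (inv-* n)) (*-identityˡ z))

    inv-*ℕ : ∀ m n .{{_ : NonZero m}} .{{_ : NonZero n}} → inv (m ℕ.* n) ≡ inv m * inv n
    inv-*ℕ m n = cancel-ι (m ℕ.* n) {{ℕ.m*n≢0 m n}} (trans (inv-* (m ℕ.* n) {{ℕ.m*n≢0 m n}}) (sym (begin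
      ι (+ (m ℕ.* n)) * (inv m * inv n)          ≡⟨ cong (_* (inv m * inv n)) (ι-*ℕ m n) ⟩
      ι (+ m) * ι (+ n) * (inv m * inv n)        ≡⟨ solve 4 (λ a b c d → a :* b :* (c :* d) := (a :* c) :* (b :* d)) refl (ι (+ m)) (ι (+ n)) (inv m) (inv n) ⟩
      ι (+ m) * inv m * (ι (+ n) * inv n)        ≡⟨ cong₂ _*_ (inv-* m) (inv-* n) ⟩
      1# * 1#                                    ≡⟨ *-identityˡ 1# ⟩
      1#                                         ∎)))
      where open ≡-Reasoning

    Series : Set
    Series = ℕ → K

    infix 4 _≗ₛ_
    _≗ₛ_ : Series → Series → Set
    F ≗ₛ G = ∀ n → F n ≡ G n

    infixl 7 _⊛_
    _⊛_ : Series → Series → Series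
    (F ⊛ G) n = ∑ᴷ (suc n) (λ i → F i * G (n ℕ.∸ i))

    infixl 6 _⊕_
    _⊕_ : Series → Series → Series
    (F ⊕ G) n = F n + G n

    shift₁ : Series → Series
    shift₁ F zero    = 0#
    shift₁ F (suc n) = F n

    shift : ℕ → Series → Series
    shift zero    F = F
    shift (suc j) F = shift₁ (shift j F)

    shift-≥ : ∀ j F n → shift j F (j ℕ.+ n) ≡ F n
    shift-≥ zero F n = refl
    shift-≥ (suc j) F n = shift-≥ j F n

    shift-∸ : ∀ j F n → j ℕ.≤ n → shift j F n ≡ F (n ℕ.∸ j)
    shift-∸ j F n j≤n = trans (cong (shift j F) (sym (ℕ.m+[n∸m]≡n j≤n))) (shift-≥ j F (n ℕ.∸ j))

    shift-< : ∀ j F n → n ℕ.< j → shift j F n ≡ 0#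
    shift-< (suc j) F zero _ = refl
    shift-< (suc j) F (suc n) (s≤s n<j) = shift-< j F n n<j

    shift-+ : ∀ i j F → shift (i ℕ.+ j) F ≗ₛ shift i (shift j F)
    shift-+ zero j F n = refl
    shift-+ (suc i) j F zero = refl
    shift-+ (suc i) j F (suc n) = shift-+ i j F n

    ⊛-cong : ∀ {F F′ G G′} n → (∀ i → i ℕ.≤ n → F i ≡ F′ i) → (∀ i → i ℕ.≤ n → G i ≡ G′ i) → (F ⊛ G) n ≡ (F′ ⊛ G′) n
    ⊛-cong n f g = ∑ᴷ-cong (suc n) (λ i i≤n → cong₂ _*_ (f i (ℕ.≤-pred i≤n)) (g (n ℕ.∸ i) (ℕ.m∸n≤m n i)))

    ⊛-congˡ : ∀ F {G G′} → G ≗ₛ G′ → F ⊛ G ≗ₛ F ⊛ G′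
    ⊛-congˡ F e n = ⊛-cong {F} {F} n (λ _ _ → refl) (λ i _ → e i)

    ⊛-comm : ∀ F G → F ⊛ G ≗ₛ G ⊛ F
    ⊛-comm F G n = trans (∑ᴷ-rev (suc n) (λ i → F i * G (n ℕ.∸ i)))
      (∑ᴷ-cong (suc n) (λ i i≤n → trans (cong (λ z → F (n ℕ.∸ i) * G z) (ℕ.m∸[m∸n]≡n (ℕ.≤-pred i≤n))) (*-comm _ _)))

    -- Reading the product as the sum of F_j Y^j G with any cutoff J beyond the degree makes the
    -- range independent of n, so that associativity and evaluation become exchanges of finite sums.
    ⊛-shift : ∀ F G J n → n ℕ.< J → (F ⊛ G) n ≡ ∑ᴷ J (λ j → F j * shift j G n)
    ⊛-shift F G J n n<J = begin
      ∑ᴷ (suc n) (λ i → F i * G (n ℕ.∸ i))           ≡⟨ ∑ᴷ-cong (suc n) (λ i i≤n → cong (F i *_) (sym (shift-∸ i G n (ℕ.≤-pred i≤n)))) ⟩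
      ∑ᴷ (suc n) (λ j → F j * shift j G n)           ≡⟨ sym (+-identityʳ _) ⟩
      ∑ᴷ (suc n) (λ j → F j * shift j G n) + 0#      ≡⟨ cong (_+_ (∑ᴷ (suc n) (λ j → F j * shift j G n)))
        (sym (∑ᴷ-zero (J ℕ.∸ suc n) (λ i _ → trans (cong (F (suc n ℕ.+ i) *_) (shift-< (suc n ℕ.+ i) G n (ℕ.m≤m+n (suc n) i))) (zeroʳ _)))) ⟩
      ∑ᴷ (suc n) (λ j → F j * shift j G n) + ∑ᴷ (J ℕ.∸ suc n) (λ i → F (suc n ℕ.+ i) * shift (suc n ℕ.+ i) G n)
                                                     ≡⟨ sym (∑ᴷ-split (suc n) (J ℕ.∸ suc n) (λ j → F j * shift j G n)) ⟩
      ∑ᴷ (suc n ℕ.+ (J ℕ.∸ suc n)) (λ j → F j * shift j G n) ≡⟨ cong (λ s → ∑ᴷ s (λ j → F j * shift j G n)) (ℕ.m+[n∸m]≡n n<J) ⟩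
      ∑ᴷ J (λ j → F j * shift j G n)                 ∎
      where open ≡-Reasoning

    shift₁-⊛ : ∀ F G → shift₁ F ⊛ G ≗ₛ shift₁ (F ⊛ G)
    shift₁-⊛ F G zero = trans (+-identityˡ _) (zeroˡ _)
    shift₁-⊛ F G (suc n) = trans (∑ᴷ-head (suc n) (λ i → shift₁ F i * G (suc n ℕ.∸ i)))
      (trans (cong (_+ (F ⊛ G) n) (zeroˡ _)) (+-identityˡ _))

    shift-⊛ : ∀ j F G → shift j F ⊛ G ≗ₛ shift j (F ⊛ G)
    shift-⊛ zero F G n = refl
    shift-⊛ (suc j) F G n = trans (shift₁-⊛ (shift j F) G n) (lift n)
      where
      lift : shift₁ (shift j F ⊛ G) ≗ₛ shift₁ (shift j (F ⊛ G))
      lift zero = refl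
      lift (suc n) = shift-⊛ j F G n

    ⊛-assoc : ∀ F G H → (F ⊛ G) ⊛ H ≗ₛ F ⊛ (G ⊛ H)
    ⊛-assoc F G H n = begin
      ((F ⊛ G) ⊛ H) n
        ≡⟨ ∑ᴷ-cong (suc n) (λ i i≤n → trans (cong (_* H (n ℕ.∸ i)) (⊛-shift F G (suc n) i i≤n)) (∑ᴷ-*ʳ (suc n) (H (n ℕ.∸ i)) (λ j → F j * shift j G i))) ⟩
      ∑ᴷ (suc n) (λ i → ∑ᴷ (suc n) (λ j → F j * shift j G i * H (n ℕ.∸ i)))
        ≡⟨ ∑ᴷ-swap (suc n) (suc n) (λ i j → F j * shift j G i * H (n ℕ.∸ i)) ⟩
      ∑ᴷ (suc n) (λ j → ∑ᴷ (suc n) (λ i → F j * shift j G i * H (n ℕ.∸ i)))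
        ≡⟨ ∑ᴷ-ext (suc n) (λ j → trans (∑ᴷ-ext (suc n) (λ i → *-assoc (F j) (shift j G i) (H (n ℕ.∸ i)))) (sym (∑ᴷ-*ˡ (suc n) (F j) (λ i → shift j G i * H (n ℕ.∸ i))))) ⟩
      ∑ᴷ (suc n) (λ j → F j * (shift j G ⊛ H) n)
        ≡⟨ ∑ᴷ-ext (suc n) (λ j → cong (F j *_) (shift-⊛ j G H n)) ⟩
      ∑ᴷ (suc n) (λ j → F j * shift j (G ⊛ H) n)
        ≡⟨ sym (⊛-shift F (G ⊛ H) (suc n) n ℕ.≤-refl) ⟩
      (F ⊛ (G ⊛ H)) n ∎
      where open ≡-Reasoning

    ⊛-distribˡ : ∀ F G H → F ⊛ (G ⊕ H) ≗ₛ (F ⊛ G) ⊕ (F ⊛ H)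
    ⊛-distribˡ F G H n = trans (∑ᴷ-ext (suc n) (λ i → distribˡ _ _ _)) (∑ᴷ-+ (suc n) _ _)

    -- Sol g F says that F = exp(∫ g/Y): constant term 1 and Y F′ = F g.

    Sol : Series → Series → Set
    Sol g F = F 0 ≡ 1# × (∀ n → ι (+ n) * F n ≡ (F ⊛ g) n)

    Sol-⊛ : ∀ {g g′ F F′} → Sol g F → Sol g′ F′ → Sol (g ⊕ g′) (F ⊛ F′)
    Sol-⊛ {g} {g′} {F} {F′} (F0 , dF) (F′0 , dF′) =
      trans (+-identityˡ _) (trans (cong₂ _*_ F0 F′0) (*-identityˡ 1#)) , λ n → begin
        ι (+ n) * (F ⊛ F′) n
          ≡⟨ ∑ᴷ-*ˡ (suc n) (ι (+ n)) _ ⟩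
        ∑ᴷ (suc n) (λ i → ι (+ n) * (F i * F′ (n ℕ.∸ i)))
          ≡⟨ ∑ᴷ-cong (suc n) (λ i i≤n → leibniz n i (ℕ.≤-pred i≤n)) ⟩
        ∑ᴷ (suc n) (λ i → (F ⊛ g) i * F′ (n ℕ.∸ i) + F i * (F′ ⊛ g′) (n ℕ.∸ i))
          ≡⟨ ∑ᴷ-+ (suc n) _ _ ⟩
        ((F ⊛ g) ⊛ F′) n + (F ⊛ (F′ ⊛ g′)) n
          ≡⟨ cong₂ _+_ (trans (⊛-assoc F g F′ n) (trans (⊛-congˡ F (⊛-comm g F′) n) (sym (⊛-assoc F F′ g n)))) (sym (⊛-assoc F F′ g′ n)) ⟩
        ((F ⊛ F′) ⊛ g) n + ((F ⊛ F′) ⊛ g′) n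
          ≡⟨ sym (⊛-distribˡ (F ⊛ F′) g g′ n) ⟩
        ((F ⊛ F′) ⊛ (g ⊕ g′)) n ∎
      where
      open ≡-Reasoning
      leibniz : ∀ n i → i ℕ.≤ n → ι (+ n) * (F i * F′ (n ℕ.∸ i)) ≡ (F ⊛ g) i * F′ (n ℕ.∸ i) + F i * (F′ ⊛ g′) (n ℕ.∸ i)
      leibniz n i i≤n = begin
        ι (+ n) * (F i * F′ (n ℕ.∸ i))
          ≡⟨ cong (_* (F i * F′ (n ℕ.∸ i))) (trans (cong (λ z → ι (+ z)) (sym (ℕ.m+[n∸m]≡n i≤n))) (ι-+ℕ i (n ℕ.∸ i))) ⟩
        (ι (+ i) + ι (+ (n ℕ.∸ i))) * (F i * F′ (n ℕ.∸ i))
          ≡⟨ solve 4 (λ a b x y → (a :+ b) :* (x :* y) := (a :* x) :* y :+ x :* (b :* y)) refl (ι (+ i)) (ι (+ (n ℕ.∸ i))) (F i) (F′ (n ℕ.∸ i)) ⟩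
        (ι (+ i) * F i) * F′ (n ℕ.∸ i) + F i * (ι (+ (n ℕ.∸ i)) * F′ (n ℕ.∸ i))
          ≡⟨ cong₂ (λ a b → a * F′ (n ℕ.∸ i) + F i * b) (dF i) (dF′ (n ℕ.∸ i)) ⟩
        (F ⊛ g) i * F′ (n ℕ.∸ i) + F i * (F′ ⊛ g′) (n ℕ.∸ i) ∎

    -- As g has no constant term, the recursion determines each coefficient from lower ones, and up
    -- to degree N it sees g only up to N. Identities between products of exponentials thus reduce
    -- to additions of exponents.
    Sol-unique : ∀ {g g′ F F′} N → g 0 ≡ 0# → (∀ i → i ℕ.≤ N → g i ≡ g′ i) → Sol g F → Sol g′ F′ → ∀ n → n ℕ.≤ N → F n ≡ F′ n
    Sol-unique {g} {g′} {F} {F′} N g0 gg (F0 , dF) (F′0 , dF′) = <-rec (λ n → n ℕ.≤ N → F n ≡ F′ n) step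
      where
      open ≡-Reasoning
      step : ∀ n → (∀ {m} → m ℕ.< n → m ℕ.≤ N → F m ≡ F′ m) → n ℕ.≤ N → F n ≡ F′ n
      step zero _ _ = trans F0 (sym F′0)
      step (suc n) rec n≤N = cancel-ι (suc n) (begin
        ι (+ suc n) * F (suc n)    ≡⟨ dF (suc n) ⟩
        (F ⊛ g) (suc n)            ≡⟨ cong₂ _+_ (∑ᴷ-cong (suc n) (λ i i≤n → cong₂ _*_ (rec i≤n (ℕ.≤-trans (ℕ.<⇒≤ i≤n) n≤N))
                                        (gg _ (ℕ.≤-trans (ℕ.m∸n≤m (suc n) i) n≤N)))) last ⟩
        (F′ ⊛ g′) (suc n)          ≡⟨ sym (dF′ (suc n)) ⟩
        ι (+ suc n) * F′ (suc n)   ∎)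
        where
        last : F (suc n) * g (n ℕ.∸ n) ≡ F′ (suc n) * g′ (n ℕ.∸ n)
        last = trans (cong (λ z → F (suc n) * g z) (ℕ.n∸n≡0 n)) (trans (cong (F (suc n) *_) g0) (trans (zeroʳ _)
          (sym (trans (cong (λ z → F′ (suc n) * g′ z) (ℕ.n∸n≡0 n)) (trans (cong (F′ (suc n) *_) (trans (sym (gg 0 z≤n)) g0)) (zeroʳ _))))))

    monomial : K → ℕ → Series
    monomial u j n with n ℕ.≟ j
    ... | yes _ = u
    ... | no _  = 0#

    monomial-at : ∀ u j → monomial u j j ≡ u
    monomial-at u j with j ℕ.≟ j
    ... | yes _ = refl
    ... | no ne = ⊥-elim (ne refl)

    monomial-off : ∀ u j n → n ≢ j → monomial u j n ≡ 0#
    monomial-off u j n ne with n ℕ.≟ j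
    ... | yes e = ⊥-elim (ne e)
    ... | no _ = refl

    ⊛-monomial : ∀ F u j n → (F ⊛ monomial u j) n ≡ u * shift j F n
    ⊛-monomial F u j n = trans (⊛-comm F (monomial u j) n) (trans (⊛-shift (monomial u j) F (suc n ℕ.+ suc j) n (ℕ.m≤m+n (suc n) (suc j)))
      (trans (∑ᴷ-single (suc n ℕ.+ suc j) (λ i → monomial u j i * shift i F n) j (ℕ.≤-trans (ℕ.n<1+n j) (ℕ.m≤n+m (suc j) (suc n)))
         (λ i _ ne → trans (cong (_* shift i F n) (monomial-off u j i ne)) (zeroˡ _)))
       (cong (_* shift j F n) (monomial-at u j))))

    -- spread j G = G(Y^j)
    spread : (j : ℕ) .{{_ : NonZero j}} → Series → Series
    spread j G n with n ℕ.% j ℕ.≟ 0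
    ... | yes _ = G (n ℕ./ j)
    ... | no _  = 0#

    spread-at : ∀ j .{{_ : NonZero j}} G i → spread j G (i ℕ.* j) ≡ G i
    spread-at j G i with (i ℕ.* j) ℕ.% j ℕ.≟ 0
    ... | yes _ = cong G (ℕ.m*n/n≡m i j)
    ... | no ne = ⊥-elim (ne (ℕ.m*n%n≡0 i j))

    spread-off : ∀ j .{{_ : NonZero j}} G n → n ℕ.% j ≢ 0 → spread j G n ≡ 0#
    spread-off j G n ne with n ℕ.% j ℕ.≟ 0
    ... | yes e = ⊥-elim (ne e)
    ... | no _ = refl

    ifact : ℕ → K
    ifact zero = 1#
    ifact (suc n) = inv (suc n) * ifact n

    -- exps u j = exp(u Y^j / j)
    exps : K → (j : ℕ) .{{_ : NonZero j}} → Series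
    exps u j = spread j (λ i → (u * inv j) ^ i * ifact i)

    data Mult (j n : ℕ) .{{_ : NonZero j}} : Set where
      multiple : ∀ i → n ≡ i ℕ.* j → Mult j n
      other    : n ℕ.% j ≢ 0 → Mult j n

    mult? : ∀ j n .{{_ : NonZero j}} → Mult j n
    mult? j n with n ℕ.% j ℕ.≟ 0
    ... | yes e = multiple (n ℕ./ j) (trans (ℕ.m≡m%n+[m/n]*n n j) (cong (ℕ._+ n ℕ./ j ℕ.* j) e))
    ... | no ne = other ne

    exps-Sol : ∀ u j .{{_ : NonZero j}} → Sol (monomial u j) (exps u j)
    exps-Sol u j = trans (spread-at j _ 0) (*-identityˡ 1#) , λ n → trans (recurrence n (mult? j n)) (sym (⊛-monomial (exps u j) u j n))
      where
      open ≡-Reasoning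
      G : ℕ → K
      G i = (u * inv j) ^ i * ifact i
      0≢j : ¬ (0 ≡ j)
      0≢j e = ℕ.≢-nonZero⁻¹ j (sym e)
      recurrence : ∀ n → Mult j n → ι (+ n) * exps u j n ≡ u * shift j (exps u j) n
      recurrence n (multiple zero refl) = trans (cong (_* exps u j 0) ι-0) (trans (zeroˡ _)
        (sym (trans (cong (u *_) (shift-< j (exps u j) 0 (ℕ.n≢0⇒n>0 (λ e → 0≢j (sym e))))) (zeroʳ u))))
      recurrence n (multiple (suc i) refl) = begin
        ι (+ (suc i ℕ.* j)) * exps u j (suc i ℕ.* j)
          ≡⟨ cong₂ _*_ (ι-*ℕ (suc i) j) (spread-at j G (suc i)) ⟩
        ι (+ suc i) * ι (+ j) * ((u * inv j) * (u * inv j) ^ i * (inv (suc i) * ifact i))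
          ≡⟨ solve 7 (λ s j u v a w b → s :* j :* ((u :* v) :* a :* (w :* b)) := (s :* w) :* (j :* v) :* (u :* (a :* b))) refl
               (ι (+ suc i)) (ι (+ j)) u (inv j) ((u * inv j) ^ i) (inv (suc i)) (ifact i) ⟩
        (ι (+ suc i) * inv (suc i)) * (ι (+ j) * inv j) * (u * G i)
          ≡⟨ cong₂ (λ a b → a * b * (u * G i)) (inv-* (suc i)) (inv-* j) ⟩
        1# * 1# * (u * G i)
          ≡⟨ trans (cong (_* (u * G i)) (*-identityˡ 1#)) (*-identityˡ _) ⟩
        u * G i
          ≡⟨ cong (u *_) (sym (trans (shift-≥ j (exps u j) (i ℕ.* j)) (spread-at j G i))) ⟩
        u * shift j (exps u j) (suc i ℕ.* j) ∎
      recurrence n (other ne) = trans (cong (ι (+ n) *_) (spread-off j G n ne)) (trans (zeroʳ _) (sym (trans (cong (u *_) shift0) (zeroʳ u))))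
        where
        shift0 : shift j (exps u j) n ≡ 0#
        shift0 with j ℕ.≤? n
        ... | no j≰n = shift-< j (exps u j) n (ℕ.≰⇒> j≰n)
        ... | yes j≤n = trans (shift-∸ j (exps u j) n j≤n) (spread-off j G (n ℕ.∸ j) (λ e → ne (trans (sym (ℕ.m≤n⇒[n∸m]%m≡n%m j≤n)) e)))

    -- The substitution of xY for Y commutes with Y d/dY.
    Sol-scale : ∀ {g F} x → Sol g F → Sol (λ n → g n * x ^ n) (λ n → F n * x ^ n)
    Sol-scale {g} {F} x (F0 , dF) = trans (*-identityʳ _) F0 , λ n → begin
      ι (+ n) * (F n * x ^ n)     ≡⟨ sym (*-assoc _ _ _) ⟩
      ι (+ n) * F n * x ^ n       ≡⟨ cong (_* x ^ n) (dF n) ⟩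
      (F ⊛ g) n * x ^ n           ≡⟨ ∑ᴷ-*ʳ (suc n) (x ^ n) _ ⟩
      ∑ᴷ (suc n) (λ i → F i * g (n ℕ.∸ i) * x ^ n) ≡⟨ ∑ᴷ-cong (suc n) (λ i i≤n → trans
          (cong (λ z → F i * g (n ℕ.∸ i) * z) (trans (cong (x ^_) (sym (ℕ.m+[n∸m]≡n (ℕ.≤-pred i≤n)))) (^-+ x i (n ℕ.∸ i))))
          (solve 4 (λ a b c d → a :* b :* (c :* d) := a :* c :* (b :* d)) refl (F i) (g (n ℕ.∸ i)) (x ^ i) (x ^ (n ℕ.∸ i)))) ⟩
      ((λ n → F n * x ^ n) ⊛ (λ n → g n * x ^ n)) n ∎
      where open ≡-Reasoning

-- Denominators of the coefficients of exp(Y + Y^p/p).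

module DworkExponential where

  open BigOperators
  open Congruences using (_≈[_]_; by; ≈-sym; ∣⇒0≈; 0≈⇒∣; ∏; ∏-split; ∏-cong)
  open Residues
  open PowerSeries
  open import Data.Nat as ℕ using (ℕ; zero; suc; NonZero; z≤n; s≤s)
  import Data.Nat.Properties as ℕ
  import Data.Nat.DivMod as ℕ
  import Data.Nat.Divisibility as ℕ
  open import Data.Nat.Primality using (Prime)
  open import Data.Nat.Induction using (<-rec)
  import Data.Nat.Tactic.RingSolver as ℕ
  open import Data.Integer as ℤ using (ℤ; +_)
  import Data.Integer.Properties as ℤ
  import Data.Integer.Tactic.RingSolver as ℤ
  open import Data.Product using (_,_)
  open import Data.Sum using (_⊎_; inj₁; inj₂)
  open import Data.Empty using (⊥-elim)
  open import Relation.Nullary using (yes; no)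
  open import Relation.Binary.PropositionalEquality

  module Integrality (F : CharZeroField) (p q h : ℕ) (pr : Prime p) (p≡1+q : p ≡ suc q) (q≡h+h : q ≡ h ℕ.+ h) where

    open Algebra₀ F public
    open OddPrime p q h pr p≡1+q q≡h+h public hiding (p≢0; q≢0)
    open OddPrime p q h pr p≡1+q q≡h+h using (p≢0; q≢0)

    3≤p : 3 ℕ.≤ p
    3≤p = subst (3 ℕ.≤_) (sym p≡1+q) (s≤s (subst (2 ℕ.≤_) (sym q≡h+h) (ℕ.+-mono-≤ 1≤h 1≤h)))

    -- The localisation of ℤ at p inside K; the denominator is an arbitrary unit modulo p, so sums
    -- and products need no reduction to lowest terms.
    record Int (x : K) : Set where
      constructor int
      field
        den num : ℤ
        unit    : Unit den
        eq      : x * ι den ≡ ι num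

    Int-ι : ∀ z → Int (ι z)
    Int-ι z = int (+ 1) z unit-1 (trans (cong (ι z *_) ι-1) (*-identityʳ _))

    Int-0 : Int 0#
    Int-0 = subst Int ι-0 (Int-ι (+ 0))

    Int-1 : Int 1#
    Int-1 = subst Int ι-1 (Int-ι (+ 1))

    Int-+ : ∀ {x y} → Int x → Int y → Int (x + y)
    Int-+ {x} {y} (int d n u e) (int d′ n′ u′ e′) = int (d ℤ.* d′) (n ℤ.* d′ ℤ.+ n′ ℤ.* d) (unit-* u u′) (begin
      (x + y) * ι (d ℤ.* d′)              ≡⟨ cong ((x + y) *_) (ι-* d d′) ⟩
      (x + y) * (ι d * ι d′)              ≡⟨ solve 4 (λ x y a b → (x :+ y) :* (a :* b) := (x :* a) :* b :+ (y :* b) :* a) refl x y (ι d) (ι d′) ⟩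
      x * ι d * ι d′ + y * ι d′ * ι d     ≡⟨ cong₂ (λ a b → a * ι d′ + b * ι d) e e′ ⟩
      ι n * ι d′ + ι n′ * ι d             ≡⟨ sym (trans (ι-+ _ _) (cong₂ _+_ (ι-* n d′) (ι-* n′ d))) ⟩
      ι (n ℤ.* d′ ℤ.+ n′ ℤ.* d)           ∎)
      where open ≡-Reasoning

    Int-* : ∀ {x y} → Int x → Int y → Int (x * y)
    Int-* {x} {y} (int d n u e) (int d′ n′ u′ e′) = int (d ℤ.* d′) (n ℤ.* n′) (unit-* u u′) (begin
      x * y * ι (d ℤ.* d′)        ≡⟨ cong (x * y *_) (ι-* d d′) ⟩
      x * y * (ι d * ι d′)        ≡⟨ solve 4 (λ x y a b → x :* y :* (a :* b) := (x :* a) :* (y :* b)) refl x y (ι d) (ι d′) ⟩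
      x * ι d * (y * ι d′)        ≡⟨ cong₂ _*_ e e′ ⟩
      ι n * ι n′                  ≡⟨ sym (ι-* n n′) ⟩
      ι (n ℤ.* n′)                ∎)
      where open ≡-Reasoning

    Int-neg : ∀ {x} → Int x → Int (- x)
    Int-neg {x} (int d n u e) = int d (ℤ.- n) u (trans (solve 2 (λ x d → :- x :* d := :- (x :* d)) refl x (ι d)) (trans (cong -_ e) (sym (ι-neg n))))

    Int-^ : ∀ {x} n → Int x → Int (x ^ n)
    Int-^ zero i = Int-1
    Int-^ (suc n) i = Int-* i (Int-^ n i)

    Int-∑ : ∀ n {f} → (∀ i → i ℕ.< n → Int (f i)) → Int (∑ᴷ n f)
    Int-∑ = ∑ᴷ-pred Int Int-0 Int-+

    Int-÷ : ∀ {x} s → Unit s → Int (x * ι s) → Int x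
    Int-÷ {x} s us (int d n u e) = int (s ℤ.* d) n (unit-* us u) (trans (cong (x *_) (ι-* s d)) (trans (sym (*-assoc _ _ _)) e))

    Int-inv : ∀ n .{{_ : NonZero n}} → Unit (+ n) → Int (inv n)
    Int-inv n u = Int-÷ (+ n) u (subst Int (sym (trans (*-comm _ _) (inv-* n))) Int-1)

    pw : ℕ → K
    pw k = ι (+ (p ℕ.^ k))

    pw-+ : ∀ a b → pw (a ℕ.+ b) ≡ pw a * pw b
    pw-+ a b = trans (cong (λ z → ι (+ z)) (ℕ.^-distribˡ-+-* p a b)) (ι-*ℕ (p ℕ.^ a) (p ℕ.^ b))

    pw-0 : pw 0 ≡ 1#
    pw-0 = ι-1

    pw-1 : pw 1 ≡ ι (+ p)
    pw-1 = cong (λ z → ι (+ z)) (ℕ.*-identityʳ p)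

    pw-* : ∀ a b → pw (a ℕ.* b) ≡ pw b ^ a
    pw-* zero b = ι-1
    pw-* (suc a) b = trans (pw-+ b (a ℕ.* b)) (cong (pw b *_) (pw-* a b))

    pw-^ : ∀ a → pw a ≡ ι (+ p) ^ a
    pw-^ a = trans (cong pw (sym (ℕ.*-identityʳ a))) (trans (pw-* a 1) (cong (_^ a) pw-1))

    Int-pw : ∀ k → Int (pw k)
    Int-pw k = Int-ι _

    Int-pw-mono : ∀ {a b x} → a ℕ.≤ b → Int (pw a * x) → Int (pw b * x)
    Int-pw-mono {a} {b} {x} a≤b i = subst Int (trans (sym (*-assoc _ _ _)) (cong (_* x)
      (trans (sym (pw-+ (b ℕ.∸ a) a)) (cong pw (ℕ.m∸n+n≡m a≤b))))) (Int-* (Int-pw (b ℕ.∸ a)) i)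

    Int-pw* : ∀ a {x} → Int x → Int (pw a * x)
    Int-pw* a = Int-* (Int-pw a)

    +-multiple : ∀ m r → + (m ℕ.* p ℕ.+ r) ≈[ p ] + r
    +-multiple m r = by (+ m) (trans (cong (+_) (ℕ.+-comm (m ℕ.* p) r)) (trans (ℤ.pos-+ r (m ℕ.* p))
      (cong (ℤ._+_ (+ r)) (trans (cong +_ (ℕ.*-comm m p)) (ℤ.pos-* p m)))))

    -- The multiples of p up to mp + r contribute p^m m!, as in Legendre's formula. The two lemmas
    -- alternate: a full block of p factors is completed by its last, divisible one.
    fact-split : ∀ m r → r ℕ.< p → fact (m ℕ.* p ℕ.+ r) ≡ (+ p) ℤ.^ m ℤ.* fact m ℤ.* stripped (m ℕ.* p ℕ.+ r)
    fact-split-0 : ∀ m → fact (m ℕ.* p) ≡ (+ p) ℤ.^ m ℤ.* fact m ℤ.* stripped (m ℕ.* p)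

    fact-split m r r<p = begin
      ∏ (m ℕ.* p ℕ.+ r) (λ i → + suc i)  ≡⟨ ∏-split (m ℕ.* p) r (λ i → + suc i) ⟩
      fact (m ℕ.* p) ℤ.* ∏ r (λ i → + suc (m ℕ.* p ℕ.+ i))
        ≡⟨ cong₂ ℤ._*_ (fact-split-0 m) (∏-cong r (λ i i<r → sym (strip-unit (suc-unit i i<r)))) ⟩
      A ℤ.* stripped (m ℕ.* p) ℤ.* ∏ r (λ i → strip (+ suc (m ℕ.* p ℕ.+ i)))
        ≡⟨ ℤ.*-assoc A _ _ ⟩
      A ℤ.* (stripped (m ℕ.* p) ℤ.* ∏ r (λ i → strip (+ suc (m ℕ.* p ℕ.+ i))))
        ≡⟨ cong (A ℤ.*_) (sym (∏-split (m ℕ.* p) r (λ i → strip (+ suc i)))) ⟩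
      A ℤ.* stripped (m ℕ.* p ℕ.+ r) ∎
      where
      open ≡-Reasoning
      A = (+ p) ℤ.^ m ℤ.* fact m
      suc-unit : ∀ i → i ℕ.< r → Unit (+ suc (m ℕ.* p ℕ.+ i))
      suc-unit i i<r = unit-≈ (≈-sym (subst (λ z → + z ≈[ p ] + suc i) (ℕ.+-suc (m ℕ.* p) i) (+-multiple m (suc i))))
        (unit-small (suc i) (s≤s z≤n) (ℕ.≤-<-trans i<r r<p))

    fact-split-0 zero = refl
    fact-split-0 (suc m) = begin
      fact (p ℕ.+ m ℕ.* p)                          ≡⟨ cong fact size ⟩
      fact (m ℕ.* p ℕ.+ q) ℤ.* + suc (m ℕ.* p ℕ.+ q) ≡⟨ cong₂ ℤ._*_ (fact-split m q q<p) (cong +_ (sym size)) ⟩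
      (+ p) ℤ.^ m ℤ.* fact m ℤ.* stripped (m ℕ.* p ℕ.+ q) ℤ.* + (suc m ℕ.* p) ≡⟨ cong ((+ p) ℤ.^ m ℤ.* fact m ℤ.* stripped (m ℕ.* p ℕ.+ q) ℤ.*_) (ℤ.pos-* (suc m) p) ⟩
      (+ p) ℤ.^ m ℤ.* fact m ℤ.* stripped (m ℕ.* p ℕ.+ q) ℤ.* (+ suc m ℤ.* + p) ≡⟨ lem ((+ p) ℤ.^ m) (fact m) (stripped (m ℕ.* p ℕ.+ q)) (+ suc m) (+ p) ⟩
      (+ p) ℤ.* (+ p) ℤ.^ m ℤ.* (fact m ℤ.* + suc m) ℤ.* (stripped (m ℕ.* p ℕ.+ q) ℤ.* + 1)
        ≡⟨ cong ((+ p) ℤ.* (+ p) ℤ.^ m ℤ.* (fact m ℤ.* + suc m) ℤ.*_) (cong (stripped (m ℕ.* p ℕ.+ q) ℤ.*_) (sym strip1)) ⟩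
      (+ p) ℤ.^ suc m ℤ.* fact (suc m) ℤ.* stripped (suc (m ℕ.* p ℕ.+ q)) ≡⟨ cong (λ z → (+ p) ℤ.^ suc m ℤ.* fact (suc m) ℤ.* stripped z) (sym size) ⟩
      (+ p) ℤ.^ suc m ℤ.* fact (suc m) ℤ.* stripped (p ℕ.+ m ℕ.* p) ∎
      where
      open ≡-Reasoning
      size : p ℕ.+ m ℕ.* p ≡ suc (m ℕ.* p ℕ.+ q)
      size = trans (cong (ℕ._+ m ℕ.* p) p≡1+q) (cong suc (ℕ.+-comm q (m ℕ.* p)))
      strip1 : strip (+ suc (m ℕ.* p ℕ.+ q)) ≡ + 1
      strip1 = strip-zero (subst (λ z → + z ≈[ p ] + 0) size (∣⇒0≈ (ℕ.n∣m*n (suc m))))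
      lem : ∀ a b c d e → a ℤ.* b ℤ.* c ℤ.* (d ℤ.* e) ≡ e ℤ.* a ℤ.* (b ℤ.* d) ℤ.* (c ℤ.* + 1)
      lem = ℤ.solve-∀

    ifact-fact : ∀ n → ifact n * ι (fact n) ≡ 1#
    ifact-fact zero = trans (*-identityˡ _) ι-1
    ifact-fact (suc n) = begin
      inv (suc n) * ifact n * ι (fact n ℤ.* + suc n)      ≡⟨ cong (inv (suc n) * ifact n *_) (ι-* (fact n) (+ suc n)) ⟩
      inv (suc n) * ifact n * (ι (fact n) * ι (+ suc n))  ≡⟨ solve 4 (λ a b c d → a :* b :* (c :* d) := (d :* a) :* (b :* c)) refl (inv (suc n)) (ifact n) (ι (fact n)) (ι (+ suc n)) ⟩
      ι (+ suc n) * inv (suc n) * (ifact n * ι (fact n))  ≡⟨ cong₂ _*_ (inv-* (suc n)) (ifact-fact n) ⟩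
      1# * 1#                                             ≡⟨ *-identityˡ 1# ⟩
      1#                                                  ∎
      where open ≡-Reasoning

    ifact-split : ∀ m r → r ℕ.< p → pw m * ifact (m ℕ.* p ℕ.+ r) * ι (stripped (m ℕ.* p ℕ.+ r)) ≡ ifact m
    ifact-split m r r<p = begin
      pw m * ifact n * ι s                                 ≡⟨ sym (*-identityʳ _) ⟩
      pw m * ifact n * ι s * 1#                            ≡⟨ cong (pw m * ifact n * ι s *_) (sym (ifact-fact m)) ⟩
      pw m * ifact n * ι s * (ifact m * ι (fact m))        ≡⟨ solve 5 (λ a b c d e → a :* b :* c :* (d :* e) := d :* (b :* (a :* e :* c))) refl (pw m) (ifact n) (ι s) (ifact m) (ι (fact m)) ⟩
      ifact m * (ifact n * (pw m * ι (fact m) * ι s))      ≡⟨ cong (λ z → ifact m * (ifact n * z)) (sym total) ⟩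
      ifact m * (ifact n * ι (fact n))                     ≡⟨ cong (ifact m *_) (ifact-fact n) ⟩
      ifact m * 1#                                         ≡⟨ *-identityʳ _ ⟩
      ifact m                                              ∎
      where
      open ≡-Reasoning
      n = m ℕ.* p ℕ.+ r
      s = stripped n
      total : ι (fact n) ≡ pw m * ι (fact m) * ι s
      total = trans (cong ι (fact-split m r r<p)) (trans (ι-* _ s) (cong (_* ι s) (trans (ι-* _ (fact m)) (cong (_* ι (fact m)) (trans (ι-^ (+ p) m) (sym (pw-^ m)))))))

    Int-ifact-split : ∀ a m r → r ℕ.< p → Int (pw a * ifact m) → Int (pw (a ℕ.+ m) * ifact (m ℕ.* p ℕ.+ r))
    Int-ifact-split a m r r<p i = Int-÷ (stripped n) (stripped-unit n) (subst Int (sym (begin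
        pw (a ℕ.+ m) * ifact n * ι (stripped n)       ≡⟨ cong (λ z → z * ifact n * ι (stripped n)) (pw-+ a m) ⟩
        pw a * pw m * ifact n * ι (stripped n)        ≡⟨ solve 4 (λ a b c d → a :* b :* c :* d := a :* (b :* c :* d)) refl (pw a) (pw m) (ifact n) (ι (stripped n)) ⟩
        pw a * (pw m * ifact n * ι (stripped n))      ≡⟨ cong (pw a *_) (ifact-split m r r<p) ⟩
        pw a * ifact m                                ∎)) i)
      where
      open ≡-Reasoning
      n = m ℕ.* p ℕ.+ r

    decompose : ∀ n → n ≡ n ℕ./ p ℕ.* p ℕ.+ n ℕ.% p
    decompose n = trans (ℕ.m≡m%n+[m/n]*n n p) (ℕ.+-comm (n ℕ.% p) _)

    2m≤ : ∀ n → n ℕ./ p ℕ.+ n ℕ./ p ℕ.≤ n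
    2m≤ n = ℕ.≤-trans (subst (ℕ._≤ n ℕ./ p ℕ.* p) (trans (ℕ.*-comm (n ℕ./ p) 2) (cong (n ℕ./ p ℕ.+_) (ℕ.+-identityʳ _)))
      (ℕ.*-monoʳ-≤ (n ℕ./ p) (ℕ.<⇒≤ 3≤p))) (ℕ.m/n*n≤m n p)

    -- The valuation of i! is ⌊i/p⌋ plus that of ⌊i/p⌋!, hence by induction at most 2⌊i/p⌋, which is
    -- at most i.
    Int-pw-ifact : ∀ i → Int (pw i * ifact i)
    Int-pw-ifact = <-rec (λ i → Int (pw i * ifact i)) step
      where
      step : ∀ i → (∀ {m} → m ℕ.< i → Int (pw m * ifact m)) → Int (pw i * ifact i)
      step zero _ = Int-* (Int-pw 0) Int-1
      step i@(suc _) rec = Int-pw-mono (2m≤ i) (subst (λ z → Int (pw (i ℕ./ p ℕ.+ i ℕ./ p) * ifact z)) (sym (decompose i))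
        (Int-ifact-split (i ℕ./ p) (i ℕ./ p) (i ℕ.% p) (ℕ.m%n<n i p) (rec (ℕ.m/n<m i p 1<p))))

    -- The exponent 2⌊i/p⌋ is the one that exp(uY^j/j) with j ≥ 2 can afford in degree ij.
    Int-pw2-ifact : ∀ i → Int (pw (i ℕ./ p ℕ.+ i ℕ./ p) * ifact i)
    Int-pw2-ifact i = subst (λ z → Int (pw (i ℕ./ p ℕ.+ i ℕ./ p) * ifact z)) (sym (decompose i))
        (Int-ifact-split (i ℕ./ p) (i ℕ./ p) (i ℕ.% p) (ℕ.m%n<n i p) (Int-pw-ifact (i ℕ./ p)))

    data Divisibility (j : ℕ) : Set where
      prime-to : Unit (+ j) → Divisibility j
      multiple-of : ∀ i → j ≡ i ℕ.* p → Divisibility j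

    divisibility : ∀ j → Divisibility j
    divisibility j with unit? (+ j)
    ... | inj₂ u = prime-to u
    ... | inj₁ z with 0≈⇒∣ z
    ...   | ℕ.divides i e = multiple-of i e

    inv-p-pw : ∀ a → pw (suc a) * inv p ≡ pw a
    inv-p-pw a = trans (cong (_* inv p) (trans (pw-+ 1 a) (cong (_* pw a) pw-1)))
      (trans (solve 3 (λ x a v → x :* a :* v := (x :* v) :* a) refl (ι (+ p)) (pw a) (inv p)) (trans (cong (_* pw a) (inv-* p)) (*-identityˡ _)))

    Int-pw-inv : ∀ j → Int (pw j * inv (suc j))
    Int-pw-inv = <-rec (λ j → Int (pw j * inv (suc j))) step
      where
      step : ∀ j → (∀ {i} → i ℕ.< j → Int (pw i * inv (suc i))) → Int (pw j * inv (suc j))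
      step j rec with divisibility (suc j)
      ... | prime-to u = Int-pw* j (Int-inv (suc j) u)
      ... | multiple-of (suc i) e = subst Int (sym (begin
              pw j * inv (suc j)                 ≡⟨ cong₂ (λ a b → pw a * b) j≡ (trans (cong inv e) (inv-*ℕ (suc i) p)) ⟩
              pw (suc (j ℕ.∸ 1)) * (inv (suc i) * inv p) ≡⟨ solve 3 (λ a b c → a :* (b :* c) := (a :* c) :* b) refl (pw (suc (j ℕ.∸ 1))) (inv (suc i)) (inv p) ⟩
              pw (suc (j ℕ.∸ 1)) * inv p * inv (suc i) ≡⟨ cong (_* inv (suc i)) (inv-p-pw (j ℕ.∸ 1)) ⟩
              pw (j ℕ.∸ 1) * inv (suc i)         ∎)) (Int-pw-mono i≤ (rec i<j))
        where
        open ≡-Reasoning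
        i+2≤ : suc (suc i) ℕ.≤ j
        i+2≤ = ℕ.≤-pred (subst (suc (suc (suc i)) ℕ.≤_) (sym e) (ℕ.≤-trans (ℕ.≤-trans (s≤s (s≤s (s≤s (ℕ.m≤m*n i 3)))) ℕ.≤-refl) (ℕ.*-monoʳ-≤ (suc i) 3≤p)))
        i<j : i ℕ.< j
        i<j = ℕ.<⇒≤ i+2≤
        j≡ : j ≡ suc (j ℕ.∸ 1)
        j≡ = sym (ℕ.m+[n∸m]≡n {1} (ℕ.≤-trans (s≤s z≤n) i<j))
        i≤ : i ℕ.≤ j ℕ.∸ 1
        i≤ = ℕ.≤-pred (subst (suc i ℕ.≤_) j≡ i<j)

    -- Two powers of p are saved against the crude bound for 1/(j+2). For a denominator (i+1)p this
    -- rests on (i+1)p ≥ i + 3, hence on p ≥ 3.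
    Int-pw-inv₂ : ∀ j → Int (pw j * inv (suc (suc j)))
    Int-pw-inv₂ j with divisibility (suc (suc j))
    ... | prime-to u = Int-pw* j (Int-inv (suc (suc j)) u)
    ... | multiple-of (suc i) e = subst Int (sym (begin
              pw j * inv (suc (suc j))           ≡⟨ cong₂ (λ a b → pw a * b) j≡ (trans (cong inv e) (inv-*ℕ (suc i) p)) ⟩
              pw (suc (j ℕ.∸ 1)) * (inv (suc i) * inv p) ≡⟨ solve 3 (λ a b c → a :* (b :* c) := (a :* c) :* b) refl (pw (suc (j ℕ.∸ 1))) (inv (suc i)) (inv p) ⟩
              pw (suc (j ℕ.∸ 1)) * inv p * inv (suc i) ≡⟨ cong (_* inv (suc i)) (inv-p-pw (j ℕ.∸ 1)) ⟩
              pw (j ℕ.∸ 1) * inv (suc i)         ∎)) (Int-pw-mono i≤ (Int-pw-inv i))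
      where
      open ≡-Reasoning
      i<j : suc i ℕ.≤ j
      i<j = ℕ.≤-pred (ℕ.≤-pred (subst (suc (suc (suc i)) ℕ.≤_) (sym e) (ℕ.≤-trans (s≤s (s≤s (s≤s (ℕ.m≤m*n i 3)))) (ℕ.*-monoʳ-≤ (suc i) 3≤p))))
      j≡ : j ≡ suc (j ℕ.∸ 1)
      j≡ = sym (ℕ.m+[n∸m]≡n {1} (ℕ.≤-trans (s≤s z≤n) i<j))
      i≤ : i ℕ.≤ j ℕ.∸ 1
      i≤ = ℕ.≤-pred (subst (suc i ℕ.≤_) j≡ i<j)

    -- Series whose n-th coefficient has p-adic valuation at least -⌊n/p⌋ form a ring.

    S : Series → Set
    S A = ∀ n → Int (pw (n ℕ./ p) * A n)

    /-superadditive : ∀ i n → i ℕ.≤ n → i ℕ./ p ℕ.+ (n ℕ.∸ i) ℕ./ p ℕ.≤ n ℕ./ p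
    /-superadditive i n i≤n = subst (ℕ._≤ n ℕ./ p) (ℕ.m*n/n≡m (i ℕ./ p ℕ.+ (n ℕ.∸ i) ℕ./ p) p)
      (ℕ./-monoˡ-≤ p (subst₂ ℕ._≤_ (sym (ℕ.*-distribʳ-+ p (i ℕ./ p) ((n ℕ.∸ i) ℕ./ p))) (ℕ.m+[n∸m]≡n i≤n)
        (ℕ.+-mono-≤ (ℕ.m/n*n≤m i p) (ℕ.m/n*n≤m (n ℕ.∸ i) p))))

    Int-pw-pair : ∀ a b {x y} → Int (pw a * x) → Int (pw b * y) → Int (pw (a ℕ.+ b) * (x * y))
    Int-pw-pair a b {x} {y} i j = subst Int (trans (solve 4 (λ a b x y → a :* x :* (b :* y) := a :* b :* (x :* y)) refl (pw a) (pw b) x y)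
      (cong (_* (x * y)) (sym (pw-+ a b)))) (Int-* i j)

    S-⊛ : ∀ {A B} → S A → S B → S (A ⊛ B)
    S-⊛ {A} {B} a b n = subst Int (sym (∑ᴷ-*ˡ (suc n) (pw (n ℕ./ p)) _))
      (Int-∑ (suc n) (λ i i≤n → Int-pw-mono (/-superadditive i n (ℕ.≤-pred i≤n)) (Int-pw-pair (i ℕ./ p) _ (a i) (b (n ℕ.∸ i)))))

    S-Int : ∀ {A} → (∀ n → Int (A n)) → S A
    S-Int a n = Int-pw* (n ℕ./ p) (a n)

    S-spread : ∀ j .{{_ : NonZero j}} G → (∀ i → Int (pw ((i ℕ.* j) ℕ./ p) * G i)) → S (spread j G)
    S-spread j G g n with mult? j n
    ... | multiple i refl = subst (λ z → Int (pw ((i ℕ.* j) ℕ./ p) * z)) (sym (spread-at j G i)) (g i)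
    ... | other ne = subst (λ z → Int (pw (n ℕ./ p) * z)) (sym (spread-off j G n ne)) (Int-pw* (n ℕ./ p) Int-0)

    S-exps-prime-to : ∀ {u} j .{{_ : NonZero j}} → Int u → 2 ℕ.≤ j → Unit (+ j) → S (exps u j)
    S-exps-prime-to {u} j iu 2≤j uj = S-spread j _ (λ i → Int-pw-mono (bound i)
      (subst Int (solve 3 (λ a b c → c :* (a :* b) := a :* (c :* b)) refl (pw (i ℕ./ p ℕ.+ i ℕ./ p)) (ifact i) ((u * inv j) ^ i))
        (Int-* (Int-^ i (Int-* iu (Int-inv j uj))) (Int-pw2-ifact i))))
      where
      bound : ∀ i → i ℕ./ p ℕ.+ i ℕ./ p ℕ.≤ (i ℕ.* j) ℕ./ p
      bound i = ℕ.≤-trans (subst (λ z → i ℕ./ p ℕ.+ z ℕ./ p ℕ.≤ (i ℕ.+ i) ℕ./ p) (ℕ.m+n∸m≡n i i) (/-superadditive i (i ℕ.+ i) (ℕ.m≤m+n i i)))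
        (ℕ./-monoˡ-≤ p (subst (ℕ._≤ i ℕ.* j) (trans (ℕ.*-comm i 2) (cong (i ℕ.+_) (ℕ.+-identityʳ i))) (ℕ.*-monoʳ-≤ i 2≤j)))

    -- In degree i(j+2)p the allowance is i(j+2) powers of p. For each of the i factors, j powers
    -- pay for 1/(j+2), one for 1/p, and the last one goes towards i!.
    S-exps-multiple : ∀ {u} j → Int u → .{{_ : NonZero (suc (suc j) ℕ.* p)}} → S (exps u (suc (suc j) ℕ.* p))
    S-exps-multiple {u} j iu = S-spread (suc (suc j) ℕ.* p) _ (λ i → subst Int (eq i)
      (Int-* (Int-^ i (Int-* iu (Int-pw-inv₂ j))) (Int-pw-ifact i)))
      where
      open ≡-Reasoning
      j″ = suc (suc j)
      base : pw j″ * (u * inv (j″ ℕ.* p)) ≡ u * (pw j * inv j″) * pw 1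
      base = begin
        pw j″ * (u * inv (j″ ℕ.* p))            ≡⟨ cong (λ z → pw j″ * (u * z)) (inv-*ℕ j″ p) ⟩
        pw j″ * (u * (inv j″ * inv p))          ≡⟨ solve 4 (λ a u b c → a :* (u :* (b :* c)) := u :* b :* (a :* c)) refl (pw j″) u (inv j″) (inv p) ⟩
        u * inv j″ * (pw j″ * inv p)            ≡⟨ cong (u * inv j″ *_) (trans (inv-p-pw (suc j)) (pw-+ 1 j)) ⟩
        u * inv j″ * (pw 1 * pw j)              ≡⟨ solve 4 (λ u b c d → u :* b :* (c :* d) := u :* (d :* b) :* c) refl u (inv j″) (pw 1) (pw j) ⟩
        u * (pw j * inv j″) * pw 1              ∎
      eq : ∀ i → (u * (pw j * inv j″)) ^ i * (pw i * ifact i) ≡ pw ((i ℕ.* (j″ ℕ.* p)) ℕ./ p) * ((u * inv (j″ ℕ.* p)) ^ i * ifact i)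
      eq i = sym (begin
        pw ((i ℕ.* (j″ ℕ.* p)) ℕ./ p) * ((u * inv (j″ ℕ.* p)) ^ i * ifact i)
          ≡⟨ cong (λ z → pw z * ((u * inv (j″ ℕ.* p)) ^ i * ifact i)) (trans (cong (ℕ._/ p) (sym (ℕ.*-assoc i j″ p))) (ℕ.m*n/n≡m (i ℕ.* j″) p)) ⟩
        pw (i ℕ.* j″) * ((u * inv (j″ ℕ.* p)) ^ i * ifact i)
          ≡⟨ trans (sym (*-assoc _ _ _)) (cong (_* ifact i) (trans (cong (_* (u * inv (j″ ℕ.* p)) ^ i) (pw-* i j″)) (sym (*-^ᴷ _ _ i)))) ⟩
        (pw j″ * (u * inv (j″ ℕ.* p))) ^ i * ifact i
          ≡⟨ cong (λ z → z ^ i * ifact i) base ⟩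
        (u * (pw j * inv j″) * pw 1) ^ i * ifact i
          ≡⟨ cong (_* ifact i) (*-^ᴷ _ (pw 1) i) ⟩
        (u * (pw j * inv j″)) ^ i * pw 1 ^ i * ifact i
          ≡⟨ trans (*-assoc _ _ _) (cong (λ z → (u * (pw j * inv j″)) ^ i * (z * ifact i)) (trans (sym (pw-* i 1)) (cong pw (ℕ.*-identityʳ i)))) ⟩
        (u * (pw j * inv j″)) ^ i * (pw i * ifact i) ∎)

    -- The factor p cancels the division by p in `exps`, so the series is exp(δ Y^p).
    S-exps-p : ∀ {δ} → Int δ → S (exps (ι (+ p) * δ) p)
    S-exps-p {δ} iδ = S-spread p _ (λ i → subst Int (eq i) (Int-* (Int-^ i iδ) (Int-pw-ifact i)))
      where
      eq : ∀ i → δ ^ i * (pw i * ifact i) ≡ pw ((i ℕ.* p) ℕ./ p) * ((ι (+ p) * δ * inv p) ^ i * ifact i)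
      eq i = trans (solve 3 (λ a b c → a :* (b :* c) := b :* (a :* c)) refl (δ ^ i) (pw i) (ifact i))
        (cong₂ (λ a b → pw a * (b ^ i * ifact i)) (sym (ℕ.m*n/n≡m i p))
          (sym (trans (solve 3 (λ p d v → p :* d :* v := (p :* v) :* d) refl (ι (+ p)) δ (inv p)) (trans (cong (_* δ) (inv-* p)) (*-identityˡ δ)))))

    exps₁-coeff : ∀ δ i → exps (ι (+ p) * δ) 1 i ≡ δ ^ i * (pw i * ifact i)
    exps₁-coeff δ i = begin
      exps (ι (+ p) * δ) 1 i                       ≡⟨ cong (exps (ι (+ p) * δ) 1) (sym (ℕ.*-identityʳ i)) ⟩
      exps (ι (+ p) * δ) 1 (i ℕ.* 1)               ≡⟨ spread-at 1 _ i ⟩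
      (ι (+ p) * δ * inv 1) ^ i * ifact i          ≡⟨ cong (λ z → z ^ i * ifact i) (trans (cong (ι (+ p) * δ *_) inv-1) (*-identityʳ _)) ⟩
      (ι (+ p) * δ) ^ i * ifact i                  ≡⟨ cong (_* ifact i) (*-^ᴷ _ _ i) ⟩
      ι (+ p) ^ i * δ ^ i * ifact i                ≡⟨ cong (λ z → z * δ ^ i * ifact i) (sym (pw-^ i)) ⟩
      pw i * δ ^ i * ifact i                       ≡⟨ solve 3 (λ a b c → a :* b :* c := b :* (a :* c)) refl (pw i) (δ ^ i) (ifact i) ⟩
      δ ^ i * (pw i * ifact i)                     ∎
      where
      open ≡-Reasoning
      inv-1 : inv 1 ≡ 1#
      inv-1 = trans (sym (*-identityˡ _)) (trans (cong (_* inv 1) (sym ι-1)) (inv-* 1))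

    S-exps₁ : ∀ {δ} → Int δ → S (exps (ι (+ p) * δ) 1)
    S-exps₁ {δ} iδ = S-Int (λ n → subst Int (sym (exps₁-coeff δ n)) (Int-* (Int-^ n iδ) (Int-pw-ifact n)))

    -- c is the coefficient sequence of exp(Y + Y^p/p), compared with
    -- (1 - Y)⁻¹ ∏ exp(- Y^j / j) over 2 ≤ j ≤ J, j ≠ p, which agrees with it up to degree J.

    gᶜ : Series
    gᶜ = monomial 1# 1 ⊕ monomial 1# p

    c : Series
    c = exps 1# 1 ⊛ exps 1# p

    c-Sol : Sol gᶜ c
    c-Sol = Sol-⊛ {monomial 1# 1} {monomial 1# p} {exps 1# 1} {exps 1# p} (exps-Sol 1# 1) (exps-Sol 1# p)

    gᶜ-0 : gᶜ 0 ≡ 0#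
    gᶜ-0 = trans (cong₂ _+_ (monomial-off 1# 1 0 (λ ())) (monomial-off 1# p 0 (λ e → ℕ.≢-nonZero⁻¹ p (sym e)))) (+-identityˡ 0#)

    ones base : Series
    ones _ = 1#
    base zero = 0#
    base (suc _) = 1#

    -- The geometric series 1/(1 - Y), for which Y times the logarithmic derivative is Y/(1 - Y).
    ones-Sol : Sol base ones
    ones-Sol = refl , λ n → trans (*-identityʳ _) (sym (trans (⊛-comm ones base n) (trans (∑ᴷ-ext (suc n) (λ i → *-identityʳ (base i))) (count n))))
      where
      count : ∀ n → ∑ᴷ (suc n) base ≡ ι (+ n)
      count zero = trans (+-identityˡ 0#) (sym ι-0)
      count (suc n) = trans (cong (_+ 1#) (count n)) (trans (+-comm _ _) (sym (ι-suc n)))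

    data Kind (j : ℕ) : Set where
      special  : j ≡ 1 ⊎ j ≡ p → Kind j
      ordinary : j ≢ 1 → j ≢ p → Kind j

    kind : ∀ j → Kind j
    kind j with j ℕ.≟ 1 | j ℕ.≟ p
    ... | yes e | _ = special (inj₁ e)
    ... | no _ | yes e = special (inj₂ e)
    ... | no a | no b = ordinary a b

    gB : ℕ → Series
    B : ℕ → Series
    gB zero = base
    gB (suc J) with kind (suc J)
    ... | special _ = gB J
    ... | ordinary _ _ = gB J ⊕ monomial (- 1#) (suc J)
    B zero = ones
    B (suc J) with kind (suc J)
    ... | special _ = B J
    ... | ordinary _ _ = B J ⊛ exps (- 1#) (suc J)

    B-Sol : ∀ J → Sol (gB J) (B J)
    B-Sol zero = ones-Sol
    B-Sol (suc J) with kind (suc J)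
    ... | special _ = B-Sol J
    ... | ordinary _ _ = Sol-⊛ {gB J} {monomial (- 1#) (suc J)} {B J} {exps (- 1#) (suc J)} (B-Sol J) (exps-Sol (- 1#) (suc J))

    S-B : ∀ J → S (B J)
    S-B zero = S-Int (λ _ → Int-1)
    S-B (suc J) with kind (suc J)
    ... | special _ = S-B J
    ... | ordinary j≢1 j≢p = S-⊛ {B J} {exps (- 1#) (suc J)} (S-B J) (factor (divisibility (suc J)))
      where
      factor : Divisibility (suc J) → S (exps (- 1#) (suc J))
      factor (prime-to u) = S-exps-prime-to (suc J) (Int-neg Int-1) (ℕ.≤∧≢⇒< (s≤s z≤n) (λ e → j≢1 (sym e))) u
      factor (multiple-of (suc zero) e) = ⊥-elim (j≢p (trans e (ℕ.+-identityʳ p)))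
      factor (multiple-of (suc (suc i)) e) = transport (suc J) (suc (suc i) ℕ.* p) {{b≢0 = ℕ.m*n≢0 (suc (suc i)) p}} e (S-exps-multiple i (Int-neg Int-1) {{ℕ.m*n≢0 (suc (suc i)) p}})
        where
        transport : ∀ a b .{{_ : NonZero a}} .{{b≢0 : NonZero b}} → a ≡ b → S (exps (- 1#) b) → S (exps (- 1#) a)
        transport a .a refl s = s

    gB-untouched : ∀ J n → (∀ i → 1 ℕ.≤ i → i ℕ.≤ J → i ≢ 1 → i ≢ p → n ≢ i) → gB J n ≡ base n
    gB-untouched zero n _ = refl
    gB-untouched (suc J) n avoid with kind (suc J)
    ... | special _ = gB-untouched J n (λ i a b → avoid i a (ℕ.m≤n⇒m≤1+n b))
    ... | ordinary a b = trans (cong₂ _+_ (gB-untouched J n (λ i a b → avoid i a (ℕ.m≤n⇒m≤1+n b)))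
        (monomial-off (- 1#) (suc J) n (avoid (suc J) (s≤s z≤n) ℕ.≤-refl a b))) (+-identityʳ _)

    -- The coefficient 1 of Y^n in Y/(1 - Y) is cancelled by the factor exp(-Y^n/n), and no other
    -- factor touches degree n.
    gB-killed : ∀ J n → 1 ℕ.≤ n → n ℕ.≤ J → n ≢ 1 → n ≢ p → gB J n ≡ 0#
    gB-killed zero zero () _ _ _
    gB-killed (suc J) n 1≤n n≤J n≢1 n≢p with kind (suc J) | n ℕ.≟ suc J
    ... | special (inj₁ e) | yes refl = ⊥-elim (n≢1 e)
    ... | special (inj₂ e) | yes refl = ⊥-elim (n≢p e)
    ... | special _ | no ne = gB-killed J n 1≤n (ℕ.≤-pred (ℕ.≤∧≢⇒< n≤J ne)) n≢1 n≢p
    ... | ordinary _ _ | yes refl = trans (cong₂ _+_ (gB-untouched J (suc J) (λ i _ i≤J _ _ e → ℕ.<-irrefl (sym e) (s≤s i≤J)))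
            (monomial-at (- 1#) (suc J))) (solve-1-1)
      where
      solve-1-1 : 1# + - 1# ≡ 0#
      solve-1-1 = trans (cong₂ (λ a b → a + - b) (sym ι-1) (sym ι-1)) (trans (solve 0 (con (+ 1) :+ :- con (+ 1) := con (+ 0)) refl) ι-0)
    ... | ordinary _ _ | no ne = trans (cong₂ _+_ (gB-killed J n 1≤n (ℕ.≤-pred (ℕ.≤∧≢⇒< n≤J ne)) n≢1 n≢p) (monomial-off (- 1#) (suc J) n ne)) (+-identityʳ _)

    gB-gᶜ : ∀ J n → n ℕ.≤ J → gᶜ n ≡ gB J n
    gB-gᶜ J zero _ = trans gᶜ-0 (sym (gB-untouched J 0 (λ i 1≤i _ _ _ e → ℕ.<-irrefl e 1≤i)))
    gB-gᶜ J n@(suc _) n≤J with kind n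
    ... | special (inj₁ refl) = trans (cong₂ _+_ (monomial-at 1# 1) (monomial-off 1# p 1 (ℕ.<⇒≢ 1<p))) (trans (+-identityʳ _)
            (sym (gB-untouched J 1 (λ i _ _ i≢1 _ e → i≢1 (sym e)))))
    ... | special (inj₂ refl) = trans (cong₂ _+_ (monomial-off 1# 1 p (λ e → ℕ.<⇒≢ 1<p (sym e))) (monomial-at 1# p)) (trans (+-identityˡ _)
            (sym (gB-untouched J p (λ i _ _ _ i≢p e → i≢p (sym e)))))
    ... | ordinary n≢1 n≢p = trans (cong₂ _+_ (monomial-off 1# 1 n n≢1) (monomial-off 1# p n n≢p)) (trans (+-identityˡ _)
            (sym (gB-killed J n (s≤s z≤n) n≤J n≢1 n≢p)))

    -- For the n-th coefficient the factors with j ≤ n suffice, so no infinite product has to be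
    -- formed.
    S-c : S c
    S-c n = subst (λ z → Int (pw (n ℕ./ p) * z)) (sym (Sol-unique {gᶜ} {gB n} {c} {B n} n gᶜ-0 (gB-gᶜ n) c-Sol (B-Sol n) n ℕ.≤-refl)) (S-B n n)

-- The trace identity and the Gross-Koblitz formula modulo p^k.

module TraceIdentity where

  open BigOperators
  open Residues
  open PowerSeries
  open DworkExponential
  open import Data.Nat as ℕ using (ℕ; zero; suc; NonZero; s≤s)
  import Data.Nat.Properties as ℕ
  import Data.Nat.DivMod as ℕ
  open import Data.Nat.Primality using (Prime)
  import Data.Nat.Tactic.RingSolver as ℕ
  open import Data.Integer as ℤ using (ℤ; +_)
  open import Data.Product using (proj₁; proj₂)
  open import Relation.Nullary using (yes; no)
  open import Relation.Binary.PropositionalEquality hiding (J)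

  module GrossKoblitz (F : CharZeroField) (p q h : ℕ) (pr : Prime p) (p≡1+q : p ≡ suc q) (q≡h+h : q ≡ h ℕ.+ h) where

    open Integrality F p q h pr p≡1+q q≡h+h public
    open OddPrime p q h pr p≡1+q q≡h+h using (p≢0; q≢0)

    record Iv (k : ℕ) (x : K) : Set where
      constructor iv
      field
        cofactor : K
        integral : Int cofactor
        equation : x ≡ pw k * cofactor

    Iv-0 : ∀ {k} → Iv k 0#
    Iv-0 {k} = iv 0# Int-0 (sym (zeroʳ _))

    Iv-+ : ∀ {k x y} → Iv k x → Iv k y → Iv k (x + y)
    Iv-+ (iv a i refl) (iv b j refl) = iv (a + b) (Int-+ i j) (sym (distribˡ _ _ _))

    Iv-neg : ∀ {k x} → Iv k x → Iv k (- x)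
    Iv-neg {k} (iv a i refl) = iv (- a) (Int-neg i) (solve 2 (λ x y → :- (x :* y) := x :* :- y) refl (pw k) a)

    Iv-* : ∀ {k x y} → Iv k x → Int y → Iv k (x * y)
    Iv-* {k} {y = y} (iv a i refl) j = iv (a * y) (Int-* i j) (*-assoc _ _ _)

    Iv-*ˡ : ∀ {k x y} → Int x → Iv k y → Iv k (x * y)
    Iv-*ˡ {k} {x} {y} i j = subst (Iv k) (*-comm y x) (Iv-* j i)

    Iv-∑ : ∀ {k} n {f} → (∀ i → i ℕ.< n → Iv k (f i)) → Iv k (∑ᴷ n f)
    Iv-∑ {k} = ∑ᴷ-pred (Iv k) Iv-0 Iv-+

    Iv-pw : ∀ k a b {x} → k ℕ.+ a ℕ.≤ b → Int (pw a * x) → Iv k (pw b * x)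
    Iv-pw k a b {x} le i = iv (pw (b ℕ.∸ k) * x) (Int-pw-mono (ℕ.m+n≤o⇒m≤o∸n a (subst (ℕ._≤ b) (ℕ.+-comm k a) le)) i)
      (trans (cong (λ z → pw z * x) (sym (ℕ.m+[n∸m]≡n (ℕ.m+n≤o⇒m≤o k le)))) (trans (cong (_* x) (pw-+ k (b ℕ.∸ k))) (*-assoc _ _ _)))

    module Congruence (k : ℕ) where
      infix 4 _≋_
      _≋_ : K → K → Set
      x ≋ y = Iv k (x - y)

      ≡⇒≋ : ∀ {x y} → x ≡ y → x ≋ y
      ≡⇒≋ {x} refl = subst (Iv k) (sym (trans (solve 1 (λ x → x :+ :- x := con (+ 0)) refl x) ι-0)) Iv-0

      ≋-refl : ∀ {x} → x ≋ x
      ≋-refl = ≡⇒≋ refl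

      ≋-sym : ∀ {x y} → x ≋ y → y ≋ x
      ≋-sym {x} {y} e = subst (Iv k) (solve 2 (λ x y → :- (x :+ :- y) := y :+ :- x) refl x y) (Iv-neg e)

      ≋-trans : ∀ {x y z} → x ≋ y → y ≋ z → x ≋ z
      ≋-trans {x} {y} {z} e f = subst (Iv k) (solve 3 (λ x y z → (x :+ :- y) :+ (y :+ :- z) := x :+ :- z) refl x y z) (Iv-+ e f)

      +-≋ : ∀ {x y u v} → x ≋ y → u ≋ v → x + u ≋ y + v
      +-≋ {x} {y} {u} {v} e f = subst (Iv k) (solve 4 (λ x y u v → (x :+ :- y) :+ (u :+ :- v) := (x :+ u) :+ :- (y :+ v)) refl x y u v) (Iv-+ e f)

      *-≋ˡ : ∀ {x u v} → Int x → u ≋ v → x * u ≋ x * v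
      *-≋ˡ {x} {u} {v} i e = subst (Iv k) (solve 3 (λ x u v → x :* (u :+ :- v) := x :* u :+ :- (x :* v)) refl x u v) (Iv-*ˡ i e)

      *-≋ʳ : ∀ {x u v} → Int x → u ≋ v → u * x ≋ v * x
      *-≋ʳ {x} {u} {v} i e = subst (Iv k) (solve 3 (λ x u v → (u :+ :- v) :* x := u :* x :+ :- (v :* x)) refl x u v) (Iv-* e i)

      ∑-≋ : ∀ n {f g} → (∀ i → i ℕ.< n → f i ≋ g i) → ∑ᴷ n f ≋ ∑ᴷ n g
      ∑-≋ = ∑ᴷ-rel _≋_ ≋-refl +-≋

      Iv⇒≋0 : ∀ {x} → Iv k x → x ≋ 0#
      Iv⇒≋0 {x} i = subst (Iv k) (trans (solve 1 (λ x → x := x :+ :- con (+ 0)) refl x) (cong (λ z → x + - z) ι-0)) i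

      ≋0⇒Iv : ∀ {x} → x ≋ 0# → Iv k x
      ≋0⇒Iv {x} i = subst (Iv k) (trans (cong (λ z → x + - z) (sym ι-0)) (sym (solve 1 (λ x → x := x :+ :- con (+ 0)) refl x))) i

      ∑-≋-tail : ∀ M M′ f → M ℕ.≤ M′ → (∀ i → M ℕ.≤ i → Iv k (f i)) → ∑ᴷ M′ f ≋ ∑ᴷ M f
      ∑-≋-tail M M′ f M≤M′ small = ≋-trans (≡⇒≋ (trans (cong (λ s → ∑ᴷ s f) (sym (ℕ.m+[n∸m]≡n M≤M′))) (∑ᴷ-split M (M′ ℕ.∸ M) f)))
        (≋-trans (+-≋ ≋-refl (Iv⇒≋0 (Iv-∑ (M′ ℕ.∸ M) (λ i _ → small (M ℕ.+ i) (ℕ.m≤m+n M i))))) (≡⇒≋ (+-identityʳ _)))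

    -p : K
    -p = - ι (+ p)

    -p^ : ∀ i → -p ^ i ≡ (- 1#) ^ i * pw i
    -p^ i = trans (cong (_^ i) (trans (solve 1 (λ x → :- x := :- con (+ 1) :* x) refl (ι (+ p))) (cong (λ z → - z * ι (+ p)) ι-1)))
      (trans (*-^ᴷ _ _ i) (cong ((- 1#) ^ i *_) (sym (pw-^ i))))

    Int-sign : ∀ i → Int ((- 1#) ^ i)
    Int-sign i = Int-^ i (Int-neg Int-1)

    Iv--p^ : ∀ k a b {x} → k ℕ.+ a ℕ.≤ b → Int (pw a * x) → Iv k (-p ^ b * x)
    Iv--p^ k a b {x} le i = subst (Iv k) (trans (sym (*-assoc _ _ _)) (cong (_* x) (sym (-p^ b)))) (Iv-*ˡ (Int-sign b) (Iv-pw k a b le i))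

    Int--p^ : ∀ a b {x} → a ℕ.≤ b → Int (pw a * x) → Int (-p ^ b * x)
    Int--p^ a b {x} le i = subst Int (trans (sym (*-assoc _ _ _)) (cong (_* x) (sym (-p^ b)))) (Int-* (Int-sign b) (Int-pw-mono le i))

    /-bound : ∀ n m → n ℕ.< suc m ℕ.* p → n ℕ./ p ℕ.≤ m
    /-bound n m lt = ℕ.≤-pred (ℕ.m<n*o⇒m/o<n {n} {suc m} {p} lt)

    -- The coefficient of degree p + m in Y c′ = (Y + Y^p) c.
    c-recurrence : ∀ m → ι (+ (p ℕ.+ m)) * c (p ℕ.+ m) ≡ c (q ℕ.+ m) + c m
    c-recurrence m = begin
      ι (+ (p ℕ.+ m)) * c (p ℕ.+ m)                       ≡⟨ proj₂ c-Sol (p ℕ.+ m) ⟩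
      (c ⊛ gᶜ) (p ℕ.+ m)                                  ≡⟨ ⊛-distribˡ c (monomial 1# 1) (monomial 1# p) (p ℕ.+ m) ⟩
      (c ⊛ monomial 1# 1) (p ℕ.+ m) + (c ⊛ monomial 1# p) (p ℕ.+ m)
        ≡⟨ cong₂ _+_ (trans (⊛-monomial c 1# 1 (p ℕ.+ m)) (*-identityˡ _)) (trans (⊛-monomial c 1# p (p ℕ.+ m)) (*-identityˡ _)) ⟩
      shift 1 c (p ℕ.+ m) + shift p c (p ℕ.+ m)           ≡⟨ cong₂ _+_ (cong (λ z → shift 1 c (z ℕ.+ m)) p≡1+q) (shift-≥ p c m) ⟩
      c (q ℕ.+ m) + c m                                   ∎
      where open ≡-Reasoning

    monomial-+ : ∀ u v j n → monomial u j n + monomial v j n ≡ monomial (u + v) j n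
    monomial-+ u v j n with n ℕ.≟ j
    ... | yes _ = refl
    ... | no _ = +-identityˡ 0#

    monomial-0 : ∀ {u} j n → u ≡ 0# → monomial u j n ≡ 0#
    monomial-0 j n e with n ℕ.≟ j
    ... | yes _ = e
    ... | no _ = refl

    ∑-spread : ∀ j .{{_ : NonZero j}} I (G H : ℕ → K) → ∑ᴷ (I ℕ.* j) (λ n → spread j G n * H n) ≡ ∑ᴷ I (λ i → G i * H (i ℕ.* j))
    ∑-spread j I G H = trans (∑ᴷ-blocks I j _) (∑ᴷ-ext I (λ i → trans
      (∑ᴷ-single j (λ r → spread j G (i ℕ.* j ℕ.+ r) * H (i ℕ.* j ℕ.+ r)) 0 (ℕ.>-nonZero⁻¹ j)
        (λ r r<j r≢0 → trans (cong (_* H (i ℕ.* j ℕ.+ r)) (spread-off j G _ (λ e → r≢0 (trans (sym (trans (cong (ℕ._% j) (ℕ.+-comm (i ℕ.* j) r)) (trans (ℕ.[m+kn]%n≡m%n r i j) (ℕ.m<n⇒m%n≡m r<j)))) e)))) (zeroˡ _)))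
      (trans (cong (λ z → spread j G z * H z) (ℕ.+-identityʳ (i ℕ.* j))) (cong (_* H (i ℕ.* j)) (spread-at j G i)))))

    -- Multiplying exp(Y + Y^p/p) by exp(-Y^p/p) leaves exp(Y), whose coefficients are known in
    -- closed form.
    c-inverse : ∀ n → (c ⊛ exps (- 1#) p) n ≡ ifact n
    c-inverse n = trans (Sol-unique {gᶜ ⊕ monomial (- 1#) p} {monomial 1# 1} {c ⊛ exps (- 1#) p} {exps 1# 1} n
        (trans (same 0) (monomial-off 1# 1 0 (λ ()))) (λ i _ → same i)
        (Sol-⊛ {gᶜ} {monomial (- 1#) p} {c} {exps (- 1#) p} c-Sol (exps-Sol (- 1#) p)) (exps-Sol 1# 1) n ℕ.≤-refl)
      (trans (cong (exps 1# 1) (sym (ℕ.*-identityʳ n))) (trans (spread-at 1 _ n)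
        (trans (cong (λ z → z ^ n * ifact n) (trans (cong (_* inv 1) (sym ι-1)) (inv-* 1))) (trans (cong (_* ifact n) (1^ n)) (*-identityˡ _)))))
      where
      same : ∀ i → (gᶜ ⊕ monomial (- 1#) p) i ≡ monomial 1# 1 i
      same i = trans (+-assoc _ _ _) (trans (cong (_+_ (monomial 1# 1 i)) (trans (monomial-+ 1# (- 1#) p i)
        (monomial-0 p i (trans (solve 1 (λ x → x :+ :- x := con (+ 0)) refl 1#) ι-0)))) (+-identityʳ _))

    -- The trace identity.  U is the matrix of Dwork's operator ψ∘exp(Y + Y^p/p), which commutes up to the factor p
    -- with the twisted derivation Y d/dY - N + Y; X = U T for the left inverse T of that derivation.

    module Trace (b N : ℕ) (1≤b : 1 ℕ.≤ b) where

      U X : ℕ → ℕ → K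
      U j i = -p ^ j * c (j ℕ.* p ℕ.+ b ℕ.∸ i)
      X j zero = 0#
      X j (suc i) = U j i + (ι (+ N) - ι (+ i)) * X j i

      -- Modulo the image of the twisted derivation D, the monomial Y^(i+1) equals (N - i)Y^i; thus
      -- ℓ i is the constant representing Y^i, and D T differs from the identity by the projection
      -- Y^i ↦ ℓ i.
      ℓ : ℕ → K
      ℓ zero = 1#
      ℓ (suc i) = (ι (+ N) - ι (+ i)) * ℓ i

      A : K
      A = ι (+ b) + ι (+ q) * ι (+ N)

      ι-p : ι (+ p) ≡ 1# + ι (+ q)
      ι-p = trans (cong (λ z → ι (+ z)) p≡1+q) (ι-suc q)

      -- This is `c-recurrence` in degree (j+1)p + b - i. The bound on i keeps the truncated
      -- subtraction in the index exact.
      U-recurrence : ∀ j i → i ℕ.≤ j → U (suc j) (suc i) ≡ (ι (+ p) * ι (+ suc j) + ι (+ b) - ι (+ i)) * U (suc j) i + ι (+ p) * U j i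
      U-recurrence j i i≤j = begin
        -p ^ suc j * c (suc j ℕ.* p ℕ.+ b ℕ.∸ suc i)                 ≡⟨ cong (λ z → -p ^ suc j * c z) idx₁ ⟩
        -p ^ suc j * c (q ℕ.+ m)                                     ≡⟨ cong (-p ^ suc j *_) c-eq ⟩
        -p ^ suc j * (ι (+ (p ℕ.+ m)) * c (p ℕ.+ m) - c m)           ≡⟨ solve 5 (λ p e s x y → (:- p) :* e :* (s :* x :+ :- y) := s :* ((:- p) :* e :* x) :+ p :* (e :* y)) refl
                                                                           (ι (+ p)) (-p ^ j) (ι (+ (p ℕ.+ m))) (c (p ℕ.+ m)) (c m) ⟩
        ι (+ (p ℕ.+ m)) * (-p ^ suc j * c (p ℕ.+ m)) + ι (+ p) * U j i
          ≡⟨ cong₂ (λ a z → a * (-p ^ suc j * c z) + ι (+ p) * U j i) size (sym idx₀) ⟩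
        (ι (+ p) * ι (+ suc j) + ι (+ b) - ι (+ i)) * U (suc j) i + ι (+ p) * U j i ∎
        where
        open ≡-Reasoning
        m = j ℕ.* p ℕ.+ b ℕ.∸ i
        i≤ : i ℕ.≤ j ℕ.* p ℕ.+ b
        i≤ = ℕ.≤-trans i≤j (ℕ.≤-trans (ℕ.m≤m*n j p) (ℕ.m≤m+n (j ℕ.* p) b))
        idx₀ : suc j ℕ.* p ℕ.+ b ℕ.∸ i ≡ p ℕ.+ m
        idx₀ = trans (cong (ℕ._∸ i) (ℕ.+-assoc p (j ℕ.* p) b)) (ℕ.+-∸-assoc p i≤)
        idx₁ : suc j ℕ.* p ℕ.+ b ℕ.∸ suc i ≡ q ℕ.+ m
        idx₁ = trans (cong (λ z → z ℕ.+ j ℕ.* p ℕ.+ b ℕ.∸ suc i) p≡1+q) (trans (cong (ℕ._∸ i) (ℕ.+-assoc q (j ℕ.* p) b)) (ℕ.+-∸-assoc q i≤))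
        c-eq : c (q ℕ.+ m) ≡ ι (+ (p ℕ.+ m)) * c (p ℕ.+ m) - c m
        c-eq = trans (solve 2 (λ x y → x := x :+ y :+ :- y) refl (c (q ℕ.+ m)) (c m)) (cong (_- c m) (sym (c-recurrence m)))
        size : ι (+ (p ℕ.+ m)) ≡ ι (+ p) * ι (+ suc j) + ι (+ b) - ι (+ i)
        size = begin
          ι (+ (p ℕ.+ m))                               ≡⟨ solve 2 (λ x y → x := x :+ y :+ :- y) refl (ι (+ (p ℕ.+ m))) (ι (+ i)) ⟩
          ι (+ (p ℕ.+ m)) + ι (+ i) - ι (+ i)           ≡⟨ cong (_- ι (+ i)) (sym (ι-+ℕ (p ℕ.+ m) i)) ⟩
          ι (+ (p ℕ.+ m ℕ.+ i)) - ι (+ i)               ≡⟨ cong (λ z → ι (+ z) - ι (+ i)) (trans (ℕ.+-assoc p m i) (trans (cong (p ℕ.+_) (ℕ.m∸n+n≡m i≤)) (sym (ℕ.+-assoc p (j ℕ.* p) b)))) ⟩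
          ι (+ (suc j ℕ.* p ℕ.+ b)) - ι (+ i)           ≡⟨ cong (_- ι (+ i)) (trans (ι-+ℕ (suc j ℕ.* p) b) (cong (_+ ι (+ b)) (trans (ι-*ℕ (suc j) p) (*-comm _ _)))) ⟩
          ι (+ p) * ι (+ suc j) + ι (+ b) - ι (+ i)     ∎

      -- The left side is an entry of U D T, since D T is the identity minus the projection to
      -- constants. Moving D to the left of U turns it into pD + A, and U T is X. The induction on i
      -- uses only the recursions defining `X` and `ℓ`.
      commutation : ∀ j i → i ℕ.≤ suc j →
        U (suc j) i - ℓ i * U (suc j) 0 ≡ (ι (+ p) * (ι (+ suc j) - ι (+ N)) + A) * X (suc j) i + ι (+ p) * X j i
      commutation j zero _ = trans (solve 3 (λ u e s → u :+ :- (e :* u) := (con (+ 1) :+ :- e) :* u) refl (U (suc j) 0) 1# 0#)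
        (trans (cong (λ z → (z + - 1#) * U (suc j) 0) ι-1)
        (trans (solve 3 (λ u e z → (e :+ :- e) :* u := con (+ 0)) refl (U (suc j) 0) 1# 0#)
        (trans ι-0 (sym (trans (cong₂ _+_ (zeroʳ _) (zeroʳ _)) (+-identityˡ 0#))))))
      commutation j (suc i) (s≤s i≤j) = begin
        U (suc j) (suc i) - ℓ (suc i) * U (suc j) 0
          ≡⟨ cong (_- ℓ (suc i) * U (suc j) 0) (U-recurrence j i i≤j) ⟩
        (P * J + β - I) * U (suc j) i + P * U j i - (n - I) * ℓ i * U (suc j) 0
          ≡⟨ solve 9 (λ P J β I n u v l w → (P :* J :+ β :+ :- I) :* u :+ P :* v :+ :- ((n :+ :- I) :* l :* w)
               := (n :+ :- I) :* (u :+ :- (l :* w)) :+ ((P :* J :+ β :+ :- n) :* u :+ P :* v)) refl P J β I n (U (suc j) i) (U j i) (ℓ i) (U (suc j) 0) ⟩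
        (n - I) * (U (suc j) i - ℓ i * U (suc j) 0) + ((P * J + β - n) * U (suc j) i + P * U j i)
          ≡⟨ cong (λ z → (n - I) * z + ((P * J + β - n) * U (suc j) i + P * U j i)) (commutation j i (ℕ.m≤n⇒m≤1+n i≤j)) ⟩
        (n - I) * ((P * (J - n) + A) * X (suc j) i + P * X j i) + ((P * J + β - n) * U (suc j) i + P * U j i)
          ≡⟨ cong (λ z → (n - I) * ((P * (J - n) + A) * X (suc j) i + P * X j i) + (z * U (suc j) i + P * U j i)) coeff ⟩
        (n - I) * ((P * (J - n) + A) * X (suc j) i + P * X j i) + ((P * (J - n) + A) * U (suc j) i + P * U j i)
          ≡⟨ solve 7 (λ m C x P y u v → m :* (C :* x :+ P :* y) :+ (C :* u :+ P :* v) := C :* (u :+ m :* x) :+ P :* (v :+ m :* y)) refl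
               (n - I) (P * (J - n) + A) (X (suc j) i) P (X j i) (U (suc j) i) (U j i) ⟩
        (P * (J - n) + A) * X (suc j) (suc i) + P * X j (suc i) ∎
        where
        open ≡-Reasoning
        P = ι (+ p)
        J = ι (+ suc j)
        β = ι (+ b)
        I = ι (+ i)
        n = ι (+ N)
        coeff : P * J + β - n ≡ P * (J - n) + A
        coeff = trans (cong (λ z → z * J + β - n) ι-p) (trans
          (solve 5 (λ e Q J n β → (e :+ Q) :* J :+ β :+ :- n := (e :+ Q) :* (J :+ :- n) :+ (β :+ Q :* n) :+ (e :* n :+ :- n)) refl 1# (ι (+ q)) J n β)
          (trans (cong₂ _+_ (cong (λ z → z * (J - n) + A) (sym ι-p)) (trans (cong (_- n) (*-identityˡ n)) (trans (solve 1 (λ x → x :+ :- x := con (+ 0)) refl n) ι-0))) (+-identityʳ _)))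

      -- Diagonal entries of the commutation relation telescope: the off-diagonal term p X_{M,M+1}
      -- is p U_{M,M} + p(N - M) X_{M,M}, and its last part cancels the previous boundary term.
      trace-partial : ∀ M → ∑ᴷ (suc M) (λ j → U j j) - ∑ᴷ (suc M) (λ j → ℓ j * U j 0)
        ≡ A * ∑ᴷ (suc M) (λ j → X j j) + ι (+ p) * ∑ᴷ M (λ j → U j j) + ι (+ p) * (ι (+ M) - ι (+ N)) * X M M
      trace-partial zero = begin
        (0# + U 0 0) - (0# + 1# * U 0 0)   ≡⟨ cong₂ (λ a b → a - b) (+-identityˡ _) (trans (+-identityˡ _) (*-identityˡ _)) ⟩
        U 0 0 - U 0 0                      ≡⟨ trans (solve 1 (λ x → x :+ :- x := con (+ 0)) refl (U 0 0)) ι-0 ⟩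
        0#                                 ≡⟨ sym (trans (cong₂ _+_ (trans (cong₂ _+_ (trans (cong (A *_) (+-identityˡ 0#)) (zeroʳ A)) (zeroʳ _)) (+-identityˡ 0#)) (zeroʳ _)) (+-identityˡ 0#)) ⟩
        A * (0# + 0#) + ι (+ p) * 0# + ι (+ p) * (ι (+ 0) - ι (+ N)) * 0# ∎
        where open ≡-Reasoning
      trace-partial (suc M) = begin
        (T + u) - (L + l * w)
          ≡⟨ solve 4 (λ T u L lw → (T :+ u) :+ :- (L :+ lw) := (T :+ :- L) :+ (u :+ :- lw)) refl T u L (l * w) ⟩
        (T - L) + (u - l * w)
          ≡⟨ cong₂ _+_ (trace-partial M) (commutation M (suc M) ℕ.≤-refl) ⟩
        (A * XX + P * T₀ + P * (ι (+ M) - n) * x₀) + ((P * (J - n) + A) * x₁ + P * (u₀ + (n - ι (+ M)) * x₀))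
          ≡⟨ solve 10 (λ A XX P T₀ M n x₀ J x₁ u₀ → (A :* XX :+ P :* T₀ :+ P :* (M :+ :- n) :* x₀) :+ ((P :* (J :+ :- n) :+ A) :* x₁ :+ P :* (u₀ :+ (n :+ :- M) :* x₀))
              := A :* (XX :+ x₁) :+ P :* (T₀ :+ u₀) :+ P :* (J :+ :- n) :* x₁) refl A XX P T₀ (ι (+ M)) n x₀ J x₁ u₀ ⟩
        A * (XX + x₁) + P * (T₀ + u₀) + P * (J - n) * x₁ ∎
        where
        open ≡-Reasoning
        P = ι (+ p)
        n = ι (+ N)
        J = ι (+ suc M)
        T = ∑ᴷ (suc M) (λ j → U j j)
        T₀ = ∑ᴷ M (λ j → U j j)
        L = ∑ᴷ (suc M) (λ j → ℓ j * U j 0)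
        XX = ∑ᴷ (suc M) (λ j → X j j)
        u = U (suc M) (suc M)
        u₀ = U M M
        l = ℓ (suc M)
        w = U (suc M) 0
        x₀ = X M M
        x₁ = X (suc M) (suc M)

      -- Stopping at M = N is essential: the boundary term carries the factor M - N.
      trace : (1# - ι (+ p)) * ∑ᴷ (suc N) (λ j → U j j)
        ≡ ∑ᴷ (suc N) (λ j → ℓ j * U j 0) + A * ∑ᴷ (suc N) (λ j → X j j) - ι (+ p) * U N N
      trace = begin
        (1# - P) * (T₀ + u)                          ≡⟨ cong (λ z → (z - P) * (T₀ + u)) (sym ι-1) ⟩
        (ι (+ 1) - P) * (T₀ + u)                     ≡⟨ solve 4 (λ P T u L → (con (+ 1) :+ :- P) :* (T :+ u) := L :+ (T :+ u :+ :- L) :+ :- (P :* (T :+ u))) refl P T₀ u L ⟩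
        L + (T₀ + u - L) - P * (T₀ + u)              ≡⟨ cong (λ z → L + z - P * (T₀ + u)) (trace-partial N) ⟩
        L + (A * XX + P * T₀ + P * (n - n) * X N N) - P * (T₀ + u)
                                                     ≡⟨ solve 8 (λ L A XX P T n x u → L :+ (A :* XX :+ P :* T :+ P :* (n :+ :- n) :* x) :+ :- (P :* (T :+ u)) := L :+ A :* XX :+ :- (P :* u)) refl L A XX P T₀ n (X N N) u ⟩
        L + A * XX - P * u                           ∎
        where
        open ≡-Reasoning
        P = ι (+ p)
        n = ι (+ N)
        T₀ = ∑ᴷ N (λ j → U j j)
        u = U N N
        L = ∑ᴷ (suc N) (λ j → ℓ j * U j 0)
        XX = ∑ᴷ (suc N) (λ j → X j j)

      ℓ-closed : ∀ j → j ℕ.≤ N → ℓ j ≡ ι (fact N) * ifact (N ℕ.∸ j)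
      ℓ-closed zero _ = sym (trans (*-comm _ _) (ifact-fact N))
      ℓ-closed (suc j) j<N = begin
        (ι (+ N) - ι (+ j)) * ℓ j                       ≡⟨ cong₂ _*_ diff (ℓ-closed j (ℕ.<⇒≤ j<N)) ⟩
        ι (+ suc d) * (ι (fact N) * ifact (N ℕ.∸ j))    ≡⟨ cong (λ z → ι (+ suc d) * (ι (fact N) * ifact z)) N-j ⟩
        ι (+ suc d) * (ι (fact N) * (inv (suc d) * ifact d)) ≡⟨ solve 4 (λ a b v e → a :* (b :* (v :* e)) := (a :* v) :* (b :* e)) refl (ι (+ suc d)) (ι (fact N)) (inv (suc d)) (ifact d) ⟩
        ι (+ suc d) * inv (suc d) * (ι (fact N) * ifact d) ≡⟨ trans (cong (_* (ι (fact N) * ifact d)) (inv-* (suc d))) (*-identityˡ _) ⟩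
        ι (fact N) * ifact d                            ∎
        where
        open ≡-Reasoning
        d = N ℕ.∸ suc j
        N-j : N ℕ.∸ j ≡ suc d
        N-j = ℕ.+-∸-assoc 1 j<N
        diff : ι (+ N) - ι (+ j) ≡ ι (+ suc d)
        diff = trans (cong (λ z → ι (+ z) - ι (+ j)) (trans (sym (ℕ.m+[n∸m]≡n (ℕ.<⇒≤ j<N))) (cong (j ℕ.+_) N-j)))
          (trans (cong (_- ι (+ j)) (ι-+ℕ j (suc d))) (solve 2 (λ a b → a :+ b :+ :- a := b) refl (ι (+ j)) (ι (+ suc d))))

      -- With ℓ_j = N!/(N-j)!, the sum is (-p)^N N! times the coefficient of degree Np + b in c ·
      -- exp(-Y^p/p) = exp(Y); the condition b < p ensures that j ≤ N covers all of that
      -- coefficient.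
      λ-closed : b ℕ.< p → ∑ᴷ (suc N) (λ j → ℓ j * U j 0) ≡ -p ^ N * ι (fact N) * ifact (N ℕ.* p ℕ.+ b)
      λ-closed b<p = begin
        ∑ᴷ (suc N) (λ j → ℓ j * U j 0)
          ≡⟨ ∑ᴷ-cong (suc N) (λ j j≤N → term j (ℕ.≤-pred j≤N)) ⟩
        ∑ᴷ (suc N) (λ j → C * (G (N ℕ.∸ j) * shift ((N ℕ.∸ j) ℕ.* p) c n))
          ≡⟨ sym (∑ᴷ-*ˡ (suc N) C _) ⟩
        C * ∑ᴷ (suc N) (λ j → G (N ℕ.∸ j) * shift ((N ℕ.∸ j) ℕ.* p) c n)
          ≡⟨ cong (C *_) (sym (∑ᴷ-rev (suc N) (λ i → G i * shift (i ℕ.* p) c n))) ⟩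
        C * ∑ᴷ (suc N) (λ i → G i * shift (i ℕ.* p) c n)
          ≡⟨ cong (C *_) (sym (∑-spread p (suc N) G (λ i → shift i c n))) ⟩
        C * ∑ᴷ (suc N ℕ.* p) (λ i → exps (- 1#) p i * shift i c n)
          ≡⟨ cong (C *_) (sym (⊛-shift (exps (- 1#) p) c (suc N ℕ.* p) n n<)) ⟩
        C * (exps (- 1#) p ⊛ c) n
          ≡⟨ cong (C *_) (trans (⊛-comm (exps (- 1#) p) c n) (c-inverse n)) ⟩
        C * ifact n ∎
        where
        open ≡-Reasoning
        n = N ℕ.* p ℕ.+ b
        C = -p ^ N * ι (fact N)
        G : ℕ → K
        G i = (- 1# * inv p) ^ i * ifact i
        n< : n ℕ.< suc N ℕ.* p
        n< = subst (ℕ._< suc N ℕ.* p) (ℕ.+-comm b (N ℕ.* p)) (ℕ.+-monoˡ-< (N ℕ.* p) b<p)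
        -p-inv : -p * (- 1# * inv p) ≡ 1#
        -p-inv = trans (cong (λ z → -p * (- z * inv p)) (sym ι-1)) (trans (solve 2 (λ P v → :- P :* (:- con (+ 1) :* v) := P :* v) refl (ι (+ p)) (inv p)) (inv-* p))
        term : ∀ j → j ℕ.≤ N → ℓ j * U j 0 ≡ C * (G (N ℕ.∸ j) * shift ((N ℕ.∸ j) ℕ.* p) c n)
        term j j≤N = sym (begin
          -p ^ N * fN * ((v ^ d * ifact d) * shift (d ℕ.* p) c n)
            ≡⟨ cong₂ (λ a z → a * fN * ((v ^ d * ifact d) * z)) (trans (cong (-p ^_) (sym (ℕ.m+[n∸m]≡n j≤N))) (^-+ -p j d)) (trans (cong (shift (d ℕ.* p) c) idx) (shift-≥ (d ℕ.* p) c (j ℕ.* p ℕ.+ b))) ⟩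
          -p ^ j * -p ^ d * fN * ((v ^ d * ifact d) * cj)
            ≡⟨ solve 6 (λ a e f v i x → a :* e :* f :* ((v :* i) :* x) := f :* i :* ((e :* v) :* (a :* x))) refl (-p ^ j) (-p ^ d) fN (v ^ d) (ifact d) cj ⟩
          fN * ifact d * ((-p ^ d * v ^ d) * (-p ^ j * cj))
            ≡⟨ cong₂ (λ a z → a * (z * (-p ^ j * cj))) (sym (ℓ-closed j j≤N)) (trans (sym (*-^ᴷ -p v d)) (trans (cong (_^ d) -p-inv) (1^ d))) ⟩
          ℓ j * (1# * (-p ^ j * cj))
            ≡⟨ cong (ℓ j *_) (*-identityˡ _) ⟩
          ℓ j * U j 0 ∎)
          where
          d = N ℕ.∸ j
          v = - 1# * inv p
          fN = ι (fact N)
          cj = c (j ℕ.* p ℕ.+ b)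
          idx : n ≡ d ℕ.* p ℕ.+ (j ℕ.* p ℕ.+ b)
          idx = trans (cong (λ z → z ℕ.* p ℕ.+ b) (sym (ℕ.m∸n+n≡m j≤N))) (trans (cong (ℕ._+ b) (ℕ.*-distribʳ-+ p d j)) (ℕ.+-assoc (d ℕ.* p) (j ℕ.* p) b))

      λ-stripped : b ℕ.< p → ∑ᴷ (suc N) (λ j → ℓ j * U j 0) * ι (stripped (N ℕ.* p ℕ.+ b)) ≡ (- 1#) ^ N
      λ-stripped b<p = begin
        ∑ᴷ (suc N) (λ j → ℓ j * U j 0) * ι s           ≡⟨ cong (_* ι s) (λ-closed b<p) ⟩
        -p ^ N * ι (fact N) * ifact n * ι s            ≡⟨ cong (λ z → z * ι (fact N) * ifact n * ι s) (-p^ N) ⟩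
        (- 1#) ^ N * pw N * ι (fact N) * ifact n * ι s ≡⟨ solve 5 (λ a b d e f → a :* b :* d :* e :* f := a :* ((b :* e :* f) :* d)) refl ((- 1#) ^ N) (pw N) (ι (fact N)) (ifact n) (ι s) ⟩
        (- 1#) ^ N * (pw N * ifact n * ι s * ι (fact N)) ≡⟨ cong (λ z → (- 1#) ^ N * (z * ι (fact N))) (ifact-split N b b<p) ⟩
        (- 1#) ^ N * (ifact N * ι (fact N))            ≡⟨ cong ((- 1#) ^ N *_) (ifact-fact N) ⟩
        (- 1#) ^ N * 1#                                ≡⟨ *-identityʳ _ ⟩
        (- 1#) ^ N                                     ∎
        where
        open ≡-Reasoning
        n = N ℕ.* p ℕ.+ b
        s = stripped n

      Int-U : b ℕ.< p → ∀ j i → Int (U j i)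
      Int-U b<p j i = Int--p^ ((j ℕ.* p ℕ.+ b ℕ.∸ i) ℕ./ p) j
        (/-bound _ j (ℕ.≤-<-trans (ℕ.m∸n≤m _ i) (subst (ℕ._< suc j ℕ.* p) (ℕ.+-comm b (j ℕ.* p)) (ℕ.+-monoˡ-< (j ℕ.* p) b<p)))) (S-c _)

      Int-X : b ℕ.< p → ∀ j i → Int (X j i)
      Int-X b<p j zero = Int-0
      Int-X b<p j (suc i) = Int-+ (Int-U b<p j i) (Int-* (Int-+ (Int-ι _) (Int-neg (Int-ι _))) (Int-X b<p j i))

    -- The terms of exp(Y + Y^p/p) in degrees congruent to b modulo q, divided by Y^b and evaluated
    -- at Y^q = -p: a truncated Gauss sum without its factor π^b.
    γ : ℕ → ℕ → K
    γ M b = ∑ᴷ M (λ i → -p ^ i * c (b ℕ.+ i ℕ.* q))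

    -- The valuation is at least i - ⌊(b + iq)/p⌋, and i > b + κp means exactly b + iq < (i - κ)p.
    γ-tail : ∀ κ b i → b ℕ.+ κ ℕ.* p ℕ.< i → Iv (suc κ) (-p ^ i * c (b ℕ.+ i ℕ.* q))
    γ-tail κ b i lt = Iv--p^ (suc κ) ((b ℕ.+ i ℕ.* q) ℕ./ p) i
      (subst (suc κ ℕ.+ (b ℕ.+ i ℕ.* q) ℕ./ p ℕ.≤_) (ℕ.m+[n∸m]≡n κ<i) (ℕ.+-monoʳ-≤ (suc κ) (/-bound _ (i ℕ.∸ suc κ) bound))) (S-c _)
      where
      κ<i : κ ℕ.< i
      κ<i = ℕ.≤-<-trans (ℕ.≤-trans (ℕ.m≤m*n κ p) (ℕ.m≤n+m (κ ℕ.* p) b)) lt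
      bound : b ℕ.+ i ℕ.* q ℕ.< suc (i ℕ.∸ suc κ) ℕ.* p
      bound = subst (b ℕ.+ i ℕ.* q ℕ.<_) (trans (sym (ℕ.*-distribʳ-∸ p i κ)) (cong (ℕ._* p) (ℕ.+-∸-assoc 1 κ<i)))
        (ℕ.m+n≤o⇒m≤o∸n (suc (b ℕ.+ i ℕ.* q)) (subst₂ ℕ._≤_ (lem b (i ℕ.* q) (κ ℕ.* p)) (trans (sym (ℕ.*-suc i q)) (cong (i ℕ.*_) (sym p≡1+q))) (ℕ.+-monoˡ-≤ (i ℕ.* q) lt)))
        where
        lem : ∀ b x y → suc (b ℕ.+ y) ℕ.+ x ≡ suc (b ℕ.+ x) ℕ.+ y
        lem = ℕ.solve-∀

    Int-γ-term : ∀ b i → b ℕ.< p → Int (-p ^ i * c (b ℕ.+ i ℕ.* q))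
    Int-γ-term b i b<p = Int--p^ ((b ℕ.+ i ℕ.* q) ℕ./ p) i (/-bound _ i (ℕ.+-mono-<-≤ b<p (ℕ.*-monoʳ-≤ i (ℕ.<⇒≤ q<p)))) (S-c _)

    Int-γ : ∀ M b → b ℕ.< p → Int (γ M b)
    Int-γ M b b<p = Int-∑ M (λ i _ → Int-γ-term b i b<p)

    module _ (κ : ℕ) where

      open Congruence (suc κ)

      γ-stable : ∀ b M M′ → b ℕ.+ κ ℕ.* p ℕ.< M → M ℕ.≤ M′ → γ M′ b ≋ γ M b
      γ-stable b M M′ lt M≤M′ = ∑-≋-tail M M′ _ M≤M′ (λ i M≤i → γ-tail κ b i (ℕ.<-≤-trans lt M≤i))

      -- With N = b · Q(k) the scalar A = b + qN equals b p^k, so the X-sum of the trace identity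
      -- vanishes modulo p^k. What remains is the ℓ-sum, computed by `λ-stripped`.
      gross-koblitz : ∀ b → 1 ℕ.≤ b → b ℕ.< p → ∀ M → b ℕ.* Q (suc κ) ℕ.< M →
        (1# - ι (+ p)) * γ M b * ι (stripped (b ℕ.* Q (suc κ) ℕ.* p ℕ.+ b)) ≋ (- 1#) ^ (b ℕ.* Q (suc κ))
      gross-koblitz b 1≤b b<p M N<M = ≋-trans
        (*-≋ʳ (Int-ι _) (≋-trans (*-≋ˡ (Int-+ Int-1 (Int-neg (Int-ι _))) (≋-trans (γ-stable b (suc N) M bound N<M) (≡⇒≋ trace-form))) step))
        (≡⇒≋ (λ-stripped b<p))
        where
        N = b ℕ.* Q (suc κ)
        open Trace b N 1≤b
        bound : b ℕ.+ κ ℕ.* p ℕ.< suc N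
        bound = s≤s (subst (b ℕ.+ κ ℕ.* p ℕ.≤_) (sym (ℕ.*-suc b (p ℕ.* Q κ))) (ℕ.+-monoʳ-≤ b
          (ℕ.≤-trans (ℕ.≤-trans (ℕ.*-monoˡ-≤ p (k≤Q κ)) (ℕ.≤-reflexive (ℕ.*-comm (Q κ) p))) (ℕ.m≤n*m (p ℕ.* Q κ) b {{ℕ.>-nonZero 1≤b}}))))
        index : ∀ j → j ℕ.* p ℕ.+ b ℕ.∸ j ≡ b ℕ.+ j ℕ.* q
        index j = trans (cong (λ z → z ℕ.+ b ℕ.∸ j) (trans (cong (j ℕ.*_) p≡1+q) (ℕ.*-suc j q)))
          (trans (cong (ℕ._∸ j) (ℕ.+-assoc j (j ℕ.* q) b)) (trans (ℕ.m+n∸m≡n j _) (ℕ.+-comm (j ℕ.* q) b)))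
        trace-form : γ (suc N) b ≡ ∑ᴷ (suc N) (λ j → U j j)
        trace-form = ∑ᴷ-ext (suc N) (λ j → cong (λ z → -p ^ j * c z) (sym (index j)))
        A≡ : A ≡ pw (suc κ) * ι (+ b)
        A≡ = trans (sym (trans (ι-+ℕ b (q ℕ.* N)) (cong (_+_ (ι (+ b))) (ι-*ℕ q N))))
          (trans (cong (λ z → ι (+ z)) (trans (lem b q (Q (suc κ))) (cong (ℕ._* b) (1+qQ (suc κ))))) (ι-*ℕ (p ℕ.^ suc κ) b))
          where
          lem : ∀ b q Q → b ℕ.+ q ℕ.* (b ℕ.* Q) ≡ (1 ℕ.+ q ℕ.* Q) ℕ.* b
          lem = ℕ.solve-∀
        corner-index : b ℕ.+ N ℕ.* q ≡ b ℕ.* p ℕ.^ κ ℕ.* p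
        corner-index = trans (lem b (Q (suc κ)) q) (trans (cong (b ℕ.*_) (trans (1+qQ (suc κ)) (ℕ.*-comm p (p ℕ.^ κ)))) (sym (ℕ.*-assoc b (p ℕ.^ κ) p)))
          where
          lem : ∀ b Q q → b ℕ.+ b ℕ.* Q ℕ.* q ≡ b ℕ.* (1 ℕ.+ q ℕ.* Q)
          lem = ℕ.solve-∀
        -- The coefficient has degree b + Nq = b p^κ · p, so it loses at most b p^κ powers of p; the
        -- term has N + 1 of them, and N = b p^κ + b Q(κ) with Q(κ) ≥ κ.
        corner : Iv (suc κ) (ι (+ p) * U N N)
        corner = subst (Iv (suc κ)) (trans (solve 3 (λ P e x → :- (:- P :* e :* x) := P :* (e :* x)) refl (ι (+ p)) (-p ^ N) (c (b ℕ.+ N ℕ.* q)))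
            (cong (λ z → ι (+ p) * (-p ^ N * c z)) (sym (index N))))
          (Iv-neg (Iv--p^ (suc κ) (b ℕ.* p ℕ.^ κ) (suc N) (s≤s size)
            (subst (λ z → Int (pw z * c (b ℕ.+ N ℕ.* q))) (trans (cong (ℕ._/ p) corner-index) (ℕ.m*n/n≡m (b ℕ.* p ℕ.^ κ) p)) (S-c (b ℕ.+ N ℕ.* q)))))
          where
          size : κ ℕ.+ b ℕ.* p ℕ.^ κ ℕ.≤ N
          size = subst (κ ℕ.+ b ℕ.* p ℕ.^ κ ℕ.≤_) (trans (ℕ.+-comm (b ℕ.* Q κ) _) (trans (sym (ℕ.*-distribˡ-+ b (p ℕ.^ κ) (Q κ))) (cong (b ℕ.*_) (sym (Q-suc κ)))))
            (ℕ.+-monoˡ-≤ (b ℕ.* p ℕ.^ κ) (ℕ.≤-trans (k≤Q κ) (ℕ.m≤n*m (Q κ) b {{ℕ.>-nonZero 1≤b}})))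
        step : (1# - ι (+ p)) * ∑ᴷ (suc N) (λ j → U j j) ≋ ∑ᴷ (suc N) (λ j → ℓ j * U j 0)
        step = subst (Iv (suc κ)) (trans (solve 3 (λ L a u → a :+ :- u := L :+ a :+ :- u :+ :- L) refl (∑ᴷ (suc N) (λ j → ℓ j * U j 0)) (A * ∑ᴷ (suc N) (λ j → X j j)) (ι (+ p) * U N N))
            (cong (_- ∑ᴷ (suc N) (λ j → ℓ j * U j 0)) (sym trace)))
          (Iv-+ (Iv-* (iv (ι (+ b)) (Int-ι _) A≡) (Int-∑ (suc N) (λ j _ → Int-X b<p j j))) (Iv-neg corner))

      c-0 : c 0 ≡ 1#
      c-0 = proj₁ c-Sol

      γ-0 : ∀ M → γ (suc M) 0 ≡ 1# + -p * γ M q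
      γ-0 M = trans (∑ᴷ-head M _) (cong₂ _+_ (trans (*-identityˡ _) c-0)
        (trans (∑ᴷ-ext M (λ i → *-assoc _ _ _)) (sym (∑ᴷ-*ˡ M -p _))))

-- Evaluation at Y^q = -p and the additive character.

module AdditiveCharacter where

  open BigOperators
  open Congruences using (_≈[_]_; by)
  open Residues
  open PowerSeries
  open DworkExponential
  open TraceIdentity
  open import Data.Nat as ℕ using (ℕ; zero; suc; z≤n)
  import Data.Nat.Properties as ℕ
  import Data.Nat.DivMod as ℕ
  import Data.Nat.Divisibility as ℕ
  open import Data.Nat.Primality using (Prime)
  import Data.Nat.Tactic.RingSolver as ℕ
  open import Data.Integer as ℤ using (ℤ; +_)
  import Data.Integer.Properties as ℤ
  import Data.Integer.Tactic.RingSolver as ℤ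
  open import Data.Product using (_,_; proj₁; proj₂)
  open import Data.Empty using (⊥-elim)
  open import Relation.Nullary using (yes; no)
  open import Relation.Binary.PropositionalEquality hiding (J)

  module Evaluation (F : CharZeroField) (p q h : ℕ) (pr : Prime p) (p≡1+q : p ≡ suc q) (q≡h+h : q ≡ h ℕ.+ h)
    (κ M : ℕ) (κp<M : κ ℕ.* p ℕ.< M) where

    open GrossKoblitz F p q h pr p≡1+q q≡h+h public
    open OddPrime p q h pr p≡1+q q≡h+h using (p≢0; q≢0)

    k : ℕ
    k = suc κ

    open Congruence k public

    ι-≋ : ∀ {x y} → x ≈[ p ℕ.^ k ] y → ι x ≋ ι y
    ι-≋ {x} {y} (by d refl) = iv (ι d) (Int-ι d) (trans (cong (_- ι y) (trans (ι-+ y _) (cong (_+_ (ι y)) (ι-* (+ (p ℕ.^ k)) d))))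
      (solve 2 (λ y z → y :+ z :+ :- y := z) refl (ι y) (pw k * ι d)))

    -- The quotient lies in the localisation only; its denominator is a unit modulo p and can be
    -- cancelled from the integer congruence.
    ≋-ι : ∀ {x y} → ι x ≋ ι y → x ≈[ p ℕ.^ k ] y
    ≋-ι {x} {y} (iv a (int d n u e) eq) = Congruences.minus-zero (cancel-unit k u (by n (trans (ι-injective ints) (lem d (+ (p ℕ.^ k) ℤ.* n)))))
      where
      lem : ∀ d m → m ≡ d ℤ.* + 0 ℤ.+ m
      lem = ℤ.solve-∀
      ints : ι (d ℤ.* (x ℤ.- y)) ≡ ι (+ (p ℕ.^ k) ℤ.* n)
      ints = begin
        ι (d ℤ.* (x ℤ.- y))       ≡⟨ trans (ι-* d _) (cong (ι d *_) (trans (ι-+ x (ℤ.- y)) (cong (_+_ (ι x)) (ι-neg y)))) ⟩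
        ι d * (ι x - ι y)         ≡⟨ cong (ι d *_) eq ⟩
        ι d * (pw k * a)          ≡⟨ solve 3 (λ d w a → d :* (w :* a) := w :* (a :* d)) refl (ι d) (pw k) a ⟩
        pw k * (a * ι d)          ≡⟨ cong (pw k *_) e ⟩
        pw k * ι n                ≡⟨ sym (ι-* (+ (p ℕ.^ k)) n) ⟩
        ι (+ (p ℕ.^ k) ℤ.* n)     ∎
        where open ≡-Reasoning

    -- Evaluation at Y^q = -p of the part of a series supported on multiples of q (truncated).
    ev : Series → K
    ev A = ∑ᴷ M (λ l → -p ^ l * A (l ℕ.* q))

    ev-cong : ∀ {A B} → A ≗ₛ B → ev A ≡ ev B
    ev-cong e = ∑ᴷ-ext M (λ l → cong (-p ^ l *_) (e (l ℕ.* q)))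

    ∑-shift : ∀ (g h : ℕ → K) i → (∀ l → l ℕ.< i → g l ≡ 0#) → (∀ l → g (i ℕ.+ l) ≡ h l) →
      (∀ l → M ℕ.≤ i ℕ.+ l → Iv k (h l)) → ∑ᴷ M g ≋ ∑ᴷ M h
    ∑-shift g h i low match small = ≋-trans (≋-sym upper) (≡⇒≋ lower)
      where
      lower : ∑ᴷ (M ℕ.+ i) g ≡ ∑ᴷ M h
      lower = trans (cong (λ s → ∑ᴷ s g) (ℕ.+-comm M i)) (trans (∑ᴷ-split i M g)
        (trans (cong₂ _+_ (∑ᴷ-zero i low) (∑ᴷ-ext M match)) (+-identityˡ _)))
      high : ∀ l → Iv k (g (M ℕ.+ l))
      high l with i ℕ.≤? M ℕ.+ l
      ... | no i≰ = subst (Iv k) (sym (low (M ℕ.+ l) (ℕ.≰⇒> i≰))) Iv-0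
      ... | yes i≤ = subst (Iv k) (trans (sym (match _)) (cong g (ℕ.m+[n∸m]≡n i≤)))
                       (small (M ℕ.+ l ℕ.∸ i) (subst (M ℕ.≤_) (sym (ℕ.m+[n∸m]≡n i≤)) (ℕ.m≤m+n M l)))
      upper : ∑ᴷ (M ℕ.+ i) g ≋ ∑ᴷ M g
      upper = ∑-≋-tail M (M ℕ.+ i) g (ℕ.m≤m+n M i) (λ j M≤j → subst (λ z → Iv k (g z)) (ℕ.m+[n∸m]≡n M≤j) (high (j ℕ.∸ M)))

    -- The term (-p)^L times a coefficient of degree Lq has valuation at least L - ⌊Lq/p⌋. Since Lp
    -- - Lq = L > κp, this is at least k from the truncation on.
    degree-bound : ∀ L → M ℕ.≤ L → k ℕ.+ (L ℕ.* q) ℕ./ p ℕ.≤ L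
    degree-bound L M≤L = subst (k ℕ.+ (L ℕ.* q) ℕ./ p ℕ.≤_) (ℕ.m+[n∸m]≡n κ<L) (ℕ.+-monoʳ-≤ k (/-bound _ (L ℕ.∸ k) bound))
      where
      lt : κ ℕ.* p ℕ.< L
      lt = ℕ.<-≤-trans κp<M M≤L
      κ<L : κ ℕ.< L
      κ<L = ℕ.≤-<-trans (ℕ.m≤m*n κ p) lt
      bound : L ℕ.* q ℕ.< suc (L ℕ.∸ k) ℕ.* p
      bound = subst (L ℕ.* q ℕ.<_) (trans (sym (ℕ.*-distribʳ-∸ p L κ)) (cong (ℕ._* p) (ℕ.+-∸-assoc 1 κ<L)))
        (ℕ.m+n≤o⇒m≤o∸n (suc (L ℕ.* q)) (subst₂ ℕ._≤_ (cong suc (ℕ.+-comm (κ ℕ.* p) (L ℕ.* q))) (trans (sym (ℕ.*-suc L q)) (cong (L ℕ.*_) (sym p≡1+q))) (ℕ.+-monoˡ-≤ (L ℕ.* q) lt)))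

    -- A factor Y^q acts as -p, up to terms pushed across the truncation. These are small only when
    -- the weight f has no more denominator than its degree m + iq permits, so f has to be carried
    -- along.
    ev-fold : ∀ A → S A → ∀ m i f → Int (pw ((m ℕ.+ i ℕ.* q) ℕ./ p) * f) →
      f * ev (shift (m ℕ.+ i ℕ.* q) A) ≋ f * -p ^ i * ev (shift m A)
    ev-fold A sA m i f If = ≋-trans (≡⇒≋ (∑ᴷ-*ˡ M f _)) (≋-trans (∑-shift _ _ i low match small) (≡⇒≋ (sym (∑ᴷ-*ˡ M (f * -p ^ i) _))))
      where
      open ≡-Reasoning
      g h′ : ℕ → K
      g l = f * (-p ^ l * shift (m ℕ.+ i ℕ.* q) A (l ℕ.* q))
      h′ l = f * -p ^ i * (-p ^ l * shift m A (l ℕ.* q))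
      low : ∀ l → l ℕ.< i → g l ≡ 0#
      low l l<i = trans (cong (λ z → f * (-p ^ l * z)) (shift-< (m ℕ.+ i ℕ.* q) A (l ℕ.* q) (ℕ.<-≤-trans (ℕ.*-monoˡ-< q l<i) (ℕ.m≤n+m (i ℕ.* q) m))))
        (trans (cong (f *_) (zeroʳ _)) (zeroʳ f))
      match : ∀ l → g (i ℕ.+ l) ≡ h′ l
      match l = begin
        f * (-p ^ (i ℕ.+ l) * shift (m ℕ.+ i ℕ.* q) A ((i ℕ.+ l) ℕ.* q))
          ≡⟨ cong₂ (λ a z → f * (a * z)) (^-+ -p i l) (trans (cong₂ (λ a b → shift a A b) (ℕ.+-comm m (i ℕ.* q)) (ℕ.*-distribʳ-+ q i l))
               (trans (shift-+ (i ℕ.* q) m A (i ℕ.* q ℕ.+ l ℕ.* q)) (shift-≥ (i ℕ.* q) (shift m A) (l ℕ.* q)))) ⟩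
        f * (-p ^ i * -p ^ l * shift m A (l ℕ.* q))
          ≡⟨ solve 4 (λ f a b x → f :* (a :* b :* x) := f :* a :* (b :* x)) refl f (-p ^ i) (-p ^ l) (shift m A (l ℕ.* q)) ⟩
        h′ l ∎
      small : ∀ l → M ℕ.≤ i ℕ.+ l → Iv k (h′ l)
      small l M≤ with m ℕ.≤? l ℕ.* q
      ... | no m≰ = subst (Iv k) (sym (trans (cong (λ z → f * -p ^ i * (-p ^ l * z)) (shift-< m A (l ℕ.* q) (ℕ.≰⇒> m≰))) (trans (cong (f * -p ^ i *_) (zeroʳ _)) (zeroʳ _)))) Iv-0
      ... | yes m≤ = subst (Iv k) (trans (cong (_* (f * A r)) (^-+ -p i l)) (trans
            (solve 4 (λ a b f x → a :* b :* (f :* x) := f :* a :* (b :* x)) refl (-p ^ i) (-p ^ l) f (A r)) (cong (λ z → f * -p ^ i * (-p ^ l * z)) (sym (shift-∸ m A (l ℕ.* q) m≤)))))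
          (Iv--p^ k (n₁ ℕ./ p ℕ.+ r ℕ./ p) (i ℕ.+ l) (ℕ.≤-trans (ℕ.+-monoʳ-≤ k floor) (degree-bound (i ℕ.+ l) M≤)) (Int-pw-pair (n₁ ℕ./ p) (r ℕ./ p) If (sA r)))
        where
        r = l ℕ.* q ℕ.∸ m
        n₁ = m ℕ.+ i ℕ.* q
        total : n₁ ℕ.+ r ≡ (i ℕ.+ l) ℕ.* q
        total = trans (lem m (i ℕ.* q) r) (trans (cong (i ℕ.* q ℕ.+_) (ℕ.m+[n∸m]≡n m≤)) (sym (ℕ.*-distribʳ-+ q i l)))
          where
          lem : ∀ m x r → m ℕ.+ x ℕ.+ r ≡ x ℕ.+ (m ℕ.+ r)
          lem = ℕ.solve-∀
        floor : n₁ ℕ./ p ℕ.+ r ℕ./ p ℕ.≤ ((i ℕ.+ l) ℕ.* q) ℕ./ p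
        floor = subst₂ (λ a b → n₁ ℕ./ p ℕ.+ a ℕ./ p ℕ.≤ b ℕ./ p) (ℕ.m+n∸m≡n n₁ r) total (/-superadditive n₁ (n₁ ℕ.+ r) (ℕ.m≤m+n n₁ r))

    ev-⊛ : ∀ A B J → M ℕ.* q ℕ.≤ J → ev (A ⊛ B) ≡ ∑ᴷ J (λ n → A n * ev (shift n B))
    ev-⊛ A B J Mq≤J = begin
      ∑ᴷ M (λ l → -p ^ l * (A ⊛ B) (l ℕ.* q))
        ≡⟨ ∑ᴷ-cong M (λ l l<M → trans (cong (-p ^ l *_) (⊛-shift A B J (l ℕ.* q) (ℕ.<-≤-trans (ℕ.*-monoˡ-< q l<M) Mq≤J))) (∑ᴷ-*ˡ J (-p ^ l) _)) ⟩
      ∑ᴷ M (λ l → ∑ᴷ J (λ n → -p ^ l * (A n * shift n B (l ℕ.* q))))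
        ≡⟨ ∑ᴷ-swap M J _ ⟩
      ∑ᴷ J (λ n → ∑ᴷ M (λ l → -p ^ l * (A n * shift n B (l ℕ.* q))))
        ≡⟨ ∑ᴷ-ext J (λ n → trans (∑ᴷ-ext M (λ l → solve 3 (λ e a b → e :* (a :* b) := a :* (e :* b)) refl (-p ^ l) (A n) (shift n B (l ℕ.* q)))) (sym (∑ᴷ-*ˡ M (A n) _))) ⟩
      ∑ᴷ J (λ n → A n * ev (shift n B)) ∎
      where open ≡-Reasoning

    S-shift : ∀ A j → S A → S (shift j A)
    S-shift A j sA n with j ℕ.≤? n
    ... | no j≰ = subst (λ z → Int (pw (n ℕ./ p) * z)) (sym (shift-< j A n (ℕ.≰⇒> j≰))) (Int-pw* (n ℕ./ p) Int-0)
    ... | yes j≤ = subst (λ z → Int (pw (n ℕ./ p) * z)) (sym (shift-∸ j A n j≤)) (Int-pw-mono (ℕ./-monoˡ-≤ p (ℕ.m∸n≤m n j)) (sA (n ℕ.∸ j)))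

    Int-ev : ∀ A → S A → Int (ev A)
    Int-ev A sA = Int-∑ M (λ l _ → Int--p^ ((l ℕ.* q) ℕ./ p) l (/-bound _ l (ℕ.≤-<-trans (ℕ.*-monoʳ-≤ l (ℕ.<⇒≤ q<p)) (ℕ.m<n+m (l ℕ.* p) (ℕ.>-nonZero⁻¹ p)))) (sA _))

    -- Where Y^q = -p one has Y^p = -pY, hence exp(δ Y^p) and exp(-pδ Y) take the same value.
    ev-exps-p : ∀ δ B → S B → Int δ → ev (exps (ι (+ p) * δ) p ⊛ B) ≋ ev (exps (ι (+ p) * (- δ)) 1 ⊛ B)
    ev-exps-p δ B sB iδ = ≋-trans (≡⇒≋ (trans (ev-⊛ _ B (I ℕ.* p) (ℕ.m≤m*n I p)) (∑-spread p I _ (λ n → ev (shift n B)))))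
      (≋-trans (∑-≋ I term) (≡⇒≋ (sym (ev-⊛ _ B I ℕ.≤-refl))))
      where
      I = M ℕ.* q
      G : ℕ → K
      G i = (ι (+ p) * δ * inv p) ^ i * ifact i
      i*p : ∀ i → i ℕ.* p ≡ i ℕ.+ i ℕ.* q
      i*p i = trans (cong (i ℕ.*_) p≡1+q) (ℕ.*-suc i q)
      G-form : ∀ i → G i * -p ^ i ≡ exps (ι (+ p) * (- δ)) 1 i
      G-form i = begin
        (ι (+ p) * δ * inv p) ^ i * ifact i * -p ^ i    ≡⟨ cong₂ (λ a b → a ^ i * ifact i * b) unscale (-p^ i) ⟩
        δ ^ i * ifact i * ((- 1#) ^ i * pw i)            ≡⟨ solve 4 (λ a b s w → a :* b :* (s :* w) := (s :* a) :* (w :* b)) refl (δ ^ i) (ifact i) ((- 1#) ^ i) (pw i) ⟩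
        (- 1#) ^ i * δ ^ i * (pw i * ifact i)            ≡⟨ cong (_* (pw i * ifact i)) (trans (sym (*-^ᴷ (- 1#) δ i)) (cong (_^ i) neg1)) ⟩
        (- δ) ^ i * (pw i * ifact i)                     ≡⟨ sym (exps₁-coeff (- δ) i) ⟩
        exps (ι (+ p) * (- δ)) 1 i                       ∎
        where
        open ≡-Reasoning
        unscale : ι (+ p) * δ * inv p ≡ δ
        unscale = trans (solve 3 (λ p d v → p :* d :* v := (p :* v) :* d) refl (ι (+ p)) δ (inv p)) (trans (cong (_* δ) (inv-* p)) (*-identityˡ δ))
        neg1 : - 1# * δ ≡ - δ
        neg1 = trans (cong (λ z → - z * δ) (sym ι-1)) (solve 1 (λ d → :- con (+ 1) :* d := :- d) refl δ)
      term : ∀ i → i ℕ.< I → G i * ev (shift (i ℕ.* p) B) ≋ exps (ι (+ p) * (- δ)) 1 i * ev (shift i B)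
      term i _ = ≋-trans (≡⇒≋ (cong (λ z → G i * ev (shift z B)) (i*p i)))
        (≋-trans (ev-fold B sB i i (G i) (subst₂ (λ a b → Int (pw (a ℕ./ p) * b)) (i*p i) (spread-at p G i) (S-exps-p iδ (i ℕ.* p))))
          (≡⇒≋ (cong (_* ev (shift i B)) (G-form i))))

    E : ℤ → Series
    E x n = c n * ι x ^ n

    S-E : ∀ x → S (E x)
    S-E x n = subst Int (*-assoc _ _ _) (Int-* (S-c n) (Int-^ n (Int-ι x)))

    gE : ℤ → Series
    gE x = monomial (ι x) 1 ⊕ monomial (ι (x ℤ.^ p)) p

    monomial-scale : ∀ y j n → monomial 1# j n * y ^ n ≡ monomial (y ^ j) j n
    monomial-scale y j n with n ℕ.≟ j
    ... | yes refl = *-identityˡ _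
    ... | no _ = zeroˡ _

    E-Sol : ∀ x → Sol (gE x) (E x)
    E-Sol x = proj₁ scaled , λ n → trans (proj₂ scaled n) (⊛-congˡ (E x) g-eq n)
      where
      scaled : Sol (λ n → gᶜ n * ι x ^ n) (E x)
      scaled = Sol-scale {gᶜ} {c} (ι x) c-Sol
      g-eq : (λ n → gᶜ n * ι x ^ n) ≗ₛ gE x
      g-eq n = trans (distribʳ (ι x ^ n) (monomial 1# 1 n) (monomial 1# p n)) (cong₂ _+_ (trans (monomial-scale (ι x) 1 n) (cong (λ z → monomial z 1 n) (*-identityʳ _)))
        (trans (monomial-scale (ι x) p n) (cong (λ z → monomial z p n) (sym (ι-^ x p)))))

    gE-0 : ∀ x → gE x 0 ≡ 0#
    gE-0 x = trans (cong₂ _+_ (monomial-off (ι x) 1 0 (λ ())) (monomial-off _ p 0 (λ e → ℕ.≢-nonZero⁻¹ p (sym e)))) (+-identityˡ 0#)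

    ≗-Sol : ∀ {g g′ A B} → g 0 ≡ 0# → g ≗ₛ g′ → Sol g A → Sol g′ B → A ≗ₛ B
    ≗-Sol {g} {g′} {A} {B} g0 gg sA sB n = Sol-unique {g} {g′} {A} {B} n g0 (λ i _ → gg i) sA sB n ℕ.≤-refl

    -- The exponent is p · p^k ε Y: one factor p per degree pays for the factorial, and p^k remains
    -- in every nonconstant term.
    ev-exps-small : ∀ ε A → S A → Int ε → ev (exps (ι (+ p) * (pw k * ε)) 1 ⊛ A) ≋ ev A
    ev-exps-small ε A sA iε = ≋-trans (≡⇒≋ (trans (ev-⊛ _ A (suc (M ℕ.* q)) (ℕ.n≤1+n _)) (∑ᴷ-head (M ℕ.* q) _)))
      (≋-trans (+-≋ (≡⇒≋ (trans (cong (_* ev A) (trans (exps₁-coeff (pw k * ε) 0) (trans (*-identityˡ _) (trans (*-identityʳ _) pw-0)))) (*-identityˡ _)))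
                    (Iv⇒≋0 (Iv-∑ (M ℕ.* q) (λ i _ → small i)))) (≡⇒≋ (+-identityʳ _)))
      where
      small : ∀ i → Iv k (exps (ι (+ p) * (pw k * ε)) 1 (suc i) * ev (shift (suc i) A))
      small i = subst (λ z → Iv k (z * ev (shift (suc i) A))) (sym (exps₁-coeff (pw k * ε) (suc i)))
        (Iv-* (Iv-* (Iv-* (iv ε iε refl) (Int-^ i (Int-* (Int-pw k) iε))) (Int-pw-ifact (suc i))) (Int-ev (shift (suc i) A) (S-shift A (suc i) sA)))

    -- Additivity of E at Teichmüller points, the source of the additive character.
    ev-additive : ∀ x y z w δ δ′ ε → x ℤ.+ y ℤ.+ z ≡ w ℤ.+ + p ℤ.* δ →
      x ℤ.^ p ℤ.+ y ℤ.^ p ℤ.+ z ℤ.^ p ≡ w ℤ.^ p ℤ.+ + p ℤ.* δ′ → δ ≡ δ′ ℤ.+ + (p ℕ.^ k) ℤ.* ε →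
      ev (E x ⊛ (E y ⊛ E z)) ≋ ev (E w)
    -- The product equals exp(δ′ Y^p) exp(pδ Y) E(w). Replacing Y^p by -pY leaves exp(p(δ - δ′)Y)
    -- E(w), and δ - δ′ is divisible by p^k.
    ev-additive x y z w δ δ′ ε eq₁ eqₚ eqδ = ≋-trans (≡⇒≋ (ev-cong product)) (≋-trans (ev-exps-p (ι δ′) B′ S-B′ (Int-ι δ′))
        (≋-trans (≡⇒≋ (ev-cong collapse)) (ev-exps-small (ι ε) (E w) (S-E w) (Int-ι ε))))
      where
      B′ = exps (ι (+ p) * ι δ) 1 ⊛ E w
      S-B′ : S B′
      S-B′ = S-⊛ {exps (ι (+ p) * ι δ) 1} {E w} (S-exps₁ (Int-ι δ)) (S-E w)
      Sol-B′ : Sol (monomial (ι (+ p) * ι δ) 1 ⊕ gE w) B′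
      Sol-B′ = Sol-⊛ {monomial (ι (+ p) * ι δ) 1} {gE w} {exps (ι (+ p) * ι δ) 1} {E w} (exps-Sol _ 1) (E-Sol w)
      product : E x ⊛ (E y ⊛ E z) ≗ₛ exps (ι (+ p) * ι δ′) p ⊛ B′
      product = ≗-Sol {gE x ⊕ (gE y ⊕ gE z)} {monomial (ι (+ p) * ι δ′) p ⊕ (monomial (ι (+ p) * ι δ) 1 ⊕ gE w)} {E x ⊛ (E y ⊛ E z)} {exps (ι (+ p) * ι δ′) p ⊛ B′}
        (trans (cong₂ _+_ (gE-0 x) (trans (cong₂ _+_ (gE-0 y) (gE-0 z)) (+-identityˡ 0#))) (+-identityˡ 0#)) same
        (Sol-⊛ {gE x} {gE y ⊕ gE z} {E x} {E y ⊛ E z} (E-Sol x) (Sol-⊛ {gE y} {gE z} {E y} {E z} (E-Sol y) (E-Sol z)))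
        (Sol-⊛ {monomial (ι (+ p) * ι δ′) p} {monomial (ι (+ p) * ι δ) 1 ⊕ gE w} {exps (ι (+ p) * ι δ′) p} {B′} (exps-Sol _ p) Sol-B′)
        where
        three : ∀ a b d → ι (a ℤ.+ b ℤ.+ d) ≡ ι a + ι b + ι d
        three a b d = trans (ι-+ _ d) (cong (_+ ι d) (ι-+ a b))
        two : ∀ a b → ι (a ℤ.+ + p ℤ.* b) ≡ ι a + ι (+ p) * ι b
        two a b = trans (ι-+ a _) (cong (_+_ (ι a)) (ι-* (+ p) b))
        same : ∀ n → (gE x ⊕ (gE y ⊕ gE z)) n ≡ (monomial (ι (+ p) * ι δ′) p ⊕ (monomial (ι (+ p) * ι δ) 1 ⊕ gE w)) n
        same n = begin
          (m1 (ι x) + mp (ι (x ℤ.^ p))) + ((m1 (ι y) + mp (ι (y ℤ.^ p))) + (m1 (ι z) + mp (ι (z ℤ.^ p))))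
            ≡⟨ solve 6 (λ a b d e f g → (a :+ b) :+ ((d :+ e) :+ (f :+ g)) := (a :+ d :+ f) :+ (b :+ e :+ g)) refl (m1 (ι x)) (mp (ι (x ℤ.^ p))) (m1 (ι y)) (mp (ι (y ℤ.^ p))) (m1 (ι z)) (mp (ι (z ℤ.^ p))) ⟩
          (m1 (ι x) + m1 (ι y) + m1 (ι z)) + (mp (ι (x ℤ.^ p)) + mp (ι (y ℤ.^ p)) + mp (ι (z ℤ.^ p)))
            ≡⟨ cong₂ _+_ (trans (cong (_+ m1 (ι z)) (monomial-+ _ _ 1 n)) (monomial-+ _ _ 1 n)) (trans (cong (_+ mp (ι (z ℤ.^ p))) (monomial-+ _ _ p n)) (monomial-+ _ _ p n)) ⟩
          m1 (ι x + ι y + ι z) + mp (ι (x ℤ.^ p) + ι (y ℤ.^ p) + ι (z ℤ.^ p))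
            ≡⟨ cong₂ (λ a b → m1 a + mp b) (trans (sym (three x y z)) (trans (cong ι eq₁) (two w δ))) (trans (sym (three _ _ _)) (trans (cong ι eqₚ) (two (w ℤ.^ p) δ′))) ⟩
          m1 (ι w + ι (+ p) * ι δ) + mp (ι (w ℤ.^ p) + ι (+ p) * ι δ′)
            ≡⟨ cong₂ _+_ (sym (monomial-+ _ _ 1 n)) (sym (monomial-+ _ _ p n)) ⟩
          (m1 (ι w) + m1 (ι (+ p) * ι δ)) + (mp (ι (w ℤ.^ p)) + mp (ι (+ p) * ι δ′))
            ≡⟨ solve 4 (λ a b d e → (a :+ b) :+ (d :+ e) := e :+ (b :+ (a :+ d))) refl (m1 (ι w)) (m1 (ι (+ p) * ι δ)) (mp (ι (w ℤ.^ p))) (mp (ι (+ p) * ι δ′)) ⟩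
          mp (ι (+ p) * ι δ′) + (m1 (ι (+ p) * ι δ) + (m1 (ι w) + mp (ι (w ℤ.^ p)))) ∎
          where
          open ≡-Reasoning
          m1 mp : K → K
          m1 u = monomial u 1 n
          mp u = monomial u p n
      collapse : exps (ι (+ p) * (- ι δ′)) 1 ⊛ B′ ≗ₛ exps (ι (+ p) * (pw k * ι ε)) 1 ⊛ E w
      collapse = ≗-Sol {monomial (ι (+ p) * (- ι δ′)) 1 ⊕ (monomial (ι (+ p) * ι δ) 1 ⊕ gE w)} {monomial (ι (+ p) * (pw k * ι ε)) 1 ⊕ gE w}
          {exps (ι (+ p) * (- ι δ′)) 1 ⊛ B′} {exps (ι (+ p) * (pw k * ι ε)) 1 ⊛ E w}
        (trans (cong₂ _+_ (monomial-off (ι (+ p) * (- ι δ′)) 1 0 (λ ())) (trans (cong₂ _+_ (monomial-off (ι (+ p) * ι δ) 1 0 (λ ())) (gE-0 w)) (+-identityˡ 0#))) (+-identityˡ 0#))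
        (λ n → trans (sym (+-assoc _ _ _)) (cong (_+ gE w n) (trans (monomial-+ _ _ 1 n) (cong (λ u → monomial u 1 n) diff))))
        (Sol-⊛ {monomial (ι (+ p) * (- ι δ′)) 1} {monomial (ι (+ p) * ι δ) 1 ⊕ gE w} {exps (ι (+ p) * (- ι δ′)) 1} {B′} (exps-Sol _ 1) Sol-B′)
        (Sol-⊛ {monomial (ι (+ p) * (pw k * ι ε)) 1} {gE w} {exps (ι (+ p) * (pw k * ι ε)) 1} {E w} (exps-Sol _ 1) (E-Sol w))
        where
        diff : ι (+ p) * (- ι δ′) + ι (+ p) * ι δ ≡ ι (+ p) * (pw k * ι ε)
        diff = trans (cong (λ z → ι (+ p) * (- ι δ′) + ι (+ p) * z) (trans (cong ι eqδ) (trans (ι-+ δ′ _) (cong (_+_ (ι δ′)) (ι-* (+ (p ℕ.^ k)) ε)))))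
          (solve 3 (λ P d e → P :* (:- d) :+ P :* (d :+ e) := P :* e) refl (ι (+ p)) (ι δ′) (pw k * ι ε))

    E-coeff : ∀ x → ι x ^ q ≋ 1# → ∀ b i → b ℕ.< p → E x (b ℕ.+ i ℕ.* q) * -p ^ i ≋ (-p ^ i * c (b ℕ.+ i ℕ.* q)) * ι x ^ b
    E-coeff x x^q b i b<p = ≋-trans (≡⇒≋ (trans (solve 3 (λ a x e → a :* x :* e := e :* a :* x) refl (c (b ℕ.+ i ℕ.* q)) (ι x ^ (b ℕ.+ i ℕ.* q)) (-p ^ i))
        (cong (-p ^ i * c (b ℕ.+ i ℕ.* q) *_) (trans (^-+ (ι x) b (i ℕ.* q)) (cong (ι x ^ b *_) (^-* (ι x) i q))))))
      (*-≋ˡ (Int-γ-term b i b<p) (≋-trans (*-≋ˡ (Int-^ b (Int-ι x)) (powers i)) (≡⇒≋ (*-identityʳ _))))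
      where
      powers : ∀ i → (ι x ^ q) ^ i ≋ 1#
      powers zero = ≋-refl
      powers (suc i) = ≋-trans (*-≋ʳ (Int-^ i (Int-^ q (Int-ι x))) x^q) (≋-trans (≡⇒≋ (*-identityˡ _)) (powers i))

    -- As x^q ≡ 1, all degrees b + iq carry the same power x^b, and their coefficients collect into
    -- γ_b: the expansion of the additive character in multiplicative ones.
    ev-E-⊛ : ∀ x A → S A → ι x ^ q ≋ 1# → ev (E x ⊛ A) ≋ ∑ᴷ q (λ b → γ M b * ι x ^ b * ev (shift b A))
    ev-E-⊛ x A sA x^q = ≋-trans (≡⇒≋ (trans (ev-⊛ (E x) A (M ℕ.* q) ℕ.≤-refl) (∑ᴷ-blocks M q _)))
      (≋-trans (∑-≋ M (λ i _ → ∑-≋ q (λ b b<q → term i b b<q))) (≡⇒≋ (trans (∑ᴷ-swap M q _) (∑ᴷ-ext q (λ b → collect b)))))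
      where
      term : ∀ i b → b ℕ.< q → E x (i ℕ.* q ℕ.+ b) * ev (shift (i ℕ.* q ℕ.+ b) A) ≋ (-p ^ i * c (b ℕ.+ i ℕ.* q)) * ι x ^ b * ev (shift b A)
      term i b b<q = ≋-trans (≡⇒≋ (cong (λ z → E x z * ev (shift z A)) (ℕ.+-comm (i ℕ.* q) b)))
        (≋-trans (ev-fold A sA b i (E x (b ℕ.+ i ℕ.* q)) (S-E x _)) (*-≋ʳ (Int-ev (shift b A) (S-shift A b sA)) (E-coeff x x^q b i (ℕ.<-trans b<q q<p))))
      collect : ∀ b → ∑ᴷ M (λ i → (-p ^ i * c (b ℕ.+ i ℕ.* q)) * ι x ^ b * ev (shift b A)) ≡ γ M b * ι x ^ b * ev (shift b A)
      collect b = trans (sym (∑ᴷ-*ʳ M (ev (shift b A)) _)) (cong (_* ev (shift b A)) (sym (∑ᴷ-*ʳ M (ι x ^ b) _)))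

    one : Series
    one = monomial 1# 0

    ⊛-one : ∀ A → A ⊛ one ≗ₛ A
    ⊛-one A n = trans (⊛-monomial A 1# 0 n) (*-identityˡ _)

    S-one : S one
    S-one = S-Int int-one
      where
      int-one : ∀ n → Int (one n)
      int-one n with n ℕ.≟ 0
      ... | yes _ = Int-1
      ... | no _ = Int-0

    shift-cong : ∀ j {A B} → A ≗ₛ B → shift j A ≗ₛ shift j B
    shift-cong zero e n = e n
    shift-cong (suc j) e zero = refl
    shift-cong (suc j) e (suc n) = shift-cong j e n

    ⊛-shiftʳ : ∀ j A B → shift j (A ⊛ B) ≗ₛ A ⊛ shift j B
    ⊛-shiftʳ j A B n = trans (shift-cong j (⊛-comm A B) n) (trans (sym (shift-⊛ j B A n)) (⊛-comm (shift j B) A n))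

    -- After three expansions only the monomial Y^(a+b+d) is left to evaluate; it gives zero unless
    -- q divides the degree, so the fractional powers of -p never occur.
    ev-triple : ∀ x y z → ι x ^ q ≋ 1# → ι y ^ q ≋ 1# → ι z ^ q ≋ 1# → ev (E x ⊛ (E y ⊛ E z)) ≋
      ∑ᴷ q (λ a → γ M a * ι x ^ a * ∑ᴷ q (λ b → γ M b * ι y ^ b * ∑ᴷ q (λ d → γ M d * ι z ^ d * ev (shift (d ℕ.+ (b ℕ.+ a)) one))))
    ev-triple x y z ux uy uz = ≋-trans (ev-E-⊛ x (E y ⊛ E z) (S-⊛ {E y} {E z} (S-E y) (S-E z)) ux)
      (∑-≋ q (λ a a<q → *-≋ˡ (coeff x a a<q) (≋-trans (≡⇒≋ (ev-cong (⊛-shiftʳ a (E y) (E z)))) (≋-trans (ev-E-⊛ y (shift a (E z)) (S-shift (E z) a (S-E z)) uy)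
      (∑-≋ q (λ b b<q → *-≋ˡ (coeff y b b<q) (≋-trans (≡⇒≋ (ev-cong (λ n → trans (sym (shift-+ b a (E z) n)) (trans (shift-cong (b ℕ.+ a) (λ n → sym (⊛-one (E z) n)) n) (⊛-shiftʳ (b ℕ.+ a) (E z) one n)))))
        (≋-trans (ev-E-⊛ z (shift (b ℕ.+ a) one) (S-shift one (b ℕ.+ a) S-one) uz)
          (≡⇒≋ (∑ᴷ-ext q (λ d → cong (γ M d * ι z ^ d *_) (ev-cong (λ n → sym (shift-+ d (b ℕ.+ a) one n)))))))))))))) 
      where
      coeff : ∀ x a → a ℕ.< q → Int (γ M a * ι x ^ a)
      coeff x a a<q = Int-* (Int-γ M a (ℕ.<-trans a<q q<p)) (Int-^ a (Int-ι x))

    ev-E-unit : ∀ w → ι w ^ q ≋ 1# → ev (E w) ≋ γ M 0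
    ev-E-unit w w^q = ∑-≋ M (λ l _ → ≋-trans (≡⇒≋ (*-comm _ _)) (≋-trans (E-coeff w w^q 0 l (ℕ.>-nonZero⁻¹ p)) (≡⇒≋ (*-identityʳ _))))

    ev-E-zero : ∀ w → ι w ≋ 0# → ev (E w) ≋ 1#
    ev-E-zero w w0 = ≋-trans (∑-≋ M each) (≡⇒≋ (trans (∑ᴷ-single M pick 0 (ℕ.≤-<-trans z≤n κp<M) (λ { zero _ ne → ⊥-elim (ne refl) ; (suc l) _ _ → refl })) refl))
      where
      pick : ℕ → K
      pick zero = 1#
      pick (suc _) = 0#
      each : ∀ l → l ℕ.< M → -p ^ l * E w (l ℕ.* q) ≋ pick l
      each zero _ = ≡⇒≋ (trans (*-identityˡ _) (trans (*-identityʳ _) (c-0 κ)))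
      each (suc l) _ = Iv⇒≋0 (subst (Iv k) (*-assoc _ _ _) (Iv-*ˡ (Int-γ-term 0 (suc l) (ℕ.>-nonZero⁻¹ p)) (powers (suc l ℕ.* q) (ℕ.≤-trans 1≤q (ℕ.m≤m+n q (l ℕ.* q))))))
        where
        powers : ∀ n → 1 ℕ.≤ n → Iv k (ι w ^ n)
        powers (suc n) _ = Iv-* (≋0⇒Iv w0) (Int-^ n (Int-ι w))

    ev-one-multiple : ∀ s → s ℕ.< M → ev (shift (s ℕ.* q) one) ≡ -p ^ s
    ev-one-multiple s s<M = trans (∑ᴷ-single M _ s s<M (λ l _ l≢s → trans (cong (-p ^ l *_) (off l l≢s)) (zeroʳ _)))
      (trans (cong (-p ^ s *_) (trans (cong (shift (s ℕ.* q) one) (sym (ℕ.+-identityʳ (s ℕ.* q)))) (trans (shift-≥ (s ℕ.* q) one 0) (monomial-at 1# 0)))) (*-identityʳ _))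
      where
      off : ∀ l → l ≢ s → shift (s ℕ.* q) one (l ℕ.* q) ≡ 0#
      off l l≢s = shift-off (s ℕ.* q) (l ℕ.* q) (λ e → l≢s (ℕ.*-cancelʳ-≡ l s q e))
        where
        shift-off : ∀ j n → n ≢ j → shift j one n ≡ 0#
        shift-off zero n ne = monomial-off 1# 0 n ne
        shift-off (suc j) zero _ = refl
        shift-off (suc j) (suc n) ne = shift-off j n (λ e → ne (cong suc e))

-- Morita's gamma function modulo p^k: periodicity, multiplication and reflection.

module MoritaGamma where

  open BigOperators
  open Congruences
  open Residues
  open import Defs using (modℤ; modℕ; sgnPow; prodℤ; gammaNat)
  open import Data.Bool using (Bool; true; false; if_then_else_; _∧_; not)
  open import Data.List using (_∷_; map; filterᵇ; applyUpTo)
  open import Data.Nat as ℕ using (ℕ; zero; suc; NonZero; z≤n; s≤s)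
  import Data.Nat.Properties as ℕ
  import Data.Nat.DivMod as ℕ
  import Data.Nat.Divisibility as ℕ
  open import Data.Nat.Primality using (Prime)
  import Data.Nat.Tactic.RingSolver as ℕ
  open import Data.Integer using (ℤ; +_; _+_; _*_; -_; _-_; _^_)
  open import Data.Integer.Properties
  open import Data.Integer.Tactic.RingSolver using (solve-∀)
  open import Data.Sum using (inj₁; inj₂)
  open import Data.Empty using (⊥-elim)
  open import Function using (_∘_; id)
  open import Relation.Nullary using (yes; no)
  open import Relation.Binary.PropositionalEquality

  sgnPow-^ : ∀ e → sgnPow e ≡ -1ℤ ^ e
  sgnPow-^ zero = refl
  sgnPow-^ (suc zero) = refl
  sgnPow-^ (suc (suc e)) = trans (cong (λ r → if r ℕ.≡ᵇ 0 then + 1 else -1ℤ) (trans (cong (ℕ._% 2) (ℕ.+-comm 2 e)) (ℕ.[m+n]%n≡m%n e 2)))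
    (trans (sgnPow-^ e) (lem (-1ℤ ^ e)))
    where
    lem : ∀ a → a ≡ (- + 1) * ((- + 1) * a)
    lem = solve-∀

  prod-filter : ∀ (P : ℕ → Bool) f N →
    prodℤ (map +_ (filterᵇ P (applyUpTo f N))) ≡ ∏ N (λ j → if P (f j) then + f j else + 1)
  prod-filter P f zero = refl
  prod-filter P f (suc N) = trans (split (P (f 0)) refl) (sym (∏-head N (λ j → if P (f j) then + f j else + 1)))
    where
    rest = ∏ N (λ j → if P (f (suc j)) then + f (suc j) else + 1)
    split : ∀ b → P (f 0) ≡ b → prodℤ (map +_ (filterᵇ P (f 0 ∷ applyUpTo (f ∘ suc) N))) ≡ (if P (f 0) then + f 0 else + 1) * rest
    split true e rewrite e = cong (+ f 0 *_) (prod-filter P (f ∘ suc) N)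
    split false e rewrite e = trans (prod-filter P (f ∘ suc) N) (sym (*-identityˡ rest))

  module PadicGamma (p q h : ℕ) (pr : Prime p) (p≡1+q : p ≡ suc q) (q≡h+h : q ≡ h ℕ.+ h) (κ : ℕ) where

    open OddPrime p q h pr p≡1+q q≡h+h

    k P : ℕ
    k = suc κ
    P = p ℕ.^ k

    instance
      P≢0 : NonZero P
      P≢0 = ℕ.m^n≢0 p k

    private
      p∣P : p ℕ.∣ P
      p∣P = p∣p^ κ

    ΓN : ℕ → ℤ
    ΓN Y = -1ℤ ^ Y * ∏ Y (λ j → strip (+ j))

    gammaNat-ΓN : ∀ N → gammaNat p N ≡ ΓN N
    gammaNat-ΓN N = cong₂ _*_ (sgnPow-^ N) (trans (prod-filter test id N) (∏-ext N select))
      where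
      test : ℕ → Bool
      test j = not (j ℕ.≡ᵇ 0) ∧ not (modℕ j p ℕ.≡ᵇ 0)
      select : ∀ j → (if test j then + j else + 1) ≡ strip (+ j)
      select zero = sym (strip-zero ≈-refl)
      select (suc j) with modℕ (suc j) p ℕ.≟ 0
      ... | yes e = trans (cong (λ r → if not (r ℕ.≡ᵇ 0) then + suc j else + 1) e)
                      (sym (strip-zero (≈-trans (≈-sym (modℤ-≈ (+ suc j))) (≡⇒≈ (cong +_ e)))))
      ... | no ne = trans (cong (λ b → if not b then + suc j else + 1) (nonzero (modℕ (suc j) p) ne))
                      (sym (strip-unit (λ z → ne (modℤ-eq (ℕ.>-nonZero⁻¹ p) z))))
        where
        nonzero : ∀ r → r ≢ 0 → (r ℕ.≡ᵇ 0) ≡ false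
        nonzero zero ne = ⊥-elim (ne refl)
        nonzero (suc r) _ = refl

    ΓN-suc : ∀ Y → ΓN (suc Y) ≡ - strip (+ Y) * ΓN Y
    ΓN-suc Y = lem (-1ℤ ^ Y) (∏ Y (λ j → strip (+ j))) (strip (+ Y))
      where
      lem : ∀ a b c → (- + 1) * a * (b * c) ≡ - c * (a * b)
      lem = solve-∀

    ΓN-unit : ∀ Y → Unit (ΓN Y)
    ΓN-unit Y = unit-* (unit-^ Y unit--1) (unit-∏ Y _ (λ i _ → strip-is-unit (+ i)))

    -- A block of p^k consecutive factors contributes -1 by Wilson's theorem modulo p^k, and the
    -- sign (-1)^(p^k) contributes another -1.
    ΓN-period : ∀ Y → ΓN (P ℕ.+ Y) ≈[ P ] ΓN Y
    ΓN-period Y = begin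
      -1ℤ ^ (P ℕ.+ Y) * ∏ (P ℕ.+ Y) (λ j → strip (+ j))
        ≡⟨ cong₂ _*_ (trans (^-distribˡ-+-* -1ℤ P Y) (cong (_* -1ℤ ^ Y) (-1^p^ k))) (∏-split P Y (λ j → strip (+ j))) ⟩
      -1ℤ * -1ℤ ^ Y * (∏ P (λ j → strip (+ j)) * ∏ Y (λ j → strip (+ (P ℕ.+ j))))
        ≈⟨ *-modˡ (-1ℤ * -1ℤ ^ Y) (*-mod (wilson κ) (∏-mod Y (λ j _ → strip-mod p∣P (shifted j)))) ⟩
      -1ℤ * -1ℤ ^ Y * (-1ℤ * ∏ Y (λ j → strip (+ j)))
        ≡⟨ lem (-1ℤ ^ Y) (∏ Y (λ j → strip (+ j))) ⟩
      ΓN Y ∎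
      where
      open ≈-Reasoning P
      lem : ∀ a b → (- + 1) * a * ((- + 1) * b) ≡ a * b
      lem = solve-∀
      shifted : ∀ j → + (P ℕ.+ j) ≈[ P ] + j
      shifted j = by (+ 1) (trans (pos-+ P j) (lem′ (+ P) (+ j)))
        where
        lem′ : ∀ a b → a + b ≡ b + a * + 1
        lem′ = solve-∀

    ΓN-multiple : ∀ d Y → ΓN (d ℕ.* P ℕ.+ Y) ≈[ P ] ΓN Y
    ΓN-multiple zero Y = ≈-refl
    ΓN-multiple (suc d) Y = ≈-trans (≡⇒≈ (cong ΓN (ℕ.+-assoc P (d ℕ.* P) Y))) (≈-trans (ΓN-period (d ℕ.* P ℕ.+ Y)) (ΓN-multiple d Y))

    Γ̂ : ℤ → ℤ
    Γ̂ X = ΓN (modℤ X P)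

    Γ̂-cong : ∀ {X Y} → X ≈[ P ] Y → Γ̂ X ≡ Γ̂ Y
    Γ̂-cong e = cong ΓN (modℤ-cong e)

    Γ̂-unit : ∀ X → Unit (Γ̂ X)
    Γ̂-unit X = ΓN-unit (modℤ X P)

    Γ̂-nat : ∀ Y → Γ̂ (+ Y) ≈[ P ] ΓN Y
    Γ̂-nat Y = ≈-sym (≈-trans (≡⇒≈ (cong ΓN (trans (ℕ.m≡m%n+[m/n]*n Y P) (ℕ.+-comm (Y ℕ.% P) _))))
      (≈-trans (ΓN-multiple (Y ℕ./ P) (Y ℕ.% P)) (≡⇒≈ (cong ΓN (sym residue)))))
      where
      residue : modℤ (+ Y) P ≡ Y ℕ.% P
      residue = modℤ-eq (ℕ.m%n<n Y P) (by (+ (Y ℕ./ P)) (trans (cong +_ (ℕ.m≡m%n+[m/n]*n Y P)) (trans (pos-+ (Y ℕ.% P) _)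
        (cong (_+_ (+ (Y ℕ.% P))) (trans (pos-* (Y ℕ./ P) P) (*-comm (+ (Y ℕ./ P)) (+ P)))))))

    Γ̂-suc : ∀ X → Γ̂ (X + + 1) ≈[ P ] - strip X * Γ̂ X
    Γ̂-suc X = begin
      Γ̂ (X + + 1)                    ≡⟨ Γ̂-cong (+-mod (≈-sym (modℤ-≈ X)) (≈-refl {x = + 1})) ⟩
      Γ̂ (+ Y + + 1)                  ≡⟨ cong Γ̂ (cong +_ (ℕ.+-comm Y 1)) ⟩
      Γ̂ (+ suc Y)                    ≈⟨ Γ̂-nat (suc Y) ⟩
      ΓN (suc Y)                     ≡⟨ ΓN-suc Y ⟩
      - strip (+ Y) * ΓN Y           ≈⟨ *-modʳ (ΓN Y) (neg-mod (strip-mod p∣P (modℤ-≈ X))) ⟩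
      - strip X * ΓN Y               ∎
      where
      open ≈-Reasoning P
      Y = modℤ X P

    Γ̂-0 : Γ̂ (+ 0) ≡ + 1
    Γ̂-0 = cong ΓN (modℤ-small (ℕ.m^n>0 p k))

    -- A product of such factors raises d to the number of integers prime to p in the range; it
    -- records what rescaling by d does to a restricted product.
    sel : ℤ → ℤ → ℤ
    sel d x with unit? x
    ... | inj₁ _ = + 1
    ... | inj₂ _ = d

    sel-unit : ∀ d {x} → Unit x → sel d x ≡ d
    sel-unit d {x} u with unit? x
    ... | inj₁ z = ⊥-elim (u z)
    ... | inj₂ _ = refl

    sel-zero : ∀ d {x} → x ≈[ p ] + 0 → sel d x ≡ + 1
    sel-zero d {x} z with unit? x
    ... | inj₁ _ = refl
    ... | inj₂ u = ⊥-elim (u z)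

    private
      +-multiple : ∀ m r → + (m ℕ.* p ℕ.+ r) ≈[ p ] + r
      +-multiple m r = by (+ m) (trans (cong +_ (ℕ.+-comm (m ℕ.* p) r)) (trans (pos-+ r (m ℕ.* p))
        (cong (_+_ (+ r)) (trans (cong +_ (ℕ.*-comm m p)) (pos-* p m)))))

      suc-unit : ∀ m i → i ℕ.< q → Unit (+ suc (m ℕ.* p ℕ.+ i))
      suc-unit m i i<q = unit-≈ (≈-sym (subst (λ z → + z ≈[ p ] + suc i) (ℕ.+-suc (m ℕ.* p) i) (+-multiple m (suc i))))
        (unit-small (suc i) (s≤s z≤n) (suc<p i<q))

    ∏-sel : ∀ d m r → r ℕ.≤ q → ∏ (m ℕ.* p ℕ.+ r) (λ i → sel d (+ suc i)) ≡ d ^ (m ℕ.* q ℕ.+ r)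
    ∏-sel-0 : ∀ d m → ∏ (m ℕ.* p) (λ i → sel d (+ suc i)) ≡ d ^ (m ℕ.* q)

    ∏-sel d m r r≤q = trans (∏-split (m ℕ.* p) r _) (trans (cong₂ _*_ (∏-sel-0 d m)
      (trans (∏-cong r (λ i i<r → sel-unit d (suc-unit m i (ℕ.<-≤-trans i<r r≤q)))) (∏-const r d))) (sym (^-distribˡ-+-* d (m ℕ.* q) r)))

    ∏-sel-0 d zero = refl
    ∏-sel-0 d (suc m) = trans (cong (λ n → ∏ n (λ i → sel d (+ suc i))) size) (trans (cong₂ _*_ (∏-sel d m q ℕ.≤-refl) last)
      (trans (*-identityʳ _) (cong (d ^_) (ℕ.+-comm (m ℕ.* q) q))))
      where
      size : suc m ℕ.* p ≡ suc (m ℕ.* p ℕ.+ q)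
      size = trans (cong (ℕ._+ m ℕ.* p) p≡1+q) (cong suc (ℕ.+-comm q (m ℕ.* p)))
      last : sel d (+ suc (m ℕ.* p ℕ.+ q)) ≡ + 1
      last = sel-zero d (subst (λ z → + z ≈[ p ] + 0) size (∣⇒0≈ (ℕ.n∣m*n (suc m))))

    -- Γ_p(b/q) is read off at the integer pt b, which is b/q modulo p^k.

    pt : ℕ → ℕ
    pt b = suc ((q ℕ.∸ b) ℕ.* Q k)

    pt-≈ : ∀ b → b ℕ.≤ q → + q * + pt b ≈[ P ] + b
    pt-≈ b b≤q = by (+ (q ℕ.∸ b)) (trans (sym (pos-* q (pt b))) (trans (cong +_ eq) (trans (pos-+ b _) (cong (_+_ (+ b)) (trans (cong +_ (ℕ.*-comm (q ℕ.∸ b) P)) (pos-* P (q ℕ.∸ b)))))))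
      where
      open ≡-Reasoning
      d = q ℕ.∸ b
      lem : ∀ q d Q → q ℕ.* suc (d ℕ.* Q) ≡ q ℕ.+ d ℕ.* (q ℕ.* Q)
      lem = ℕ.solve-∀
      eq : q ℕ.* pt b ≡ b ℕ.+ d ℕ.* P
      eq = begin
        q ℕ.* suc (d ℕ.* Q k)           ≡⟨ lem q d (Q k) ⟩
        q ℕ.+ d ℕ.* (q ℕ.* Q k)         ≡⟨ cong (ℕ._+ d ℕ.* (q ℕ.* Q k)) (sym (ℕ.m+[n∸m]≡n b≤q)) ⟩
        b ℕ.+ d ℕ.+ d ℕ.* (q ℕ.* Q k)   ≡⟨ trans (ℕ.+-assoc b d _) (cong (b ℕ.+_) (sym (ℕ.*-suc d (q ℕ.* Q k)))) ⟩
        b ℕ.+ d ℕ.* suc (q ℕ.* Q k)     ≡⟨ cong (λ z → b ℕ.+ d ℕ.* z) (1+qQ k) ⟩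
        b ℕ.+ d ℕ.* P                   ∎

    unit-q : Unit (+ q)
    unit-q = unit-small q 1≤q q<p

    Γb : ℕ → ℤ
    Γb b = Γ̂ (+ pt b)

    Γ̂-at : ∀ X b → b ℕ.≤ q → + q * X ≈[ P ] + b → Γ̂ X ≡ Γb b
    Γ̂-at X b b≤q e = Γ̂-cong (cancel-unit k {+ q} unit-q (≈-trans e (≈-sym (pt-≈ b b≤q))))

    Γb-0 : Γb 0 ≡ + 1
    Γb-0 = trans (sym (Γ̂-at (+ 0) 0 z≤n (≡⇒≈ (*-zeroʳ (+ q))))) Γ̂-0

    -- Below `pt b` there are (q - b)p^κ integers prime to p. The exponent p^κ is the one defining
    -- the Teichmüller lift, so the product is τ(d)^(q-b).
    ∏-sel-pt : ∀ d b → b ℕ.≤ q → ∏ (pt b) (λ j → sel d (+ j)) ≡ d ^ ((q ℕ.∸ b) ℕ.* p ℕ.^ κ)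
    ∏-sel-pt d b b≤q = begin
      ∏ (suc ((q ℕ.∸ b) ℕ.* Q k)) (λ j → sel d (+ j))        ≡⟨ ∏-head ((q ℕ.∸ b) ℕ.* Q k) (λ j → sel d (+ j)) ⟩
      sel d (+ 0) * ∏ ((q ℕ.∸ b) ℕ.* Q k) (λ j → sel d (+ suc j)) ≡⟨ trans (cong (_* ∏ ((q ℕ.∸ b) ℕ.* Q k) (λ j → sel d (+ suc j))) (sel-zero d ≈-refl)) (*-identityˡ _) ⟩
      ∏ ((q ℕ.∸ b) ℕ.* Q k) (λ j → sel d (+ suc j))          ≡⟨ cong (λ n → ∏ n (λ j → sel d (+ suc j))) (lem₁ (q ℕ.∸ b) p (Q κ)) ⟩
      ∏ ((q ℕ.∸ b) ℕ.* Q κ ℕ.* p ℕ.+ (q ℕ.∸ b)) (λ j → sel d (+ suc j)) ≡⟨ ∏-sel d ((q ℕ.∸ b) ℕ.* Q κ) (q ℕ.∸ b) (ℕ.m∸n≤m q b) ⟩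
      d ^ ((q ℕ.∸ b) ℕ.* Q κ ℕ.* q ℕ.+ (q ℕ.∸ b))            ≡⟨ cong (d ^_) (trans (lem₂ (q ℕ.∸ b) (Q κ) q) (cong ((q ℕ.∸ b) ℕ.*_) (1+qQ κ))) ⟩
      d ^ ((q ℕ.∸ b) ℕ.* p ℕ.^ κ)                            ∎
      where
      open ≡-Reasoning
      lem₁ : ∀ d p Q → d ℕ.* suc (p ℕ.* Q) ≡ d ℕ.* Q ℕ.* p ℕ.+ d
      lem₁ = ℕ.solve-∀
      lem₂ : ∀ d Q q → d ℕ.* Q ℕ.* q ℕ.+ d ≡ d ℕ.* (1 ℕ.+ q ℕ.* Q)
      lem₂ = ℕ.solve-∀

    -- Gauss's multiplication formula: both sides satisfy the same recursion in Y.
    module _ (m : ℕ) (m̄ : ℤ) (mm̄ : + m * m̄ ≈[ P ] + 1) where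

      private
        um : Unit (+ m)
        um = unit-*ˡ m̄ (λ z → unit-1 (≈-trans (≈-sym (≈-down p∣P mm̄)) z))

        um̄ : Unit m̄
        um̄ = unit-*ˡ (+ m) (λ z → unit-1 (≈-trans (≈-sym (≈-down p∣P mm̄)) (≈-trans (≡⇒≈ (*-comm (+ m) m̄)) z)))

        G : ℕ → ℕ → ℤ
        G Y i = Γ̂ ((+ Y + + i) * m̄)

      distribution : ℕ → ℤ
      distribution Y = ∏ m (λ i → Γ̂ ((+ Y + + i) * m̄))

      -- Passing from Y to Y + 1 trades the factor Γ_p(Y/m) for Γ_p(Y/m + 1), and the functional
      -- equation compares the two.
      distribution-suc : ∀ Y → distribution (suc Y) ≈[ P ] distribution Y * - strip (+ Y * m̄)
      distribution-suc Y = cancel-unit k {G Y 0} (Γ̂-unit _) (begin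
        G Y 0 * ∏ m (λ i → G (suc Y) i)        ≡⟨ cong (G Y 0 *_) (∏-ext m (λ i → cong (λ z → Γ̂ (z * m̄)) (cong +_ (sym (ℕ.+-suc Y i))))) ⟩
        G Y 0 * ∏ m (λ i → G Y (suc i))        ≡⟨ sym (∏-head m (G Y)) ⟩
        ∏ m (G Y) * G Y m                      ≈⟨ *-modˡ (∏ m (G Y)) step ⟩
        ∏ m (G Y) * (- strip (+ Y * m̄) * G Y 0) ≡⟨ lem (∏ m (G Y)) (- strip (+ Y * m̄)) (G Y 0) ⟩
        G Y 0 * (∏ m (G Y) * - strip (+ Y * m̄)) ∎)
        where
        open ≈-Reasoning P
        lem : ∀ a b c → a * (b * c) ≡ c * (a * b)
        lem = solve-∀
        lem₂ : ∀ y m v → (y + m) * v ≡ y * v + m * v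
        lem₂ = solve-∀
        step : G Y m ≈[ P ] - strip (+ Y * m̄) * G Y 0
        step = ≈-trans (≡⇒≈ (Γ̂-cong (≈-trans (≡⇒≈ (lem₂ (+ Y) (+ m) m̄)) (+-mod (≈-refl {x = + Y * m̄}) mm̄))))
          (≈-trans (Γ̂-suc (+ Y * m̄)) (≡⇒≈ (cong (λ z → - strip (+ Y * m̄) * Γ̂ (z * m̄)) (sym (+-identityʳ (+ Y))))))

      multiplication : ∀ Y → distribution Y * ∏ Y (λ j → sel (+ m) (+ j)) ≈[ P ] Γ̂ (+ Y) * distribution 0
      multiplication zero = ≡⇒≈ (trans (*-identityʳ (distribution 0)) (trans (sym (*-identityˡ (distribution 0))) (cong (_* distribution 0) (sym Γ̂-0))))
      multiplication (suc Y) = begin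
        distribution (suc Y) * (Πs * s)                      ≈⟨ *-modʳ (Πs * s) (distribution-suc Y) ⟩
        distribution Y * - strip (+ Y * m̄) * (Πs * s)        ≡⟨ lem (distribution Y) (strip (+ Y * m̄)) Πs s ⟩
        - (strip (+ Y * m̄) * s) * (distribution Y * Πs)      ≈⟨ *-mod (neg-mod selected) (multiplication Y) ⟩
        - strip (+ Y) * (Γ̂ (+ Y) * distribution 0)           ≡⟨ sym (*-assoc (- strip (+ Y)) (Γ̂ (+ Y)) (distribution 0)) ⟩
        - strip (+ Y) * Γ̂ (+ Y) * distribution 0             ≈⟨ *-modʳ (distribution 0) (≈-sym (≈-trans (≡⇒≈ (cong Γ̂ (cong +_ (ℕ.+-comm 1 Y)))) (Γ̂-suc (+ Y)))) ⟩
        Γ̂ (+ suc Y) * distribution 0                         ∎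
        where
        open ≈-Reasoning P
        Πs = ∏ Y (λ j → sel (+ m) (+ j))
        s = sel (+ m) (+ Y)
        lem : ∀ a b c d → a * - b * (c * d) ≡ - (b * d) * (a * c)
        lem = solve-∀
        -- The factor m clears the denominator of Y/m precisely when Y is prime to p; at multiples
        -- of p both stripped factors are 1.
        selected : strip (+ Y * m̄) * sel (+ m) (+ Y) ≈[ P ] strip (+ Y)
        selected with unit? (+ Y)
        ... | inj₁ z = ≡⇒≈ (trans (*-identityʳ (strip (+ Y * m̄))) (strip-zero (*-zero-modʳ m̄ z)))
        ... | inj₂ u = ≈-trans (≡⇒≈ (trans (cong (_* + m) (strip-unit (unit-* u um̄))) (lem₃ (+ Y) m̄ (+ m))))
                       (≈-trans (*-modˡ (+ Y) mm̄) (≡⇒≈ (*-identityʳ (+ Y))))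
          where
          lem₃ : ∀ y v m → y * v * m ≡ y * (m * v)
          lem₃ = solve-∀

    -- Replacing Y by Y + 1 multiplies the product by the ratio of stripped Y and stripped -Y, which
    -- is -1 at units and 1 at multiples of p.
    reflection : ∀ Y → Γ̂ (+ Y) * Γ̂ (+ 1 - + Y) ≈[ P ] - ∏ Y (λ j → sel -1ℤ (+ j))
    reflection zero = ≈-trans (*-mod (≡⇒≈ Γ̂-0) (Γ̂-nat 1)) (≡⇒≈ (trans (*-identityˡ (ΓN 1)) (trans (ΓN-suc 0) (cong (λ z → - z * + 1) (strip-zero ≈-refl)))))
    reflection (suc Y) = begin
      Γ̂ (+ suc Y) * Γ̂ (+ 1 - + suc Y)           ≡⟨ cong₂ (λ a b → Γ̂ a * Γ̂ b) (cong +_ (ℕ.+-comm 1 Y)) (lem₀ (+ Y)) ⟩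
      Γ̂ (+ Y + + 1) * Γ̂ (- + Y)                 ≈⟨ *-modʳ (Γ̂ (- + Y)) (Γ̂-suc (+ Y)) ⟩
      - strip (+ Y) * Γ̂ (+ Y) * Γ̂ (- + Y)       ≡⟨ cong (λ z → - z * Γ̂ (+ Y) * Γ̂ (- + Y)) flip ⟩
      - (s * strip (- + Y)) * Γ̂ (+ Y) * Γ̂ (- + Y) ≡⟨ lem s (strip (- + Y)) (Γ̂ (+ Y)) (Γ̂ (- + Y)) ⟩
      s * (Γ̂ (+ Y) * (- strip (- + Y) * Γ̂ (- + Y))) ≈⟨ *-modˡ s (*-modˡ (Γ̂ (+ Y)) (≈-sym (≈-trans (≡⇒≈ (cong Γ̂ (lem₁ (+ Y)))) (Γ̂-suc (- + Y))))) ⟩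
      s * (Γ̂ (+ Y) * Γ̂ (+ 1 - + Y))             ≈⟨ *-modˡ s (reflection Y) ⟩
      s * - ∏ Y (λ j → sel -1ℤ (+ j))           ≡⟨ lem₂ s (∏ Y (λ j → sel -1ℤ (+ j))) ⟩
      - ∏ (suc Y) (λ j → sel -1ℤ (+ j))         ∎
      where
      open ≈-Reasoning P
      s = sel -1ℤ (+ Y)
      lem₀ : ∀ y → + 1 - (+ 1 + y) ≡ - y
      lem₀ = solve-∀
      lem₁ : ∀ y → + 1 - y ≡ - y + + 1
      lem₁ = solve-∀
      lem₂ : ∀ a b → a * - b ≡ - (b * a)
      lem₂ = solve-∀
      lem : ∀ s t a b → - (s * t) * a * b ≡ s * (a * (- t * b))
      lem = solve-∀
      flip : strip (+ Y) ≡ sel -1ℤ (+ Y) * strip (- + Y)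
      flip with unit? (+ Y)
      ... | inj₁ z = sym (trans (*-identityˡ _) (strip-zero (≈-trans (neg-mod z) ≈-refl)))
      ... | inj₂ u = sym (trans (cong (-1ℤ *_) (strip-unit (unit-neg u))) (lem₃ (+ Y)))
        where
        lem₃ : ∀ y → (- + 1) * - y ≡ y
        lem₃ = solve-∀

    reflection-b : ∀ b → b ℕ.≤ q → Γb b * Γb (q ℕ.∸ b) ≈[ P ] - -1ℤ ^ (q ℕ.∸ b)
    reflection-b b b≤q = ≈-trans (*-modˡ (Γb b) (≡⇒≈ (sym (Γ̂-at (+ 1 - + pt b) (q ℕ.∸ b) (ℕ.m∸n≤m q b) complement))))
      (≈-trans (reflection (pt b)) (≡⇒≈ (cong -_ (trans (∏-sel-pt -1ℤ b b≤q) sign))))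
      where
      lem : ∀ q y → q * (+ 1 - y) ≡ q - q * y
      lem = solve-∀
      complement : + q * (+ 1 - + pt b) ≈[ P ] + (q ℕ.∸ b)
      complement = ≈-trans (≡⇒≈ (lem (+ q) (+ pt b))) (≈-trans (-‿mod (≈-refl {x = + q}) (pt-≈ b b≤q)) (≡⇒≈ (trans ([+m]-[+n]≡m⊖n q b) (⊖-≥ b≤q))))
      sign : -1ℤ ^ ((q ℕ.∸ b) ℕ.* p ℕ.^ κ) ≡ -1ℤ ^ (q ℕ.∸ b)
      sign = trans (cong (-1ℤ ^_) (ℕ.*-comm (q ℕ.∸ b) (p ℕ.^ κ))) (trans (sym (^-*-assoc -1ℤ (p ℕ.^ κ) (q ℕ.∸ b))) (cong (_^ (q ℕ.∸ b)) (-1^p^ κ)))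

-- Gauss sum expansions and Jacobi sums as products of gamma values.

module JacobiSums where

  open BigOperators
  open Congruences
  open Residues
  open PowerSeries
  open DworkExponential
  open TraceIdentity
  open AdditiveCharacter
  open MoritaGamma
  open import Data.Nat as ℕ using (ℕ; zero; suc; z≤n; s≤s)
  import Data.Nat.Properties as ℕ
  import Data.Nat.DivMod as ℕ
  import Data.Nat.Divisibility as ℕ
  open import Data.Nat.Primality using (Prime)
  import Data.Nat.Tactic.RingSolver as ℕ
  open import Data.Integer as ℤ using (ℤ; +_)
  import Data.Integer.Properties as ℤ
  import Data.Integer.Tactic.RingSolver as ℤ
  open import Data.Product using (proj₁; proj₂)
  open import Data.Sum using (inj₁; inj₂)
  open import Data.Empty using (⊥-elim)
  open import Relation.Nullary using (Dec; yes; no)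
  open import Relation.Binary.PropositionalEquality hiding (J)

  module GaussSums (F : CharZeroField) (p q h : ℕ) (pr : Prime p) (p≡1+q : p ≡ suc q) (q≡h+h : q ≡ h ℕ.+ h) (κ : ℕ) where

    open OddPrime p q h pr p≡1+q q≡h+h using (p≢0; q≢0; Q; stripped; stripped-unit; 1+qQ; Q-suc; inverse-pk; wilson; fermat-p; lift-powers; p^∣p^1+; p∣p^; euclid; scale-∑; ∑-mod-single; cancel-unit; module Characters)
    open Characters κ using (P; τ; τ-resp; τ-*; τ-zero; τ^-zero; τ-q; τ≈id; ∑τ-trivial; ∑τ-nontrivial)
    open PadicGamma p q h pr p≡1+q q≡h+h κ using (k; ΓN; ΓN-multiple; Γ̂-nat; Γb; Γb-0; pt; reflection-b; unit-q)

    -- The truncation has to exceed b · Q(k) for b ≤ q (Gross-Koblitz), 2 (the powers (-p)^s that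
    -- occur) and κp (the tail). The extra one in M is the term split off by `γ-0`.
    M₀ M : ℕ
    M₀ = 2 ℕ.+ q ℕ.* Q k ℕ.+ κ ℕ.* p
    M = suc M₀

    κp<M : κ ℕ.* p ℕ.< M
    κp<M = s≤s (ℕ.m≤n+m (κ ℕ.* p) (2 ℕ.+ q ℕ.* Q k))

    open Evaluation F p q h pr p≡1+q q≡h+h κ M κp<M hiding (k; Q; stripped; stripped-unit; 1+qQ; Q-suc; inverse-pk; wilson; fermat-p; lift-powers; p^∣p^1+; p∣p^; euclid; scale-∑; ∑-mod-single; cancel-unit; module Characters)

    bQ<M₀ : ∀ b → b ℕ.≤ q → b ℕ.* Q k ℕ.< M₀
    bQ<M₀ b b≤q = s≤s (ℕ.≤-trans (ℕ.*-monoˡ-≤ (Q k) b≤q) (ℕ.≤-trans (ℕ.n≤1+n _) (ℕ.m≤m+n _ (κ ℕ.* p))))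

    ι-sign : ∀ n → (- 1#) ^ n ≡ ι (-1ℤ ℤ.^ n)
    ι-sign n = trans (cong (_^ n) (trans (cong -_ (sym ι-1)) (sym (ι-neg (+ 1))))) (sym (ι-^ -1ℤ n))

    cancel-≋ : ∀ {x y} s → Int x → Int y → Unit s → x * ι s ≋ y * ι s → x ≋ y
    cancel-≋ {x} {y} s ix iy us e = ≋-trans (≋-sym (undo ix)) (≋-trans (*-≋ʳ (Int-ι t) e) (undo iy))
      where
      t = proj₁ (inverse-pk k s us)
      undo : ∀ {x} → Int x → x * ι s * ι t ≋ x
      undo {x} ix = ≋-trans (≡⇒≋ (trans (*-assoc _ _ _) (cong (x *_) (sym (ι-* s t)))))
        (≋-trans (*-≋ˡ ix (≋-trans (ι-≋ (proj₂ (inverse-pk k s us))) (≡⇒≋ ι-1))) (≡⇒≋ (*-identityʳ x)))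

    u : K
    u = 1# - ι (+ p)

    Int-u : Int u
    Int-u = Int-+ Int-1 (Int-neg (Int-ι _))

    u≡ : u ≡ ι (ℤ.- + q)
    u≡ = trans (cong (λ z → 1# - ι (+ z)) p≡1+q) (trans (cong (λ z → 1# - z) (ι-suc q))
      (trans (solve 2 (λ a b → a :+ :- (a :+ b) := :- b) refl 1# (ι (+ q))) (sym (ι-neg (+ q)))))

    Q-index : ∀ b → b ℕ.* Q k ℕ.* p ℕ.+ b ≡ b ℕ.* Q (suc k)
    Q-index b = lem b (Q k) p
      where
      lem : ∀ b Q p → b ℕ.* Q ℕ.* p ℕ.+ b ≡ b ℕ.* suc (p ℕ.* Q)
      lem = ℕ.solve-∀

    ∏-stripped : ∀ n → ∏ (suc n) (λ j → strip (+ j)) ≡ stripped n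
    ∏-stripped n = trans (∏-head n (λ j → strip (+ j))) (trans (cong (ℤ._* stripped n) (strip-zero ≈-refl)) (ℤ.*-identityˡ _))

    -- The index is b · Q(k+1) = bP + b · Q(k), so the stripped product is up to sign Γ_p at 1 + b ·
    -- Q(k), which represents 1 - b/q. The reflection formula then leads to Γ_p(b/q).
    Γb-stripped : ∀ b → b ℕ.≤ q → Γb b ℤ.* stripped (b ℕ.* Q k ℕ.* p ℕ.+ b) ≈[ P ] -1ℤ ℤ.^ (b ℕ.* Q k)
    Γb-stripped b b≤q = begin
      Γb b ℤ.* s                                       ≡⟨ cong (Γb b ℤ.*_) (sym (sign-twice n s)) ⟩
      Γb b ℤ.* (-1ℤ ℤ.^ n ℤ.* (-1ℤ ℤ.^ n ℤ.* s))       ≡⟨ lem₁ (Γb b) (-1ℤ ℤ.^ n) s ⟩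
      ℤ.- (-1ℤ ℤ.^ n) ℤ.* (Γb b ℤ.* (-1ℤ ℤ.* -1ℤ ℤ.^ n ℤ.* s)) ≈⟨ *-modˡ (ℤ.- (-1ℤ ℤ.^ n)) (*-modˡ (Γb b) (≈-sym Γ-value)) ⟩
      ℤ.- (-1ℤ ℤ.^ n) ℤ.* (Γb b ℤ.* Γb (q ℕ.∸ b))      ≈⟨ *-modˡ (ℤ.- (-1ℤ ℤ.^ n)) (reflection-b b b≤q) ⟩
      ℤ.- (-1ℤ ℤ.^ n) ℤ.* ℤ.- (-1ℤ ℤ.^ (q ℕ.∸ b))      ≡⟨ lem₂ (-1ℤ ℤ.^ n) (-1ℤ ℤ.^ (q ℕ.∸ b)) ⟩
      -1ℤ ℤ.^ (q ℕ.∸ b) ℤ.* -1ℤ ℤ.^ n                  ≡⟨ cong (λ z → -1ℤ ℤ.^ (q ℕ.∸ b) ℤ.* -1ℤ ℤ.^ z) n≡ ⟩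
      -1ℤ ℤ.^ (q ℕ.∸ b) ℤ.* -1ℤ ℤ.^ (b ℕ.* P ℕ.+ b ℕ.* Q k) ≡⟨ cong (-1ℤ ℤ.^ (q ℕ.∸ b) ℤ.*_) (trans (ℤ.^-distribˡ-+-* -1ℤ (b ℕ.* P) (b ℕ.* Q k)) (cong (ℤ._* -1ℤ ℤ.^ (b ℕ.* Q k)) sign-bP)) ⟩
      -1ℤ ℤ.^ (q ℕ.∸ b) ℤ.* (-1ℤ ℤ.^ b ℤ.* -1ℤ ℤ.^ (b ℕ.* Q k)) ≡⟨ sym (ℤ.*-assoc (-1ℤ ℤ.^ (q ℕ.∸ b)) _ _) ⟩
      -1ℤ ℤ.^ (q ℕ.∸ b) ℤ.* -1ℤ ℤ.^ b ℤ.* -1ℤ ℤ.^ (b ℕ.* Q k) ≡⟨ cong (ℤ._* -1ℤ ℤ.^ (b ℕ.* Q k)) (trans (sym (ℤ.^-distribˡ-+-* -1ℤ (q ℕ.∸ b) b)) (trans (cong (-1ℤ ℤ.^_) (ℕ.m∸n+n≡m b≤q)) -1^q)) ⟩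
      + 1 ℤ.* -1ℤ ℤ.^ (b ℕ.* Q k)                      ≡⟨ ℤ.*-identityˡ _ ⟩
      -1ℤ ℤ.^ (b ℕ.* Q k)                              ∎
      where
      open ≈-Reasoning P
      n = b ℕ.* Q k ℕ.* p ℕ.+ b
      s = stripped n
      sign-twice : ∀ n s → -1ℤ ℤ.^ n ℤ.* (-1ℤ ℤ.^ n ℤ.* s) ≡ s
      sign-twice n s = trans (sym (ℤ.*-assoc (-1ℤ ℤ.^ n) (-1ℤ ℤ.^ n) s)) (trans (cong (ℤ._* s) (trans (sym (ℤ.^-distribˡ-+-* -1ℤ n n)) (-1^-even n))) (ℤ.*-identityˡ s))
      lem₁ : ∀ g e s → g ℤ.* (e ℤ.* (e ℤ.* s)) ≡ ℤ.- e ℤ.* (g ℤ.* ((ℤ.- + 1) ℤ.* e ℤ.* s))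
      lem₁ = ℤ.solve-∀
      lem₂ : ∀ a b → ℤ.- a ℤ.* ℤ.- b ≡ b ℤ.* a
      lem₂ = ℤ.solve-∀
      n≡ : n ≡ b ℕ.* P ℕ.+ b ℕ.* Q k
      n≡ = trans (Q-index b) (trans (cong (b ℕ.*_) (Q-suc k)) (ℕ.*-distribˡ-+ b P (Q k)))
      sign-bP : -1ℤ ℤ.^ (b ℕ.* P) ≡ -1ℤ ℤ.^ b
      sign-bP = trans (cong (-1ℤ ℤ.^_) (ℕ.*-comm b P)) (trans (sym (ℤ.^-*-assoc -1ℤ P b)) (cong (ℤ._^ b) (-1^p^ k)))
      Γ-value : Γb (q ℕ.∸ b) ≈[ P ] -1ℤ ℤ.* -1ℤ ℤ.^ n ℤ.* s
      Γ-value = ≈-trans (Γ̂-nat (pt (q ℕ.∸ b))) (≈-trans (≡⇒≈ (cong (λ z → ΓN (suc (z ℕ.* Q k))) (ℕ.m∸[m∸n]≡n b≤q)))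
        (≈-trans (≈-sym (ΓN-multiple b (suc (b ℕ.* Q k)))) (≡⇒≈ (trans (cong ΓN (trans (ℕ.+-suc (b ℕ.* P) _) (cong suc (sym n≡))))
          (cong (-1ℤ ℤ.* -1ℤ ℤ.^ n ℤ.*_) (∏-stripped n))))))

    gk-Γ : ∀ b → b ℕ.< q → u * γ M b ≋ ι (Γb b)
    gk-Γ b@(suc _) b<q = cancel-≋ s (Int-* Int-u (Int-γ M b b<p)) (Int-ι _) (stripped-unit (b ℕ.* Q k ℕ.* p ℕ.+ b))
      (≋-trans (gross-koblitz κ b (s≤s z≤n) b<p M (ℕ.m<n⇒m<1+n (bQ<M₀ b (ℕ.<⇒≤ b<q))))
        (≋-trans (≡⇒≋ (ι-sign (b ℕ.* Q k))) (≋-trans (≋-sym (ι-≋ (Γb-stripped b (ℕ.<⇒≤ b<q)))) (≡⇒≋ (ι-* (Γb b) s)))))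
      where
      s = stripped (b ℕ.* Q k ℕ.* p ℕ.+ b)
      b<p = ℕ.<-trans b<q q<p
    -- The trace identity requires b ≥ 1. Splitting off the constant term expresses γ_0 through γ_q;
    -- for b = q the stripped product runs up to p^(k+1) - 1, so Wilson gives u γ_q ≡ -1, and u + p
    -- = 1 = Γ_p(0).
    gk-Γ zero _ = ≋-trans (≡⇒≋ expand) (≋-trans (+-≋ (≋-refl {u}) (*-≋ˡ (Int-neg (Int-ι _)) v≋-1)) (≡⇒≋ (trans finish (trans (sym ι-1) (cong ι (sym Γb-0))))))
      where
      v = u * γ M₀ q
      expand : u * γ M 0 ≡ u + -p * v
      expand = trans (cong (u *_) (γ-0 κ M₀)) (trans (distribˡ u 1# _) (cong₂ _+_ (*-identityʳ u)
        (solve 3 (λ a b d → a :* (b :* d) := b :* (a :* d)) refl u -p (γ M₀ q))))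
      s = stripped (q ℕ.* Q k ℕ.* p ℕ.+ q)
      s≈-1 : s ≈[ P ] -1ℤ
      s≈-1 = ≈-trans (≡⇒≈ (trans (cong stripped (Q-index q)) (trans (sym (∏-stripped (q ℕ.* Q (suc k)))) (cong (λ n → ∏ n (λ j → strip (+ j))) (1+qQ (suc k))))))
        (≈-down (p^∣p^1+ k) (wilson k))
      sign : (- 1#) ^ (q ℕ.* Q k) ≡ 1#
      sign = trans (ι-sign (q ℕ.* Q k)) (trans (cong ι (trans (sym (ℤ.^-*-assoc -1ℤ q (Q k))) (trans (cong (ℤ._^ Q k) -1^q) (ℤ.^-zeroˡ (Q k))))) ι-1)
      v≋-1 : v ≋ - 1#
      v≋-1 = ≋-trans (≡⇒≋ (trans (solve 2 (λ v o → v := :- (v :* :- con (+ 1))) refl v 1#) (cong (λ z → - (v * z)) (trans refl (sym (ι-neg (+ 1)))))))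
        (subst (Iv k) (solve 2 (λ a b → :- (a :+ :- b) := :- a :+ :- (:- b)) refl (v * ι -1ℤ) 1#)
          (Iv-neg (≋-trans (*-≋ˡ (Int-* Int-u (Int-γ M₀ q q<p)) (≋-sym (ι-≋ s≈-1))) (≋-trans (gross-koblitz κ q 1≤q q<p M₀ (bQ<M₀ q ℕ.≤-refl)) (≡⇒≋ sign)))))
      finish : u + -p * - 1# ≡ 1#
      finish = trans (cong (λ z → u + -p * - z) (sym ι-1)) (trans (solve 2 (λ o P → o :+ :- P :+ :- P :* :- con (+ 1) := o) refl 1# (ι (+ p))) refl)

    -- The sum of ψ(cv) over nonzero c, for a nontrivial additive character ψ modulo p.
    η : ℤ → ℤ
    η v with unit? v
    ... | inj₁ _ = + q
    ... | inj₂ _ = -1ℤ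

    pick : ∀ l {A : Set} → Dec A → ℤ
    pick l (yes _) = (ℤ.- + p) ℤ.^ l
    pick l (no _) = + 0

    -- The value of Y^s under Y^q = -p, as an integer: a power of -p if q divides s (within the
    -- truncation), zero otherwise.
    e : ℕ → ℤ
    e s = ∑ M (λ l → pick l (l ℕ.* q ℕ.≟ s))

    ι-∑ : ∀ n f → ι (∑ n f) ≡ ∑ᴷ n (λ i → ι (f i))
    ι-∑ zero f = ι-0
    ι-∑ (suc n) f = trans (ι-+ (∑ n f) (f n)) (cong (_+ ι (f n)) (ι-∑ n f))

    ι-e : ∀ s → ι (e s) ≡ ev (shift s one)
    ι-e s = trans (ι-∑ M _) (∑ᴷ-ext M each)
      where
      shift-one : ∀ j n → shift j one n ≡ monomial 1# j n
      shift-one zero n = refl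
      shift-one (suc j) zero = sym (monomial-off 1# (suc j) 0 (λ ()))
      shift-one (suc j) (suc n) = trans (shift-one j n) (trans (both j n) refl)
        where
        both : ∀ j n → monomial 1# j n ≡ monomial 1# (suc j) (suc n)
        both j n with n ℕ.≟ j
        ... | yes refl = sym (monomial-at 1# (suc j))
        ... | no ne = sym (monomial-off 1# (suc j) (suc n) (λ e → ne (ℕ.suc-injective e)))
      each : ∀ l → ι (pick l (l ℕ.* q ℕ.≟ s)) ≡ -p ^ l * shift s one (l ℕ.* q)
      each l with l ℕ.* q ℕ.≟ s
      ... | yes refl = trans (ι-^ (ℤ.- + p) l) (trans (cong (_^ l) (ι-neg (+ p))) (trans (sym (*-identityʳ _))
                         (cong (-p ^ l *_) (sym (trans (shift-one (l ℕ.* q) (l ℕ.* q)) (monomial-at 1# (l ℕ.* q)))))))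
      ... | no ne = trans ι-0 (trans (sym (zeroʳ _)) (cong (-p ^ l *_) (sym (trans (shift-one s (l ℕ.* q)) (monomial-off 1# s (l ℕ.* q) ne)))))

    e-multiple : ∀ s → s ℕ.≤ 2 → e (s ℕ.* q) ≡ (ℤ.- + p) ℤ.^ s
    e-multiple s s≤2 = ι-injective (trans (ι-e (s ℕ.* q)) (trans (ev-one-multiple s s<M) (sym (trans (ι-^ (ℤ.- + p) s) (cong (_^ s) (ι-neg (+ p)))))))
      where
      s<M : s ℕ.< M
      s<M = s≤s (ℕ.≤-trans s≤2 (ℕ.≤-trans (ℕ.m≤m+n 2 (q ℕ.* Q k)) (ℕ.m≤m+n _ (κ ℕ.* p))))

    module _ (x y z : ℤ) where

      private
        -- One p-th power more than in `τ`: the defects of additivity are divided by p, so the lifts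
        -- must be accurate modulo p^(k+1).
        σ : ℤ → ℤ
        σ v = v ℤ.^ (p ℕ.^ k)

        w = x ℤ.+ y ℤ.+ z

        σ≈ : ∀ v → σ v ≈[ p ] v
        σ≈ v = Characters.τ≈id k v

        σ^p : ∀ v → σ v ℤ.^ p ≈[ p ℕ.^ suc k ] σ v
        σ^p v = ≈-trans (≡⇒≈ (trans (ℤ.^-*-assoc v (p ℕ.^ k) p) (trans (cong (v ℤ.^_) (ℕ.*-comm (p ℕ.^ k) p)) (sym (ℤ.^-*-assoc v p (p ℕ.^ k)))))) (lift-powers k (fermat-p v))

        σ≈τ : ∀ v → σ v ≈[ P ] τ v
        σ≈τ v = ≈-trans (≡⇒≈ (sym (ℤ.^-*-assoc v p (p ℕ.^ κ)))) (lift-powers κ (fermat-p v))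

        sum₁ : σ x ℤ.+ σ y ℤ.+ σ z ≈[ p ] σ w
        sum₁ = ≈-trans (+-mod (+-mod (σ≈ x) (σ≈ y)) (σ≈ z)) (≈-sym (σ≈ w))

        sumₚ : σ x ℤ.^ p ℤ.+ σ y ℤ.^ p ℤ.+ σ z ℤ.^ p ≈[ p ] σ w ℤ.^ p
        sumₚ = ≈-trans (+-mod (+-mod (fermat-p (σ x)) (fermat-p (σ y))) (fermat-p (σ z))) (≈-trans sum₁ (≈-sym (fermat-p (σ w))))

        δ = _≈[_]_.quotient sum₁
        δ′ = _≈[_]_.quotient sumₚ

        -- The lifts satisfy σ^p ≡ σ modulo p^(k+1), so the defect of the sum and the defect of the
        -- sum of p-th powers agree there.
        pδ : + p ℤ.* δ ≈[ p ℕ.^ suc k ] + p ℤ.* δ′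
        pδ = ≈-trans (≡⇒≈ (solve-for (σ x ℤ.+ σ y ℤ.+ σ z) (σ w) (+ p ℤ.* δ) (_≈[_]_.equality sum₁)))
          (≈-trans (-‿mod (+-mod (+-mod (≈-sym (σ^p x)) (≈-sym (σ^p y))) (≈-sym (σ^p z))) (≈-sym (σ^p w)))
            (≡⇒≈ (sym (solve-for (σ x ℤ.^ p ℤ.+ σ y ℤ.^ p ℤ.+ σ z ℤ.^ p) (σ w ℤ.^ p) (+ p ℤ.* δ′) (_≈[_]_.equality sumₚ)))))
          where
          solve-for : ∀ a b d → a ≡ b ℤ.+ d → d ≡ a ℤ.- b
          solve-for a b d refl = lem b d
            where
            lem : ∀ b d → d ≡ (b ℤ.+ d) ℤ.- b
            lem = ℤ.solve-∀

        ε = _≈[_]_.quotient pδ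

        δ-eq : δ ≡ δ′ ℤ.+ + (p ℕ.^ k) ℤ.* ε
        δ-eq = ℤ.*-cancelˡ-≡ (+ p) δ _ {{ℤ.≢-nonZero (λ e → ℕ.≢-nonZero⁻¹ p (ℤ.+-injective e))}} (trans (_≈[_]_.equality pδ)
          (trans (cong (λ m → + p ℤ.* δ′ ℤ.+ m ℤ.* ε) (ℤ.pos-* p (p ℕ.^ k))) (lem (+ p) δ′ (+ (p ℕ.^ k)) ε)))
          where
          lem : ∀ p d m e → p ℤ.* d ℤ.+ p ℤ.* m ℤ.* e ≡ p ℤ.* (d ℤ.+ m ℤ.* e)
          lem = ℤ.solve-∀

        additive : ev (E (σ x) ⊛ (E (σ y) ⊛ E (σ z))) ≋ ev (E (σ w))
        additive = ev-additive (σ x) (σ y) (σ z) (σ w) δ δ′ ε (_≈[_]_.equality sum₁) (_≈[_]_.equality sumₚ) δ-eq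

        root : ∀ {v} → Unit v → ι (σ v) ^ q ≋ 1#
        root {v} uv = ≋-trans (≡⇒≋ (sym (ι-^ (σ v) q))) (≋-trans (ι-≋ (≈-trans (^-mod q (σ≈τ v)) (τ-q uv))) (≡⇒≋ ι-1))

        -- If w ≡ 0 the series takes the value 1, and u³ = -q³. Otherwise its value is γ_0, one
        -- factor u turns it into Γ_p(0) = 1, and u² = q².
        value : u * (u * (u * ev (E (σ w)))) ≋ ι (ℤ.- (+ q ℤ.* + q ℤ.* η w))
        value with unit? w
        ... | inj₁ zw = ≋-trans (*-≋ˡ Int-u (*-≋ˡ Int-u (*-≋ˡ Int-u (ev-E-zero (σ w) (≋-trans (ι-≋ (≈-trans (σ≈τ w) (τ-zero zw))) (≡⇒≋ ι-0))))))
            (≡⇒≋ (trans (cong (λ z → u * (u * z)) (*-identityʳ u)) (trans (cong₂ _*_ u≡ (cong₂ _*_ u≡ u≡))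
              (trans (cong (ι (ℤ.- + q) *_) (sym (ι-* _ _))) (trans (sym (ι-* _ _)) (cong ι (lem (+ q))))))))
          where
          lem : ∀ q → ℤ.- q ℤ.* (ℤ.- q ℤ.* ℤ.- q) ≡ ℤ.- (q ℤ.* q ℤ.* q)
          lem = ℤ.solve-∀
        ... | inj₂ uw = ≋-trans (*-≋ˡ Int-u (*-≋ˡ Int-u (≋-trans (*-≋ˡ Int-u (ev-E-unit (σ w) (root uw)))
              (≋-trans (gk-Γ 0 1≤q) (≡⇒≋ (cong ι Γb-0))))))
            (≡⇒≋ (trans (cong₂ (λ a b → a * (b * ι (+ 1))) u≡ u≡) (trans (cong (ι (ℤ.- + q) *_) (sym (ι-* _ _))) (trans (sym (ι-* _ _)) (cong ι (lem (+ q)))))))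
          where
          lem : ∀ q → ℤ.- q ℤ.* (ℤ.- q ℤ.* + 1) ≡ ℤ.- (q ℤ.* q ℤ.* (ℤ.- + 1))
          lem = ℤ.solve-∀

        absorb : ∀ v (f : ℕ → K) → u * ∑ᴷ q (λ a → γ M a * ι v ^ a * f a) ≡ ∑ᴷ q (λ a → (u * γ M a) * ι v ^ a * f a)
        absorb v f = trans (∑ᴷ-*ˡ q u _) (∑ᴷ-ext q (λ a → solve 4 (λ u g v f → u :* (g :* v :* f) := (u :* g) :* v :* f) refl u (γ M a) (ι v ^ a) (f a)))

        push : ∀ (g f : ℕ → K) → u * ∑ᴷ q (λ a → g a * f a) ≡ ∑ᴷ q (λ a → g a * (u * f a))
        push g f = trans (∑ᴷ-*ˡ q u _) (∑ᴷ-ext q (λ a → solve 3 (λ u g f → u :* (g :* f) := g :* (u :* f)) refl u (g a) (f a)))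

        absorb-ι : ∀ v (f : ℕ → K) (f′ : ℕ → ℤ) → (∀ a → a ℕ.< q → f a ≋ ι (f′ a)) →
          ∑ᴷ q (λ a → (u * γ M a) * ι (σ v) ^ a * f a) ≋ ι (∑ q (λ a → Γb a ℤ.* τ v ℤ.^ a ℤ.* f′ a))
        absorb-ι v f f′ ff = ≋-trans (∑-≋ q (λ a a<q → ≋-trans (*-≋ˡ (Int-* (Int-* Int-u (Int-γ M a (ℕ.<-trans a<q q<p))) (Int-^ a (Int-ι _))) (ff a a<q))
            (*-≋ʳ (Int-ι _) (≋-trans (*-≋ʳ (Int-^ a (Int-ι _)) (gk-Γ a a<q)) (*-≋ˡ (Int-ι _) (≋-trans (≡⇒≋ (sym (ι-^ (σ v) a))) (ι-≋ (^-mod a (σ≈τ v)))))))))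
          (≡⇒≋ (sym (trans (ι-∑ q _) (∑ᴷ-ext q (λ a → trans (ι-* _ (f′ a)) (cong (_* ι (f′ a)) (ι-* (Γb a) _)))))))

      -- The three factors u = 1 - p = -q are distributed over the three expansions, where each
      -- turns its γ into a gamma value.
      additive-character : Unit x → Unit y → Unit z → ℤ.- (+ q ℤ.* + q ℤ.* η (x ℤ.+ y ℤ.+ z)) ≈[ P ]
        ∑ q (λ a → Γb a ℤ.* τ x ℤ.^ a ℤ.* ∑ q (λ b → Γb b ℤ.* τ y ℤ.^ b ℤ.* ∑ q (λ d → Γb d ℤ.* τ z ℤ.^ d ℤ.* e (d ℕ.+ (b ℕ.+ a)))))
      additive-character ux uy uz = ≋-ι (≋-trans (≋-sym value) (≋-trans (*-≋ˡ Int-u (*-≋ˡ Int-u (*-≋ˡ Int-u (≋-trans (≋-sym additive) (ev-triple (σ x) (σ y) (σ z) (root ux) (root uy) (root uz))))))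
        (≋-trans (≡⇒≋ rearrange)
          (absorb-ι x _ _ (λ a _ → absorb-ι y _ _ (λ b _ → absorb-ι z _ _ (λ d _ → ≡⇒≋ (sym (ι-e (d ℕ.+ (b ℕ.+ a)))))))))))
        where
        open ≡-Reasoning
        D : ℕ → ℕ → ℕ → K
        D a b d = ev (shift (d ℕ.+ (b ℕ.+ a)) one)
        A₂ : ℕ → ℕ → K
        A₂ a b = ∑ᴷ q (λ d → γ M d * ι (σ z) ^ d * D a b d)
        A₁ : ℕ → K
        A₁ a = ∑ᴷ q (λ b → γ M b * ι (σ y) ^ b * A₂ a b)
        rearrange : u * (u * (u * ∑ᴷ q (λ a → γ M a * ι (σ x) ^ a * A₁ a))) ≡
          ∑ᴷ q (λ a → (u * γ M a) * ι (σ x) ^ a * ∑ᴷ q (λ b → (u * γ M b) * ι (σ y) ^ b * ∑ᴷ q (λ d → (u * γ M d) * ι (σ z) ^ d * D a b d)))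
        rearrange = begin
          u * (u * (u * ∑ᴷ q (λ a → γ M a * ι (σ x) ^ a * A₁ a)))
            ≡⟨ cong (λ z → u * (u * z)) (absorb (σ x) A₁) ⟩
          u * (u * ∑ᴷ q (λ a → (u * γ M a) * ι (σ x) ^ a * A₁ a))
            ≡⟨ trans (cong (u *_) (push _ A₁)) (push _ (λ a → u * A₁ a)) ⟩
          ∑ᴷ q (λ a → (u * γ M a) * ι (σ x) ^ a * (u * (u * A₁ a)))
            ≡⟨ ∑ᴷ-ext q (λ a → cong ((u * γ M a) * ι (σ x) ^ a *_) (trans (cong (u *_) (absorb (σ y) (A₂ a))) (trans (push _ (A₂ a))
                 (∑ᴷ-ext q (λ b → cong ((u * γ M b) * ι (σ y) ^ b *_) (absorb (σ z) (D a b))))))) ⟩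
          ∑ᴷ q (λ a → (u * γ M a) * ι (σ x) ^ a * ∑ᴷ q (λ b → (u * γ M b) * ι (σ y) ^ b * ∑ᴷ q (λ d → (u * γ M d) * ι (σ z) ^ d * D a b d))) ∎

    exchange : ∀ n m (w : ℕ → ℤ) (A : ℕ → ℤ) (B : ℕ → ℕ → ℤ) →
      ∑ n (λ z → w z ℤ.* ∑ m (λ a → A a ℤ.* B a z)) ≡ ∑ m (λ a → A a ℤ.* ∑ n (λ z → w z ℤ.* B a z))
    exchange n m w A B = trans (∑-ext n (λ z → ∑-*ˡ m (w z) _)) (trans (∑-swap n m _) (∑-ext m (λ a →
      trans (∑-ext n (λ z → lem (w z) (A a) (B a z))) (sym (∑-*ˡ n (A a) _)))))
      where
      lem : ∀ w a b → w ℤ.* (a ℤ.* b) ≡ a ℤ.* (w ℤ.* b)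
      lem = ℤ.solve-∀

    -- Orthogonality: the exponent q - b + d lies strictly between 0 and 2q, so q divides it only
    -- for d = b.
    extract : ∀ b → b ℕ.< q → (f : ℕ → ℤ) → ∑ p (λ z → τ (+ z) ℤ.^ (q ℕ.∸ b) ℤ.* ∑ q (λ d → Γb d ℤ.* τ (+ z) ℤ.^ d ℤ.* f d)) ≈[ P ] Γb b ℤ.* f b ℤ.* + q
    extract b b<q f = ≈-trans (≡⇒≈ reorder) (≈-trans (∑-mod-single q _ b b<q off) (*-modˡ (Γb b ℤ.* f b)
        (subst (λ m → ∑ p (λ z → τ (+ z) ℤ.^ m) ≈[ P ] + q) (trans (ℕ.+-identityʳ q) (sym (ℕ.m∸n+n≡m (ℕ.<⇒≤ b<q)))) (∑τ-trivial 1 (s≤s z≤n)))))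
      where
      lem : ∀ g t f → g ℤ.* t ℤ.* f ≡ (g ℤ.* f) ℤ.* t
      lem = ℤ.solve-∀
      reorder : ∑ p (λ z → τ (+ z) ℤ.^ (q ℕ.∸ b) ℤ.* ∑ q (λ d → Γb d ℤ.* τ (+ z) ℤ.^ d ℤ.* f d)) ≡ ∑ q (λ d → Γb d ℤ.* f d ℤ.* ∑ p (λ z → τ (+ z) ℤ.^ ((q ℕ.∸ b) ℕ.+ d)))
      reorder = trans (∑-ext p (λ z → cong (τ (+ z) ℤ.^ (q ℕ.∸ b) ℤ.*_) (∑-ext q (λ d → lem (Γb d) (τ (+ z) ℤ.^ d) (f d)))))
        (trans (exchange p q (λ z → τ (+ z) ℤ.^ (q ℕ.∸ b)) (λ d → Γb d ℤ.* f d) (λ d z → τ (+ z) ℤ.^ d))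
          (∑-ext q (λ d → cong (Γb d ℤ.* f d ℤ.*_) (∑-ext p (λ z → sym (ℤ.^-distribˡ-+-* (τ (+ z)) (q ℕ.∸ b) d))))))
      off : ∀ d → d ℕ.< q → d ≢ b → Γb d ℤ.* f d ℤ.* ∑ p (λ z → τ (+ z) ℤ.^ ((q ℕ.∸ b) ℕ.+ d)) ≈[ P ] + 0
      off d d<q d≢b = *-zero-mod (Γb d ℤ.* f d) (∑τ-nontrivial ((q ℕ.∸ b) ℕ.+ d) (λ { (ℕ.divides c eq) → absurd c eq }))
        where
        absurd : ∀ c → (q ℕ.∸ b) ℕ.+ d ≡ c ℕ.* q → _
        absurd zero eq = ℕ.<-irrefl (sym (ℕ.m+n≡0⇒m≡0 (q ℕ.∸ b) eq)) (ℕ.m<n⇒0<n∸m b<q)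
        absurd (suc zero) eq = d≢b (ℕ.+-cancelˡ-≡ (q ℕ.∸ b) d b (trans eq (trans (ℕ.+-identityʳ q) (sym (ℕ.m∸n+n≡m (ℕ.<⇒≤ b<q))))))
        absurd (suc (suc c)) eq = ℕ.<-irrefl eq (ℕ.<-≤-trans (ℕ.+-mono-≤-< (ℕ.m∸n≤m q b) d<q) (ℕ.+-monoʳ-≤ q (ℕ.m≤m+n q (c ℕ.* q))))

    η-cong : ∀ {v w} → v ≈[ p ] w → η v ≡ η w
    η-cong {v} {w} v≈w with unit? v | unit? w
    ... | inj₁ _ | inj₁ _ = refl
    ... | inj₂ _ | inj₂ _ = refl
    ... | inj₁ a | inj₂ b = ⊥-elim (b (≈-trans (≈-sym v≈w) a))
    ... | inj₂ a | inj₁ b = ⊥-elim (a (≈-trans v≈w b))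

    η-scale : ∀ c v → Unit c → η (c ℤ.* v) ≡ η v
    η-scale c v uc with unit? (c ℤ.* v) | unit? v
    ... | inj₁ _ | inj₁ _ = refl
    ... | inj₂ _ | inj₂ _ = refl
    ... | inj₂ a | inj₁ b = ⊥-elim (a (*-zero-mod c b))
    ... | inj₁ a | inj₂ b with euclid c v a
    ...   | inj₁ z = ⊥-elim (uc z)
    ...   | inj₂ z = ⊥-elim (b z)

    -- p times a Jacobi sum, corrected when both characters are trivial
    J : ℕ → ℕ → ℤ → ℤ
    J m n z = ∑ p (λ x → τ (+ x) ℤ.^ m ℤ.* ∑ p (λ y → τ (+ y) ℤ.^ n ℤ.* η (+ x ℤ.+ + y ℤ.+ z)))

    -- Substitute zx and zy for x and y; η does not change when its argument is multiplied by a
    -- unit.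
    J-scale : ∀ m n z → Unit z → J m n z ≈[ P ] τ z ℤ.^ m ℤ.* τ z ℤ.^ n ℤ.* J m n (+ 1)
    J-scale m n z uz = begin
      ∑ p (λ x → G (+ x))                   ≈⟨ ≈-sym (scale-∑ z uz G G-resp) ⟩
      ∑ p (λ x → G (z ℤ.* + x))             ≈⟨ ∑-mod p (λ x _ → term x) ⟩
      ∑ p (λ x → (τ z ℤ.^ m ℤ.* τ z ℤ.^ n) ℤ.* (τ (+ x) ℤ.^ m ℤ.* ∑ p (λ y → τ (+ y) ℤ.^ n ℤ.* η (+ x ℤ.+ + y ℤ.+ + 1)))) ≡⟨ sym (∑-*ˡ p (τ z ℤ.^ m ℤ.* τ z ℤ.^ n) _) ⟩
      τ z ℤ.^ m ℤ.* τ z ℤ.^ n ℤ.* J m n (+ 1) ∎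
      where
      open ≈-Reasoning P
      H : ℤ → ℤ → ℤ
      H x y = τ y ℤ.^ n ℤ.* η (x ℤ.+ y ℤ.+ z)
      G : ℤ → ℤ
      G x = τ x ℤ.^ m ℤ.* ∑ p (λ y → H x (+ y))
      G-resp : ∀ {x y} → x ≈[ p ] y → G x ≈[ P ] G y
      G-resp x≈y = *-mod (^-mod m (τ-resp x≈y)) (∑-mod p (λ y _ → *-modˡ (τ (+ y) ℤ.^ n) (≡⇒≈ (η-cong (+-mod (+-mod x≈y ≈-refl) ≈-refl)))))
      lem₁ : ∀ z x y → z ℤ.* x ℤ.+ z ℤ.* y ℤ.+ z ≡ z ℤ.* (x ℤ.+ y ℤ.+ + 1)
      lem₁ = ℤ.solve-∀
      lem₂ : ∀ a b c d → a ℤ.* b ℤ.* (c ℤ.* d) ≡ (a ℤ.* c) ℤ.* (b ℤ.* d)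
      lem₂ = ℤ.solve-∀
      lem₃ : ∀ a b c → a ℤ.* b ℤ.* c ≡ a ℤ.* (b ℤ.* c)
      lem₃ = ℤ.solve-∀
      pow : ∀ x e → τ (z ℤ.* x) ℤ.^ e ≡ τ z ℤ.^ e ℤ.* τ x ℤ.^ e
      pow x e = trans (cong (ℤ._^ e) (τ-* z x)) (*-^ (τ z) (τ x) e)
      inner : ∀ x → ∑ p (λ y → H (z ℤ.* + x) (+ y)) ≈[ P ] τ z ℤ.^ n ℤ.* ∑ p (λ y → τ (+ y) ℤ.^ n ℤ.* η (+ x ℤ.+ + y ℤ.+ + 1))
      inner x = ≈-trans (≈-sym (scale-∑ z uz (H (z ℤ.* + x)) (λ y≈ → *-mod (^-mod n (τ-resp y≈)) (≡⇒≈ (η-cong (+-mod (+-mod (≈-refl {x = z ℤ.* + x}) y≈) (≈-refl {x = z})))))))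
        (≡⇒≈ (trans (∑-ext p (λ y → trans (cong₂ ℤ._*_ (pow (+ y) n) (trans (cong η (lem₁ z (+ x) (+ y))) (η-scale z (+ x ℤ.+ + y ℤ.+ + 1) uz))) (lem₃ (τ z ℤ.^ n) (τ (+ y) ℤ.^ n) (η (+ x ℤ.+ + y ℤ.+ + 1)))))
          (sym (∑-*ˡ p (τ z ℤ.^ n) _))))
      term : ∀ x → G (z ℤ.* + x) ≈[ P ] (τ z ℤ.^ m ℤ.* τ z ℤ.^ n) ℤ.* (τ (+ x) ℤ.^ m ℤ.* ∑ p (λ y → τ (+ y) ℤ.^ n ℤ.* η (+ x ℤ.+ + y ℤ.+ + 1)))
      term x = ≈-trans (*-mod (≡⇒≈ (pow (+ x) m)) (inner x)) (≡⇒≈ (sym (lem₂ (τ z ℤ.^ m) (τ z ℤ.^ n) (τ (+ x) ℤ.^ m) _)))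

    -- A positive power of τ vanishes at multiples of p, so congruences available only at units can
    -- be used under a sum over all residues.
    weigh : ∀ {x m A B} → 1 ℕ.≤ m → (Unit x → A ≈[ P ] B) → τ x ℤ.^ m ℤ.* A ≈[ P ] τ x ℤ.^ m ℤ.* B
    weigh {x} {m} {A} {B} 1≤m f with unit? x
    ... | inj₁ z = ≈-trans (*-zero-modʳ A (τ^-zero m 1≤m z)) (≈-sym (*-zero-modʳ B (τ^-zero m 1≤m z)))
    ... | inj₂ ux = *-modˡ (τ x ℤ.^ m) (f ux)

    -- The expansion of η(x + y + z) is multiplied by the complementary characters and summed over
    -- x, y and z. On one side orthogonality isolates the three gamma values and (-p)^s; on the
    -- other, homogeneity makes the sum over z a trivial character sum, because the exponents add up
    -- to (3 - s)q. The powers of q cancel.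
    jacobi-Γ : ∀ b₁ b₂ b₃ s → b₁ ℕ.< q → b₂ ℕ.< q → b₃ ℕ.< q → b₃ ℕ.+ (b₂ ℕ.+ b₁) ≡ s ℕ.* q →
      J (q ℕ.∸ b₁) (q ℕ.∸ b₂) (+ 1) ≈[ P ] ℤ.- (Γb b₁ ℤ.* Γb b₂ ℤ.* Γb b₃ ℤ.* (ℤ.- + p) ℤ.^ s)
    jacobi-Γ b₁ b₂ b₃ s b₁<q b₂<q b₃<q total = cancel-unit k {+ q ℤ.* + q ℤ.* + q} (unit-* (unit-* unit-q unit-q) unit-q) (≈-trans (≡⇒≈ (lem₀ (+ q) (J m₁ m₂ (+ 1))))
        (≈-trans (neg-mod (≈-trans (≈-sym left) right)) (≡⇒≈ (trans (cong (λ z → ℤ.- (Γb b₁ ℤ.* (Γb b₂ ℤ.* (Γb b₃ ℤ.* z ℤ.* + q) ℤ.* + q) ℤ.* + q)) (trans (cong e total) (e-multiple s s≤2)))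
          (lem₁ (+ q) (Γb b₁) (Γb b₂) (Γb b₃) ((ℤ.- + p) ℤ.^ s))))))
      where
      open ≈-Reasoning P
      m₁ = q ℕ.∸ b₁
      m₂ = q ℕ.∸ b₂
      m₃ = q ℕ.∸ b₃
      lem₀ : ∀ q j → q ℤ.* q ℤ.* q ℤ.* j ≡ ℤ.- (ℤ.- (q ℤ.* q) ℤ.* (q ℤ.* j))
      lem₀ = ℤ.solve-∀
      lem₁ : ∀ q a b c e → ℤ.- (a ℤ.* (b ℤ.* (c ℤ.* e ℤ.* q) ℤ.* q) ℤ.* q) ≡ q ℤ.* q ℤ.* q ℤ.* ℤ.- (a ℤ.* b ℤ.* c ℤ.* e)
      lem₁ = ℤ.solve-∀
      s<3 : s ℕ.* q ℕ.< 3 ℕ.* q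
      s<3 = subst₂ ℕ._<_ total (cong (λ z → q ℕ.+ (q ℕ.+ z)) (sym (ℕ.+-identityʳ q))) (ℕ.+-mono-< b₃<q (ℕ.+-mono-< b₂<q b₁<q))
      s≤2 : s ℕ.≤ 2
      s≤2 = ℕ.≤-pred (ℕ.*-cancelʳ-< q s 3 s<3)
      1≤m : ∀ {b} → b ℕ.< q → 1 ℕ.≤ q ℕ.∸ b
      1≤m = ℕ.m<n⇒0<n∸m
      W : ℤ
      W = ∑ p (λ z → τ (+ z) ℤ.^ m₃ ℤ.* ∑ p (λ x → τ (+ x) ℤ.^ m₁ ℤ.* ∑ p (λ y → τ (+ y) ℤ.^ m₂ ℤ.* (ℤ.- (+ q ℤ.* + q ℤ.* η (+ x ℤ.+ + y ℤ.+ + z))))))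
      exps-total : m₃ ℕ.+ (m₁ ℕ.+ m₂) ≡ (3 ℕ.∸ s) ℕ.* q
      exps-total = ℕ.+-cancelʳ-≡ (s ℕ.* q) (m₃ ℕ.+ (m₁ ℕ.+ m₂)) ((3 ℕ.∸ s) ℕ.* q) (trans (cong (m₃ ℕ.+ (m₁ ℕ.+ m₂) ℕ.+_) (sym total))
        (trans (lem₂ m₃ m₁ m₂ b₃ b₂ b₁) (trans (cong₂ ℕ._+_ (ℕ.m∸n+n≡m (ℕ.<⇒≤ b₃<q)) (cong₂ ℕ._+_ (ℕ.m∸n+n≡m (ℕ.<⇒≤ b₁<q)) (ℕ.m∸n+n≡m (ℕ.<⇒≤ b₂<q))))
          (trans (lem₃ q) (trans (cong (ℕ._* q) (sym (ℕ.m∸n+n≡m (ℕ.m≤n⇒m≤1+n s≤2)))) (ℕ.*-distribʳ-+ q (3 ℕ.∸ s) s))))))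
        where
        lem₂ : ∀ a b c d e f → a ℕ.+ (b ℕ.+ c) ℕ.+ (d ℕ.+ (e ℕ.+ f)) ≡ (a ℕ.+ d) ℕ.+ ((b ℕ.+ f) ℕ.+ (c ℕ.+ e))
        lem₂ = ℕ.solve-∀
        lem₃ : ∀ q → q ℕ.+ (q ℕ.+ q) ≡ 3 ℕ.* q
        lem₃ = ℕ.solve-∀
      left : W ≈[ P ] ℤ.- (+ q ℤ.* + q) ℤ.* (+ q ℤ.* J m₁ m₂ (+ 1))
      left = begin
        W ≡⟨ ∑-ext p (λ z → pull z) ⟩
        ∑ p (λ z → ℤ.- (+ q ℤ.* + q) ℤ.* (τ (+ z) ℤ.^ m₃ ℤ.* J m₁ m₂ (+ z))) ≡⟨ sym (∑-*ˡ p (ℤ.- (+ q ℤ.* + q)) _) ⟩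
        ℤ.- (+ q ℤ.* + q) ℤ.* ∑ p (λ z → τ (+ z) ℤ.^ m₃ ℤ.* J m₁ m₂ (+ z))
          ≈⟨ *-modˡ (ℤ.- (+ q ℤ.* + q)) (∑-mod p (λ z _ → ≈-trans (weigh {+ z} {m₃} (1≤m b₃<q) (J-scale m₁ m₂ (+ z))) (≡⇒≈ (gather z)))) ⟩
        ℤ.- (+ q ℤ.* + q) ℤ.* ∑ p (λ z → τ (+ z) ℤ.^ ((3 ℕ.∸ s) ℕ.* q) ℤ.* J m₁ m₂ (+ 1)) ≡⟨ cong (ℤ.- (+ q ℤ.* + q) ℤ.*_) (sym (∑-*ʳ p (J m₁ m₂ (+ 1)) _)) ⟩
        ℤ.- (+ q ℤ.* + q) ℤ.* (∑ p (λ z → τ (+ z) ℤ.^ ((3 ℕ.∸ s) ℕ.* q)) ℤ.* J m₁ m₂ (+ 1))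
          ≈⟨ *-modˡ (ℤ.- (+ q ℤ.* + q)) (*-modʳ (J m₁ m₂ (+ 1)) (∑τ-trivial (3 ℕ.∸ s) (ℕ.m<n⇒0<n∸m (s≤s s≤2)))) ⟩
        ℤ.- (+ q ℤ.* + q) ℤ.* (+ q ℤ.* J m₁ m₂ (+ 1)) ∎
        where
        lem : ∀ t q h → t ℤ.* ℤ.- (q ℤ.* q ℤ.* h) ≡ ℤ.- (q ℤ.* q) ℤ.* (t ℤ.* h)
        lem = ℤ.solve-∀
        lem′ : ∀ t c x → t ℤ.* (c ℤ.* x) ≡ c ℤ.* (t ℤ.* x)
        lem′ = ℤ.solve-∀
        pull : ∀ z → τ (+ z) ℤ.^ m₃ ℤ.* ∑ p (λ x → τ (+ x) ℤ.^ m₁ ℤ.* ∑ p (λ y → τ (+ y) ℤ.^ m₂ ℤ.* (ℤ.- (+ q ℤ.* + q ℤ.* η (+ x ℤ.+ + y ℤ.+ + z)))))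
          ≡ ℤ.- (+ q ℤ.* + q) ℤ.* (τ (+ z) ℤ.^ m₃ ℤ.* J m₁ m₂ (+ z))
        pull z = trans (cong (τ (+ z) ℤ.^ m₃ ℤ.*_) (trans (∑-ext p (λ x → trans (cong (τ (+ x) ℤ.^ m₁ ℤ.*_) (trans (∑-ext p (λ y → lem (τ (+ y) ℤ.^ m₂) (+ q) (η (+ x ℤ.+ + y ℤ.+ + z)))) (sym (∑-*ˡ p (ℤ.- (+ q ℤ.* + q)) _))))
          (lem′ (τ (+ x) ℤ.^ m₁) (ℤ.- (+ q ℤ.* + q)) _))) (sym (∑-*ˡ p (ℤ.- (+ q ℤ.* + q)) _)))) (lem′ (τ (+ z) ℤ.^ m₃) (ℤ.- (+ q ℤ.* + q)) (J m₁ m₂ (+ z)))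
        gather : ∀ z → τ (+ z) ℤ.^ m₃ ℤ.* (τ (+ z) ℤ.^ m₁ ℤ.* τ (+ z) ℤ.^ m₂ ℤ.* J m₁ m₂ (+ 1)) ≡ τ (+ z) ℤ.^ ((3 ℕ.∸ s) ℕ.* q) ℤ.* J m₁ m₂ (+ 1)
        gather z = trans (sym (ℤ.*-assoc (τ (+ z) ℤ.^ m₃) _ _)) (cong (ℤ._* J m₁ m₂ (+ 1)) (trans (cong (τ (+ z) ℤ.^ m₃ ℤ.*_) (sym (ℤ.^-distribˡ-+-* (τ (+ z)) m₁ m₂)))
          (trans (sym (ℤ.^-distribˡ-+-* (τ (+ z)) m₃ (m₁ ℕ.+ m₂))) (cong (τ (+ z) ℤ.^_) exps-total))))
      D : ℕ → ℕ → ℤ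
      D z r = ∑ q (λ d → Γb d ℤ.* τ (+ z) ℤ.^ d ℤ.* e (d ℕ.+ r))
      right : W ≈[ P ] Γb b₁ ℤ.* (Γb b₂ ℤ.* (Γb b₃ ℤ.* e (b₃ ℕ.+ (b₂ ℕ.+ b₁)) ℤ.* + q) ℤ.* + q) ℤ.* + q
      right = begin
        W
          ≈⟨ ∑-mod p (λ z _ → weigh {+ z} {m₃} (1≤m b₃<q) (λ uz → ∑-mod p (λ x _ → weigh {+ x} {m₁} (1≤m b₁<q) (λ ux → ∑-mod p (λ y _ → weigh {+ y} {m₂} (1≤m b₂<q) (λ uy → additive-character (+ x) (+ y) (+ z) ux uy uz)))))) ⟩
        ∑ p (λ z → τ (+ z) ℤ.^ m₃ ℤ.* ∑ p (λ x → τ (+ x) ℤ.^ m₁ ℤ.* ∑ p (λ y → τ (+ y) ℤ.^ m₂ ℤ.* ∑ q (λ a → Γb a ℤ.* τ (+ x) ℤ.^ a ℤ.* ∑ q (λ b → Γb b ℤ.* τ (+ y) ℤ.^ b ℤ.* D z (b ℕ.+ a))))))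
          ≡⟨ ∑-ext p (λ z → cong (τ (+ z) ℤ.^ m₃ ℤ.*_) (∑-ext p (λ x → cong (τ (+ x) ℤ.^ m₁ ℤ.*_) (exchange p q (λ y → τ (+ y) ℤ.^ m₂) (λ a → Γb a ℤ.* τ (+ x) ℤ.^ a) (λ a y → ∑ q (λ b → Γb b ℤ.* τ (+ y) ℤ.^ b ℤ.* D z (b ℕ.+ a))))))) ⟩
        ∑ p (λ z → τ (+ z) ℤ.^ m₃ ℤ.* ∑ p (λ x → τ (+ x) ℤ.^ m₁ ℤ.* ∑ q (λ a → Γb a ℤ.* τ (+ x) ℤ.^ a ℤ.* ∑ p (λ y → τ (+ y) ℤ.^ m₂ ℤ.* ∑ q (λ b → Γb b ℤ.* τ (+ y) ℤ.^ b ℤ.* D z (b ℕ.+ a))))))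
          ≈⟨ ∑-mod p (λ z _ → *-modˡ (τ (+ z) ℤ.^ m₃) (≈-trans (∑-mod p (λ x _ → *-modˡ (τ (+ x) ℤ.^ m₁) (∑-mod q (λ a _ → *-modˡ (Γb a ℤ.* τ (+ x) ℤ.^ a) (extract b₂ b₂<q (λ b → D z (b ℕ.+ a)))))))
               (extract b₁ b₁<q (λ a → Γb b₂ ℤ.* D z (b₂ ℕ.+ a) ℤ.* + q)))) ⟩
        ∑ p (λ z → τ (+ z) ℤ.^ m₃ ℤ.* (Γb b₁ ℤ.* (Γb b₂ ℤ.* D z (b₂ ℕ.+ b₁) ℤ.* + q) ℤ.* + q))
          ≡⟨ trans (∑-ext p (λ z → lem (τ (+ z) ℤ.^ m₃) (Γb b₁) (Γb b₂) (D z (b₂ ℕ.+ b₁)) (+ q))) (sym (∑-*ˡ p (Γb b₁ ℤ.* Γb b₂ ℤ.* + q ℤ.* + q) _)) ⟩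
        Γb b₁ ℤ.* Γb b₂ ℤ.* + q ℤ.* + q ℤ.* ∑ p (λ z → τ (+ z) ℤ.^ m₃ ℤ.* D z (b₂ ℕ.+ b₁))
          ≈⟨ *-modˡ (Γb b₁ ℤ.* Γb b₂ ℤ.* + q ℤ.* + q) (extract b₃ b₃<q (λ d → e (d ℕ.+ (b₂ ℕ.+ b₁)))) ⟩
        Γb b₁ ℤ.* Γb b₂ ℤ.* + q ℤ.* + q ℤ.* (Γb b₃ ℤ.* e (b₃ ℕ.+ (b₂ ℕ.+ b₁)) ℤ.* + q)
          ≡⟨ lem″ (Γb b₁) (Γb b₂) (+ q) (Γb b₃ ℤ.* e (b₃ ℕ.+ (b₂ ℕ.+ b₁)) ℤ.* + q) ⟩
        Γb b₁ ℤ.* (Γb b₂ ℤ.* (Γb b₃ ℤ.* e (b₃ ℕ.+ (b₂ ℕ.+ b₁)) ℤ.* + q) ℤ.* + q) ℤ.* + q ∎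
        where
        lem : ∀ t a b d q → t ℤ.* (a ℤ.* (b ℤ.* d ℤ.* q) ℤ.* q) ≡ a ℤ.* b ℤ.* q ℤ.* q ℤ.* (t ℤ.* d)
        lem = ℤ.solve-∀
        lem″ : ∀ a b q c → a ℤ.* b ℤ.* q ℤ.* q ℤ.* c ≡ a ℤ.* (b ℤ.* c ℤ.* q) ℤ.* q
        lem″ = ℤ.solve-∀

-- Rational parameters over a common denominator.

module Fractions where

  open Congruences
  open Residues
  open PowerSeries using (CharZeroField)
  open MoritaGamma
  open import Defs using (modℤ; invMod; ratMod; floorℚ; frac; gammaMod)
  open import Data.Nat as ℕ using (ℕ; zero; suc; NonZero)
  import Data.Nat.Properties as ℕ
  import Data.Nat.Divisibility as ℕ
  import Data.Nat.Coprimality as Cop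
  open import Data.Nat.Primality using (Prime)
  open import Data.Integer as ℤ using (ℤ; +_; -[1+_]; ∣_∣; _+_; _*_; -_; _-_; _^_)
  import Data.Integer.Properties as ℤ
  import Data.Integer.DivMod as ℤ
  import Data.Integer.Tactic.RingSolver as ℤ
  open import Data.Rational as ℚ using (ℚ; mkℚ; ↥_; ↧_; toℚᵘ)
  import Data.Rational.Properties as ℚ
  open import Data.Rational.Unnormalised as ℚᵘ using (mkℚᵘ; *≡*; _≃_)
  import Data.Rational.Unnormalised.Properties as ℚᵘ
  open import Data.Product using (proj₂)
  open import Data.Empty using (⊥-elim)
  open import Relation.Binary.PropositionalEquality

  -- The fraction u/D need not be reduced, which allows all parameters to be written over one
  -- denominator while ℚ keeps lowest terms.
  record IsFrac (r : ℚ) (u : ℤ) (D : ℕ) : Set where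
    constructor isFrac
    field
      cross : ↥ r * + D ≡ u * ↧ r

  private
    to : ∀ {r u d} → IsFrac r u (suc d) → toℚᵘ r ≃ mkℚᵘ u d
    to {r@record{}} (isFrac e) = *≡* e

    from : ∀ {r u d} → toℚᵘ r ≃ mkℚᵘ u d → IsFrac r u (suc d)
    from {r@record{}} (*≡* e) = isFrac e

  isFrac-/ : ∀ u D .{{_ : NonZero D}} → IsFrac (u ℚ./ D) u D
  isFrac-/ u (suc d) = from {u ℚ./ suc d} (ℚ.toℚᵘ-fromℚᵘ (mkℚᵘ u d))

  isFrac-+ : ∀ {r s u v} D .{{_ : NonZero D}} → IsFrac r u D → IsFrac s v D → IsFrac (r ℚ.+ s) (u + v) D
  isFrac-+ {r} {s} {u} {v} (suc d) a b = from {r ℚ.+ s} (ℚᵘ.≃-trans (ℚ.toℚᵘ-homo-+ r s)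
    (ℚᵘ.≃-trans (ℚᵘ.+-cong (to {r} a) (to {s} b)) (*≡* (trans (lem u v (+ suc d)) (cong ((u + v) *_) (sym (ℤ.pos-* (suc d) (suc d))))))))
    where
    lem : ∀ u v D → (u * D + v * D) * D ≡ (u + v) * (D * D)
    lem = ℤ.solve-∀

  isFrac-neg : ∀ {r u} D .{{_ : NonZero D}} → IsFrac r u D → IsFrac (ℚ.- r) (- u) D
  isFrac-neg {r} (suc d) a = from {ℚ.- r} (ℚᵘ.≃-trans (ℚ.toℚᵘ-homo‿- r) (ℚᵘ.-‿cong (to {r} a)))

  isFrac-change : ∀ r {u u′ D D′} .{{_ : NonZero D}} → IsFrac r u D → u * + D′ ≡ u′ * + D → IsFrac r u′ D′
  isFrac-change r {u} {u′} {D@(suc _)} {D′} (isFrac a) e = isFrac (ℤ.*-cancelʳ-≡ _ _ (+ D) (begin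
    ↥ r * + D′ * + D      ≡⟨ l₁ (↥ r) (+ D′) (+ D) ⟩
    ↥ r * + D * + D′      ≡⟨ cong (_* + D′) a ⟩
    u * ↧ r * + D′        ≡⟨ l₁ u (↧ r) (+ D′) ⟩
    u * + D′ * ↧ r        ≡⟨ cong (_* ↧ r) e ⟩
    u′ * + D * ↧ r        ≡⟨ l₁ u′ (+ D) (↧ r) ⟩
    u′ * ↧ r * + D        ∎))
    where
    open ≡-Reasoning
    l₁ : ∀ a b c → a * b * c ≡ a * c * b
    l₁ = ℤ.solve-∀

  -- The library's floor divides the reduced numerator by the reduced denominator. Rescaling its
  -- remainder puts u - ⌊r⌋D between 0 and D, which identifies it as the residue of u.
  floor-isFrac : ∀ {r u} D .{{_ : NonZero D}} → IsFrac r u D → u ≡ + modℤ u D + floorℚ r * + D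
  floor-isFrac {r@(mkℚ num d-1 _)} {u} D@(suc _) (isFrac a) = finish x refl
    where
    open ≡-Reasoning
    N = suc d-1
    f = floorℚ r
    rem = num ℤ.% + N
    x = u - f * + D
    l₀ : ∀ u z → u ≡ (u - z) + z
    l₀ = ℤ.solve-∀
    l₁ : ∀ u f D N → (u - f * D) * N ≡ u * N - f * N * D
    l₁ = ℤ.solve-∀
    l₂ : ∀ e f N D → (e + f * N) * D - f * N * D ≡ e * D
    l₂ = ℤ.solve-∀
    scaled : x * + N ≡ + (rem ℕ.* D)
    scaled = begin
      x * + N                                             ≡⟨ l₁ u f (+ D) (+ N) ⟩
      u * + N - f * + N * + D                       ≡⟨ cong (λ z → z - f * + N * + D) (sym a) ⟩
      num * + D - f * + N * + D                     ≡⟨ cong (λ z → z * + D - f * + N * + D) (ℤ.a≡a%n+[a/n]*n num (+ N)) ⟩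
      (+ rem + f * + N) * + D - f * + N * + D   ≡⟨ l₂ (+ rem) f (+ N) (+ D) ⟩
      + rem * + D                                         ≡⟨ sym (ℤ.pos-* rem D) ⟩
      + (rem ℕ.* D)                                         ∎
    finish : ∀ y → y ≡ x → u ≡ + modℤ u D + f * + D
    finish (+ e) y≡ = trans (l₀ u (f * + D)) (cong (_+ f * + D) (trans (sym y≡) (cong +_ (sym (modℤ-eq e<D
        (by f (trans (l₀ u (f * + D)) (cong₂ _+_ (sym y≡) (ℤ.*-comm f (+ D))))))))))
      where
      e<D : e ℕ.< D
      e<D = ℕ.*-cancelʳ-< N e D (ℕ.≤-<-trans (ℕ.≤-reflexive (ℤ.+-injective (trans (ℤ.pos-* e N) (trans (cong (_* + N) y≡) scaled))))
        (ℕ.<-≤-trans (ℕ.*-monoˡ-< D (ℤ.n%d<d num (+ N))) (ℕ.≤-reflexive (ℕ.*-comm N D))))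
    finish -[1+ e ] y≡ = ⊥-elim (neg≢pos (trans (cong (_* + N) y≡) scaled))
      where
      neg≢pos : ∀ {m} → -[1+ e ] * + N ≢ + m
      neg≢pos ()

  isFrac-frac : ∀ {r u} D .{{_ : NonZero D}} → IsFrac r u D → IsFrac (frac r) (+ modℤ u D) D
  isFrac-frac {r} {u} D a = subst (λ z → IsFrac (frac r) z D) eq
    (isFrac-+ {r} {ℚ.- (floorℚ r ℚ./ 1)} D a (isFrac-neg {floorℚ r ℚ./ 1} D (isFrac-change (floorℚ r ℚ./ 1) {floorℚ r} {floorℚ r * + D} {1} {D} (isFrac-/ (floorℚ r) 1) (sym (ℤ.*-identityʳ _)))))
    where
    lem : ∀ m z → (m + z) - z ≡ m
    lem = ℤ.solve-∀
    eq : u - floorℚ r * + D ≡ + modℤ u D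
    eq = trans (cong (λ z → z - floorℚ r * + D) (floor-isFrac {r} D a)) (lem (+ modℤ u D) (floorℚ r * + D))

  ℚ-field : CharZeroField
  ℚ-field = record
    { K = ℚ ; _+_ = ℚ._+_ ; _*_ = ℚ._*_ ; -_ = ℚ.-_ ; 0# = ℚ.0ℚ ; 1# = ℚ.1ℚ
    ; isCommutativeRing = ℚ.+-*-isCommutativeRing
    ; ι = ι ; ι-+ = ι-+ ; ι-* = ι-* ; ι-neg = ι-neg ; ι-0 = refl ; ι-1 = refl
    ; ι-injective = λ {x} {y} e → trans (sym (num x)) (trans (cong ↥_ e) (num y))
    ; inv = inv ; inv-* = inv-* }
    where
    ι : ℤ → ℚ
    ι z = z ℚ./ 1
    to-ι : ∀ z → toℚᵘ (ι z) ≃ mkℚᵘ z 0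
    to-ι z = ℚ.toℚᵘ-fromℚᵘ (mkℚᵘ z 0)
    lem₁ : ∀ x y → (x + y) * + 1 ≡ (x * + 1 + y * + 1) * + 1
    lem₁ = ℤ.solve-∀
    ι-+ : ∀ x y → ι (x + y) ≡ ι x ℚ.+ ι y
    ι-+ x y = ℚ.toℚᵘ-injective (ℚᵘ.≃-trans (to-ι (x + y)) (ℚᵘ.≃-trans (*≡* (lem₁ x y))
      (ℚᵘ.≃-sym (ℚᵘ.≃-trans (ℚ.toℚᵘ-homo-+ (ι x) (ι y)) (ℚᵘ.+-cong (to-ι x) (to-ι y))))))
    ι-* : ∀ x y → ι (x * y) ≡ ι x ℚ.* ι y
    ι-* x y = ℚ.toℚᵘ-injective (ℚᵘ.≃-trans (to-ι (x * y))
      (ℚᵘ.≃-sym (ℚᵘ.≃-trans (ℚ.toℚᵘ-homo-* (ι x) (ι y)) (ℚᵘ.*-cong (to-ι x) (to-ι y)))))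
    ι-neg : ∀ x → ι (- x) ≡ ℚ.- ι x
    ι-neg x = ℚ.toℚᵘ-injective (ℚᵘ.≃-trans (to-ι (- x))
      (ℚᵘ.≃-sym (ℚᵘ.≃-trans (ℚ.toℚᵘ-homo‿- (ι x)) (ℚᵘ.-‿cong (to-ι x)))))
    whole : ∀ z → ι z ≡ mkℚ z 0 (Cop.sym (Cop.1-coprimeTo ∣ z ∣))
    whole z = ℚ.↥p/↧p≡p (mkℚ z 0 (Cop.sym (Cop.1-coprimeTo ∣ z ∣)))
    num : ∀ z → ↥ ι z ≡ z
    num z = cong ↥_ (whole z)
    inv : ℕ → ℚ
    inv zero = ℚ.0ℚ
    inv (suc n) = ℚ.1/ (mkℚ (+ suc n) 0 (Cop.sym (Cop.1-coprimeTo (suc n))))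
    inv-* : ∀ n .{{_ : NonZero n}} → ι (+ n) ℚ.* inv n ≡ ℚ.1ℚ
    inv-* (suc n) = trans (cong (ℚ._* inv (suc n)) (whole (+ suc n))) (ℚ.*-inverseʳ (mkℚ (+ suc n) 0 (Cop.sym (Cop.1-coprimeTo (suc n)))))

  module GammaAtRational (p q h : ℕ) (pr : Prime p) (p≡1+q : p ≡ suc q) (q≡h+h : q ≡ h ℕ.+ h) (κ : ℕ) where

    open OddPrime p q h pr p≡1+q q≡h+h
    open PadicGamma p q h pr p≡1+q q≡h+h κ

    invMod-≈ : ∀ u → Unit u → u * invMod p k u ≈[ P ] + 1
    invMod-≈ u uu = ≈-trans (≡⇒≈ (cong (λ z → u * u ^ (p ℕ.^ κ ℕ.* z ℕ.∸ 1)) (cong (ℕ._∸ 1) p≡1+q))) (proj₂ (inverse-pk k u uu))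

    ratMod-≈ : ∀ r {u D} → IsFrac r u D → Unit (+ D) → ratMod p k r * + D ≈[ P ] u
    ratMod-≈ r@(mkℚ num d-1 c) {u} {D} (isFrac a) uD = begin
      num * v * + D          ≡⟨ lem num v (+ D) ⟩
      num * + D * v          ≡⟨ cong (_* v) a ⟩
      u * + N * v            ≡⟨ ℤ.*-assoc u (+ N) v ⟩
      u * (+ N * v)          ≈⟨ *-modˡ u (invMod-≈ (+ N) unit-N) ⟩
      u * + 1                  ≡⟨ ℤ.*-identityʳ u ⟩
      u                          ∎
      where
      open ≈-Reasoning P
      N = suc d-1
      v = invMod p k (+ N)
      lem : ∀ a b c → a * b * c ≡ a * c * b
      lem = ℤ.solve-∀
      -- The reduced denominator divides any other one, so it inherits being prime to p.
      N∣D : N ℕ.∣ D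
      N∣D = Cop.coprime-divisor (Cop.sym (Cop.recompute c)) (ℕ.divides ∣ u ∣ (trans (sym (ℤ.abs-* num (+ D))) (trans (cong ∣_∣ a) (ℤ.abs-* u (+ N)))))
      unit-N : Unit (+ N)
      unit-N z = uD (∣⇒0≈ (ℕ.∣-trans (0≈⇒∣ z) N∣D))

    gammaMod-≈ : ∀ r {u} D .{{_ : NonZero D}} X → IsFrac r u D → Unit (+ D) → X * + D ≈[ P ] + modℤ u D → gammaMod p k (frac r) ≡ Γ̂ X
    gammaMod-≈ r {u} D X a uD e = trans (gammaNat-ΓN (modℤ (ratMod p k (frac r)) P)) (Γ̂-cong (cancel-unit k {+ D} {ratMod p k (frac r)} {X} uD
      (≈-trans (≡⇒≈ (ℤ.*-comm (+ D) (ratMod p k (frac r)))) (≈-trans (ratMod-≈ (frac r) (isFrac-frac {r} D a) uD) (≈-trans (≈-sym e) (≡⇒≈ (ℤ.*-comm X (+ D))))))))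

-- A single term of the hypergeometric sum: gamma factors and power of p.

module Parameters where

  open BigOperators
  open Congruences
  open Residues
  open MoritaGamma
  open Fractions
  open import Defs
  open import Algebra.Structures using (IsCommutativeMonoid)
  open import Data.List using (List; map; applyUpTo; zip; length)
  open import Data.List.Properties using (length-applyUpTo)
  open import Data.Nat as ℕ using (ℕ; zero; suc; NonZero; z≤n)
  import Data.Nat.Properties as ℕ
  import Data.Nat.Divisibility as ℕ
  open import Data.Nat.Primality using (Prime)
  import Data.Nat.Tactic.RingSolver as ℕ
  open import Data.Integer as ℤ using (ℤ; +_; -[1+_]; _+_; _*_; -_; _-_; _^_)
  import Data.Integer.Properties as ℤ
  import Data.Integer.Tactic.RingSolver as ℤ
  open import Data.Rational as ℚ using (ℚ)
  open import Data.Product using (Σ-syntax; _,_; _×_; proj₁; proj₂)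
  open import Data.Empty using (⊥-elim)
  open import Function using (_∘_)
  open import Relation.Binary.PropositionalEquality

  module Cycle {A : Set} {_∙_ : A → A → A} {ε : A} (isCM : IsCommutativeMonoid _≡_ _∙_ ε) where

    open Big isCM

    module _ (m : ℕ) .{{_ : NonZero m}} (c : ℤ) (G : ℕ → A) where

      cycle : big m (λ j → G (modℤ (c + + j) m)) ≡ big m G
      cycle = big-perm m (λ j → modℤ (c + + j) m) (λ j → modℤ (- c + + j) m) (λ _ _ → modℤ-< _) (λ _ _ → modℤ-< _)
        (λ i i<m → modℤ-eq i<m (≈-trans (+-mod (≈-refl {x = c}) (modℤ-≈ (- c + + i))) (≡⇒≈ (lem₁ c (+ i)))))
        (λ i i<m → modℤ-eq i<m (≈-trans (+-mod (≈-refl {x = - c}) (modℤ-≈ (c + + i))) (≡⇒≈ (lem₂ c (+ i))))) G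
        where
        lem₁ : ∀ c i → c + (- c + i) ≡ i
        lem₁ = ℤ.solve-∀
        lem₂ : ∀ c i → - c + (c + i) ≡ i
        lem₂ = ℤ.solve-∀

      cycle⁻ : big m (λ j → G (modℤ (c - + j) m)) ≡ big m G
      cycle⁻ = big-perm m σ σ (λ _ _ → modℤ-< _) (λ _ _ → modℤ-< _) inv inv G
        where
        σ : ℕ → ℕ
        σ j = modℤ (c - + j) m
        lem : ∀ c i → c - (c - i) ≡ i
        lem = ℤ.solve-∀
        inv : ∀ i → i ℕ.< m → σ (σ i) ≡ i
        inv i i<m = modℤ-eq i<m (≈-trans (-‿mod (≈-refl {x = c}) (modℤ-≈ (c - + i))) (≡⇒≈ (lem c (+ i))))

    module _ (m q : ℕ) .{{_ : NonZero m}} .{{_ : NonZero q}} (v c : ℤ) (b : ℕ) (b<q : b ℕ.< q) (v≡ : v ≡ + b + + q * c) (G : ℕ → A) where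

      private
        instance
          mq≢0 : NonZero (m ℕ.* q)
          mq≢0 = ℕ.m*n≢0 m q

        bound : ∀ i → i ℕ.< m → b ℕ.+ q ℕ.* i ℕ.< m ℕ.* q
        bound i i<m = ℕ.<-≤-trans (ℕ.+-monoˡ-< (q ℕ.* i) b<q) (ℕ.≤-trans (ℕ.≤-reflexive (sym (ℕ.*-suc q i))) (ℕ.≤-trans (ℕ.*-monoʳ-≤ q i<m) (ℕ.≤-reflexive (ℕ.*-comm q m))))

        residue : ∀ {x} c′ → x ≡ + b + + q * c′ → modℤ x (m ℕ.* q) ≡ b ℕ.+ q ℕ.* modℤ c′ m
        residue {x} c′ e = modℤ-eq (bound _ (modℤ-< c′)) (≈-trans (≡⇒≈ e)
          (≈-trans (+-mod (≈-refl {x = + b}) (subst (λ n → + q * c′ ≈[ n ] + q * + modℤ c′ m) (ℕ.*-comm q m) (*-up q (≈-sym (modℤ-≈ c′)))))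
            (≡⇒≈ (sym (trans (ℤ.pos-+ b _) (cong (λ z → + b + z) (ℤ.pos-* q _)))))))

      -- The residues of v + jq modulo mq are the numbers b + qi in rotated order, with b the
      -- residue of v modulo q. So fractional parts of a full set of shifted parameters depend on v
      -- only through b.
      cycle-q : big m (λ j → G (modℤ (v + + j * + q) (m ℕ.* q))) ≡ big m (λ i → G (b ℕ.+ q ℕ.* i))
      cycle-q = trans (big-ext m (λ j → cong G (residue (c + + j) (trans (cong (_+ + j * + q) v≡) (lem (+ b) (+ q) c (+ j))))))
        (cycle m c (λ i → G (b ℕ.+ q ℕ.* i)))
        where
        lem : ∀ b q c j → b + q * c + j * q ≡ b + q * (c + j)
        lem = ℤ.solve-∀

      cycle-q⁻ : big m (λ j → G (modℤ (v - + j * + q) (m ℕ.* q))) ≡ big m (λ i → G (b ℕ.+ q ℕ.* i))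
      cycle-q⁻ = trans (big-ext m (λ j → cong G (residue (c - + j) (trans (cong (_- + j * + q) v≡) (lem (+ b) (+ q) c (+ j))))))
        (cycle⁻ m c (λ i → G (b ℕ.+ q ℕ.* i)))
        where
        lem : ∀ b q c j → b + q * c - j * q ≡ b + q * (c - j)
        lem = ℤ.solve-∀

  module Cycle∏ = Cycle ℤ.*-1-isCommutativeMonoid
  module Cycle∑ = Cycle ℤ.+-0-isCommutativeMonoid

  prod-zip : ∀ {X : Set} (G : X × X → ℤ) (f g : ℕ → X) N →
    prodℤ (map G (zip (applyUpTo f N) (applyUpTo g N))) ≡ ∏ N (λ j → G (f j , g j))
  prod-zip G f g zero = refl
  prod-zip G f g (suc N) = trans (cong (G (f 0 , g 0) *_) (prod-zip G (f ∘ suc) (g ∘ suc) N)) (sym (∏-head N (λ j → G (f j , g j))))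

  sum-zip : ∀ {X : Set} (G : X × X → ℤ) (f g : ℕ → X) N →
    sumℤ (map G (zip (applyUpTo f N) (applyUpTo g N))) ≡ ∑ N (λ j → G (f j , g j))
  sum-zip G f g zero = refl
  sum-zip G f g (suc N) = trans (cong (_+_ (G (f 0 , g 0))) (sum-zip G (f ∘ suc) (g ∘ suc) N)) (sym (∑-head N (λ j → G (f j , g j))))

  sum-upTo : ∀ (G : ℕ → ℤ) f N → sumℤ (map G (applyUpTo f N)) ≡ ∑ N (λ j → G (f j))
  sum-upTo G f zero = refl
  sum-upTo G f (suc N) = trans (cong (_+_ (G (f 0))) (sum-upTo G (f ∘ suc) N)) (sym (∑-head N (λ j → G (f j))))

  module Terms (p q h : ℕ) (pr : Prime p) (p≡1+q : p ≡ suc q) (q≡h+h : q ≡ h ℕ.+ h) (κ : ℕ) where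

    open OddPrime p q h pr p≡1+q q≡h+h
    open Characters κ hiding (P; p∣P)
    open PadicGamma p q h pr p≡1+q q≡h+h κ
    open GammaAtRational p q h pr p≡1+q q≡h+h κ

    gm : ℚ → ℤ
    gm r = gammaMod p k (frac r)

    module Distribution (m : ℕ) .{{m≢0 : NonZero m}} (um : Unit (+ m)) where

      D : ℕ
      D = m ℕ.* q

      instance
        D≢0 : NonZero D
        D≢0 = ℕ.m*n≢0 m q

      uD : Unit (+ D)
      uD = subst Unit (sym (ℤ.pos-* m q)) (unit-* um unit-q)

      private
        D̄ : ℤ
        D̄ = proj₁ (inverse-pk k (+ D) uD)

        DD̄ : + D * D̄ ≈[ P ] + 1
        DD̄ = proj₂ (inverse-pk k (+ D) uD)

        -- The inverse of m is taken as q/D, which makes (b + qi)/D and (b/q + i)/m agree by a ring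
        -- identity.
        m̄ : ℤ
        m̄ = + q * D̄

        mm̄ : + m * m̄ ≈[ P ] + 1
        mm̄ = ≈-trans (≡⇒≈ (trans (sym (ℤ.*-assoc (+ m) (+ q) D̄)) (cong (_* D̄) (sym (ℤ.pos-* m q))))) DD̄

      G : ℕ → ℤ
      G B = Γ̂ (+ B * D̄)

      gm-G : ∀ r {u} → IsFrac r u D → gm r ≡ G (modℤ u D)
      gm-G r {u} a = gammaMod-≈ r D (+ modℤ u D * D̄) a uD (≈-trans (≡⇒≈ (lem (+ modℤ u D) D̄ (+ D))) (≈-trans (*-modˡ (+ modℤ u D) DD̄) (≡⇒≈ (ℤ.*-identityʳ _))))
        where
        lem : ∀ a b c → a * b * c ≡ a * (c * b)
        lem = ℤ.solve-∀

      T : ℤ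
      T = distribution m m̄ mm̄ 0

      -- The points (b + qi)/(mq) are (b/q + i)/m, so this is Gauss's formula at the integer
      -- representing b/q; `T` is its constant, the product of the Γ_p(i/m).
      ∏-G : ∀ b → b ℕ.≤ q → ∏ m (λ i → G (b ℕ.+ q ℕ.* i)) * τ (+ m) ^ (q ℕ.∸ b) ≈[ P ] Γb b * T
      ∏-G b b≤q = ≈-trans (≡⇒≈ (cong₂ _*_ (∏-ext m (λ i → Γ̂-cong (point i))) power)) (multiplication m m̄ mm̄ (pt b))
        where
        power : τ (+ m) ^ (q ℕ.∸ b) ≡ ∏ (pt b) (λ j → sel (+ m) (+ j))
        power = trans (ℤ.^-*-assoc (+ m) (p ℕ.^ κ) (q ℕ.∸ b)) (trans (cong ((+ m) ^_) (ℕ.*-comm (p ℕ.^ κ) (q ℕ.∸ b))) (sym (∏-sel-pt (+ m) b b≤q)))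
        lem : ∀ y i q d → (q * y + q * i) * d ≡ (y + i) * (q * d)
        lem = ℤ.solve-∀
        point : ∀ i → + (b ℕ.+ q ℕ.* i) * D̄ ≈[ P ] (+ pt b + + i) * m̄
        point i = ≈-trans (*-modʳ D̄ (≈-trans (≡⇒≈ (trans (ℤ.pos-+ b (q ℕ.* i)) (cong (λ z → + b + z) (ℤ.pos-* q i)))) (+-mod (≈-sym (pt-≈ b b≤q)) (≈-refl {x = + q * + i}))))
          (≡⇒≈ (lem (+ pt b) (+ i) (+ q) D̄))

    invMod-ratio : ∀ N x y → (∀ j → j ℕ.< N → Unit (y j)) →
      ∏ N (λ j → x j * invMod p k (y j)) * ∏ N y ≈[ P ] ∏ N x
    invMod-ratio N x y uy = ≈-trans (≡⇒≈ (sym (∏-* N (λ j → x j * invMod p k (y j)) y))) (∏-mod N (λ j j<N →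
      ≈-trans (≡⇒≈ (lem (x j) (invMod p k (y j)) (y j))) (≈-trans (*-modˡ (x j) (invMod-≈ (y j) (uy j j<N))) (≡⇒≈ (ℤ.*-identityʳ (x j))))))
      where
      lem : ∀ a b c → a * b * c ≡ a * (c * b)
      lem = ℤ.solve-∀

    -- The -1 in the exponent uses up one of the m + 1 scaling powers of p, at the cost of a sign.
    scaledPow-≡ : ∀ m s → scaledPow p (suc m) (+ s - + 1) ≡ - (+ (p ℕ.^ m) * (- + p) ^ s)
    scaledPow-≡ m zero = lem (+ (p ℕ.^ m))
      where
      lem : ∀ a → (- + 1) * a ≡ - (a * + 1)
      lem = ℤ.solve-∀
    scaledPow-≡ m (suc s) = begin
      sgnPow s * + (p ℕ.^ (suc m ℕ.+ s))                       ≡⟨ cong₂ _*_ (sgnPow-^ s) (trans (cong (λ z → + (p ℕ.^ z)) (sym (ℕ.+-suc m s)))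
                                                                      (trans (cong +_ (ℕ.^-distribˡ-+-* p m (suc s))) (trans (ℤ.pos-* (p ℕ.^ m) (p ℕ.^ suc s)) (cong (+ (p ℕ.^ m) *_) (trans (pos-^ p (suc s)) refl))))) ⟩
      -1ℤ ^ s * (+ (p ℕ.^ m) * (+ p * (+ p) ^ s))      ≡⟨ lem (-1ℤ ^ s) (+ (p ℕ.^ m)) (+ p) ((+ p) ^ s) ⟩
      - (+ (p ℕ.^ m) * (- + p * (-1ℤ ^ s * (+ p) ^ s))) ≡⟨ cong (λ z → - (+ (p ℕ.^ m) * (- + p * z))) (trans (sym (*-^ -1ℤ (+ p) s)) (cong (_^ s) (lem₁ (+ p)))) ⟩
      - (+ (p ℕ.^ m) * (- + p) ^ suc s) ∎
      where
      open ≡-Reasoning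
      lem : ∀ a b c d → a * (b * (c * d)) ≡ - (b * (- c * (a * d)))
      lem = ℤ.solve-∀
      lem₁ : ∀ x → (- + 1) * x ≡ - x
      lem₁ = ℤ.solve-∀

    q∸h≡h : q ℕ.∸ h ≡ h
    q∸h≡h = trans (cong (ℕ._∸ h) q≡h+h) (ℕ.m+n∸m≡n h h)

    Γh² : Γb h * Γb h ≈[ P ] - -1ℤ ^ h
    Γh² = subst (λ z → Γb h * Γb z ≈[ P ] - -1ℤ ^ z) q∸h≡h (reflection-b h (ℕ.<⇒≤ h<q))

    module Term (m′ : ℕ) (um : Unit (+ suc m′)) (un : Unit (+ suc (suc m′))) (a : ℕ) where

      m n : ℕ
      m = suc m′
      n = suc m

      α : ℚ
      α = divℚ (+ a) (p ℕ.∸ 1)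

      -- The top parameter 1/2 is kept apart as `half`, so that the remaining m top and all n bottom
      -- parameters form complete sets to which Gauss's formula applies. The value at 0 has its own
      -- clause because the parameter list writes it as 0/1.
      tp bp : ℕ → ℚ
      tp j = + (2 ℕ.* j ℕ.+ 1) ℚ./ (2 ℕ.* m)
      bp zero = + 0 ℚ./ 1
      bp (suc j) = + suc j ℚ./ n

      half : ℚ
      half = + 1 ℚ./ 2

      module Dm = Distribution m um
      module Dn = Distribution n un

      private
        divℚ-frac : ∀ q′ .{{_ : NonZero q′}} → IsFrac (divℚ (+ a) q′) (+ a) q′
        divℚ-frac (suc d) = isFrac-/ (+ a) (suc d)

        α-frac₁ : IsFrac α (+ a) q
        α-frac₁ = subst (λ z → IsFrac (divℚ (+ a) z) (+ a) q) (sym (cong (ℕ._∸ 1) p≡1+q)) (divℚ-frac q)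

      α-frac : ∀ N → IsFrac α (+ a * + N) (N ℕ.* q)
      α-frac N = isFrac-change α {D = q} α-frac₁ (trans (cong (+ a *_) (ℤ.pos-* N q)) (sym (ℤ.*-assoc (+ a) (+ N) (+ q))))

      half-frac : IsFrac half (+ h) q
      half-frac = isFrac-change half {D = 2} (isFrac-/ (+ 1) 2) (trans (ℤ.*-identityˡ (+ q)) (trans (cong +_ q≡h+h) (trans (ℤ.pos-+ h h) (lem (+ h)))))
        where
        lem : ∀ h → h + h ≡ h * + 2
        lem = ℤ.solve-∀

      tp-frac : ∀ j → IsFrac (tp j) (+ h + + j * + q) (m ℕ.* q)
      tp-frac j = isFrac-change (tp j) {D = 2 ℕ.* m} (isFrac-/ (+ (2 ℕ.* j ℕ.+ 1)) (2 ℕ.* m)) (begin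
        + (2 ℕ.* j ℕ.+ 1) * + (m ℕ.* q)          ≡⟨ sym (ℤ.pos-* (2 ℕ.* j ℕ.+ 1) (m ℕ.* q)) ⟩
        + ((2 ℕ.* j ℕ.+ 1) ℕ.* (m ℕ.* q))          ≡⟨ cong +_ (trans (cong (λ z → (2 ℕ.* j ℕ.+ 1) ℕ.* (m ℕ.* z)) q≡h+h) (trans (lem j m h) (cong (λ z → (h ℕ.+ j ℕ.* z) ℕ.* (2 ℕ.* m)) (sym q≡h+h)))) ⟩
        + ((h ℕ.+ j ℕ.* q) ℕ.* (2 ℕ.* m))          ≡⟨ ℤ.pos-* (h ℕ.+ j ℕ.* q) (2 ℕ.* m) ⟩
        + (h ℕ.+ j ℕ.* q) * + (2 ℕ.* m)          ≡⟨ cong (_* + (2 ℕ.* m)) (trans (ℤ.pos-+ h (j ℕ.* q)) (cong (λ z → + h + z) (ℤ.pos-* j q))) ⟩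
        (+ h + + j * + q) * + (2 ℕ.* m)      ∎)
        where
        open ≡-Reasoning
        lem : ∀ j m h → (2 ℕ.* j ℕ.+ 1) ℕ.* (m ℕ.* (h ℕ.+ h)) ≡ (h ℕ.+ j ℕ.* (h ℕ.+ h)) ℕ.* (2 ℕ.* m)
        lem = ℕ.solve-∀

      bp-frac : ∀ j → IsFrac (bp j) (+ j * + q) (n ℕ.* q)
      bp-frac zero = isFrac-change (bp 0) {D = 1} (isFrac-/ (+ 0) 1) refl
      bp-frac (suc j) = isFrac-change (bp (suc j)) {D = n} (isFrac-/ (+ suc j) n) (trans (cong (+ suc j *_) (ℤ.pos-* n q)) (lem (+ suc j) (+ n) (+ q)))
        where
        lem : ∀ a b c → a * (b * c) ≡ a * c * b
        lem = ℤ.solve-∀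

      -- the numerators of ⟨1/2 - α⟩, ⟨1/2 - mα⟩ and ⟨nα⟩ over q

      v₁ v₂ v₃ : ℤ
      v₁ = + h - + a
      v₂ = + h - + a * + m
      v₃ = + a * + n

      b₁ b₂ b₃ : ℕ
      b₁ = modℤ v₁ q
      b₂ = modℤ v₂ q
      b₃ = modℤ v₃ q

      b₁≈ : + b₁ ≈[ q ] v₁
      b₁≈ = modℤ-≈ v₁
      b₂≈ : + b₂ ≈[ q ] v₂
      b₂≈ = modℤ-≈ v₂
      b₃≈ : + b₃ ≈[ q ] v₃
      b₃≈ = modℤ-≈ v₃

      b₁<q : b₁ ℕ.< q
      b₁<q = modℤ-< v₁
      b₂<q : b₂ ℕ.< q
      b₂<q = modℤ-< v₂
      b₃<q : b₃ ℕ.< q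
      b₃<q = modℤ-< v₃

      private
        split : ∀ v → v ≡ + modℤ v q + + q * _≈[_]_.quotient (≈-sym (modℤ-≈ {q} v))
        split v = _≈[_]_.equality (≈-sym (modℤ-≈ {q} v))

        h-split : + h ≡ + h + + q * + 0
        h-split = lem (+ h) (+ q)
          where
          lem : ∀ h q → h ≡ h + q * + 0
          lem = ℤ.solve-∀

        0-split : + 0 ≡ + 0 + + q * + 0
        0-split = lem (+ q)
          where
          lem : ∀ q → + 0 ≡ + 0 + q * + 0
          lem = ℤ.solve-∀

        0<q : 0 ℕ.< q
        0<q = 1≤q

        half-frac′ : IsFrac (half ℚ.- α) v₁ q
        half-frac′ = isFrac-+ q half-frac (isFrac-neg q α-frac₁)

        tp-frac′ : ∀ j → IsFrac (tp j ℚ.- α) (v₂ + + j * + q) (m ℕ.* q)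
        tp-frac′ j = subst (λ u → IsFrac (tp j ℚ.- α) u (m ℕ.* q)) (lem (+ h) (+ j * + q) (+ a * + m)) (isFrac-+ (m ℕ.* q) (tp-frac j) (isFrac-neg (m ℕ.* q) (α-frac m)))
          where
          lem : ∀ h x y → h + x + - y ≡ h - y + x
          lem = ℤ.solve-∀

        bp-frac⁻ : ∀ j → IsFrac (ℚ.- bp j) (+ 0 - + j * + q) (n ℕ.* q)
        bp-frac⁻ j = subst (λ u → IsFrac (ℚ.- bp j) u (n ℕ.* q)) (sym (ℤ.+-identityˡ _)) (isFrac-neg (n ℕ.* q) (bp-frac j))

        bp-frac′ : ∀ j → IsFrac (ℚ.- bp j ℚ.+ α) (v₃ - + j * + q) (n ℕ.* q)
        bp-frac′ j = subst (λ u → IsFrac (ℚ.- bp j ℚ.+ α) u (n ℕ.* q)) (ℤ.+-comm (- (+ j * + q)) v₃) (isFrac-+ (n ℕ.* q) (isFrac-neg (n ℕ.* q) (bp-frac j)) (α-frac n))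

        gm-q : ∀ r {v} → IsFrac r v q → gm r ≡ Γb (modℤ v q)
        gm-q r {v} f = gammaMod-≈ r q (+ pt (modℤ v q)) f unit-q (≈-trans (≡⇒≈ (ℤ.*-comm (+ pt (modℤ v q)) (+ q))) (pt-≈ (modℤ v q) (ℕ.<⇒≤ (modℤ-< v))))

      X₁ X₂ X₃ X₄ : ℤ
      X₁ = ∏ m (λ j → gm (tp j ℚ.- α))
      X₂ = ∏ m (λ j → gm (tp j))
      X₃ = ∏ n (λ j → gm (ℚ.- bp j ℚ.+ α))
      X₄ = ∏ n (λ j → gm (ℚ.- bp j))

      X₁-≈ : X₁ * τ (+ m) ^ (q ℕ.∸ b₂) ≈[ P ] Γb b₂ * Dm.T
      X₁-≈ = ≈-trans (≡⇒≈ (cong (_* τ (+ m) ^ (q ℕ.∸ b₂)) (trans (∏-ext m (λ j → Dm.gm-G (tp j ℚ.- α) (tp-frac′ j)))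
        (Cycle∏.cycle-q m q v₂ _ b₂ b₂<q (split v₂) Dm.G)))) (Dm.∏-G b₂ (ℕ.<⇒≤ b₂<q))

      X₂-≈ : X₂ * τ (+ m) ^ h ≈[ P ] Γb h * Dm.T
      X₂-≈ = ≈-trans (≡⇒≈ (cong₂ (λ x e → x * τ (+ m) ^ e) (trans (∏-ext m (λ j → Dm.gm-G (tp j) (tp-frac j)))
        (Cycle∏.cycle-q m q (+ h) (+ 0) h h<q h-split Dm.G)) (sym q∸h≡h))) (Dm.∏-G h (ℕ.<⇒≤ h<q))

      X₃-≈ : X₃ * τ (+ n) ^ (q ℕ.∸ b₃) ≈[ P ] Γb b₃ * Dn.T
      X₃-≈ = ≈-trans (≡⇒≈ (cong (_* τ (+ n) ^ (q ℕ.∸ b₃)) (trans (∏-ext n (λ j → Dn.gm-G (ℚ.- bp j ℚ.+ α) (bp-frac′ j)))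
        (Cycle∏.cycle-q⁻ n q v₃ _ b₃ b₃<q (split v₃) Dn.G)))) (Dn.∏-G b₃ (ℕ.<⇒≤ b₃<q))

      X₄-≈ : X₄ ≈[ P ] Dn.T
      X₄-≈ = begin
        X₄                          ≡⟨ sym (ℤ.*-identityʳ X₄) ⟩
        X₄ * + 1                  ≈⟨ *-modˡ X₄ (≈-sym (τ-q un)) ⟩
        X₄ * τ (+ n) ^ q        ≡⟨ cong (_* τ (+ n) ^ q) (trans (∏-ext n (λ j → Dn.gm-G (ℚ.- bp j) (bp-frac⁻ j))) (Cycle∏.cycle-q⁻ n q (+ 0) (+ 0) 0 0<q 0-split Dn.G)) ⟩
        ∏ n (λ i → Dn.G (0 ℕ.+ q ℕ.* i)) * τ (+ n) ^ (q ℕ.∸ 0) ≈⟨ Dn.∏-G 0 z≤n ⟩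
        Γb 0 * Dn.T               ≡⟨ trans (cong (_* Dn.T) Γb-0) (ℤ.*-identityˡ Dn.T) ⟩
        Dn.T                        ∎
        where open ≈-Reasoning P

      ps : List (ℚ × ℚ)
      ps = zip (topParams n) (bottomParams n)

      R : ℤ
      R = prodℤ (map (gammaRatio p k a) ps)

      private
        num den : ℕ → ℤ
        num j = gm (ℚ.- bp j ℚ.+ α)
        den j = gm (ℚ.- bp j)

        gm-unit : ∀ r → Unit (gm r)
        gm-unit r = subst Unit (sym (gammaNat-ΓN (modℤ (ratMod p k (frac r)) P))) (ΓN-unit (modℤ (ratMod p k (frac r)) P))

        -- The first pair is taken apart: its upper entry 1/2 stands alone, and its lower entry 0
        -- completes the set of the j/n.
        R-split : R ≡ (gm (half ℚ.- α) * invMod p k (gm half)) * ∏ m (λ j → gm (tp j ℚ.- α) * invMod p k (gm (tp j))) * ∏ n (λ j → num j * invMod p k (den j))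
        R-split = begin
          gammaRatio p k a (half , bp 0) * prodℤ (map (gammaRatio p k a) (zip (applyUpTo tp m) (applyUpTo (bp ∘ suc) m)))
            ≡⟨ cong (gammaRatio p k a (half , bp 0) *_) (prod-zip (gammaRatio p k a) tp (bp ∘ suc) m) ⟩
          gammaRatio p k a (half , bp 0) * ∏ m (λ j → gammaRatio p k a (tp j , bp (suc j)))
            ≡⟨ cong (gammaRatio p k a (half , bp 0) *_) (trans (∏-ext m (λ j → ℤ.*-assoc (t j) (num (suc j)) (invMod p k (den (suc j))))) (∏-* m t (λ j → num (suc j) * invMod p k (den (suc j))))) ⟩
          gammaRatio p k a (half , bp 0) * (∏ m t * ∏ m (λ j → num (suc j) * invMod p k (den (suc j))))
            ≡⟨ lem (gm (half ℚ.- α) * invMod p k (gm half)) (num 0) (invMod p k (den 0)) (∏ m t) (∏ m (λ j → num (suc j) * invMod p k (den (suc j)))) ⟩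
          (gm (half ℚ.- α) * invMod p k (gm half)) * ∏ m t * (num 0 * invMod p k (den 0) * ∏ m (λ j → num (suc j) * invMod p k (den (suc j))))
            ≡⟨ cong ((gm (half ℚ.- α) * invMod p k (gm half)) * ∏ m t *_) (sym (∏-head m (λ j → num j * invMod p k (den j)))) ⟩
          (gm (half ℚ.- α) * invMod p k (gm half)) * ∏ m t * ∏ n (λ j → num j * invMod p k (den j)) ∎
          where
          open ≡-Reasoning
          t : ℕ → ℤ
          t j = gm (tp j ℚ.- α) * invMod p k (gm (tp j))
          lem : ∀ a b c d e → a * b * c * (d * e) ≡ a * d * (b * c * e)
          lem = ℤ.solve-∀

      R-den : R * (Γb h * X₂ * X₄) ≈[ P ] Γb b₁ * X₁ * X₃
      R-den = begin
        R * (Γb h * X₂ * X₄)        ≡⟨ cong₂ (λ r g → r * (g * X₂ * X₄)) R-split (sym (trans (gm-q half half-frac) (cong Γb (modℤ-small h<q)))) ⟩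
        (A * I) * B * C * (g * X₂ * X₄) ≡⟨ lem A I B C g X₂ X₄ ⟩
        (A * (g * I)) * (B * X₂) * (C * X₄)
          ≈⟨ *-mod (*-mod (≈-trans (*-modˡ A (invMod-≈ g (gm-unit half))) (≡⇒≈ (trans (ℤ.*-identityʳ A) (gm-q (half ℚ.- α) half-frac′))))
               (invMod-ratio m (λ j → gm (tp j ℚ.- α)) (λ j → gm (tp j)) (λ j _ → gm-unit (tp j)))) (invMod-ratio n num den (λ j _ → gm-unit (ℚ.- bp j))) ⟩
        Γb b₁ * X₁ * X₃ ∎
        where
        open ≈-Reasoning P
        A = gm (half ℚ.- α)
        g = gm half
        I = invMod p k g
        B = ∏ m (λ j → gm (tp j ℚ.- α) * invMod p k (gm (tp j)))
        C = ∏ n (λ j → num j * invMod p k (den j))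
        lem : ∀ A I B C g x y → (A * I) * B * C * (g * x * y) ≡ (A * (g * I)) * (B * x) * (C * y)
        lem = ℤ.solve-∀

      -- Gauss's constants cancel between numerators and denominators. The two copies of Γ_p(1/2) in
      -- the denominator contribute -(-1)^h by reflection, and the powers of τ(m) and τ(n) are what
      -- the multiplication formulas leave behind.
      R-value : R ≈[ P ] - (-1ℤ ^ h) * (Γb b₁ * Γb b₂ * Γb b₃) * (τ (+ m) ^ (h ℕ.+ b₂) * τ (+ n) ^ b₃)
      R-value = cancel-unit k {U} unit-U (≈-trans left (≈-sym right))
        where
        open ≈-Reasoning P
        tm = τ (+ m)
        tn = τ (+ n)
        ε = - (-1ℤ ^ h)
        GGG = Γb b₁ * Γb b₂ * Γb b₃
        U = Γb h * X₂ * X₄ * (tm ^ h * tm ^ (q ℕ.∸ b₂) * tn ^ (q ℕ.∸ b₃))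
        unit-U : Unit U
        unit-U = unit-* (unit-* (unit-* (Γ̂-unit _) (unit-∏ m _ (λ j _ → gm-unit (tp j)))) (unit-∏ n _ (λ j _ → gm-unit (ℚ.- bp j))))
          (unit-* (unit-* (unit-^ h (τ-unit um)) (unit-^ (q ℕ.∸ b₂) (τ-unit um))) (unit-^ (q ℕ.∸ b₃) (τ-unit un)))
        l₁ : ∀ g x y a b c R → g * x * y * (a * b * c) * R ≡ R * (g * x * y) * (a * b * c)
        l₁ = ℤ.solve-∀
        l₂ : ∀ g x y a b c → g * x * y * (a * b * c) ≡ g * (x * b) * (y * c) * a
        l₂ = ℤ.solve-∀
        left : U * R ≈[ P ] Γb b₁ * (Γb b₂ * Dm.T) * (Γb b₃ * Dn.T) * tm ^ h
        left = begin
          U * R ≡⟨ l₁ (Γb h) X₂ X₄ (tm ^ h) (tm ^ (q ℕ.∸ b₂)) (tn ^ (q ℕ.∸ b₃)) R ⟩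
          R * (Γb h * X₂ * X₄) * (tm ^ h * tm ^ (q ℕ.∸ b₂) * tn ^ (q ℕ.∸ b₃)) ≈⟨ *-modʳ (tm ^ h * tm ^ (q ℕ.∸ b₂) * tn ^ (q ℕ.∸ b₃)) R-den ⟩
          Γb b₁ * X₁ * X₃ * (tm ^ h * tm ^ (q ℕ.∸ b₂) * tn ^ (q ℕ.∸ b₃)) ≡⟨ l₂ (Γb b₁) X₁ X₃ (tm ^ h) (tm ^ (q ℕ.∸ b₂)) (tn ^ (q ℕ.∸ b₃)) ⟩
          Γb b₁ * (X₁ * tm ^ (q ℕ.∸ b₂)) * (X₃ * tn ^ (q ℕ.∸ b₃)) * tm ^ h ≈⟨ *-modʳ (tm ^ h) (*-mod (*-modˡ (Γb b₁) X₁-≈) X₃-≈) ⟩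
          Γb b₁ * (Γb b₂ * Dm.T) * (Γb b₃ * Dn.T) * tm ^ h ∎
        l₃ : ∀ g x y a b c e GGG d f → g * x * y * (a * b * c) * (e * GGG * (a * d * f)) ≡ (g * (x * a)) * y * (b * d) * (c * f) * (e * GGG * a)
        l₃ = ℤ.solve-∀
        l₄ : ∀ g T S e b₁ b₂ b₃ a → g * (g * T) * S * + 1 * + 1 * (e * (b₁ * b₂ * b₃) * a) ≡ (g * g * e) * (b₁ * (b₂ * T) * (b₃ * S) * a)
        l₄ = ℤ.solve-∀
        full : ∀ {x} b → b ℕ.≤ q → Unit x → τ x ^ (q ℕ.∸ b) * τ x ^ b ≈[ P ] + 1
        full {x} b b≤q ux = ≈-trans (≡⇒≈ (trans (sym (ℤ.^-distribˡ-+-* (τ x) (q ℕ.∸ b) b)) (cong (τ x ^_) (ℕ.m∸n+n≡m b≤q)))) (τ-q ux)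
        square : Γb h * Γb h * ε ≈[ P ] + 1
        square = ≈-trans (*-modʳ ε Γh²) (≡⇒≈ (trans (sq (-1ℤ ^ h)) (trans (sym (ℤ.^-distribˡ-+-* -1ℤ h h)) (-1^-even h))))
          where
          sq : ∀ e → - e * - e ≡ e * e
          sq = ℤ.solve-∀
        right : U * (ε * GGG * (tm ^ (h ℕ.+ b₂) * tn ^ b₃)) ≈[ P ] Γb b₁ * (Γb b₂ * Dm.T) * (Γb b₃ * Dn.T) * tm ^ h
        right = begin
          U * (ε * GGG * (tm ^ (h ℕ.+ b₂) * tn ^ b₃)) ≡⟨ cong (λ z → U * (ε * GGG * (z * tn ^ b₃))) (ℤ.^-distribˡ-+-* tm h b₂) ⟩
          U * (ε * GGG * (tm ^ h * tm ^ b₂ * tn ^ b₃)) ≡⟨ l₃ (Γb h) X₂ X₄ (tm ^ h) (tm ^ (q ℕ.∸ b₂)) (tn ^ (q ℕ.∸ b₃)) ε GGG (tm ^ b₂) (tn ^ b₃) ⟩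
          (Γb h * (X₂ * tm ^ h)) * X₄ * (tm ^ (q ℕ.∸ b₂) * tm ^ b₂) * (tn ^ (q ℕ.∸ b₃) * tn ^ b₃) * (ε * GGG * tm ^ h)
            ≈⟨ *-modʳ (ε * GGG * tm ^ h) (*-mod (*-mod (*-mod (*-modˡ (Γb h) X₂-≈) X₄-≈) (full b₂ (ℕ.<⇒≤ b₂<q) um)) (full b₃ (ℕ.<⇒≤ b₃<q) un)) ⟩
          Γb h * (Γb h * Dm.T) * Dn.T * + 1 * + 1 * (ε * GGG * tm ^ h) ≡⟨ l₄ (Γb h) Dm.T Dn.T ε (Γb b₁) (Γb b₂) (Γb b₃) (tm ^ h) ⟩
          (Γb h * Γb h * ε) * (Γb b₁ * (Γb b₂ * Dm.T) * (Γb b₃ * Dn.T) * tm ^ h) ≈⟨ *-modʳ (Γb b₁ * (Γb b₂ * Dm.T) * (Γb b₃ * Dn.T) * tm ^ h) square ⟩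
          + 1 * (Γb b₁ * (Γb b₂ * Dm.T) * (Γb b₃ * Dn.T) * tm ^ h) ≡⟨ ℤ.*-identityˡ _ ⟩
          Γb b₁ * (Γb b₂ * Dm.T) * (Γb b₃ * Dn.T) * tm ^ h ∎

      private
        -- Hermite's identity: summing floors amounts to summing the (permuted) residues
        floor-sum : ∀ N .{{_ : NonZero N}} (x y : ℕ → ℕ) (w : ℤ) (Φ : ℕ → ℤ) b b′ →
          (∀ j → + x j + w ≡ + y j + Φ j * + (N ℕ.* q)) →
          ∑ N (λ j → + x j) ≡ ∑ N (λ i → + (b ℕ.+ q ℕ.* i)) → ∑ N (λ j → + y j) ≡ ∑ N (λ i → + (b′ ℕ.+ q ℕ.* i)) →
          + b + w ≡ + b′ + ∑ N Φ * + q
        floor-sum N@(suc _) x y w Φ b b′ each sx sy = ℤ.*-cancelˡ-≡ (+ N) _ _ (cancelʳ (begin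
          + N * (+ b + w) + S                  ≡⟨ l₁ (+ N) (+ b) w S ⟩
          (+ N * + b + S) + + N * w          ≡⟨ cong₂ _+_ (sym (trans sx (arith b))) (sym (∑-const N w)) ⟩
          ∑ N (λ j → + x j) + ∑ N (λ _ → w)        ≡⟨ sym (∑-+ N (λ j → + x j) (λ _ → w)) ⟩
          ∑ N (λ j → + x j + w)                    ≡⟨ ∑-ext N each ⟩
          ∑ N (λ j → + y j + Φ j * + (N ℕ.* q))  ≡⟨ ∑-+ N (λ j → + y j) (λ j → Φ j * + (N ℕ.* q)) ⟩
          ∑ N (λ j → + y j) + ∑ N (λ j → Φ j * + (N ℕ.* q)) ≡⟨ cong₂ _+_ (trans sy (arith b′)) (trans (sym (∑-*ʳ N (+ (N ℕ.* q)) Φ)) (cong (∑ N Φ *_) (ℤ.pos-* N q))) ⟩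
          (+ N * + b′ + S) + ∑ N Φ * (+ N * + q) ≡⟨ l₂ (+ N) (+ b′) S (∑ N Φ) (+ q) ⟩
          + N * (+ b′ + ∑ N Φ * + q) + S     ∎))
          where
          open ≡-Reasoning
          S = ∑ N (λ i → + q * + i)
          cancelʳ : ∀ {x y} → x + S ≡ y + S → x ≡ y
          cancelʳ {x} {y} e = trans (l₀ x S) (trans (cong (_- S) e) (sym (l₀ y S)))
            where
            l₀ : ∀ x s → x ≡ x + s - s
            l₀ = ℤ.solve-∀
          arith : ∀ b → ∑ N (λ i → + (b ℕ.+ q ℕ.* i)) ≡ + N * + b + S
          arith b = trans (∑-ext N (λ i → trans (ℤ.pos-+ b (q ℕ.* i)) (cong (λ z → + b + z) (ℤ.pos-* q i))))
            (trans (∑-+ N (λ _ → + b) (λ i → + q * + i)) (cong (_+ S) (∑-const N (+ b))))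
          l₁ : ∀ N b w S → N * (b + w) + S ≡ (N * b + S) + N * w
          l₁ = ℤ.solve-∀
          l₂ : ∀ N b S F q → (N * b + S) + F * (N * q) ≡ N * (b + F * q) + S
          l₂ = ℤ.solve-∀

        F₁ : ℤ
        F₁ = floorℚ (frac half ℚ.- α)

        F₂ F₃ : ℕ → ℤ
        F₂ j = floorℚ (frac (tp j) ℚ.- α)
        F₃ j = floorℚ (frac (ℚ.- bp j) ℚ.+ α)

        F₁-eq : v₁ ≡ + b₁ + F₁ * + q
        F₁-eq = floor-isFrac q (isFrac-+ q (subst (λ z → IsFrac (frac half) (+ z) q) (modℤ-small h<q) (isFrac-frac q half-frac)) (isFrac-neg q α-frac₁))

        floor-step : ∀ r {v w r′} D .{{_ : NonZero D}} → IsFrac r v D → IsFrac r′ w D →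
          + modℤ v D + w ≡ + modℤ (v + w) D + floorℚ (frac r ℚ.+ r′) * + D
        floor-step r {v} {w} {r′} D f f′ = trans (floor-isFrac D (isFrac-+ D (isFrac-frac D f) f′))
          (cong (λ z → + z + floorℚ (frac r ℚ.+ r′) * + D) (modℤ-cong (+-mod (modℤ-≈ v) (≈-refl {x = w}))))

        F₂-eq : v₂ ≡ + b₂ + ∑ m F₂ * + q
        F₂-eq = floor-sum m (λ j → modℤ (+ h + + j * + q) (m ℕ.* q)) (λ j → modℤ (v₂ + + j * + q) (m ℕ.* q)) (- (+ a * + m)) F₂ h b₂
          (λ j → trans (floor-step (tp j) (m ℕ.* q) (tp-frac j) (isFrac-neg (m ℕ.* q) (α-frac m)))
                   (cong (λ z → + modℤ z (m ℕ.* q) + F₂ j * + (m ℕ.* q)) (lem (+ h) (+ j * + q) (+ a * + m))))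
          (Cycle∑.cycle-q m q (+ h) (+ 0) h h<q h-split (λ i → + i)) (Cycle∑.cycle-q m q v₂ _ b₂ b₂<q (split v₂) (λ i → + i))
          where
          lem : ∀ h x y → h + x + - y ≡ h - y + x
          lem = ℤ.solve-∀

        F₃-eq : v₃ ≡ + b₃ + ∑ n F₃ * + q
        F₃-eq = trans (sym (ℤ.+-identityˡ v₃)) (floor-sum n (λ j → modℤ (+ 0 - + j * + q) (n ℕ.* q)) (λ j → modℤ (v₃ - + j * + q) (n ℕ.* q)) v₃ F₃ 0 b₃
          (λ j → trans (floor-step (ℚ.- bp j) (n ℕ.* q) (bp-frac⁻ j) (α-frac n))
                   (cong (λ z → + modℤ z (n ℕ.* q) + F₃ j * + (n ℕ.* q)) (lem (+ j * + q) v₃)))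
          (Cycle∑.cycle-q⁻ n q (+ 0) (+ 0) 0 0<q 0-split (λ i → + i)) (Cycle∑.cycle-q⁻ n q v₃ _ b₃ b₃<q (split v₃) (λ i → + i)))
          where
          lem : ∀ x v → + 0 - x + v ≡ v - x
          lem = ℤ.solve-∀

      exponent : ℤ
      exponent = sumℤ (map (expo p k a) ps)

      private
        exponent-split : exponent ≡ - (F₁ + ∑ m F₂ + ∑ n F₃)
        exponent-split = begin
          expo p k a (half , bp 0) + sumℤ (map (expo p k a) (zip (applyUpTo tp m) (applyUpTo (bp ∘ suc) m)))
            ≡⟨ cong (λ z → expo p k a (half , bp 0) + z) (sum-zip (expo p k a) tp (bp ∘ suc) m) ⟩
          expo p k a (half , bp 0) + ∑ m (λ j → - F₂ j - F₃ (suc j))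
            ≡⟨ cong (λ z → expo p k a (half , bp 0) + z) (trans (∑-ext m (λ j → l₀ (F₂ j) (F₃ (suc j)))) (trans (sym (∑-*ˡ m -1ℤ (λ j → F₂ j + F₃ (suc j)))) (cong (-1ℤ *_) (∑-+ m F₂ (F₃ ∘ suc))))) ⟩
          (- F₁ - F₃ 0) + -1ℤ * (∑ m F₂ + ∑ m (F₃ ∘ suc))
            ≡⟨ l₁ F₁ (F₃ 0) (∑ m F₂) (∑ m (F₃ ∘ suc)) ⟩
          - (F₁ + ∑ m F₂ + (F₃ 0 + ∑ m (F₃ ∘ suc)))
            ≡⟨ cong (λ z → - (F₁ + ∑ m F₂ + z)) (sym (∑-head m F₃)) ⟩
          - (F₁ + ∑ m F₂ + ∑ n F₃) ∎
          where
          open ≡-Reasoning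
          l₀ : ∀ x y → - x - y ≡ (- + 1) * (x + y)
          l₀ = ℤ.solve-∀
          l₁ : ∀ f g x y → (- f - g) + (- + 1) * (x + y) ≡ - (f + x + (g + y))
          l₁ = ℤ.solve-∀

        -- The numerators v₁, v₂, v₃ add up to 2h = q, so the sum of the floors is determined by the
        -- sum of their residues.
        exponent-q : (exponent + + 1) * + q ≡ + (b₃ ℕ.+ (b₂ ℕ.+ b₁))
        exponent-q = begin
          (exponent + + 1) * + q         ≡⟨ cong (λ z → (z + + 1) * + q) exponent-split ⟩
          (- (F₁ + ∑ m F₂ + ∑ n F₃) + + 1) * + q
            ≡⟨ l₁ F₁ (∑ m F₂) (∑ n F₃) (+ q) (+ b₁) (+ b₂) (+ b₃) ⟩
          (+ q - ((+ b₁ + F₁ * + q) + (+ b₂ + ∑ m F₂ * + q) + (+ b₃ + ∑ n F₃ * + q))) + (+ b₃ + (+ b₂ + + b₁))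
            ≡⟨ cong (λ z → (+ q - z) + (+ b₃ + (+ b₂ + + b₁))) (trans (cong₂ _+_ (cong₂ _+_ (sym F₁-eq) (sym F₂-eq)) (sym F₃-eq)) (trans (l₂ (+ h) (+ a) (+ m)) (trans (sym (ℤ.pos-+ h h)) (cong +_ (sym q≡h+h))))) ⟩
          (+ q - + q) + (+ b₃ + (+ b₂ + + b₁)) ≡⟨ trans (cong (_+ (+ b₃ + (+ b₂ + + b₁))) (ℤ.+-inverseʳ (+ q))) (ℤ.+-identityˡ _) ⟩
          + (b₃ ℕ.+ (b₂ ℕ.+ b₁)) ∎
          where
          open ≡-Reasoning
          l₁ : ∀ x y z q a b c → (- (x + y + z) + + 1) * q ≡ (q - ((a + x * q) + (b + y * q) + (c + z * q))) + (c + (b + a))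
          l₁ = ℤ.solve-∀
          l₂ : ∀ h a m → (h - a) + (h - a * m) + a * (+ 1 + m) ≡ h + h
          l₂ = ℤ.solve-∀

      -- The integer exponent + 1 is nonnegative because q times it is a sum of residues. The same s
      -- governs the power of -p in the Jacobi sum formula.
      exponent-value : Σ[ s ∈ ℕ ] (b₃ ℕ.+ (b₂ ℕ.+ b₁) ≡ s ℕ.* q × exponent ≡ + s - + 1)
      exponent-value = go (exponent + + 1) refl
        where
        lem : ∀ e → e ≡ (e + + 1) - + 1
        lem = ℤ.solve-∀
        absurd : ∀ e {q′ x} .{{_ : NonZero q′}} → -[1+ e ] * + q′ ≢ + x
        absurd e {suc q′} ()
        go : ∀ x → x ≡ exponent + + 1 → Σ[ s ∈ ℕ ] (b₃ ℕ.+ (b₂ ℕ.+ b₁) ≡ s ℕ.* q × exponent ≡ + s - + 1)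
        go (+ s) e = s , ℤ.+-injective (trans (sym exponent-q) (trans (cong (_* + q) (sym e)) (sym (ℤ.pos-* s q)))) , trans (lem exponent) (cong (_- + 1) (sym e))
        go -[1+ s ] e = ⊥-elim (absurd s {q} (trans (cong (_* + q) e) exponent-q))

      scaled-value : scaledPow p (length (topParams n)) exponent ≡ - (+ (p ℕ.^ m) * (- + p) ^ proj₁ exponent-value)
      scaled-value = trans (cong₂ (scaledPow p) (cong suc (length-applyUpTo tp m)) (proj₂ (proj₂ exponent-value))) (scaledPow-≡ m (proj₁ exponent-value))

-- Orthogonality, the roots of f_t and the trivial characters.

module PointCount where

  open BigOperators
  open Congruences
  open Residues
  open MoritaGamma
  open Fractions
  open Parameters
  open JacobiSums
  open import Defs
  open import Data.Bool using (Bool; true; false; if_then_else_; T)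
  open import Data.Bool.ListAction using (any)
  open import Data.List using (_∷_; map; applyUpTo; upTo; filterᵇ; length)
  open import Data.List.Properties using (length-applyUpTo)
  import Data.List.Relation.Unary.Any.Properties as Any
  open import Data.Nat as ℕ using (ℕ; zero; suc; z≤n; s≤s)
  import Data.Nat.Properties as ℕ
  import Data.Nat.DivMod as ℕ
  import Data.Nat.Divisibility as ℕ
  open import Data.Nat.Primality using (Prime)
  import Data.Nat.Tactic.RingSolver as ℕ
  open import Data.Integer as ℤ using (ℤ; +_; _+_; _*_; -_; _-_; _^_)
  import Data.Integer.Properties as ℤ
  import Data.Integer.Tactic.RingSolver as ℤ
  open import Data.Product using (_,_; proj₁; proj₂)
  open import Data.Sum using (inj₁; inj₂; [_,_]′)
  open import Data.Empty using (⊥; ⊥-elim)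
  open import Data.Unit using (tt)
  open import Function using (_∘_; id)
  open import Relation.Nullary using (Dec; yes; no; ¬_)
  open import Relation.Binary.PropositionalEquality hiding (J)

  ≡ᵇ-no : ∀ {a b} → a ≢ b → (a ℕ.≡ᵇ b) ≡ false
  ≡ᵇ-no {a} {b} ne with a ℕ.≡ᵇ b in e
  ... | false = refl
  ... | true = ⊥-elim (ne (ℕ.≡ᵇ⇒≡ a b (subst T (sym e) tt)))

  ≡ᵇ-yes : ∀ {a b} → a ≡ b → (a ℕ.≡ᵇ b) ≡ true
  ≡ᵇ-yes {a} refl with a ℕ.≡ᵇ a in e
  ... | true = refl
  ... | false = ⊥-elim (subst T e (ℕ.≡⇒≡ᵇ a a refl))

  sum-filter : ∀ (G : ℕ → ℤ) (B : ℕ → Bool) f N →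
    sumℤ (map G (filterᵇ B (applyUpTo f N))) ≡ ∑ N (λ j → if B (f j) then G (f j) else + 0)
  sum-filter G B f zero = refl
  sum-filter G B f (suc N) = trans (split (B (f 0)) refl) (sym (∑-head N (λ j → if B (f j) then G (f j) else + 0)))
    where
    rest = ∑ N (λ j → if B (f (suc j)) then G (f (suc j)) else + 0)
    split : ∀ b → B (f 0) ≡ b → sumℤ (map G (filterᵇ B (f 0 ∷ applyUpTo (f ∘ suc) N))) ≡ (if B (f 0) then G (f 0) else + 0) + rest
    split true e rewrite e = cong (_+_ (G (f 0))) (sum-filter G B (f ∘ suc) N)
    split false e rewrite e = trans (sum-filter G B (f ∘ suc) N) (sym (ℤ.+-identityˡ rest))

  module Main (p q h : ℕ) (pr : Prime p) (p≡1+q : p ≡ suc q) (q≡h+h : q ≡ h ℕ.+ h) (κ : ℕ) where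

    open OddPrime p q h pr p≡1+q q≡h+h
    open Characters κ
    open PadicGamma p q h pr p≡1+q q≡h+h κ using (k; Γb; unit-q)
    open GammaAtRational p q h pr p≡1+q q≡h+h κ using (invMod-≈)
    open GaussSums ℚ-field p q h pr p≡1+q q≡h+h κ using (J; jacobi-Γ; η)
    open Terms p q h pr p≡1+q q≡h+h κ using (module Term)

    -- Euler's criterion at the level of Teichmüller lifts. A witness y of the search gives τ(y)^q ≡
    -- 1; a failed search is the case of `nonsquare`, and τ fixes -1.
    φ-τ : ∀ x → φ p x ≈[ P ] τ x ^ h
    φ-τ x with modℤ x p ℕ.≟ 0
    ... | yes e = ≈-trans (≡⇒≈ (cong (λ b → if b then + 0 else (if any (λ y → modℕ (y ℕ.* y) p ℕ.≡ᵇ modℤ x p) (upTo p) then + 1 else -1ℤ)) (≡ᵇ-yes e))) (≈-sym (τ^-zero h 1≤h (≈-trans (≈-sym (modℤ-≈ x)) (≡⇒≈ (cong +_ e)))))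
    ... | no ne = ≈-trans (≡⇒≈ (cong (λ b → if b then + 0 else (if any test (upTo p) then + 1 else -1ℤ)) (≡ᵇ-no ne))) (go (any test (upTo p)) refl)
      where
      test : ℕ → Bool
      test y = modℕ (y ℕ.* y) p ℕ.≡ᵇ modℤ x p
      ux : Unit x
      ux z = ne (modℤ-eq (ℕ.>-nonZero⁻¹ p) z)
      go : ∀ b → any test (upTo p) ≡ b → (if any test (upTo p) then + 1 else -1ℤ) ≈[ P ] τ x ^ h
      go true e rewrite e with Any.applyUpTo⁻ id (Any.any⁻ test (upTo p) (subst T (sym e) tt))
      ... | y , y<p , ty = ≈-sym (≈-trans (^-mod h (τ-resp (≈-sym square)))
            (≈-trans (≡⇒≈ (trans (cong (_^ h) (τ-* (+ y) (+ y))) (trans (*-^ (τ (+ y)) (τ (+ y)) h) (trans (sym (ℤ.^-distribˡ-+-* (τ (+ y)) h h)) (cong (τ (+ y) ^_) (sym q≡h+h)))))) (τ-q uy)))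
        where
        square : + y * + y ≈[ p ] x
        square = ≈-trans (≡⇒≈ (sym (ℤ.pos-* y y))) (modℤ-inv (ℕ.≡ᵇ⇒≡ _ _ ty))
        uy : Unit (+ y)
        uy z = ux (≈-trans (≈-sym square) (*-zero-mod (+ y) z))
      go false e rewrite e = ≈-sym (≈-trans (≡⇒≈ (sym (τ-^ x h))) (≈-trans (τ-resp (nonsquare x ux none)) (≡⇒≈ τ--1)))
        where
        none : ∀ y → y ℕ.< p → ¬ (+ y * + y ≈[ p ] x)
        none y y<p s = subst T e (Any.any⁺ test (Any.applyUpTo⁺ id (ℕ.≡⇒≡ᵇ _ _ (modℤ-cong (≈-trans (≡⇒≈ (ℤ.pos-* y y)) s))) y<p))

    -- The quotients serve as the offsets that `τ^-cong` needs to compare exponents within ℕ.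
    mod-q : ∀ x y → + x ≈[ q ] + y → x ℕ.+ (y ℕ./ q) ℕ.* q ≡ y ℕ.+ (x ℕ./ q) ℕ.* q
    mod-q x y e = begin
      x ℕ.+ (y ℕ./ q) ℕ.* q                           ≡⟨ cong (ℕ._+ (y ℕ./ q) ℕ.* q) (ℕ.m≡m%n+[m/n]*n x q) ⟩
      x ℕ.% q ℕ.+ (x ℕ./ q) ℕ.* q ℕ.+ (y ℕ./ q) ℕ.* q ≡⟨ cong (λ r → r ℕ.+ (x ℕ./ q) ℕ.* q ℕ.+ (y ℕ./ q) ℕ.* q) same ⟩
      y ℕ.% q ℕ.+ (x ℕ./ q) ℕ.* q ℕ.+ (y ℕ./ q) ℕ.* q ≡⟨ lem (y ℕ.% q) ((x ℕ./ q) ℕ.* q) ((y ℕ./ q) ℕ.* q) ⟩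
      y ℕ.% q ℕ.+ (y ℕ./ q) ℕ.* q ℕ.+ (x ℕ./ q) ℕ.* q ≡⟨ cong (ℕ._+ (x ℕ./ q) ℕ.* q) (sym (ℕ.m≡m%n+[m/n]*n y q)) ⟩
      y ℕ.+ (x ℕ./ q) ℕ.* q                           ∎
      where
      open ≡-Reasoning
      lem : ∀ a b c → a ℕ.+ b ℕ.+ c ≡ a ℕ.+ c ℕ.+ b
      lem = ℕ.solve-∀
      rem : ∀ z → + (z ℕ.% q) ≈[ q ] + z
      rem z = ≈-sym (by (+ (z ℕ./ q)) (trans (cong +_ (ℕ.m≡m%n+[m/n]*n z q)) (trans (ℤ.pos-+ (z ℕ.% q) _) (cong (_+_ (+ (z ℕ.% q))) (trans (cong +_ (ℕ.*-comm (z ℕ./ q) q)) (ℤ.pos-* q (z ℕ./ q)))))))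
      same : x ℕ.% q ≡ y ℕ.% q
      same = residue-unique {q} (ℕ.m%n<n x q) (ℕ.m%n<n y q) (≈-trans (rem x) (≈-trans e (≈-sym (rem y))))

    τ^-mod-unit : ∀ {x} m m′ → Unit x → + m ≈[ q ] + m′ → τ x ^ m ≈[ P ] τ x ^ m′
    τ^-mod-unit m m′ ux e = τ^-cong-unit m m′ (m′ ℕ./ q) (m ℕ./ q) ux (mod-q m m′ e)

    τ^-mod : ∀ x m m′ → 1 ℕ.≤ m → 1 ℕ.≤ m′ → + m ≈[ q ] + m′ → τ x ^ m ≈[ P ] τ x ^ m′
    τ^-mod x m m′ 1≤m 1≤m′ e = τ^-cong x m m′ (m′ ℕ./ q) (m ℕ./ q) 1≤m 1≤m′ (mod-q m m′ e)

    +q≡ : + q ≡ + h + + h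
    +q≡ = trans (cong +_ q≡h+h) (ℤ.pos-+ h h)

    -- With y = -u, the condition ν (u-1) y^m = 1 is f_t(u) = 0 up to unit factors.
    module Roots (n m t : ℕ) (n≡1+m : n ≡ suc m) (um : Unit (+ m)) (un : Unit (+ n)) (ut : Unit (+ t))
      (m̂ t̂ : ℤ) (mm̂ : + m * m̂ ≈[ p ] + 1) (tt̂ : + t * t̂ ≈[ p ] + 1) (x : ℕ) where

      ν′ A : ℤ
      ν′ = -1ℤ ^ n * (+ n) ^ n * m̂ ^ m * t̂
      A = ν′ * + x * (- + suc x) ^ m

      private
        u w mt N : ℤ
        u = + suc x
        N = + (n ℕ.^ n)
        w = invMod p 1 N
        mt = + (m ℕ.^ m ℕ.* t)

        unit-N : Unit N
        unit-N = subst Unit (sym (pos-^ n n)) (unit-^ n un)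

        mt≡ : mt ≡ (+ m) ^ m * + t
        mt≡ = trans (ℤ.pos-* (m ℕ.^ m) t) (cong (_* + t) (pos-^ m m))

        unit-mt : Unit mt
        unit-mt = subst Unit (sym mt≡) (unit-* (unit-^ m um) ut)

        Nw : N * w ≈[ p ] + 1
        Nw = subst (λ z → N * w ≈[ z ] + 1) (ℕ.*-identityʳ p) (GammaAtRational.invMod-≈ p q h pr p≡1+q q≡h+h 0 N unit-N)

        n∸1 : n ℕ.∸ 1 ≡ m
        n∸1 = cong (ℕ._∸ 1) n≡1+m

        f-form : f p n t u ≡ u * u ^ m - u ^ m + mt * w
        f-form = cong₂ _+_ (cong₂ _-_ (cong (u ^_) n≡1+m) (cong (u ^_) n∸1)) (cong (λ e → + (e ℕ.^ e ℕ.* t) * w) n∸1)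

        V : ℤ
        V = N * (u ^ m * + x)

        scaled-f : N * f p n t u ≈[ p ] V + mt
        scaled-f = ≈-trans (≡⇒≈ (trans (cong (N *_) f-form) (l₁ N (+ x) (u ^ m) mt w)))
          (+-mod (≈-refl {x = V}) (≈-trans (*-modˡ mt Nw) (≡⇒≈ (ℤ.*-identityʳ mt))))
          where
          l₁ : ∀ N x um mt w → N * ((+ 1 + x) * um - um + mt * w) ≡ N * (um * x) + mt * (N * w)
          l₁ = ℤ.solve-∀

        A-form : A * mt ≡ - (-1ℤ ^ m * -1ℤ ^ m * V) * ((+ m) ^ m * m̂ ^ m) * (+ t * t̂)
        A-form = trans (cong₂ (λ a b → a * + x * (- u) ^ m * b) (cong₂ (λ a b → a * b * m̂ ^ m * t̂) (cong (-1ℤ ^_) n≡1+m) (sym (pos-^ n n))) mt≡)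
          (trans (cong (λ a → -1ℤ * -1ℤ ^ m * N * m̂ ^ m * t̂ * + x * a * ((+ m) ^ m * + t)) (trans (cong (_^ m) (sym (ℤ.-1*i≡-i u))) (*-^ -1ℤ u m)))
            (trans (cong (_* ((+ m) ^ m * + t)) (trans (l₂ (-1ℤ * -1ℤ ^ m * N) (m̂ ^ m) t̂ (+ x) (-1ℤ ^ m * u ^ m)) (cong (_* (m̂ ^ m * t̂)) (l₃ (-1ℤ ^ m) N (+ x) (u ^ m)))))
              (l₄ (- (-1ℤ ^ m * -1ℤ ^ m * V)) (m̂ ^ m) t̂ ((+ m) ^ m) (+ t))))
          where
          l₂ : ∀ c mh th x w → c * mh * th * x * w ≡ c * (x * w) * (mh * th)
          l₂ = ℤ.solve-∀
          l₃ : ∀ s N x um → (- + 1) * s * N * (x * (s * um)) ≡ - (s * s * (N * (um * x)))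
          l₃ = ℤ.solve-∀
          l₄ : ∀ d mh th mm t → d * (mh * th) * (mm * t) ≡ d * (mm * mh) * (t * th)
          l₄ = ℤ.solve-∀

        scaled-A : A * mt ≈[ p ] - V
        scaled-A = ≈-trans (≡⇒≈ A-form) (≈-trans (*-mod (*-mod (≡⇒≈ (cong (λ z → - (z * V)) (trans (sym (ℤ.^-distribˡ-+-* -1ℤ m m)) (-1^-even m))))
          (≈-trans (≡⇒≈ (sym (*-^ (+ m) m̂ m))) (≈-trans (^-mod m mm̂) (≡⇒≈ (ℤ.^-zeroˡ m))))) tt̂) (≡⇒≈ (l₃ V)))
          where
          l₃ : ∀ z → - (+ 1 * z) * + 1 * + 1 ≡ - z
          l₃ = ℤ.solve-∀

        balance : N * f p n t u ≈[ p ] mt * (+ 1 - A)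
        balance = ≈-trans scaled-f (≈-trans (≡⇒≈ (l₁ V mt)) (≈-trans (-‿mod (≈-refl {x = mt}) (≈-sym scaled-A)) (≡⇒≈ (l₂ mt A))))
          where
          l₁ : ∀ z t → z + t ≡ t - - z
          l₁ = ℤ.solve-∀
          l₂ : ∀ t a → t - a * t ≡ t * (+ 1 - a)
          l₂ = ℤ.solve-∀

      root⇒ : f p n t (+ suc x) ≈[ p ] + 0 → A ≈[ p ] + 1
      root⇒ z = [_,_]′ (λ bad → ⊥-elim (unit-mt bad)) (λ e → ≈-sym (minus-zero e))
        (euclid mt (+ 1 - A) (≈-trans (≈-sym balance) (*-zero-mod N z)))

      ⇒root : A ≈[ p ] + 1 → f p n t (+ suc x) ≈[ p ] + 0
      ⇒root e = [_,_]′ (λ bad → ⊥-elim (unit-N bad)) id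
        (euclid N (f p n t (+ suc x)) (≈-trans balance (*-zero-mod mt (zero-minus (≈-sym e)))))

    module Theorem (m′ : ℕ) (um : Unit (+ suc m′)) (un : Unit (+ suc (suc m′))) (t : ℕ) (ut : Unit (+ t))
      (m̂ t̂ : ℤ) (mm̂ : + suc m′ * m̂ ≈[ p ] + 1) (tt̂ : + t * t̂ ≈[ p ] + 1) where

      m n : ℕ
      m = suc m′
      n = suc m

      -- This is (-n)^n / (m^m t). Inverses modulo p suffice, since ν is only seen through τ.
      ν : ℤ
      ν = -1ℤ ^ n * (+ n) ^ n * m̂ ^ m * t̂

      inverse-unit : ∀ x y → x * y ≈[ p ] + 1 → Unit y
      inverse-unit x y e z = unit-1 (≈-trans (≈-sym e) (*-zero-mod x z))

      τ-inverse : ∀ x y → x * y ≈[ p ] + 1 → τ x * τ y ≈[ P ] + 1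
      τ-inverse x y e = ≈-trans (≡⇒≈ (sym (τ-* x y))) (≈-trans (τ-resp e) (≡⇒≈ τ-1))

      τν : ∀ a → τ ν ^ a ≡ -1ℤ ^ (a ℕ.* n) * τ t̂ ^ a * (τ m̂ ^ (a ℕ.* m) * τ (+ n) ^ (a ℕ.* n))
      τν a = begin
        τ ν ^ a ≡⟨ cong (_^ a) (trans (τ-* (-1ℤ ^ n * (+ n) ^ n * m̂ ^ m) t̂) (cong (_* τ t̂) (trans (τ-* (-1ℤ ^ n * (+ n) ^ n) (m̂ ^ m)) (cong₂ _*_ (trans (τ-* (-1ℤ ^ n) ((+ n) ^ n)) (cong₂ _*_ (trans (τ-^ -1ℤ n) (cong (_^ n) τ--1)) (τ-^ (+ n) n))) (τ-^ m̂ m))))) ⟩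
        (-1ℤ ^ n * τ (+ n) ^ n * τ m̂ ^ m * τ t̂) ^ a ≡⟨ trans (*-^ (-1ℤ ^ n * τ (+ n) ^ n * τ m̂ ^ m) (τ t̂) a) (cong (_* τ t̂ ^ a) (trans (*-^ (-1ℤ ^ n * τ (+ n) ^ n) (τ m̂ ^ m) a) (cong₂ _*_ (trans (*-^ (-1ℤ ^ n) (τ (+ n) ^ n) a) (cong₂ _*_ (flip -1ℤ n) (flip (τ (+ n)) n))) (flip (τ m̂) m)))) ⟩
        -1ℤ ^ (a ℕ.* n) * τ (+ n) ^ (a ℕ.* n) * τ m̂ ^ (a ℕ.* m) * τ t̂ ^ a ≡⟨ lem (-1ℤ ^ (a ℕ.* n)) (τ (+ n) ^ (a ℕ.* n)) (τ m̂ ^ (a ℕ.* m)) (τ t̂ ^ a) ⟩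
        -1ℤ ^ (a ℕ.* n) * τ t̂ ^ a * (τ m̂ ^ (a ℕ.* m) * τ (+ n) ^ (a ℕ.* n)) ∎
        where
        open ≡-Reasoning
        flip : ∀ x e → (x ^ e) ^ a ≡ x ^ (a ℕ.* e)
        flip x e = trans (ℤ.^-*-assoc x e a) (cong (x ^_) (ℕ.*-comm e a))
        lem : ∀ x y z w → x * y * z * w ≡ x * w * (z * y)
        lem = ℤ.solve-∀

      term : ℕ → ℤ
      term a = sgnPow (a ℕ.* length (topParams n)) * omegaBarPowMod p k a t
               * scaledPow p (length (topParams n)) (Term.exponent m′ um un a) * Term.R m′ um un a

      Jₐ : ℕ → ℤ
      Jₐ a = J (a ℕ.+ h) (a ℕ.* m ℕ.+ h) (+ 1)

      -- The complements q - b₁ and q - b₂ are a + h and am + h modulo q, so the gamma values and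
      -- (-p)^s form a Jacobi sum. The powers of τ(m), τ(n) and τ(t) combine to τ(ν)^a. Adding h to
      -- the exponents keeps them positive.
      term-value : ∀ a → term a ≈[ P ] - (-1ℤ ^ h * + (p ℕ.^ m)) * (τ ν ^ a * Jₐ a)
      term-value a = begin
        term a ≡⟨ cong₂ (λ x y → x * omegaBarPowMod p k a t * y * R) (trans (sgnPow-^ (a ℕ.* length (topParams n))) (cong (λ z → -1ℤ ^ (a ℕ.* suc z)) (length-applyUpTo tp m))) scaled-value ⟩
        S * omegaBarPowMod p k a t * - (pm * (- + p) ^ s) * R
          ≈⟨ *-mod (*-modʳ (- (pm * (- + p) ^ s)) (*-modˡ S (^-mod a bar))) R-value ⟩
        S * τ t̂ ^ a * - (pm * (- + p) ^ s) * (- (-1ℤ ^ h) * (Γb b₁ * Γb b₂ * Γb b₃) * (τ (+ m) ^ (h ℕ.+ b₂) * τ (+ n) ^ b₃))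
          ≡⟨ lem S (τ t̂ ^ a) pm ((- + p) ^ s) (-1ℤ ^ h) (Γb b₁ * Γb b₂ * Γb b₃) (τ (+ m) ^ (h ℕ.+ b₂) * τ (+ n) ^ b₃) ⟩
        - (-1ℤ ^ h * pm) * (S * τ t̂ ^ a * (τ (+ m) ^ (h ℕ.+ b₂) * τ (+ n) ^ b₃) * - (Γb b₁ * Γb b₂ * Γb b₃ * (- + p) ^ s))
          ≈⟨ *-modˡ (- (-1ℤ ^ h * pm)) (*-mod (*-modˡ (S * τ t̂ ^ a) (*-mod m-power n-power)) (≈-trans (≈-sym (jacobi-Γ b₁ b₂ b₃ s b₁<q b₂<q b₃<q (proj₁ (proj₂ exponent-value)))) J-exponents)) ⟩
        - (-1ℤ ^ h * pm) * (S * τ t̂ ^ a * (τ m̂ ^ (a ℕ.* m) * τ (+ n) ^ (a ℕ.* n)) * Jₐ a)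
          ≡⟨ cong (λ z → - (-1ℤ ^ h * pm) * (z * Jₐ a)) (sym (τν a)) ⟩
        - (-1ℤ ^ h * pm) * (τ ν ^ a * Jₐ a) ∎
        where
        open ≈-Reasoning P
        open Term m′ um un a hiding (m; n)
        S = -1ℤ ^ (a ℕ.* n)
        pm = + (p ℕ.^ m)
        s = proj₁ exponent-value
        lem : ∀ S t pm e ε G x → S * t * - (pm * e) * (- ε * G * x) ≡ - (ε * pm) * (S * t * x * - (G * e))
        lem = ℤ.solve-∀
        bar : invMod p k (omegaMod p k t) ≈[ P ] τ t̂
        bar = cancel-unit k {τ (+ t)} (τ-unit ut) (≈-trans (invMod-≈ (τ (+ t)) (τ-unit ut)) (≈-sym (τ-inverse (+ t) t̂ tt̂)))
        q≈0 : + q ≈[ q ] + 0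
        q≈0 = ≈-trans (≡⇒≈ (sym (ℤ.*-identityʳ (+ q)))) (m≈0 (+ 1))
        n-power : τ (+ n) ^ b₃ ≈[ P ] τ (+ n) ^ (a ℕ.* n)
        n-power = τ^-mod-unit b₃ (a ℕ.* n) un (≈-trans b₃≈ (≡⇒≈ (sym (ℤ.pos-* a n))))
        m-power : τ (+ m) ^ (h ℕ.+ b₂) ≈[ P ] τ m̂ ^ (a ℕ.* m)
        m-power = cancel-unit k {τ (+ m) ^ (a ℕ.* m)} (unit-^ (a ℕ.* m) (τ-unit um)) (≈-trans
            (≈-trans (≡⇒≈ (sym (ℤ.^-distribˡ-+-* (τ (+ m)) (a ℕ.* m) (h ℕ.+ b₂)))) (τ^-mod-unit (a ℕ.* m ℕ.+ (h ℕ.+ b₂)) 0 um total))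
            (≈-sym (≈-trans (≡⇒≈ (sym (*-^ (τ (+ m)) (τ m̂) (a ℕ.* m)))) (≈-trans (^-mod (a ℕ.* m) (τ-inverse (+ m) m̂ mm̂)) (≡⇒≈ (ℤ.^-zeroˡ (a ℕ.* m)))))))
          where
          l : ∀ x h → x + (h + (h - x)) ≡ h + h
          l = ℤ.solve-∀
          total : + (a ℕ.* m ℕ.+ (h ℕ.+ b₂)) ≈[ q ] + 0
          total = ≈-trans (+-mod (≡⇒≈ (ℤ.pos-* a m)) (+-mod (≈-refl {x = + h}) b₂≈)) (≈-trans (≡⇒≈ (trans (l (+ a * + m) (+ h)) (sym +q≡))) q≈0)
        complement : ∀ b v → b ℕ.< q → + b ≈[ q ] + h - v → + (q ℕ.∸ b) ≈[ q ] v + + h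
        complement b v b<q e = ≈-trans (≡⇒≈ (sym (trans (ℤ.[+m]-[+n]≡m⊖n q b) (ℤ.⊖-≥ (ℕ.<⇒≤ b<q))))) (≈-trans (-‿mod (≡⇒≈ +q≡) e) (≡⇒≈ (l (+ h) v)))
          where
          l : ∀ h v → h + h - (h - v) ≡ v + h
          l = ℤ.solve-∀
        J-exponents : J (q ℕ.∸ b₁) (q ℕ.∸ b₂) (+ 1) ≈[ P ] Jₐ a
        J-exponents = ∑-mod p (λ x _ → *-mod (τ^-mod (+ x) (q ℕ.∸ b₁) (a ℕ.+ h) (ℕ.m<n⇒0<n∸m b₁<q) (ℕ.≤-trans 1≤h (ℕ.m≤n+m h a)) (≈-trans (complement b₁ (+ a) b₁<q b₁≈) (≡⇒≈ (sym (ℤ.pos-+ a h)))))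
          (∑-mod p (λ y _ → *-modʳ (η (+ x + + y + + 1)) (τ^-mod (+ y) (q ℕ.∸ b₂) (a ℕ.* m ℕ.+ h) (ℕ.m<n⇒0<n∸m b₂<q) (ℕ.≤-trans 1≤h (ℕ.m≤n+m h (a ℕ.* m)))
            (≈-trans (complement b₂ (+ a * + m) b₂<q b₂≈) (≡⇒≈ (trans (cong (_+ + h) (sym (ℤ.pos-* a m))) (sym (ℤ.pos-+ (a ℕ.* m) h)))))))))

      Gtilde-sum : GtildeMod p k n t ≡ - invMod p k (+ q) * ∑ q term
      Gtilde-sum = trans (cong (λ z → - invMod p k (+ z) * sumℤ (map term (upTo z))) (cong (ℕ._∸ 1) p≡1+q)) (cong (- invMod p k (+ q) *_) (sum-upTo term id q))

      Gtilde-value : + q * GtildeMod p k n t ≈[ P ] -1ℤ ^ h * + (p ℕ.^ m) * ∑ q (λ a → τ ν ^ a * Jₐ a)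
      Gtilde-value = begin
        + q * GtildeMod p k n t                       ≡⟨ trans (cong (+ q *_) Gtilde-sum) (l₁ (+ q) (invMod p k (+ q)) (∑ q term)) ⟩
        - (+ q * invMod p k (+ q)) * ∑ q term     ≈⟨ *-mod (neg-mod (invMod-≈ (+ q) unit-q)) (∑-mod q (λ a _ → term-value a)) ⟩
        -1ℤ * ∑ q (λ a → - c * (τ ν ^ a * Jₐ a)) ≡⟨ cong (-1ℤ *_) (sym (∑-*ˡ q (- c) (λ a → τ ν ^ a * Jₐ a))) ⟩
        -1ℤ * (- c * ∑ q (λ a → τ ν ^ a * Jₐ a)) ≡⟨ l₂ c (∑ q (λ a → τ ν ^ a * Jₐ a)) ⟩
        c * ∑ q (λ a → τ ν ^ a * Jₐ a)            ∎
        where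
        open ≈-Reasoning P
        c = -1ℤ ^ h * + (p ℕ.^ m)
        l₁ : ∀ q i s → q * (- i * s) ≡ - (q * i) * s
        l₁ = ℤ.solve-∀
        l₂ : ∀ c s → (- + 1) * (- c * s) ≡ c * s
        l₂ = ℤ.solve-∀

      δ : ℤ → ℤ
      δ v with unit? v
      ... | inj₁ _ = + 1
      ... | inj₂ _ = + 0

      η-δ : ∀ v → η v ≡ + p * δ v - + 1
      η-δ v with unit? v
      ... | inj₁ _ = trans (lem (+ q)) (cong (λ z → z * + 1 - + 1) (sym +p≡1+q))
        where
        lem : ∀ q → q ≡ (+ 1 + q) * + 1 - + 1
        lem = ℤ.solve-∀
      ... | inj₂ _ = lem (+ p)
        where
        lem : ∀ p → - + 1 ≡ p * + 0 - + 1
        lem = ℤ.solve-∀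

      δ-zero : ∀ {v} → v ≈[ p ] + 0 → δ v ≡ + 1
      δ-zero {v} z with unit? v
      ... | inj₁ _ = refl
      ... | inj₂ u = ⊥-elim (u z)

      δ-unit : ∀ {v} → Unit v → δ v ≡ + 0
      δ-unit {v} u with unit? v
      ... | inj₁ z = ⊥-elim (u z)
      ... | inj₂ _ = refl

      opposite : ∀ x → x ℕ.< p → + (q ℕ.∸ x) ≈[ p ] - + suc x
      opposite x x<p = by (+ 1) (trans (sym (trans (ℤ.[+m]-[+n]≡m⊖n q x) (ℤ.⊖-≥ x≤q))) (trans (lem (+ q) (+ x)) (cong (λ z → - + suc x + z * + 1) (sym +p≡1+q))))
        where
        x≤q : x ℕ.≤ q
        x≤q = ℕ.≤-pred (subst (x ℕ.<_) p≡1+q x<p)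
        lem : ∀ q x → q - x ≡ - (+ 1 + x) + (+ 1 + q) * + 1
        lem = ℤ.solve-∀

      ∑-δ : ∀ x → x ℕ.< p → (f : ℕ → ℤ) → ∑ p (λ y → f y * δ (+ x + + y + + 1)) ≡ f (q ℕ.∸ x)
      ∑-δ x x<p f = trans (∑-single p _ (q ℕ.∸ x) (ℕ.≤-<-trans (ℕ.m∸n≤m q x) q<p) off) (trans (cong (f (q ℕ.∸ x) *_) (δ-zero on)) (ℤ.*-identityʳ _))
        where
        l₁ : ∀ x → x + - (+ 1 + x) + + 1 ≡ + 0
        l₁ = ℤ.solve-∀
        l₂ : ∀ x y → y ≡ (x + y + + 1) + - (+ 1 + x)
        l₂ = ℤ.solve-∀
        on : + x + + (q ℕ.∸ x) + + 1 ≈[ p ] + 0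
        on = ≈-trans (+-mod (+-mod (≈-refl {x = + x}) (opposite x x<p)) (≈-refl {x = + 1})) (≡⇒≈ (l₁ (+ x)))
        off : ∀ y → y ℕ.< p → y ≢ q ℕ.∸ x → f y * δ (+ x + + y + + 1) ≡ + 0
        off y y<p ne = trans (cong (f y *_) (δ-unit (λ z → ne (residue-unique {p} y<p (ℕ.≤-<-trans (ℕ.m∸n≤m q x) q<p)
          (≈-trans (≡⇒≈ (l₂ (+ x) (+ y))) (≈-trans (+-mod z (≈-refl {x = - + suc x})) (≈-trans (≡⇒≈ (ℤ.+-identityˡ _)) (≈-sym (opposite x x<p))))))))) (ℤ.*-zeroʳ (f y))

      -- As η is p times the indicator of 0 minus 1, the double sum is p times a sum over the line x
      -- + y + 1 = 0, where y is represented by q - x, minus a product of two complete character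
      -- sums.
      J-split : ∀ a b → J a b (+ 1) ≡ + p * ∑ p (λ x → τ (+ x) ^ a * τ (+ (q ℕ.∸ x)) ^ b) - ∑ p (λ x → τ (+ x) ^ a) * ∑ p (λ y → τ (+ y) ^ b)
      J-split a b = begin
        J a b (+ 1) ≡⟨ ∑-cong p (λ x x<p → trans (cong (τ (+ x) ^ a *_) (inner x x<p)) (l₁ (τ (+ x) ^ a) (+ p) (τ (+ (q ℕ.∸ x)) ^ b) Y)) ⟩
        ∑ p (λ x → + p * (τ (+ x) ^ a * τ (+ (q ℕ.∸ x)) ^ b) + τ (+ x) ^ a * - Y) ≡⟨ ∑-+ p (λ x → + p * (τ (+ x) ^ a * τ (+ (q ℕ.∸ x)) ^ b)) (λ x → τ (+ x) ^ a * - Y) ⟩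
        ∑ p (λ x → + p * (τ (+ x) ^ a * τ (+ (q ℕ.∸ x)) ^ b)) + ∑ p (λ x → τ (+ x) ^ a * - Y) ≡⟨ cong₂ _+_ (sym (∑-*ˡ p (+ p) _)) (trans (sym (∑-*ʳ p (- Y) _)) (l₂ X Y)) ⟩
        + p * ∑ p (λ x → τ (+ x) ^ a * τ (+ (q ℕ.∸ x)) ^ b) - X * Y ∎
        where
        open ≡-Reasoning
        X = ∑ p (λ x → τ (+ x) ^ a)
        Y = ∑ p (λ y → τ (+ y) ^ b)
        l₁ : ∀ t p s y → t * (p * s - y) ≡ p * (t * s) + t * - y
        l₁ = ℤ.solve-∀
        l₂ : ∀ x y → x * - y ≡ - (x * y)
        l₂ = ℤ.solve-∀
        l₃ : ∀ t p d → t * (p * d - + 1) ≡ p * (t * d) + (- + 1) * t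
        l₃ = ℤ.solve-∀
        inner : ∀ x → x ℕ.< p → ∑ p (λ y → τ (+ y) ^ b * η (+ x + + y + + 1)) ≡ + p * τ (+ (q ℕ.∸ x)) ^ b - Y
        inner x x<p = trans (∑-ext p (λ y → trans (cong (τ (+ y) ^ b *_) (η-δ (+ x + + y + + 1))) (l₃ (τ (+ y) ^ b) (+ p) (δ (+ x + + y + + 1)))))
          (trans (∑-+ p (λ y → + p * (τ (+ y) ^ b * δ (+ x + + y + + 1))) (λ y → -1ℤ * τ (+ y) ^ b))
            (cong₂ _+_ (trans (sym (∑-*ˡ p (+ p) _)) (cong (+ p *_) (∑-δ x x<p (λ y → τ (+ y) ^ b)))) (trans (sym (∑-*ˡ p -1ℤ _)) (ℤ.-1*i≡-i Y))))

      Z : ℕ → ℤ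
      Z x = τ (+ x) ^ h * (τ (+ (q ℕ.∸ x)) ^ h * ∑ q (λ a → τ (ν * + x * (+ (q ℕ.∸ x)) ^ m) ^ a))

      -- For a fixed point of the line the powers of a combine into τ(ν x y^m)^a, so the sum over a
      -- detects ν x y^m = 1.
      line-sum : ∑ q (λ a → τ ν ^ a * ∑ p (λ x → τ (+ x) ^ (a ℕ.+ h) * τ (+ (q ℕ.∸ x)) ^ (a ℕ.* m ℕ.+ h))) ≡ ∑ p Z
      line-sum = trans (∑-ext q (λ a → ∑-*ˡ p (τ ν ^ a) _)) (trans (∑-swap q p _) (∑-ext p (λ x → trans (∑-ext q (λ a → term′ x a))
        (trans (sym (∑-*ˡ q (τ (+ x) ^ h * τ (+ (q ℕ.∸ x)) ^ h) _)) (ℤ.*-assoc (τ (+ x) ^ h) (τ (+ (q ℕ.∸ x)) ^ h) _)))))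
        where
        l : ∀ n x hx y hy → n * ((x * hx) * (y * hy)) ≡ hx * hy * (n * x * y)
        l = ℤ.solve-∀
        term′ : ∀ x a → τ ν ^ a * (τ (+ x) ^ (a ℕ.+ h) * τ (+ (q ℕ.∸ x)) ^ (a ℕ.* m ℕ.+ h)) ≡ τ (+ x) ^ h * τ (+ (q ℕ.∸ x)) ^ h * τ (ν * + x * (+ (q ℕ.∸ x)) ^ m) ^ a
        term′ x a = trans (cong₂ (λ u v → τ ν ^ a * (u * v)) (ℤ.^-distribˡ-+-* (τ (+ x)) a h) (ℤ.^-distribˡ-+-* (τ y) (a ℕ.* m) h))
          (trans (l (τ ν ^ a) (τ (+ x) ^ a) (τ (+ x) ^ h) (τ y ^ (a ℕ.* m)) (τ y ^ h)) (cong (τ (+ x) ^ h * τ y ^ h *_)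
            (sym (trans (cong (_^ a) (trans (τ-* (ν * + x) (y ^ m)) (cong₂ _*_ (τ-* ν (+ x)) (τ-^ y m)))) (trans (*-^ (τ ν * τ (+ x)) (τ y ^ m) a)
              (cong₂ _*_ (*-^ (τ ν) (τ (+ x)) a) (trans (ℤ.^-*-assoc (τ y) m a) (cong (τ y ^_) (ℕ.*-comm m a)))))))))
          where
          y = + (q ℕ.∸ x)

      root-term : ℕ → ℤ
      root-term u = if isRoot p n t u then φ p (+ u * (+ u - + 1)) else + 0

      rootSum-∑ : rootSum p n t ≡ ∑ p root-term
      rootSum-∑ = sum-filter (λ a → φ p (+ a * (+ a - + 1))) (isRoot p n t) id p

      φ-0 : ∀ {x} → x ≈[ p ] + 0 → φ p x ≡ + 0
      φ-0 {x} z = cong (λ b → if b then + 0 else (if any (λ y → modℕ (y ℕ.* y) p ℕ.≡ᵇ modℤ x p) (upTo p) then + 1 else -1ℤ)) (≡ᵇ-yes (modℤ-eq (ℕ.>-nonZero⁻¹ p) z))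

      root-term-0 : ∀ u → + u * (+ u - + 1) ≈[ p ] + 0 → root-term u ≡ + 0
      root-term-0 u z with isRoot p n t u
      ... | true = φ-0 z
      ... | false = refl

      -- Put u = x + 1, so y = -u. The fixed powers give φ(xy) = (-1)^h φ(u(u-1)), and the sum over
      -- a is q or 0 according to whether u is a root of f_t. At x = 0, that is u = 1, both sides
      -- vanish.
      Z-value : ∀ x → x ℕ.< q → Z x ≈[ P ] + q * -1ℤ ^ h * root-term (suc x)
      Z-value zero _ = ≈-trans (*-zero-modʳ _ (τ^-zero h 1≤h ≈-refl)) (≡⇒≈ (sym (trans (cong (+ q * -1ℤ ^ h *_) (root-term-0 1 (≡⇒≈ refl))) (ℤ.*-zeroʳ (+ q * -1ℤ ^ h)))))
      Z-value x@(suc _) x<q = go (modℤ (f p n t u) p ℕ.≟ 0)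
        where
        open Roots n m t refl um un ut m̂ t̂ mm̂ tt̂ x using (root⇒; ⇒root)
        u = + suc x
        x<p = ℕ.<-trans x<q q<p
        ux = unit-small x (s≤s z≤n) x<p
        uu = unit-small (suc x) (s≤s z≤n) (suc<p x<q)
        y = + (q ℕ.∸ x)
        y≈ : y ≈[ p ] - u
        y≈ = opposite x x<p
        uy : Unit y
        uy = unit-≈ (≈-sym y≈) (unit-neg uu)
        A≈ : ν * + x * y ^ m ≈[ p ] ν * + x * (- u) ^ m
        A≈ = *-modˡ (ν * + x) (^-mod m y≈)
        unit-ν : Unit ν
        unit-ν = unit-* { -1ℤ ^ n * (+ n) ^ n * m̂ ^ m} {t̂}
          (unit-* { -1ℤ ^ n * (+ n) ^ n} {m̂ ^ m} (unit-* { -1ℤ ^ n} {(+ n) ^ n} (unit-^ { -1ℤ} n unit--1) (unit-^ {+ n} n un)) (unit-^ {m̂} m (inverse-unit (+ m) m̂ mm̂)))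
          (inverse-unit (+ t) t̂ tt̂)
        l₁ : ∀ x u → x * - u ≡ (- + 1) * (u * x)
        l₁ = ℤ.solve-∀
        l₂ : ∀ x → x ≡ + 1 + x - + 1
        l₂ = ℤ.solve-∀
        quadratic : τ (+ x) ^ h * τ y ^ h ≈[ P ] -1ℤ ^ h * φ p (u * (u - + 1))
        quadratic = ≈-trans (≡⇒≈ (trans (sym (*-^ (τ (+ x)) (τ y) h)) (cong (_^ h) (sym (τ-* (+ x) y)))))
          (≈-trans (^-mod h (τ-resp (≈-trans (*-modˡ (+ x) y≈) (≡⇒≈ (trans (l₁ (+ x) u) (cong (λ z → -1ℤ * (u * z)) (l₂ (+ x))))))))
            (≈-trans (≡⇒≈ (trans (cong (_^ h) (trans (τ-* -1ℤ (u * (u - + 1))) (cong (_* τ (u * (u - + 1))) τ--1))) (*-^ -1ℤ (τ (u * (u - + 1))) h)))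
              (*-modˡ (-1ℤ ^ h) (≈-sym (φ-τ (u * (u - + 1)))))))
        l₃ : ∀ a b c → a * (b * c) ≡ a * b * c
        l₃ = ℤ.solve-∀
        l₄ : ∀ s f q → s * f * q ≡ q * s * f
        l₄ = ℤ.solve-∀
        go : Dec (modℤ (f p n t u) p ≡ 0) → Z x ≈[ P ] + q * -1ℤ ^ h * root-term (suc x)
        go (yes e) = ≈-trans (≡⇒≈ (l₃ (τ (+ x) ^ h) (τ y ^ h) _)) (≈-trans (*-mod quadratic (∑τ-powers-1 (≈-trans A≈ (root⇒ (≈-trans (≈-sym (modℤ-≈ (f p n t u))) (≡⇒≈ (cong +_ e)))))))
          (≡⇒≈ (trans (l₄ (-1ℤ ^ h) (φ p (u * (u - + 1))) (+ q)) (cong (λ b → + q * -1ℤ ^ h * (if b then φ p (u * (u - + 1)) else + 0)) (sym (≡ᵇ-yes e))))))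
        go (no ne) = ≈-trans (*-zero-mod (τ (+ x) ^ h) (*-zero-mod (τ y ^ h) (∑τ-powers (unit-* (unit-* unit-ν ux) (unit-^ m uy))
            (λ e → ne (modℤ-eq (ℕ.>-nonZero⁻¹ p) (⇒root (≈-trans (≈-sym A≈) e)))))))
          (≡⇒≈ (sym (trans (cong (λ b → + q * -1ℤ ^ h * (if b then φ p (u * (u - + 1)) else + 0)) (≡ᵇ-no ne)) (ℤ.*-zeroʳ (+ q * -1ℤ ^ h)))))

      ∑Z : ∑ p Z ≈[ P ] + q * -1ℤ ^ h * rootSum p n t
      ∑Z = begin
        ∑ p Z                        ≡⟨ cong (λ s → ∑ s Z) p≡1+q ⟩
        ∑ q Z + Z q                ≈⟨ +-mod (∑-mod q Z-value) last ⟩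
        ∑ q (λ x → c * root-term (suc x)) + + 0 ≡⟨ trans (ℤ.+-identityʳ _) (sym (∑-*ˡ q c (λ x → root-term (suc x)))) ⟩
        c * ∑ q (λ x → root-term (suc x)) ≡⟨ cong (c *_) (sym (trans rootSum-∑ (trans (∑-p-head root-term) (trans (cong (_+ ∑ q (λ x → root-term (suc x))) (root-term-0 0 ≈-refl)) (ℤ.+-identityˡ _))))) ⟩
        c * rootSum p n t          ∎
        where
        open ≈-Reasoning P
        c = + q * -1ℤ ^ h
        -- The point x = q has y = 0 and corresponds to u = 0, whose root term is also zero.
        last : Z q ≈[ P ] + 0
        last = *-zero-mod (τ (+ q) ^ h) (*-zero-modʳ _ (τ^-zero h 1≤h (≡⇒≈ (cong +_ (ℕ.n∸n≡0 q)))))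

      B : ℤ
      B = ∑ q (λ a → τ ν ^ a * (∑ p (λ x → τ (+ x) ^ (a ℕ.+ h)) * ∑ p (λ y → τ (+ y) ^ (a ℕ.* m ℕ.+ h))))

      -- The sum over x vanishes unless q divides a + h, which for 0 ≤ a < q leaves a = h; the
      -- exponent of the other sum is then hn.
      B-value : B ≈[ P ] + q * (τ ν ^ h * ∑ p (λ y → τ (+ y) ^ (h ℕ.* n)))
      B-value = ≈-trans (∑-mod-single q _ h h<q off) (≈-trans (*-modˡ (τ ν ^ h) (*-mod main (≡⇒≈ (cong (λ e → ∑ p (λ y → τ (+ y) ^ e)) (trans (ℕ.+-comm (h ℕ.* m) h) (sym (ℕ.*-suc h m)))))))
          (≡⇒≈ (l (τ ν ^ h) (+ q) (∑ p (λ y → τ (+ y) ^ (h ℕ.* n))))))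
        where
        l : ∀ a b c → a * (b * c) ≡ b * (a * c)
        l = ℤ.solve-∀
        main : ∑ p (λ x → τ (+ x) ^ (h ℕ.+ h)) ≈[ P ] + q
        main = subst (λ e → ∑ p (λ x → τ (+ x) ^ e) ≈[ P ] + q) (trans (ℕ.+-identityʳ q) q≡h+h) (∑τ-trivial 1 (s≤s z≤n))
        off : ∀ a → a ℕ.< q → a ≢ h → τ ν ^ a * (∑ p (λ x → τ (+ x) ^ (a ℕ.+ h)) * ∑ p (λ y → τ (+ y) ^ (a ℕ.* m ℕ.+ h))) ≈[ P ] + 0
        off a a<q a≢h = *-zero-mod (τ ν ^ a) (*-zero-modʳ _ (∑τ-nontrivial (a ℕ.+ h) (λ { (ℕ.divides c e) → absurd c e })))
          where
          absurd : ∀ c → a ℕ.+ h ≡ c ℕ.* q → ⊥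
          absurd zero e = ℕ.<-irrefl (sym (ℕ.m+n≡0⇒n≡0 a e)) 1≤h
          absurd (suc zero) e = a≢h (ℕ.+-cancelʳ-≡ h a h (trans e (trans (ℕ.+-identityʳ q) q≡h+h)))
          absurd (suc (suc c)) e = ℕ.<-irrefl e (ℕ.<-≤-trans (ℕ.+-mono-< a<q h<q) (ℕ.+-monoʳ-≤ q (ℕ.m≤m+n q (c ℕ.* q))))

      -- Since q = 2h, the character y ↦ τ(y)^(hn) is trivial for even n and quadratic for odd n, so
      -- its sum is q or 0. For even n, the factor τ(ν)^h reduces to the quadratic character of
      -- (n-1)t, as n^n contributes 1 and m^(-m) has the parity of m.
      β-value : -1ℤ ^ h * (τ ν ^ h * ∑ p (λ y → τ (+ y) ^ (h ℕ.* n))) ≈[ P ] - (β p n t - + 1)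
      β-value = go (n ℕ.% 2) refl (ℕ.m%n<n n 2)
        where
        c = n ℕ./ 2
        hq : h ℕ.* (c ℕ.* 2) ≡ c ℕ.* q
        hq = trans (lem h c) (cong (c ℕ.*_) (sym q≡h+h))
          where
          lem : ∀ h c → h ℕ.* (c ℕ.* 2) ≡ c ℕ.* (h ℕ.+ h)
          lem = ℕ.solve-∀
        go : ∀ r → r ≡ n ℕ.% 2 → r ℕ.< 2 → -1ℤ ^ h * (τ ν ^ h * ∑ p (λ y → τ (+ y) ^ (h ℕ.* n))) ≈[ P ] - (β p n t - + 1)
        go (suc (suc r)) e (s≤s (s≤s ()))
        go (suc zero) e _ = ≈-trans (*-zero-mod (-1ℤ ^ h) (*-zero-mod (τ ν ^ h) (∑τ-nontrivial (h ℕ.* n) odd)))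
            (≡⇒≈ (cong (λ b → - ((if b then + 1 else (+ 1 - + (p ℕ.∸ 1) * φ p ((+ 1 - + n) * + t))) - + 1)) (sym (≡ᵇ-yes (sym e)))))
          where
          hn : h ℕ.* n ≡ h ℕ.+ c ℕ.* q
          hn = trans (cong (h ℕ.*_) (trans (ℕ.m≡m%n+[m/n]*n n 2) (cong (ℕ._+ c ℕ.* 2) (sym e)))) (trans (ℕ.*-suc h (c ℕ.* 2)) (cong (h ℕ.+_) hq))
          odd : ¬ (q ℕ.∣ h ℕ.* n)
          odd d = ℕ.>⇒∤ {{ℕ.>-nonZero 1≤h}} h<q (ℕ.∣m+n∣m⇒∣n (subst (q ℕ.∣_) (trans hn (ℕ.+-comm h (c ℕ.* q))) d) (ℕ.n∣m*n c))
        go zero e _ = ≈-trans (*-modˡ (-1ℤ ^ h) (*-mod τν-h trivial)) (≈-trans (≡⇒≈ (l₁ (-1ℤ ^ h) (τ (+ m) ^ h) (τ (+ t) ^ h) (+ q))) (≈-trans (*-modˡ (+ q) quadratic)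
            (≡⇒≈ (trans (l₂ (+ q) (φ p ((+ 1 - + n) * + t))) (trans (cong (λ z → - ((+ 1 - + z * φ p ((+ 1 - + n) * + t)) - + 1)) (sym (cong (ℕ._∸ 1) p≡1+q)))
              (cong (λ b → - ((if b then + 1 else (+ 1 - + (p ℕ.∸ 1) * φ p ((+ 1 - + n) * + t))) - + 1)) (sym (≡ᵇ-no (λ one → zero≢one (trans e one))))))))))
          where
          zero≢one : 0 ≢ 1
          zero≢one ()
          l₁ : ∀ s a b q → s * ((a * b) * q) ≡ q * (s * (a * b))
          l₁ = ℤ.solve-∀
          l₂ : ∀ q f → q * f ≡ - ((+ 1 - q * f) - + 1)
          l₂ = ℤ.solve-∀
          l₃ : ∀ m t → (+ 1 - (+ 1 + m)) * t ≡ (- + 1) * (m * t)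
          l₃ = ℤ.solve-∀
          n≡ : n ≡ c ℕ.* 2
          n≡ = trans (ℕ.m≡m%n+[m/n]*n n 2) (cong (ℕ._+ c ℕ.* 2) (sym e))
          hn : h ℕ.* n ≡ c ℕ.* q
          hn = trans (cong (h ℕ.*_) n≡) hq
          1≤c : 1 ℕ.≤ c
          1≤c = ℕ.n≢0⇒n>0 (λ c0 → ℕ.1+n≢0 (trans n≡ (cong (ℕ._* 2) c0)))
          trivial : ∑ p (λ y → τ (+ y) ^ (h ℕ.* n)) ≈[ P ] + q
          trivial = subst (λ e → ∑ p (λ y → τ (+ y) ^ e) ≈[ P ] + q) (sym hn) (∑τ-trivial c 1≤c)
          full : ∀ {x} → Unit x → τ x ^ (h ℕ.* n) ≈[ P ] + 1
          full {x} ux = ≈-trans (≡⇒≈ (cong (τ x ^_) hn)) (τ-q* c ux)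
          sign : -1ℤ ^ (h ℕ.* n) ≡ + 1
          sign = trans (cong (-1ℤ ^_) (trans hn (ℕ.*-comm c q))) (trans (sym (ℤ.^-*-assoc -1ℤ q c)) (trans (cong (_^ c) -1^q) (ℤ.^-zeroˡ c)))
          inverse-power : ∀ x y e e′ → Unit x → x * y ≈[ p ] + 1 → τ x ^ (e ℕ.+ e′) ≈[ P ] + 1 → τ y ^ e ≈[ P ] τ x ^ e′
          inverse-power x y e e′ ux xy full = cancel-unit k {τ x ^ e} (unit-^ e (τ-unit ux)) (≈-trans (≈-trans (≡⇒≈ (sym (*-^ (τ x) (τ y) e))) (≈-trans (^-mod e (τ-inverse x y xy)) (≡⇒≈ (ℤ.^-zeroˡ e))))
            (≈-sym (≈-trans (≡⇒≈ (sym (ℤ.^-distribˡ-+-* (τ x) e e′))) full)))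
          τν-h : τ ν ^ h ≈[ P ] τ (+ m) ^ h * τ (+ t) ^ h
          τν-h = ≈-trans (≡⇒≈ (τν h)) (≈-trans (*-mod (*-mod (≡⇒≈ sign) (inverse-power (+ t) t̂ h h ut tt̂ (≈-trans (≡⇒≈ (cong (τ (+ t) ^_) (sym q≡h+h))) (τ-q ut))))
              (*-mod (inverse-power (+ m) m̂ (h ℕ.* m) h um mm̂ (≈-trans (≡⇒≈ (cong (τ (+ m) ^_) (trans (ℕ.+-comm (h ℕ.* m) h) (sym (ℕ.*-suc h m))))) (full um))) (full un)))
            (≡⇒≈ (l₄ (τ (+ t) ^ h) (τ (+ m) ^ h))))
            where
            l₄ : ∀ a b → + 1 * a * (b * + 1) ≡ b * a
            l₄ = ℤ.solve-∀
          quadratic : -1ℤ ^ h * (τ (+ m) ^ h * τ (+ t) ^ h) ≈[ P ] φ p ((+ 1 - + n) * + t)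
          quadratic = ≈-sym (≈-trans (φ-τ ((+ 1 - + n) * + t)) (≡⇒≈ (trans (cong (λ z → τ z ^ h) (l₃ (+ m) (+ t)))
            (trans (cong (_^ h) (trans (τ-* -1ℤ (+ m * + t)) (cong₂ _*_ τ--1 (τ-* (+ m) (+ t))))) (trans (*-^ -1ℤ (τ (+ m) * τ (+ t)) h) (cong (-1ℤ ^ h *_) (*-^ (τ (+ m)) (τ (+ t)) h)))))))

      theorem : GtildeMod p k n t ≈[ P ] RHSscaled p n t
      theorem = cancel-unit k {+ q} unit-q (begin
        + q * GtildeMod p k n t ≈⟨ Gtilde-value ⟩
        ε * pm * ∑ q (λ a → τ ν ^ a * Jₐ a) ≡⟨ cong (ε * pm *_) splitting ⟩
        ε * pm * (+ p * ∑ p Z - B) ≈⟨ *-modˡ (ε * pm) (-‿mod (*-modˡ (+ p) ∑Z) B-value) ⟩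
        ε * pm * (+ p * (+ q * ε * RS) - + q * B′) ≡⟨ l₁ ε pm (+ p) (+ q) RS B′ ⟩
        + q * ((ε * ε) * (+ p * pm) * RS - pm * (ε * B′)) ≈⟨ *-modˡ (+ q) (-‿mod (≡⇒≈ (cong₂ (λ x y → x * y * RS) (trans (sym (ℤ.^-distribˡ-+-* -1ℤ h h)) (-1^-even h)) (sym (ℤ.pos-* p (p ℕ.^ m))))) (*-modˡ pm β-value)) ⟩
        + q * (+ 1 * + (p ℕ.^ n) * RS - pm * - (β p n t - + 1)) ≡⟨ cong (+ q *_) (l₂ (+ (p ℕ.^ n)) RS pm (β p n t - + 1)) ⟩
        + q * RHSscaled p n t ∎)
        where
        open ≈-Reasoning P
        ε = -1ℤ ^ h
        pm = + (p ℕ.^ m)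
        RS = rootSum p n t
        B′ = τ ν ^ h * ∑ p (λ y → τ (+ y) ^ (h ℕ.* n))
        l₁ : ∀ e pm p q r b → e * pm * (p * (q * e * r) - q * b) ≡ q * ((e * e) * (p * pm) * r - pm * (e * b))
        l₁ = ℤ.solve-∀
        l₂ : ∀ pn r pm b → + 1 * pn * r - pm * - b ≡ pm * b + pn * r
        l₂ = ℤ.solve-∀
        l₃ : ∀ t p s x → t * (p * s - x) ≡ p * (t * s) + (- + 1) * (t * x)
        l₃ = ℤ.solve-∀
        W X : ℕ → ℤ
        W a = ∑ p (λ x → τ (+ x) ^ (a ℕ.+ h) * τ (+ (q ℕ.∸ x)) ^ (a ℕ.* m ℕ.+ h))
        X a = ∑ p (λ x → τ (+ x) ^ (a ℕ.+ h)) * ∑ p (λ y → τ (+ y) ^ (a ℕ.* m ℕ.+ h))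
        splitting : ∑ q (λ a → τ ν ^ a * Jₐ a) ≡ + p * ∑ p Z - B
        splitting = trans (∑-ext q (λ a → trans (cong (τ ν ^ a *_) (J-split (a ℕ.+ h) (a ℕ.* m ℕ.+ h))) (l₃ (τ ν ^ a) (+ p) (W a) (X a))))
          (trans (∑-+ q (λ a → + p * (τ ν ^ a * W a)) (λ a → -1ℤ * (τ ν ^ a * X a)))
            (cong₂ _+_ (trans (sym (∑-*ˡ q (+ p) (λ a → τ ν ^ a * W a))) (cong (+ p *_) line-sum))
              (trans (sym (∑-*ˡ q -1ℤ (λ a → τ ν ^ a * X a))) (ℤ.-1*i≡-i B))))

-- From the hypotheses on n, p and t to units modulo p.

open Congruences
open Residues
open PointCount
open import Defs
open import Data.Nat using (ℕ; _≤_; _<_; _*_; _∸_; _^_; zero; suc; _+_; _%_; _/_; s≤s)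
open import Data.Nat.Properties using (*-comm; +-identityʳ)
open import Data.Nat.DivMod using (m≡m%n+[m/n]*n; m%n<n)
open import Data.Nat.Divisibility using (_∣_; 1∣_; m%n≡0⇒n∣m; ∣m⇒∣m*n; ∣n⇒∣m*n)
open import Data.Nat.Primality using (Prime; prime⇒irreducible)
open import Data.Integer using (+_)
open import Data.Product using (Σ-syntax; _,_; proj₁; proj₂)
open import Data.Sum using (inj₂)
open import Data.Empty using (⊥-elim)
open import Relation.Binary.PropositionalEquality
open import Relation.Nullary using (¬_)

odd-prime : ∀ p → Prime p → p ≢ 2 → Σ[ h ∈ ℕ ] p ≡ suc (h + h)
odd-prime p pr p≢2 = go (p % 2) refl (m%n<n p 2)
  where
  go : ∀ r → r ≡ p % 2 → r < 2 → Σ[ h ∈ ℕ ] p ≡ suc (h + h)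
  go zero e _ with prime⇒irreducible pr (m%n≡0⇒n∣m p 2 (sym e))
  ... | inj₂ 2≡p = ⊥-elim (p≢2 (sym 2≡p))
  go (suc zero) e _ = p / 2 , trans (m≡m%n+[m/n]*n p 2) (trans (cong (_+ p / 2 * 2) (sym e))
    (cong suc (trans (*-comm (p / 2) 2) (cong (λ z → p / 2 + z) (+-identityʳ (p / 2))))))
  go (suc (suc _)) _ (s≤s (s≤s ()))

theorem3p1 : (n p : ℕ) → 3 ≤ n → Prime p → p ≢ 2 → ¬ (p ∣ n * (n ∸ 1)) →
    (t : ℕ) → 1 ≤ t → t < p →
    (k : ℕ) → GtildeMod p k n t ≡ RHSscaled p n t [mod p ^ k ]
theorem3p1 n p _ _ _ _ t _ _ zero = 1∣ _
theorem3p1 (suc zero) p (s≤s ())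
theorem3p1 (suc (suc m′)) p _ pr p≢2 p∤ t 1≤t t<p (suc κ) = ≈⇒∣
  (Main.Theorem.theorem p (h + h) h pr p≡ refl κ m′ um un t ut
    (proj₁ (inverse-p (+ suc m′) um)) (proj₁ (inverse-p (+ t) ut)) (proj₂ (inverse-p (+ suc m′) um)) (proj₂ (inverse-p (+ t) ut)))
  where
  h = proj₁ (odd-prime p pr p≢2)
  p≡ = proj₂ (odd-prime p pr p≢2)
  open OddPrime p (h + h) h pr p≡ refl using (Unit; unit-small; inverse-p)
  um : Unit (+ suc m′)
  um z = p∤ (∣n⇒∣m*n (suc (suc m′)) (0≈⇒∣ z))
  un : Unit (+ suc (suc m′))
  un z = p∤ (∣m⇒∣m*n (suc m′) (0≈⇒∣ z))
  ut : Unit (+ t)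
  ut = unit-small t 1≤t t<p
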